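{- Let $p=p(n)\in(0,1)$ and let $K_{n,p}$ denote the number of edges of the random symmetric edge polytope $P_{n,p}$. Then, as $n\to\infty$, $$\mathbb{V}(K_{n,p})\simeq n^6p^3(1-p)\bigl(1-\sqrt2\,p\bigr)^2+n^5p^3(1-p)+n^4p^2(1-p)$$ $$\simeq\begin{cases} n^6p^3(1-p)\bigl(1-\sqrt2\,p\bigr)^2+n^5p^3(1-p), & \text{if } p\gg n^{ -2},\\ n^4p^2, & \text{if } p\lesssim n^{ -2}.\end{cases}$$ In particular, $\mathbb{V}(K_{n,p})\to\infty$ if and only if $p\gg n^{ -2}$ and $1-p\gg n^{ -6}$.
   Context: For a finite simple graph $G=(V,E)$ (elements of $V$ are nodes, elements of $E\subseteq\binom V2$ are arcs), with $(\mathbf{e}_i)_{i\in V}$ the standard basis of $\mathbb{R}^V$, the symmetric edge polytope is $P_G:=\operatorname{conv}\{\pm(\mathbf{e}_i-\mathbf{e}_j):\{i,j\}\in E\}\subset\mathbb{R}^V$ (empty if $E=\emptyset$). A face of a polytope is its intersection with a supporting hyperplane; the polytope itself is not regarded as a face. Edges of a polytope are its $1$-dimensional faces (so if $G$ has exactly one arc, $P_G$ has no edges). $G_{n,p}$ is the Erdős–Rényi random graph on node set $[n]$, each arc of the complete graph being retained independently with probability $p=p(n)\in(0,1)$; $P_{n,p}:=P_{G_{n,p}}$. $\mathbb{V}$ denotes variance. Asymptotic notation for sequences: $a_n\simeq b_n$ means $0<\liminf|a_n/b_n|\le\limsup|a_n/b_n|<\infty$; $a_n\gg b_n$ means $\liminf|a_n/b_n|=\infty$;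 $a_n\lesssim b_n$ means $\limsup|a_n/b_n|<\infty$. A case distinction means: if the sequence $p=p(n)$ satisfies the asymptotic condition, then the corresponding relation holds. -}

module Defs where

open import Algebra.Apartness.Bundles using (HeytingField; HeytingCommutativeRing)
open import Algebra.Bundles using (CommutativeRing; Semiring)
import Algebra.Definitions.RawSemiring as RawSemiringDefinitions
open import Data.Bool using (Bool; true; false; if_then_else_)
open import Data.Fin using (Fin; zero; suc; _≟_)
open import Data.Fin.Subset using (Subset; inside; outside)
open import Data.List as List using (List; cartesianProductWith)
open import Data.Nat as ℕ using (ℕ; zero; suc)
open import Data.Product using (Σ; ∃; ∃-syntax; _×_; _,_; proj₁)
open import Data.Sum using (_⊎_; inj₁; inj₂)
open import Data.Vec as Vec using (Vec; []; _∷_)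
open import Data.Vec.Functional using (Vector)
open import Function using (Bijection)
open import Level using (0ℓ)
open import Relation.Binary.Bundles using (Setoid)
open import Relation.Binary.Core using (Rel)
open import Relation.Binary.Lattice.Definitions using (Supremum)
import Relation.Binary.Construct.On as On
open import Relation.Binary.PropositionalEquality as ≡ using (_≡_)
open import Relation.Binary.Structures using (IsStrictPartialOrder)
open import Relation.Nullary using (¬_; does)
open import Relation.Unary using (Pred; _∈_; _⊆_; _≐_; _∩_; Satisfiable)
open import Relation.Unary.Relation.Binary.Equality using (≐-setoid)

------------------------------------------------------------------------
-- The real numbers, as a Cauchy-complete Archimedean ordered field.
--
-- The axioms are phrased so that they hold for constructive reals
-- (e.g. Bishop's regular sequences).  With excluded middle they
-- characterise ℝ up to isomorphism.

record RealField : Set₁ where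
  field
    heytingField : HeytingField 0ℓ 0ℓ 0ℓ

  open HeytingField heytingField public

  open RawSemiringDefinitions
    (Semiring.rawSemiring (CommutativeRing.semiring
      (HeytingCommutativeRing.commutativeRing heytingCommutativeRing)))
    public using (_^_; sum) renaming (_×_ to _·_)

  fromℕ : ℕ → Carrier
  fromℕ n = n · 1#

  infix 4 _<_ _≤_
  infixl 6 _⊔_

  field
    _<_                  : Rel Carrier 0ℓ
    isStrictPartialOrder : IsStrictPartialOrder _≈_ _<_
    #⇒<⊎>                : ∀ {x y} → x # y → x < y ⊎ y < x
    <⇒#                  : ∀ {x y} → x < y → x # y
    0<1                  : 0# < 1#
    +-monoˡ-<            : ∀ z {x y} → x < y → x + z < y + z
    *-positive           : ∀ {x y} → 0# < x → 0# < y → 0# < x * y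

  _≤_ : Rel Carrier 0ℓ
  x ≤ y = ¬ (y < x)

  field
    _⊔_        : Carrier → Carrier → Carrier
    ⊔-supremum : Supremum _≤_ _⊔_

  ∣_∣ : Carrier → Carrier
  ∣ x ∣ = x ⊔ (- x)

  IsCauchy : (ℕ → Carrier) → Set
  IsCauchy a = ∀ ε → 0# < ε →
    ∃[ N ] (∀ m n → N ℕ.≤ m → N ℕ.≤ n → ∣ a m - a n ∣ < ε)

  _ConvergesTo_ : (ℕ → Carrier) → Carrier → Set
  a ConvergesTo l = ∀ ε → 0# < ε →
    ∃[ N ] (∀ n → N ℕ.≤ n → ∣ a n - l ∣ < ε)

  field
    archimedean : ∀ x → ∃[ n ] x < fromℕ n
    complete    : ∀ a → IsCauchy a → ∃[ l ] a ConvergesTo l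

------------------------------------------------------------------------
-- Finite simple graphs on the node set Fin n

-- The first component of S ∷ G is the set of neighbours of node zero
-- among the remaining nodes and G is the graph induced on these, so that
-- a graph is exactly a subset of the set of all unordered pairs of nodes.

data Graph : ℕ → Set where
  []  : Graph 0
  _∷_ : ∀ {n} → Subset n → Graph n → Graph (suc n)

adjacent : ∀ {n} → Graph n → Fin n → Fin n → Bool
adjacent (S ∷ G) zero    zero    = false
adjacent (S ∷ G) zero    (suc j) = Vec.lookup S j
adjacent (S ∷ G) (suc i) zero    = Vec.lookup S i
adjacent (S ∷ G) (suc i) (suc j) = adjacent G i j

allSubsets : ∀ n → List (Subset n)
allSubsets zero    = List.[ [] ]
allSubsets (suc n) =
  cartesianProductWith _∷_ (inside List.∷ outside List.∷ List.[]) (allSubsets n)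

allGraphs : ∀ n → List (Graph n)
allGraphs zero    = List.[ [] ]
allGraphs (suc n) = cartesianProductWith _∷_ (allSubsets n) (allGraphs n)

module Theory (R : RealField) where

  open RealField R public renaming (Carrier to ℝ)

  -- #⇒invertible inverts the difference x - 0#.
  inverse : ∀ {x} → x # 0# → ℝ
  inverse x#0 = proj₁ (#⇒invertible x#0)

  ----------------------------------------------------------------------
  -- Polytopes and their edges

  Point : ℕ → Set
  Point n = Vector ℝ n

  Region : ℕ → Set₁
  Region n = Pred (Point n) 0ℓ

  infix 4 _≋_
  _≋_ : ∀ {n} → Rel (Point n) 0ℓ
  x ≋ y = ∀ k → x k ≈ y k

  ⟨_,_⟩ : ∀ {n} → Point n → Point n → ℝ
  ⟨ x , y ⟩ = sum (λ k → x k * y k)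

  combination : ∀ {m n} → (Fin m → ℝ) → (Fin m → Point n) → Point n
  combination c v k = sum (λ i → c i * v i k)

  conv : ∀ {n} → Region n → Region n
  conv S x = ∃[ m ] Σ (Fin m → Point _) λ v → Σ (Fin m → ℝ) λ c →
    (∀ i → v i ∈ S) × (∀ i → 0# ≤ c i) × sum c ≈ 1# × x ≋ combination c v

  -- Apartness from zero replaces inequality, which makes this the
  -- positive form of affine independence.
  AffinelyIndependent : ∀ {m n} → (Fin m → Point n) → Set
  AffinelyIndependent v =
    ∀ c → sum c ≈ 0# → (∃[ i ] c i # 0#) → ∃[ k ] combination c v k # 0#

  affineSpan : ∀ {m n} → (Fin m → Point n) → Region n
  affineSpan v x = ∃[ c ] sum c ≈ 1# × x ≋ combination c v

  HasDimension : ∀ {n} → ℕ → Region n → Set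
  HasDimension d F = Σ (Fin (suc d) → Point _) λ v →
    (∀ i → v i ∈ F) × AffinelyIndependent v × F ⊆ affineSpan v

  hyperplane : ∀ {n} → Point n → ℝ → Region n
  hyperplane a b x = ⟨ a , x ⟩ ≈ b

  IsSupportingHyperplane : ∀ {n} → Region n → Point n → ℝ → Set
  IsSupportingHyperplane P a b =
    (∃[ k ] a k # 0#) ×
    (∀ x → x ∈ P → ⟨ a , x ⟩ ≤ b) ×
    Satisfiable (P ∩ hyperplane a b)

  -- P itself is excluded, also when it lies in a supporting hyperplane.
  IsFace : ∀ {n} → Region n → Region n → Set
  IsFace P F =
    (∃[ a ] ∃[ b ] IsSupportingHyperplane P a b × F ≐ (P ∩ hyperplane a b)) ×
    ¬ (F ≐ P)

  IsEdge : ∀ {n} → Region n → Region n → Set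
  IsEdge P F = IsFace P F × HasDimension 1 F

  -- Two edges are identified when they are equal as sets of points.
  edges : ∀ {n} → Region n → Setoid _ _
  edges {n} P = On.setoid {B = Σ (Region n) (IsEdge P)} (≐-setoid (Point n) 0ℓ) proj₁

  HasNumberOfEdges : ∀ {n} → Region n → ℕ → Set₁
  HasNumberOfEdges P k = Bijection (≡.setoid (Fin k)) (edges P)

  ----------------------------------------------------------------------
  -- The symmetric edge polytope

  𝐞 : ∀ {n} → Fin n → Point n
  𝐞 i k = if does (i ≟ k) then 1# else 0#

  -- Both signs occur because (i , j) ranges over ordered pairs.
  arcVectors : ∀ {n} → Graph n → Region n
  arcVectors G x = ∃[ i ] ∃[ j ] adjacent G i j ≡ true × x ≋ (λ k → 𝐞 i k - 𝐞 j k)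

  symmetricEdgePolytope : ∀ {n} → Graph n → Region n
  symmetricEdgePolytope G = conv (arcVectors G)

  ----------------------------------------------------------------------
  -- The Erdős–Rényi random graph

  bernoulli : ℝ → Bool → ℝ
  bernoulli p true  = p
  bernoulli p false = 1# - p

  -- The product of the Bernoulli weights of all unordered pairs of nodes.
  probability : ∀ {n} → ℝ → Graph n → ℝ
  probability p []      = 1#
  probability p (S ∷ G) =
    Vec.foldr _ (λ s q → bernoulli p s * q) 1# S * probability p G

  𝔼 : ∀ {n} → ℝ → (Graph n → ℝ) → ℝ
  𝔼 {n} p X = List.foldr (λ G s → probability p G * X G + s) 0# (allGraphs n)

  𝕍 : ∀ {n} → ℝ → (Graph n → ℝ) → ℝ
  𝕍 p X = 𝔼 p (λ G → (X G - 𝔼 p X) ^ 2)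

  ----------------------------------------------------------------------
  -- Asymptotic relations between real sequences

  Sequence : Set
  Sequence = ℕ → ℝ

  -- For all large n the number |aₙ / bₙ| is defined and satisfies Q.
  EventuallyRatio : (Q : ℝ → Set) → Sequence → Sequence → Set
  EventuallyRatio Q a b = ∃[ N ] (∀ n → N ℕ.≤ n →
    Σ (b n # 0#) λ bₙ#0 → Q ∣ a n * inverse bₙ#0 ∣)

  infix 4 _≃_ _≫_ _≲_

  _≃_ : Rel Sequence 0ℓ
  a ≃ b = ∃[ c ] ∃[ C ] 0# < c × EventuallyRatio (λ r → c ≤ r × r ≤ C) a b

  _≫_ : Rel Sequence 0ℓ
  a ≫ b = ∀ M → EventuallyRatio (λ r → M ≤ r) a b

  _≲_ : Rel Sequence 0ℓ
  a ≲ b = ∃[ C ] EventuallyRatio (λ r → r ≤ C) a b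

  _→∞ : Sequence → Set
  a →∞ = ∀ M → ∃[ N ] (∀ n → N ℕ.≤ n → M ≤ a n)

  private
    module < = IsStrictPartialOrder isStrictPartialOrder

    fromℕ-positive : ∀ n → 0# < fromℕ (suc n)
    fromℕ-positive zero    = <.<-respʳ-≈ (sym (+-identityʳ 1#)) 0<1
    fromℕ-positive (suc n) = <.trans (fromℕ-positive n)
      (<.<-respˡ-≈ (+-identityˡ _) (+-monoˡ-< (fromℕ (suc n)) 0<1))

    ^-positive : ∀ {x} k → 0# < x → 0# < x ^ k
    ^-positive zero    0<x = 0<1
    ^-positive (suc k) 0<x = *-positive 0<x (^-positive k 0<x)

  -- The sequence n ↦ n⁻ᵏ, with the arbitrary value 0 at n = 0.
  n^-_ : ℕ → Sequence
  (n^- k) zero    = 0#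
  (n^- k) (suc n) =
    inverse (#-sym (<⇒# (^-positive k (fromℕ-positive n))))

{-# OPTIONS --safe #-}

-- Write m for the number of ordered adjacent pairs of nodes, c for the number of
-- closed walks of length 4 and U for the number of ordered non-adjacent pairs with
-- exactly one common neighbour.  Two roots span an edge of the polytope exactly
-- when some integer potential on the nodes exposes them (otherwise a square, a
-- second path or a pair of opposite roots obstructs), and counting these pairs gives
-- 2 K = Y + 2 U with Y = m² - m - c.  The discrete derivative of Y at an edge has
-- mean about 4 n² p (1 - 2 p²), so the Efron-Stein inequality, used once for Y and
-- once more for its derivative, gives the upper bound; the variance of U is of lower
-- order.  For the lower bound, Y is correlated with m and, since the slope vanishes
-- at p = 1/√2, with the sum of the products of centred adjacent arcs.  When n² p is
-- small, K is zero with high probability, and as K is a natural number its variance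
-- is at least μ - μ² for its mean μ.

module Submission where

open import Defs
open import Algebra.Apartness.Bundles using (HeytingCommutativeRing)
import Algebra.Apartness.Properties.HeytingCommutativeRing as HeytingProperties
open import Algebra.Bundles using (CommutativeRing)
import Algebra.Properties.Monoid.Mult as MonoidMult
import Algebra.Properties.Ring as RingProperties
import Algebra.Properties.Semiring.Mult as SemiringMult
import Algebra.Properties.Semiring.Sum as SemiringSum
import Algebra.Solver.Ring as RingSolver
open import Algebra.Solver.Ring.AlmostCommutativeRing
  using (_-Raw-AlmostCommutative⟶_; fromCommutativeRing)
open import Data.Bool using (Bool; T; _∧_; false; if_then_else_; not; true)
import Data.Bool.Properties as Bool
open import Data.Empty using (⊥; ⊥-elim)
open import Data.Fin as Fin using (Fin; _↑ʳ_; _↑ˡ_; _≟_; combine; remQuot; suc; zero)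
import Data.Fin.Properties as Fin
open import Data.Fin.Subset using (Subset)
open import Data.Integer as ℤ using (ℤ)
import Data.Integer.Properties as ℤ
open import Data.List as List using (List; []; _∷_; cartesianProductWith)
import Data.List.Properties as List
open import Data.Maybe using (to-witness-T)
open import Data.Maybe.Base as Maybe using (Maybe)
open import Data.Nat as ℕ using (suc; zero; ℕ)
import Data.Nat.Properties as ℕ
open import Data.Product using (_,_; _×_; proj₁; proj₂; Σ; ∃-syntax)
open import Data.Sum using ([_,_]′; _⊎_; inj₁; inj₂)
open import Data.Vec as Vec using (Vec; []; _[_]≔_; _∷_)
open import Data.Vec.N-ary using (Eq; N-ary; _$ⁿ_; curryⁿ; curryⁿ-cong)
import Data.Vec.Properties as Vec
open import Function using (_⇔_; _∘_; mk⇔)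
open import Level using (0ℓ)
open import Relation.Binary.Definitions using (tri<; tri>; tri≈)
open import Relation.Binary.PropositionalEquality as ≡ using (_≡_; _≢_)
import Relation.Binary.Reasoning.Base.Triple as Triple
open import Relation.Binary.Structures using (IsPreorder; IsStrictPartialOrder)
open import Relation.Nullary using (Dec; does; no; yes; ¬_)
open import Relation.Nullary.Decidable using (_×-dec_; _⊎-dec_; dec-false; dec-true; dec⇒maybe; ¬?)
open import Relation.Unary using (_∈_; _∩_; _≐_; _⊆_)

setEdge : ∀ {n} → Fin n → Fin n → Bool → Graph n → Graph n
setEdge zero    zero    b (S ∷ G) = S ∷ G
setEdge zero    (suc j) b (S ∷ G) = (S [ j ]≔ b) ∷ G
setEdge (suc i) zero    b (S ∷ G) = (S [ i ]≔ b) ∷ G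
setEdge (suc i) (suc j) b (S ∷ G) = S ∷ setEdge i j b G

adjacent-sym : ∀ {n} (G : Graph n) i j → adjacent G i j ≡ adjacent G j i
adjacent-sym (S ∷ G) zero    zero    = ≡.refl
adjacent-sym (S ∷ G) zero    (suc j) = ≡.refl
adjacent-sym (S ∷ G) (suc i) zero    = ≡.refl
adjacent-sym (S ∷ G) (suc i) (suc j) = adjacent-sym G i j

adjacent-irrefl : ∀ {n} (G : Graph n) i → adjacent G i i ≡ false
adjacent-irrefl (S ∷ G) zero    = ≡.refl
adjacent-irrefl (S ∷ G) (suc i) = adjacent-irrefl G i

adjacent-setEdge : ∀ {n} (G : Graph n) {i j} b → i ≢ j → adjacent (setEdge i j b G) i j ≡ b
adjacent-setEdge (S ∷ G) {zero}  {zero}  b i≢j = ⊥-elim (i≢j ≡.refl)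
adjacent-setEdge (S ∷ G) {zero}  {suc j} b i≢j = Vec.lookup∘updateAt j S
adjacent-setEdge (S ∷ G) {suc i} {zero}  b i≢j = Vec.lookup∘updateAt i S
adjacent-setEdge (S ∷ G) {suc i} {suc j} b i≢j = adjacent-setEdge G b (i≢j ∘ ≡.cong suc)

adjacent-setEdge-other : ∀ {n} (G : Graph n) {i j} b {k l} →
  ¬ (k ≡ i × l ≡ j) → ¬ (k ≡ j × l ≡ i) →
  adjacent (setEdge i j b G) k l ≡ adjacent G k l
adjacent-setEdge-other (S ∷ G) {zero}  {zero}  b {k} {l} h h′ = ≡.refl
adjacent-setEdge-other (S ∷ G) {zero}  {suc j} b {zero}  {zero}  h h′ = ≡.refl
adjacent-setEdge-other (S ∷ G) {zero}  {suc j} b {zero}  {suc l} h h′ =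
  Vec.lookup∘updateAt′ l j (λ { ≡.refl → h (≡.refl , ≡.refl) }) S
adjacent-setEdge-other (S ∷ G) {zero}  {suc j} b {suc k} {zero}  h h′ =
  Vec.lookup∘updateAt′ k j (λ { ≡.refl → h′ (≡.refl , ≡.refl) }) S
adjacent-setEdge-other (S ∷ G) {zero}  {suc j} b {suc k} {suc l} h h′ = ≡.refl
adjacent-setEdge-other (S ∷ G) {suc i} {zero}  b {zero}  {zero}  h h′ = ≡.refl
adjacent-setEdge-other (S ∷ G) {suc i} {zero}  b {zero}  {suc l} h h′ =
  Vec.lookup∘updateAt′ l i (λ { ≡.refl → h′ (≡.refl , ≡.refl) }) S
adjacent-setEdge-other (S ∷ G) {suc i} {zero}  b {suc k} {zero}  h h′ =
  Vec.lookup∘updateAt′ k i (λ { ≡.refl → h (≡.refl , ≡.refl) }) S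
adjacent-setEdge-other (S ∷ G) {suc i} {zero}  b {suc k} {suc l} h h′ = ≡.refl
adjacent-setEdge-other (S ∷ G) {suc i} {suc j} b {zero}  {zero}  h h′ = ≡.refl
adjacent-setEdge-other (S ∷ G) {suc i} {suc j} b {zero}  {suc l} h h′ = ≡.refl
adjacent-setEdge-other (S ∷ G) {suc i} {suc j} b {suc k} {zero}  h h′ = ≡.refl
adjacent-setEdge-other (S ∷ G) {suc i} {suc j} b {suc k} {suc l} h h′ =
  adjacent-setEdge-other G {i} {j} b
    (λ { (≡.refl , ≡.refl) → h (≡.refl , ≡.refl) })
    (λ { (≡.refl , ≡.refl) → h′ (≡.refl , ≡.refl) })

setEdge-loop : ∀ {n} (G : Graph n) i b → setEdge i i b G ≡ G
setEdge-loop (S ∷ G) zero    b = ≡.refl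
setEdge-loop (S ∷ G) (suc i) b = ≡.cong (S ∷_) (setEdge-loop G i b)

count : ∀ {n} → (Fin n → Bool) → ℕ
count {zero}  f = 0
count {suc n} f = (if f zero then 1 else 0) ℕ.+ count (f ∘ suc)

count-cong : ∀ {n} {f g : Fin n → Bool} → (∀ i → f i ≡ g i) → count f ≡ count g
count-cong {zero}  e = ≡.refl
count-cong {suc n} e = ≡.cong₂ (λ b k → (if b then 1 else 0) ℕ.+ k) (e zero) (count-cong (e ∘ suc))

count-none : ∀ {n} {f : Fin n → Bool} → (∀ i → f i ≡ false) → count f ≡ 0
count-none {zero}  h = ≡.refl
count-none {suc n} h = ≡.cong₂ (λ b k → (if b then 1 else 0) ℕ.+ k) (h zero) (count-none (h ∘ suc))

count-exists : ∀ {n} {f : Fin n → Bool} {k} → count f ≡ suc k → ∃[ i ] f i ≡ true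
count-exists {suc n} {f} e with f zero in f0
... | true  = zero , f0
... | false with count-exists e
...   | i , fi = suc i , fi

count≡0 : ∀ {n} {f : Fin n → Bool} → count f ≡ 0 → ∀ i → f i ≡ false
count≡0 {suc n} {f} e i with f zero in f0
count≡0 {suc n} {f} e zero    | false = f0
count≡0 {suc n} {f} e (suc i) | false = count≡0 e i

count≡1-unique : ∀ {n} {f : Fin n → Bool} → count f ≡ 1 → ∀ {i j} → f i ≡ true → f j ≡ true → i ≡ j
count≡1-unique {suc n} {f} e {i} {j} fi fj with f zero in f0
count≡1-unique {suc n} {f} e {zero} {zero} fi fj | _ = ≡.refl
count≡1-unique {suc n} {f} e {zero} {suc j} fi fj | true
  with () ← ≡.trans (≡.sym fj) (count≡0 (≡.cong ℕ.pred e) j)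
count≡1-unique {suc n} {f} e {suc i} {zero} fi fj | true
  with () ← ≡.trans (≡.sym fi) (count≡0 (≡.cong ℕ.pred e) i)
count≡1-unique {suc n} {f} e {suc i} {suc j} fi fj | true
  with () ← ≡.trans (≡.sym fi) (count≡0 (≡.cong ℕ.pred e) i)
count≡1-unique {suc n} {f} e {suc i} {suc j} fi fj | false = ≡.cong suc (count≡1-unique e fi fj)
count≡1-unique {suc n} {f} e {zero} {suc j} fi fj | false with () ← ≡.trans (≡.sym fi) f0
count≡1-unique {suc n} {f} e {suc i} {zero} fi fj | false with () ← ≡.trans (≡.sym fj) f0

count-unique : ∀ {n} {f : Fin n → Bool} i → f i ≡ true → (∀ j → f j ≡ true → j ≡ i) → count f ≡ 1
count-unique {suc n} {f} zero fi h with f zero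
count-unique {suc n} {f} zero _ h | true = ≡.cong suc (count-none none)
  where
  none : ∀ j → f (suc j) ≡ false
  none j with f (suc j) in e
  ... | true with () ← h (suc j) e
  ... | false = ≡.refl
count-unique {suc n} {f} (suc i) fi h with f zero in f0
... | true with () ← h zero f0
... | false = count-unique i fi (λ j e → suc-injective (h (suc j) e))
  where open import Data.Fin.Properties using (suc-injective)

commonNeighbour : ∀ {n} → Graph n → Fin n → Fin n → Fin n → Bool
commonNeighbour G a c b = adjacent G a b ∧ adjacent G b c

hasUniquePath : ∀ {n} → Graph n → Fin n → Fin n → Bool
hasUniquePath G a c = not (does (a ≟ c)) ∧ (not (adjacent G a c) ∧ does (count (commonNeighbour G a c) ℕ.≟ 1))

SameEdge : ∀ {n} → Fin n → Fin n → Fin n → Fin n → Set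
SameEdge i j a b = (a ≡ i × b ≡ j) ⊎ (a ≡ j × b ≡ i)

sameEdge? : ∀ {n} (i j a b : Fin n) → Dec (SameEdge i j a b)
sameEdge? i j a b with a ≟ i | b ≟ j | a ≟ j | b ≟ i
... | yes p | yes q | _ | _ = yes (inj₁ (p , q))
... | _ | _ | yes p | yes q = yes (inj₂ (p , q))
... | no ¬p | _ | no ¬q | _ = no λ { (inj₁ (p , _)) → ¬p p ; (inj₂ (q , _)) → ¬q q }
... | no ¬p | _ | yes _ | no ¬q = no λ { (inj₁ (p , _)) → ¬p p ; (inj₂ (_ , q)) → ¬q q }
... | yes _ | no ¬p | no ¬q | _ = no λ { (inj₁ (_ , p)) → ¬p p ; (inj₂ (q , _)) → ¬q q }
... | yes _ | no ¬p | yes _ | no ¬q = no λ { (inj₁ (_ , p)) → ¬p p ; (inj₂ (_ , q)) → ¬q q }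

adjacent-setEdge-same : ∀ {n} (G : Graph n) {i j} b {k l} → i ≢ j → SameEdge i j k l →
  adjacent (setEdge i j b G) k l ≡ b
adjacent-setEdge-same G b i≢j (inj₁ (≡.refl , ≡.refl)) = adjacent-setEdge G b i≢j
adjacent-setEdge-same G {i} {j} b i≢j (inj₂ (≡.refl , ≡.refl)) =
  ≡.trans (adjacent-sym (setEdge i j b G) j i) (adjacent-setEdge G b i≢j)

adjacent-setEdge-different : ∀ {n} (G : Graph n) {i j} b {k l} → ¬ SameEdge i j k l →
  adjacent (setEdge i j b G) k l ≡ adjacent G k l
adjacent-setEdge-different G b h = adjacent-setEdge-other G b (h ∘ inj₁) (h ∘ inj₂)

∧-true : ∀ {a b} → a ∧ b ≡ true → a ≡ true × b ≡ true
∧-true {true} {true} _ = ≡.refl , ≡.refl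

hasUniquePath-middle : ∀ {n} (G : Graph n) {a c} → hasUniquePath G a c ≡ true →
  ∃[ b ] adjacent G a b ≡ true × adjacent G b c ≡ true
hasUniquePath-middle G {a} {c} h with a ≟ c | adjacent G a c | count (commonNeighbour G a c) in e
hasUniquePath-middle G {a} {c} h | no _ | false | 1 with count-exists {f = commonNeighbour G a c} e
... | b , t = b , ∧-true t

-- Whether the segment between 𝐞 a - 𝐞 b and 𝐞 c - 𝐞 e is an edge of the
-- polytope, for arcs {a , b} and {c , e}.
compatible : ∀ {n} → Graph n → Fin n → Fin n → Fin n → Fin n → Bool
compatible G a b c e =
  if does (a ≟ c) then not (does (b ≟ e)) else
  if does (b ≟ e) then true else
  if does (b ≟ c) then hasUniquePath G a e else
  if does (a ≟ e) then hasUniquePath G c b else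
  not (adjacent G a e ∧ adjacent G c b)

isPolytopeEdge : ∀ {n} → Graph n → Fin n → Fin n → Fin n → Fin n → Bool
isPolytopeEdge G a b c e = (adjacent G a b ∧ adjacent G c e) ∧ compatible G a b c e

hasUniquePath-loop : ∀ {n} (G : Graph n) a → hasUniquePath G a a ≡ false
hasUniquePath-loop G a with a ≟ a
... | yes _ = ≡.refl
... | no a≢a = ⊥-elim (a≢a ≡.refl)

does-sym : ∀ {n} (a b : Fin n) → does (a ≟ b) ≡ does (b ≟ a)
does-sym a b with a ≟ b | b ≟ a
... | yes _ | yes _ = ≡.refl
... | no _ | no _ = ≡.refl
... | yes p | no q = ⊥-elim (q (≡.sym p))
... | no p | yes q = ⊥-elim (p (≡.sym q))

compatible-sym : ∀ {n} (G : Graph n) a b c e → compatible G a b c e ≡ compatible G c e a b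
compatible-sym G a b c e rewrite does-sym c a | does-sym e b | does-sym e a | does-sym c b
  with a ≟ c | b ≟ e | b ≟ c | a ≟ e
... | yes _ | _ | _ | _ = ≡.refl
... | no _ | yes _ | _ | _ = ≡.refl
... | no _ | no _ | yes ≡.refl | yes ≡.refl = ≡.refl
... | no _ | no _ | yes _ | no _ = ≡.refl
... | no _ | no _ | no _ | yes _ = ≡.refl
... | no _ | no _ | no _ | no _ = ≡.cong not (Bool.∧-comm (adjacent G a e) (adjacent G c b))

isPolytopeEdge-sym : ∀ {n} (G : Graph n) a b c e → isPolytopeEdge G a b c e ≡ isPolytopeEdge G c e a b
isPolytopeEdge-sym G a b c e = ≡.cong₂ _∧_ (Bool.∧-comm (adjacent G a b) (adjacent G c e)) (compatible-sym G a b c e)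

compatible-irrefl : ∀ {n} (G : Graph n) a b → compatible G a b a b ≡ false
compatible-irrefl G a b with a ≟ a | b ≟ b
... | yes _ | yes _ = ≡.refl
... | yes _ | no b≢b = ⊥-elim (b≢b ≡.refl)
... | no a≢a | _ = ⊥-elim (a≢a ≡.refl)

does-true : ∀ {A : Set} (A? : Dec A) → does A? ≡ true → A
does-true (yes a) _ = a

Arc : ℕ → Set
Arc n = Fin (n ℕ.* n)

tail head : ∀ {n} → Arc n → Fin n
tail {n} v = proj₁ (remQuot {n} n v)
head {n} v = proj₂ (remQuot {n} n v)

ArcPair : ℕ → Set
ArcPair n = Fin ((n ℕ.* n) ℕ.* (n ℕ.* n))

left right : ∀ {n} → ArcPair n → Arc n
left {n} z = proj₁ (remQuot {n ℕ.* n} (n ℕ.* n) z)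
right {n} z = proj₂ (remQuot {n ℕ.* n} (n ℕ.* n) z)

joined : ∀ {n} → Graph n → Arc n → Arc n → Bool
joined G v w = isPolytopeEdge G (tail v) (head v) (tail w) (head w)

-- The order on the arcs selects one of the two orders of each pair.
selected : ∀ {n} → Graph n → ArcPair n → Bool
selected {n} G z = does (left {n} z Fin.<? right {n} z) ∧ joined G (left {n} z) (right {n} z)

edgeNumber : ∀ n → Graph n → ℕ
edgeNumber n G = count (selected G)

-- Node weights exposing exactly the arcs (a , b) and (c , e).
record Potential {n} (G : Graph n) (a b c e : Fin n) : Set where
  field
    height : Fin n → ℕ
    drop   : ℕ
    drop-ab : height a ≡ height b ℕ.+ suc drop
    drop-ce : height c ≡ height e ℕ.+ suc drop
    others : ∀ i j → adjacent G i j ≡ true → ¬ (i ≡ a × j ≡ b) → ¬ (i ≡ c × j ≡ e) →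
             height i ℕ.< height j ℕ.+ suc drop

Potential-sym : ∀ {n} {G : Graph n} {a b c e} → Potential G a b c e → Potential G c e a b
Potential-sym P = record
  { height = height ; drop = drop ; drop-ab = drop-ce ; drop-ce = drop-ab
  ; others = λ i j ij h h′ → others i j ij h′ h }
  where open Potential P

adjacent⇒≢ : ∀ {n} (G : Graph n) {a b} → adjacent G a b ≡ true → a ≢ b
adjacent⇒≢ G {a} h ≡.refl with () ← ≡.trans (≡.sym h) (adjacent-irrefl G a)

adjacent-flip : ∀ {n} (G : Graph n) {a b} → adjacent G a b ≡ true → adjacent G b a ≡ true
adjacent-flip G {a} {b} h = ≡.trans (adjacent-sym G b a) h

private
  lit : ∀ {m k} → {T (m ℕ.<ᵇ k)} → m ℕ.< k
  lit {m} {k} {t} = ℕ.<ᵇ⇒< m k t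

  small : ∀ {m k β} → m ℕ.≤ β → m ℕ.< k ℕ.+ suc β
  small {m} {k} {β} m≤β = ℕ.≤-trans (ℕ.s≤s m≤β) (ℕ.m≤n+m (suc β) k)

module CommonTail {n} (G : Graph n) (a b e : Fin n) (a≢b : a ≢ b) (a≢e : a ≢ e) where

  height : Fin n → ℕ
  height i = if does (i ≟ a) then 2 else if does (i ≟ b) then 0 else if does (i ≟ e) then 0 else 1

  data Layer (i : Fin n) : ℕ → Set where
    at-a  : i ≡ a → Layer i 2
    at-b  : i ≡ b → Layer i 0
    at-e  : i ≡ e → Layer i 0
    other : Layer i 1

  layer : ∀ i → Layer i (height i)
  layer i with i ≟ a | i ≟ b | i ≟ e
  ... | yes p | _     | _     = at-a p
  ... | no _  | yes p | _     = at-b p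
  ... | no _  | no _  | yes p = at-e p
  ... | no _  | no _  | no _  = other

  others : ∀ {i j k l} → Layer i k → Layer j l → ¬ (i ≡ a × j ≡ b) → ¬ (i ≡ a × j ≡ e) → k ℕ.< l ℕ.+ 2
  others (at-a p) (at-a _) h h′ = lit
  others (at-a p) (at-b q) h h′ = ⊥-elim (h (p , q))
  others (at-a p) (at-e q) h h′ = ⊥-elim (h′ (p , q))
  others (at-a p) other    h h′ = lit
  others {l = l} (at-b _) _ h h′ = small {k = l} ℕ.z≤n
  others {l = l} (at-e _) _ h h′ = small {k = l} ℕ.z≤n
  others {l = l} other    _ h h′ = small {k = l} ℕ.≤-refl

  potential : Potential G a b a e
  potential = record
    { height = height ; drop = 1
    ; drop-ab = ≡.trans ha (≡.cong (ℕ._+ 2) (≡.sym hb)) ; drop-ce = ≡.trans ha (≡.cong (ℕ._+ 2) (≡.sym he))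
    ; others = λ i j _ → others (layer i) (layer j) }
    where
    ha : height a ≡ 2
    ha rewrite dec-true (a ≟ a) ≡.refl = ≡.refl
    hb : height b ≡ 0
    hb rewrite dec-false (b ≟ a) (a≢b ∘ ≡.sym) | dec-true (b ≟ b) ≡.refl = ≡.refl
    he : height e ≡ 0
    he rewrite dec-false (e ≟ a) (a≢e ∘ ≡.sym) with e ≟ b
    ... | yes _ = ≡.refl
    ... | no _ rewrite dec-true (e ≟ e) ≡.refl = ≡.refl

module CommonHead {n} (G : Graph n) (a b c : Fin n) (a≢b : a ≢ b) (c≢b : c ≢ b) where

  height : Fin n → ℕ
  height i = if does (i ≟ b) then 0 else if does (i ≟ a) then 2 else if does (i ≟ c) then 2 else 1

  data Layer (i : Fin n) : ℕ → Set where
    at-b  : i ≡ b → Layer i 0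
    at-a  : i ≡ a → Layer i 2
    at-c  : i ≡ c → Layer i 2
    other : Layer i 1

  layer : ∀ i → Layer i (height i)
  layer i with i ≟ b | i ≟ a | i ≟ c
  ... | yes p | _     | _     = at-b p
  ... | no _  | yes p | _     = at-a p
  ... | no _  | no _  | yes p = at-c p
  ... | no _  | no _  | no _  = other

  others : ∀ {i j k l} → Layer i k → Layer j l → ¬ (i ≡ a × j ≡ b) → ¬ (i ≡ c × j ≡ b) → k ℕ.< l ℕ.+ 2
  others (at-a p) (at-b q) h h′ = ⊥-elim (h (p , q))
  others (at-a p) (at-a _) h h′ = lit
  others (at-a p) (at-c _) h h′ = lit
  others (at-a p) other    h h′ = lit
  others (at-c p) (at-b q) h h′ = ⊥-elim (h′ (p , q))
  others (at-c p) (at-a _) h h′ = lit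
  others (at-c p) (at-c _) h h′ = lit
  others (at-c p) other    h h′ = lit
  others {l = l} (at-b _) _ h h′ = small {k = l} ℕ.z≤n
  others {l = l} other    _ h h′ = small {k = l} ℕ.≤-refl

  potential : Potential G a b c b
  potential = record
    { height = height ; drop = 1
    ; drop-ab = ≡.trans ha (≡.cong (ℕ._+ 2) (≡.sym hb)) ; drop-ce = ≡.trans hc (≡.cong (ℕ._+ 2) (≡.sym hb))
    ; others = λ i j _ → others (layer i) (layer j) }
    where
    ha : height a ≡ 2
    ha rewrite dec-false (a ≟ b) a≢b | dec-true (a ≟ a) ≡.refl = ≡.refl
    hb : height b ≡ 0
    hb rewrite dec-true (b ≟ b) ≡.refl = ≡.refl
    hc : height c ≡ 2
    hc rewrite dec-false (c ≟ b) c≢b with c ≟ a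
    ... | yes _ = ≡.refl
    ... | no _ rewrite dec-true (c ≟ c) ≡.refl = ≡.refl

-- The path a → b → e, where b is the only common neighbour of a and e.
module Path {n} (G : Graph n) (a b e : Fin n) (ab : adjacent G a b ≡ true) (be : adjacent G b e ≡ true)
  (a≢e : a ≢ e) (ae : adjacent G a e ≡ false)
  (unique : ∀ o → adjacent G a o ≡ true → adjacent G o e ≡ true → o ≡ b) where

  height : Fin n → ℕ
  height i = if does (i ≟ a) then 8 else if does (i ≟ b) then 4 else if does (i ≟ e) then 0 else
    if adjacent G a i then 5 else 3

  data Layer (i : Fin n) : ℕ → Set where
    at-a : i ≡ a → Layer i 8
    at-b : i ≡ b → Layer i 4
    at-e : i ≡ e → Layer i 0
    near : i ≢ b → adjacent G a i ≡ true → Layer i 5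
    far  : adjacent G a i ≡ false → Layer i 3

  layer : ∀ i → Layer i (height i)
  layer i with i ≟ a | i ≟ b | i ≟ e | adjacent G a i in ai
  ... | yes p | _     | _     | _     = at-a p
  ... | no _  | yes p | _     | _     = at-b p
  ... | no _  | no _  | yes p | _     = at-e p
  ... | no _  | no i≢b  | no _  | true  = near i≢b ai
  ... | no _  | no _  | no _  | false = far ai

  others : ∀ {i j k l} → Layer i k → Layer j l → adjacent G i j ≡ true → ¬ (i ≡ a × j ≡ b) → ¬ (i ≡ b × j ≡ e) → k ℕ.< l ℕ.+ 4
  others (at-a ≡.refl) (at-a _) ij h h′ = lit
  others (at-a ≡.refl) (at-b q) ij h h′ = ⊥-elim (h (≡.refl , q))
  others (at-a ≡.refl) (at-e ≡.refl) ij h h′ with () ← ≡.trans (≡.sym ij) ae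
  others (at-a ≡.refl) (near _ _) ij h h′ = lit
  others (at-a ≡.refl) (far aj) ij h h′ with () ← ≡.trans (≡.sym ij) aj
  others (at-b p) (at-e q) ij h h′ = ⊥-elim (h′ (p , q))
  others (at-b _) (at-a _) ij h h′ = lit
  others (at-b _) (at-b _) ij h h′ = lit
  others (at-b _) (near _ _) ij h h′ = lit
  others (at-b _) (far _) ij h h′ = lit
  others {l = l} (at-e _) _ ij h h′ = small {k = l} ℕ.z≤n
  others (near i≢b ai) (at-e ≡.refl) ij h h′ = ⊥-elim (i≢b (unique _ ai ij))
  others (near _ _) (at-a _) ij h h′ = lit
  others (near _ _) (at-b _) ij h h′ = lit
  others (near _ _) (near _ _) ij h h′ = lit
  others (near _ _) (far _) ij h h′ = lit
  others {l = l} (far _) _ ij h h′ = small {k = l} ℕ.≤-refl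

  potential : Potential G a b b e
  potential = record
    { height = height ; drop = 3
    ; drop-ab = ≡.trans ha (≡.cong (ℕ._+ 4) (≡.sym hb)) ; drop-ce = ≡.trans hb (≡.cong (ℕ._+ 4) (≡.sym he))
    ; others = λ i j → others (layer i) (layer j) }
    where
    ha : height a ≡ 8
    ha rewrite dec-true (a ≟ a) ≡.refl = ≡.refl
    hb : height b ≡ 4
    hb rewrite dec-false (b ≟ a) (adjacent⇒≢ G ab ∘ ≡.sym) | dec-true (b ≟ b) ≡.refl = ≡.refl
    he : height e ≡ 0
    he rewrite dec-false (e ≟ a) (a≢e ∘ ≡.sym) | dec-false (e ≟ b) (adjacent⇒≢ G be ∘ ≡.sym) | dec-true (e ≟ e) ≡.refl = ≡.refl

-- Disjoint arcs (a , b) and (c , e) for which {a , e} is not an arc.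
module Disjoint {n} (G : Graph n) (a b c e : Fin n) (ab : adjacent G a b ≡ true) (ce : adjacent G c e ≡ true)
  (a≢c : a ≢ c) (b≢e : b ≢ e) (b≢c : b ≢ c) (a≢e : a ≢ e) (ae : adjacent G a e ≡ false) where

  height : Fin n → ℕ
  height i = if does (i ≟ a) then 6 else if does (i ≟ c) then 4 else if does (i ≟ b) then 2 else
    if does (i ≟ e) then 0 else 3

  data Layer (i : Fin n) : ℕ → Set where
    at-a  : i ≡ a → Layer i 6
    at-c  : i ≡ c → Layer i 4
    at-b  : i ≡ b → Layer i 2
    at-e  : i ≡ e → Layer i 0
    other : Layer i 3

  layer : ∀ i → Layer i (height i)
  layer i with i ≟ a | i ≟ c | i ≟ b | i ≟ e
  ... | yes p | _     | _     | _     = at-a p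
  ... | no _  | yes p | _     | _     = at-c p
  ... | no _  | no _  | yes p | _     = at-b p
  ... | no _  | no _  | no _  | yes p = at-e p
  ... | no _  | no _  | no _  | no _  = other

  others : ∀ {i j k l} → Layer i k → Layer j l → adjacent G i j ≡ true → ¬ (i ≡ a × j ≡ b) → ¬ (i ≡ c × j ≡ e) → k ℕ.< l ℕ.+ 4
  others (at-a _) (at-a _) ij h h′ = lit
  others (at-a _) (at-c _) ij h h′ = lit
  others (at-a p) (at-b q) ij h h′ = ⊥-elim (h (p , q))
  others (at-a ≡.refl) (at-e ≡.refl) ij h h′ with () ← ≡.trans (≡.sym ij) ae
  others (at-a _) other ij h h′ = lit
  others (at-c _) (at-a _) ij h h′ = lit
  others (at-c _) (at-c _) ij h h′ = lit
  others (at-c _) (at-b _) ij h h′ = lit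
  others (at-c p) (at-e q) ij h h′ = ⊥-elim (h′ (p , q))
  others (at-c _) other ij h h′ = lit
  others {l = l} (at-b _) _ ij h h′ = small {k = l} (ℕ.s≤s (ℕ.s≤s ℕ.z≤n))
  others {l = l} (at-e _) _ ij h h′ = small {k = l} ℕ.z≤n
  others {l = l} other _ ij h h′ = small {k = l} ℕ.≤-refl

  potential : Potential G a b c e
  potential = record
    { height = height ; drop = 3
    ; drop-ab = ≡.trans ha (≡.cong (ℕ._+ 4) (≡.sym hb)) ; drop-ce = ≡.trans hc (≡.cong (ℕ._+ 4) (≡.sym he))
    ; others = λ i j → others (layer i) (layer j) }
    where
    ha : height a ≡ 6
    ha rewrite dec-true (a ≟ a) ≡.refl = ≡.refl
    hb : height b ≡ 2
    hb rewrite dec-false (b ≟ a) (adjacent⇒≢ G ab ∘ ≡.sym) | dec-false (b ≟ c) b≢c | dec-true (b ≟ b) ≡.refl = ≡.refl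
    hc : height c ≡ 4
    hc rewrite dec-false (c ≟ a) (a≢c ∘ ≡.sym) | dec-true (c ≟ c) ≡.refl = ≡.refl
    he : height e ≡ 0
    he rewrite dec-false (e ≟ a) (a≢e ∘ ≡.sym) | dec-false (e ≟ c) (adjacent⇒≢ G ce ∘ ≡.sym) | dec-false (e ≟ b) (b≢e ∘ ≡.sym) | dec-true (e ≟ e) ≡.refl = ≡.refl

hasUniquePath-unfold : ∀ {n} (G : Graph n) {a c} → hasUniquePath G a c ≡ true →
  a ≢ c × adjacent G a c ≡ false × count (commonNeighbour G a c) ≡ 1
hasUniquePath-unfold G {a} {c} h = a≢c , nonadjacent , does-true (count (commonNeighbour G a c) ℕ.≟ 1) (proj₂ (∧-true {not (adjacent G a c)} h′))
  where
  h′ : not (adjacent G a c) ∧ does (count (commonNeighbour G a c) ℕ.≟ 1) ≡ true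
  h′ = proj₂ (∧-true {not (does (a ≟ c))} h)
  a≢c : a ≢ c
  a≢c ≡.refl with () ← ≡.trans (≡.sym h) (hasUniquePath-loop G a)
  nonadjacent : adjacent G a c ≡ false
  nonadjacent = ≡.trans (≡.sym (Bool.not-involutive _)) (≡.cong not (proj₁ (∧-true {not (adjacent G a c)} h′)))

data Compatibility {n} (G : Graph n) (a b c e : Fin n) : Bool → Set where
  sameArc    : a ≡ c → b ≡ e → Compatibility G a b c e false
  commonTail : a ≡ c → b ≢ e → Compatibility G a b c e true
  commonHead : a ≢ c → b ≡ e → Compatibility G a b c e true
  path       : b ≡ c → Compatibility G a b c e (hasUniquePath G a e)
  path′      : a ≡ e → Compatibility G a b c e (hasUniquePath G c b)
  disjoint   : a ≢ c → b ≢ e → b ≢ c → a ≢ e → Compatibility G a b c e (not (adjacent G a e ∧ adjacent G c b))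

compatibility : ∀ {n} (G : Graph n) a b c e → Compatibility G a b c e (compatible G a b c e)
compatibility G a b c e = by-cases (a ≟ c) (b ≟ e) (b ≟ c) (a ≟ e)
  where
  by-cases : Dec (a ≡ c) → Dec (b ≡ e) → Dec (b ≡ c) → Dec (a ≡ e) → Compatibility G a b c e (compatible G a b c e)
  by-cases (yes p) (yes q) _ _ rewrite dec-true (a ≟ c) p | dec-true (b ≟ e) q = sameArc p q
  by-cases (yes p) (no q) _ _ rewrite dec-true (a ≟ c) p | dec-false (b ≟ e) q = commonTail p q
  by-cases (no p) (yes q) _ _ rewrite dec-false (a ≟ c) p | dec-true (b ≟ e) q = commonHead p q
  by-cases (no p) (no q) (yes r) _ rewrite dec-false (a ≟ c) p | dec-false (b ≟ e) q | dec-true (b ≟ c) r = path r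
  by-cases (no p) (no q) (no r) (yes s) rewrite dec-false (a ≟ c) p | dec-false (b ≟ e) q | dec-false (b ≟ c) r | dec-true (a ≟ e) s = path′ s
  by-cases (no p) (no q) (no r) (no s) rewrite dec-false (a ≟ c) p | dec-false (b ≟ e) q | dec-false (b ≟ c) r | dec-false (a ≟ e) s = disjoint p q r s

potential : ∀ {n} (G : Graph n) {a b c e} → adjacent G a b ≡ true → adjacent G c e ≡ true →
  compatible G a b c e ≡ true → Potential G a b c e
potential G {a} {b} {c} {e} ab ce h = by-cases (compatibility G a b c e) h
  where
  along : ∀ {a b e} → adjacent G a b ≡ true → adjacent G b e ≡ true → hasUniquePath G a e ≡ true → Potential G a b b e
  along {a} {b} {e} ab be h with a≢e , ae , one ← hasUniquePath-unfold G {a} {e} h =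
    Path.potential G a b e ab be a≢e ae (λ o ao oe → count≡1-unique one (≡.cong₂ _∧_ ao oe) (≡.cong₂ _∧_ ab be))
  by-cases : ∀ {t} → Compatibility G a b c e t → t ≡ true → Potential G a b c e
  by-cases (commonTail ≡.refl _) _ = CommonTail.potential G a b e (adjacent⇒≢ G ab) (adjacent⇒≢ G ce)
  by-cases (commonHead _ ≡.refl) _ = CommonHead.potential G a b c (adjacent⇒≢ G ab) (adjacent⇒≢ G ce)
  by-cases (path ≡.refl) h = along ab ce h
  by-cases (path′ ≡.refl) h = Potential-sym (along ce ab h)
  by-cases (disjoint a≢c b≢e b≢c a≢e) h with adjacent G a e in ae | adjacent G c b in cb
  ... | false | _ = Disjoint.potential G a b c e ab ce a≢c b≢e b≢c a≢e ae
  ... | true | false = Potential-sym (Disjoint.potential G c e a b ce ab (a≢c ∘ ≡.sym) (b≢e ∘ ≡.sym) (a≢e ∘ ≡.sym) (b≢c ∘ ≡.sym) cb)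

-- Two arcs that are not compatible lie in the convex hull of other arcs
-- (a square or a second path), or force the hyperplane through 0.
data Obstruction {n} (G : Graph n) (a b c e : Fin n) : Set where
  opposite : a ≡ e → b ≡ c → Obstruction G a b c e
  shortcut : b ≡ c → adjacent G a e ≡ true → Obstruction G a b c e
  detour   : b ≡ c → ∀ o → o ≢ b → adjacent G a o ≡ true → adjacent G o e ≡ true → Obstruction G a b c e
  square   : a ≢ c → b ≢ e → adjacent G a e ≡ true → adjacent G c b ≡ true → Obstruction G a b c e

obstruction : ∀ {n} (G : Graph n) {a b c e} → adjacent G a b ≡ true → adjacent G c e ≡ true → ¬ (a ≡ c × b ≡ e) →
  compatible G a b c e ≡ false → Obstruction G a b c e ⊎ Obstruction G c e a b
obstruction G {a} {b} {c} {e} ab ce distinct h = by-cases (compatibility G a b c e) h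
  where
  along : ∀ {a b e} → adjacent G a b ≡ true → adjacent G b e ≡ true → hasUniquePath G a e ≡ false → Obstruction G a b b e
  along {a} {b} {e} ab be h with a ≟ e
  ... | yes p = opposite p ≡.refl
  ... | no a≢e with adjacent G a e in ae
  ...   | true = shortcut ≡.refl ae
  ...   | false with Fin.any? (λ o → ¬? (o ≟ b) ×-dec (commonNeighbour G a e o Bool.≟ true))
  ...     | yes (o , o≢b , co) = detour ≡.refl o o≢b (proj₁ (∧-true co)) (proj₂ (∧-true {adjacent G a o} co))
  ...     | no none = ⊥-elim (impossible (≡.trans (≡.sym h) (≡.cong (λ k → does (k ℕ.≟ 1)) (count-unique b (≡.cong₂ _∧_ ab be) only))))
    where
    impossible : false ≢ true
    impossible ()
    only : ∀ o → commonNeighbour G a e o ≡ true → o ≡ b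
    only o co with o ≟ b
    ... | yes p = p
    ... | no o≢b = ⊥-elim (none (o , o≢b , co))
  by-cases : ∀ {t} → Compatibility G a b c e t → t ≡ false → Obstruction G a b c e ⊎ Obstruction G c e a b
  by-cases (sameArc p q) _ = ⊥-elim (distinct (p , q))
  by-cases (path ≡.refl) h = inj₁ (along ab ce h)
  by-cases (path′ ≡.refl) h = inj₂ (along ce ab h)
  by-cases (disjoint a≢c b≢e _ _) h with adjacent G a e in ae | adjacent G c b in cb
  ... | true | true = inj₁ (square a≢c b≢e ae cb)

nth : ∀ {n} (f : Fin n → Bool) → Fin (count f) → Fin n
nth {suc n} f k with f zero
nth {suc n} f zero    | true  = zero
nth {suc n} f (suc k) | true  = suc (nth (f ∘ suc) k)
nth {suc n} f k       | false = suc (nth (f ∘ suc) k)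

nth-true : ∀ {n} (f : Fin n → Bool) k → f (nth f k) ≡ true
nth-true {suc n} f k with f zero in e
nth-true {suc n} f zero    | true  = e
nth-true {suc n} f (suc k) | true  = nth-true (f ∘ suc) k
nth-true {suc n} f k       | false = nth-true (f ∘ suc) k

nth-injective : ∀ {n} (f : Fin n → Bool) k l → nth f k ≡ nth f l → k ≡ l
nth-injective {suc n} f k l e with f zero
nth-injective {suc n} f zero    zero    e | true  = ≡.refl
nth-injective {suc n} f (suc k) (suc l) e | true  = ≡.cong suc (nth-injective (f ∘ suc) k l (Fin.suc-injective e))
nth-injective {suc n} f k       l       e | false = nth-injective (f ∘ suc) k l (Fin.suc-injective e)

nth-surjective : ∀ {n} (f : Fin n → Bool) i → f i ≡ true → ∃[ k ] nth f k ≡ i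
nth-surjective {suc n} f i h with f zero in e
nth-surjective {suc n} f zero    h | true  = zero , ≡.refl
nth-surjective {suc n} f (suc i) h | true  with k , eq ← nth-surjective (f ∘ suc) i h = suc k , ≡.cong suc eq
nth-surjective {suc n} f (suc i) h | false with k , eq ← nth-surjective (f ∘ suc) i h = k , ≡.cong suc eq
nth-surjective {suc n} f zero    h | false with () ← ≡.trans (≡.sym h) e

arc-≡ : ∀ {n} {v w : Arc n} → tail {n} v ≡ tail {n} w → head {n} v ≡ head {n} w → v ≡ w
arc-≡ {n} {v} {w} p q = ≡.trans (≡.sym (Fin.combine-remQuot {n} n v))
  (≡.trans (≡.cong₂ combine p q) (Fin.combine-remQuot {n} n w))

pair-≡ : ∀ {n} {y z : ArcPair n} → left {n} y ≡ left {n} z → right {n} y ≡ right {n} z → y ≡ z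
pair-≡ {n} {y} {z} p q = ≡.trans (≡.sym (Fin.combine-remQuot {n ℕ.* n} (n ℕ.* n) y))
  (≡.trans (≡.cong₂ combine p q) (Fin.combine-remQuot {n ℕ.* n} (n ℕ.* n) z))

record Selected {n} (G : Graph n) (v w : Arc n) : Set where
  field
    ordered    : v Fin.< w
    first-arc  : adjacent G (tail v) (head v) ≡ true
    second-arc : adjacent G (tail w) (head w) ≡ true
    compatible-arcs : compatible G (tail v) (head v) (tail w) (head w) ≡ true

  distinct : ¬ (tail {n} v ≡ tail {n} w × head {n} v ≡ head {n} w)
  distinct (p , q) = Fin.<⇒≢ ordered (arc-≡ {n} {v} {w} p q)

selected⇒ : ∀ {n} (G : Graph n) z → selected {n} G z ≡ true → Selected G (left {n} z) (right {n} z)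
selected⇒ {n} G z h = record
  { ordered = does-true (v Fin.<? w) (proj₁ (∧-true {does (v Fin.<? w)} h))
  ; first-arc = proj₁ (∧-true {adjacent G (tail v) (head v)} arcs)
  ; second-arc = proj₂ (∧-true {adjacent G (tail v) (head v)} arcs)
  ; compatible-arcs = proj₂ (∧-true {adjacent G (tail v) (head v) ∧ adjacent G (tail w) (head w)} j) }
  where
  v w : Arc n
  v = left {n} z
  w = right {n} z
  j : joined G v w ≡ true
  j = proj₂ (∧-true {does (v Fin.<? w)} h)
  arcs : adjacent G (tail v) (head v) ∧ adjacent G (tail w) (head w) ≡ true
  arcs = proj₁ (∧-true {adjacent G (tail v) (head v) ∧ adjacent G (tail w) (head w)} j)

selected⇐ : ∀ {n} (G : Graph n) v w → Selected G v w →
  ∃[ k ] left {n} (nth (selected G) k) ≡ v × right {n} (nth (selected G) k) ≡ w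
selected⇐ {n} G v w S with nth-surjective (selected G) z z-selected
  where
  open Selected S
  z : ArcPair n
  z = combine {n ℕ.* n} v w
  z-selected : selected {n} G z ≡ true
  z-selected = at (Fin.remQuot-combine {n ℕ.* n} {n ℕ.* n} v w)
    where
    at : ∀ {r : Arc n × Arc n} → r ≡ (v , w) → does (proj₁ r Fin.<? proj₂ r) ∧ joined G (proj₁ r) (proj₂ r) ≡ true
    at ≡.refl = ≡.cong₂ _∧_ (dec-true (v Fin.<? w) ordered) (≡.cong₂ _∧_ (≡.cong₂ _∧_ first-arc second-arc) compatible-arcs)
... | k , e = k , ≡.trans (≡.cong (left {n}) e) (≡.cong proj₁ (Fin.remQuot-combine {n ℕ.* n} {n ℕ.* n} v w)) ,
                  ≡.trans (≡.cong (right {n}) e) (≡.cong proj₂ (Fin.remQuot-combine {n ℕ.* n} {n ℕ.* n} v w))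

module Reals (R : RealField) where

  open Theory R public hiding (zero)

  commutativeRing : CommutativeRing 0ℓ 0ℓ
  commutativeRing = HeytingCommutativeRing.commutativeRing heytingCommutativeRing

  open CommutativeRing commutativeRing public
    using (ring; semiring; +-monoid)
  open RingProperties ring public
    using (-0#≈0#; -‿distribˡ-*; -‿distribʳ-*; -‿involutive; -‿+-comm)

  module ≈-Reasoning where
    open import Relation.Binary.Reasoning.Setoid setoid public

  fromℕ-+ : ∀ m n → fromℕ (m ℕ.+ n) ≈ fromℕ m + fromℕ n
  fromℕ-+ = MonoidMult.×-homo-+ +-monoid 1#

  fromℕ-* : ∀ m n → fromℕ (m ℕ.* n) ≈ fromℕ m * fromℕ n
  fromℕ-* = SemiringMult.×1-homo-* semiring

  fromℤ : ℤ → ℝ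
  fromℤ (ℤ.+ n)    = fromℕ n
  fromℤ ℤ.-[1+ n ] = - fromℕ (suc n)

  module _ where

    open ≈-Reasoning

    private
      cancel : ∀ a b c → a + b - (a + c) ≈ b - c
      cancel a b c = begin
        a + b - (a + c)       ≈⟨ +-congˡ (-‿+-comm a c) ⟨
        a + b + (- a - c)     ≈⟨ +-congʳ (+-comm a b) ⟩
        b + a + (- a - c)     ≈⟨ +-assoc b a _ ⟩
        b + (a + (- a - c))   ≈⟨ +-congˡ (+-assoc a _ _) ⟨
        b + (a - a - c)       ≈⟨ +-congˡ (+-congʳ (-‿inverseʳ a)) ⟩
        b + (0# - c)          ≈⟨ +-congˡ (+-identityˡ _) ⟩
        b - c                 ∎

    fromℤ-⊖ : ∀ m n → fromℤ (m ℤ.⊖ n) ≈ fromℕ m - fromℕ n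
    fromℤ-⊖ m zero = sym (trans (+-congˡ -0#≈0#) (+-identityʳ _))
    fromℤ-⊖ zero (suc n) = sym (+-identityˡ _)
    fromℤ-⊖ (suc m) (suc n) = begin
      fromℤ (suc m ℤ.⊖ suc n)     ≡⟨ ≡.cong fromℤ (ℤ.[1+m]⊖[1+n]≡m⊖n m n) ⟩
      fromℤ (m ℤ.⊖ n)             ≈⟨ fromℤ-⊖ m n ⟩
      fromℕ m - fromℕ n           ≈⟨ cancel 1# (fromℕ m) (fromℕ n) ⟨
      fromℕ (suc m) - fromℕ (suc n) ∎

    fromℤ-+ : ∀ i j → fromℤ (i ℤ.+ j) ≈ fromℤ i + fromℤ j
    fromℤ-+ (ℤ.+ m) (ℤ.+ n) = fromℕ-+ m n
    fromℤ-+ (ℤ.+ m) ℤ.-[1+ n ] = fromℤ-⊖ m (suc n)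
    fromℤ-+ ℤ.-[1+ m ] (ℤ.+ n) = trans (fromℤ-⊖ n (suc m)) (+-comm _ _)
    fromℤ-+ ℤ.-[1+ m ] ℤ.-[1+ n ] = begin
      - fromℕ (suc (suc (m ℕ.+ n)))      ≡⟨ ≡.cong (λ k → - fromℕ k) (≡.cong suc (ℕ.+-suc m n)) ⟨
      - fromℕ (suc m ℕ.+ suc n)          ≈⟨ -‿cong (fromℕ-+ (suc m) (suc n)) ⟩
      - (fromℕ (suc m) + fromℕ (suc n))  ≈⟨ -‿+-comm _ _ ⟨
      - fromℕ (suc m) - fromℕ (suc n)    ∎

    fromℤ-neg : ∀ i → fromℤ (ℤ.- i) ≈ - fromℤ i
    fromℤ-neg (ℤ.+ zero) = sym -0#≈0#
    fromℤ-neg (ℤ.+ suc n) = refl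
    fromℤ-neg ℤ.-[1+ n ] = sym (-‿involutive _)

    private
      fromℤ-*⁺ : ∀ m j → fromℤ (ℤ.+ m ℤ.* j) ≈ fromℕ m * fromℤ j
      fromℤ-*⁺ m (ℤ.+ n) = begin
        fromℤ (ℤ.+ m ℤ.* ℤ.+ n) ≡⟨ ≡.cong fromℤ (ℤ.pos-* m n) ⟨
        fromℕ (m ℕ.* n)     ≈⟨ fromℕ-* m n ⟩
        fromℕ m * fromℕ n   ∎
      fromℤ-*⁺ m ℤ.-[1+ n ] = begin
        fromℤ (ℤ.+ m ℤ.* ℤ.- (ℤ.+ suc n))   ≡⟨ ≡.cong fromℤ (ℤ.neg-distribʳ-* (ℤ.+ m) (ℤ.+ suc n)) ⟨
        fromℤ (ℤ.- (ℤ.+ m ℤ.* ℤ.+ suc n))   ≈⟨ fromℤ-neg (ℤ.+ m ℤ.* ℤ.+ suc n) ⟩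
        - fromℤ (ℤ.+ m ℤ.* ℤ.+ suc n)       ≈⟨ -‿cong (fromℤ-*⁺ m (ℤ.+ suc n)) ⟩
        - (fromℕ m * fromℕ (suc n))     ≈⟨ -‿distribʳ-* _ _ ⟩
        fromℕ m * - fromℕ (suc n)       ∎

    fromℤ-* : ∀ i j → fromℤ (i ℤ.* j) ≈ fromℤ i * fromℤ j
    fromℤ-* (ℤ.+ m) j = fromℤ-*⁺ m j
    fromℤ-* ℤ.-[1+ m ] j = begin
      fromℤ (ℤ.- (ℤ.+ suc m) ℤ.* j)   ≡⟨ ≡.cong fromℤ (ℤ.neg-distribˡ-* (ℤ.+ suc m) j) ⟨
      fromℤ (ℤ.- (ℤ.+ suc m ℤ.* j))   ≈⟨ fromℤ-neg (ℤ.+ suc m ℤ.* j) ⟩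
      - fromℤ (ℤ.+ suc m ℤ.* j)       ≈⟨ -‿cong (fromℤ-*⁺ (suc m) j) ⟩
      - (fromℕ (suc m) * fromℤ j)   ≈⟨ -‿distribˡ-* _ _ ⟩
      - fromℕ (suc m) * fromℤ j     ∎

  -- The solver reads the coefficient 1 as 1# instead of fromℕ 1 = 1# + 0#.
  private
    coefficient : ℤ → ℝ
    coefficient (ℤ.+ 1) = 1#
    coefficient i     = fromℤ i

    coefficient≈fromℤ : ∀ i → coefficient i ≈ fromℤ i
    coefficient≈fromℤ (ℤ.+ 0)             = refl
    coefficient≈fromℤ (ℤ.+ 1)             = sym (+-identityʳ 1#)
    coefficient≈fromℤ (ℤ.+ suc (suc n))   = refl
    coefficient≈fromℤ ℤ.-[1+ n ]          = refl

    morphism : CommutativeRing.rawRing ℤ.+-*-commutativeRing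
               -Raw-AlmostCommutative⟶ fromCommutativeRing commutativeRing
    morphism = record
      { ⟦_⟧    = coefficient
      ; +-homo = λ i j → lift₂ (i ℤ.+ j) (fromℤ-+ i j)
                           (+-cong (coefficient≈fromℤ i) (coefficient≈fromℤ j))
      ; *-homo = λ i j → lift₂ (i ℤ.* j) (fromℤ-* i j)
                           (*-cong (coefficient≈fromℤ i) (coefficient≈fromℤ j))
      ; -‿homo = λ i → lift₂ (ℤ.- i) (fromℤ-neg i) (-‿cong (coefficient≈fromℤ i))
      ; 0-homo = refl
      ; 1-homo = refl
      }
      where
      lift₂ : ∀ k {x y} → fromℤ k ≈ x → y ≈ x → coefficient k ≈ y
      lift₂ k e f = trans (coefficient≈fromℤ k) (trans e (sym f))

  private
    module Solver = RingSolver
      (CommutativeRing.rawRing ℤ.+-*-commutativeRing)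
      (fromCommutativeRing commutativeRing) morphism
      (λ i j → Maybe.map (λ i≡j → reflexive (≡.cong coefficient i≡j)) (dec⇒maybe (i ℤ.≟ j)))

  open Solver public
    using (_:=_; _:+_; _:*_; _:-_; :-_; _:^_; con; Polynomial)

  private
    sides : ∀ n → N-ary n (Polynomial n) (Polynomial n × Polynomial n) → Polynomial n × Polynomial n
    sides n f = f $ⁿ Vec.map Solver.var (Vec.allFin n)

    equalNormalForms : ∀ {n} (e : Polynomial n × Polynomial n) → Maybe (∀ ρ → Solver.⟦ proj₁ e ⟧ ρ ≈ Solver.⟦ proj₂ e ⟧ ρ)
    equalNormalForms (e₁ , e₂) = Maybe.map (λ e ρ → Solver.prove ρ e₁ e₂ (Solver.⟦ e ⟧N-cong ρ))
      (Solver.normalise e₁ Solver.≟N Solver.normalise e₂)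

  -- Normal forms are compared as syntax: comparing their values, as the solver
  -- of the library does, is very expensive to type check.
  solve : ∀ n (f : N-ary n (Polynomial n) (Polynomial n × Polynomial n)) →
    {_ : T (Maybe.is-just (equalNormalForms (sides n f)))} →
    Eq n _≈_ (curryⁿ Solver.⟦ proj₁ (sides n f) ⟧) (curryⁿ Solver.⟦ proj₂ (sides n f) ⟧)
  solve n f {t} = curryⁿ-cong _≈_ Solver.⟦ proj₁ (sides n f) ⟧ Solver.⟦ proj₂ (sides n f) ⟧
    (to-witness-T (equalNormalForms (sides n f)) t)

  :0 :1 :2 :4 :8 : ∀ {n} → Polynomial n
  :0 = con (ℤ.+ 0)
  :1 = con (ℤ.+ 1)
  :2 = con (ℤ.+ 2)
  :4 = con (ℤ.+ 4)
  :8 = con (ℤ.+ 8)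

  open IsStrictPartialOrder isStrictPartialOrder public
    using (<-resp-≈; <-respˡ-≈; <-respʳ-≈)
    renaming (irrefl to <-irrefl; trans to <-trans; asym to <-asym)

  <-cotrans : ∀ {x y} → x < y → ∀ z → x < z ⊎ z < y
  <-cotrans {x} {y} x<y z with #-cotrans (<⇒# x<y) z
  ... | inj₁ x#z with #⇒<⊎> x#z
  ...   | inj₁ x<z = inj₁ x<z
  ...   | inj₂ z<x = inj₂ (<-trans z<x x<y)
  <-cotrans {x} {y} x<y z | inj₂ z#y with #⇒<⊎> z#y
  ...   | inj₁ z<y = inj₂ z<y
  ...   | inj₂ y<z = inj₁ (<-trans x<y y<z)

  <⇒≤ : ∀ {x y} → x < y → x ≤ y
  <⇒≤ = <-asym

  ≤-reflexive : ∀ {x y} → x ≈ y → x ≤ y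
  ≤-reflexive x≈y y<x = <-irrefl (sym x≈y) y<x

  ≤-refl : ∀ {x} → x ≤ x
  ≤-refl = ≤-reflexive refl

  ≤-trans : ∀ {x y z} → x ≤ y → y ≤ z → x ≤ z
  ≤-trans {y = y} x≤y y≤z z<x with <-cotrans z<x y
  ... | inj₁ z<y = y≤z z<y
  ... | inj₂ y<x = x≤y y<x

  <-≤-trans : ∀ {x y z} → x < y → y ≤ z → x < z
  <-≤-trans {z = z} x<y y≤z with <-cotrans x<y z
  ... | inj₁ x<z = x<z
  ... | inj₂ z<y = ⊥-elim (y≤z z<y)

  ≤-<-trans : ∀ {x y z} → x ≤ y → y < z → x < z
  ≤-<-trans {x = x} x≤y y<z with <-cotrans y<z x
  ... | inj₁ y<x = ⊥-elim (x≤y y<x)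
  ... | inj₂ x<z = x<z

  ≤-antisym : ∀ {x y} → x ≤ y → y ≤ x → x ≈ y
  ≤-antisym {x} {y} x≤y y≤x = proj₁ (tight x y) λ x#y →
    [ y≤x , x≤y ]′ (#⇒<⊎> x#y)

  ≤-isPreorder : IsPreorder _≈_ _≤_
  ≤-isPreorder = record
    { isEquivalence = isEquivalence ; reflexive = ≤-reflexive ; trans = ≤-trans }

  module ≤-Reasoning = Triple ≤-isPreorder <-asym <-trans <-resp-≈ <⇒≤ <-≤-trans ≤-<-trans

  ≤-cong : ∀ {x x′ y y′} → x ≈ x′ → y ≈ y′ → x ≤ y → x′ ≤ y′
  ≤-cong e f x≤y = ≤-trans (≤-reflexive (sym e)) (≤-trans x≤y (≤-reflexive f))

  ≤-byCases : ∀ {a b} x y → (x < y → a ≤ b) → (y ≤ x → a ≤ b) → a ≤ b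
  ≤-byCases x y f g b<a = g (λ x<y → f x<y b<a) b<a

  +-monoʳ-< : ∀ z {x y} → x < y → z + x < z + y
  +-monoʳ-< z x<y = <-respˡ-≈ (+-comm _ _) (<-respʳ-≈ (+-comm _ _) (+-monoˡ-< z x<y))

  +-cancelʳ-< : ∀ z {x y} → x + z < y + z → x < y
  +-cancelʳ-< z {x} {y} lt =
    <-respˡ-≈ (shift x) (<-respʳ-≈ (shift y) (+-monoˡ-< (- z) lt))
    where
    shift : ∀ x → x + z - z ≈ x
    shift x = solve 2 (λ x z → x :+ z :- z := x) x z

  +-monoˡ-≤ : ∀ z {x y} → x ≤ y → x + z ≤ y + z
  +-monoˡ-≤ z x≤y lt = x≤y (+-cancelʳ-< z lt)

  +-cancelʳ-≤ : ∀ z {x y} → x + z ≤ y + z → x ≤ y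
  +-cancelʳ-≤ z le lt = le (+-monoˡ-< z lt)

  +-mono-≤ : ∀ {w x y z} → w ≤ x → y ≤ z → w + y ≤ x + z
  +-mono-≤ {w} {x} {y} {z} w≤x y≤z =
    ≤-trans (+-monoˡ-≤ y w≤x)
      (≤-cong (+-comm _ _) (+-comm _ _) (+-monoˡ-≤ x y≤z))

  +-mono-<-≤ : ∀ {w x y z} → w < x → y ≤ z → w + y < x + z
  +-mono-<-≤ {w} {x} {y} {z} w<x y≤z = <-≤-trans (+-monoˡ-< y w<x) (+-mono-≤ ≤-refl y≤z)

  ≤-fromDifference : ∀ {x y} d → 0# ≤ d → x + d ≈ y → x ≤ y
  ≤-fromDifference {x} {y} d 0≤d e =
    ≤-trans (≤-reflexive (sym (+-identityʳ x)))
      (≤-trans (+-mono-≤ (≤-refl {x}) 0≤d) (≤-reflexive e))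

  <-fromDifference : ∀ {x y} d → 0# < d → x + d ≈ y → x < y
  <-fromDifference {x} {y} d 0<d e =
    <-respˡ-≈ (+-identityʳ x) (<-respʳ-≈ e (+-monoʳ-< x 0<d))

  x≤y⇒0≤y-x : ∀ {x y} → x ≤ y → 0# ≤ y - x
  x≤y⇒0≤y-x {x} {y} x≤y = ≤-cong (-‿inverseʳ x) refl (+-monoˡ-≤ (- x) x≤y)

  x<y⇒0<y-x : ∀ {x y} → x < y → 0# < y - x
  x<y⇒0<y-x {x} {y} x<y = <-respˡ-≈ (-‿inverseʳ x) (+-monoˡ-< (- x) x<y)

  0≤y-x⇒x≤y : ∀ {x y} → 0# ≤ y - x → x ≤ y
  0≤y-x⇒x≤y {x} {y} h =
    ≤-fromDifference (y - x) h (solve 2 (λ x y → x :+ (y :- x) := y) x y)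

  neg-mono-≤ : ∀ {x y} → x ≤ y → - y ≤ - x
  neg-mono-≤ {x} {y} x≤y = ≤-fromDifference (y - x) (x≤y⇒0≤y-x x≤y)
    (solve 2 (λ x y → :- y :+ (y :- x) := :- x) x y)

  neg-mono-< : ∀ {x y} → x < y → - y < - x
  neg-mono-< {x} {y} x<y = <-fromDifference (y - x) (x<y⇒0<y-x x<y)
    (solve 2 (λ x y → :- y :+ (y :- x) := :- x) x y)

  0≤-+ : ∀ {x y} → 0# ≤ x → 0# ≤ y → 0# ≤ x + y
  0≤-+ 0≤x 0≤y = ≤-cong (+-identityʳ 0#) refl (+-mono-≤ 0≤x 0≤y)

  0<-+ : ∀ {x y} → 0# < x → 0# ≤ y → 0# < x + y
  0<-+ 0<x 0≤y = <-respˡ-≈ (+-identityʳ 0#) (+-mono-<-≤ 0<x 0≤y)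

  #0-factorˡ : ∀ {x y} → x * y # 0# → x # 0#
  #0-factorˡ {x} {y} xy#0 with #⇒invertible xy#0
  ... | z , zxy≈1 , _ = invertible⇒# (y * z ,
    trans (solve 3 (λ x y z → y :* z :* (x :- :0) := z :* (x :* y :- :0)) x y z) zxy≈1 ,
    trans (solve 3 (λ x y z → (x :- :0) :* (y :* z) := z :* (x :* y :- :0)) x y z) zxy≈1)

  #-respˡ-≈ : ∀ {x y z} → x ≈ y → x # z → y # z
  #-respˡ-≈ x≈y x#z with #⇒<⊎> x#z
  ... | inj₁ x<z = <⇒# (<-respˡ-≈ x≈y x<z)
  ... | inj₂ z<x = #-sym (<⇒# (<-respʳ-≈ x≈y z<x))

  #0-factorʳ : ∀ {x y} → x * y # 0# → y # 0#
  #0-factorʳ xy#0 = #0-factorˡ (#-respˡ-≈ (*-comm _ _) xy#0)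

  <0⇒0<- : ∀ {x} → x < 0# → 0# < - x
  <0⇒0<- x<0 = <-respˡ-≈ -0#≈0# (neg-mono-< x<0)

  0≤∧#⇒0< : ∀ {x} → 0# ≤ x → x # 0# → 0# < x
  0≤∧#⇒0< 0≤x x#0 with #⇒<⊎> x#0
  ... | inj₁ x<0 = ⊥-elim (0≤x x<0)
  ... | inj₂ 0<x = 0<x

  0≤-* : ∀ {x y} → 0# ≤ x → 0# ≤ y → 0# ≤ x * y
  0≤-* 0≤x 0≤y xy<0 = <-asym xy<0
    (*-positive (0≤∧#⇒0< 0≤x (#0-factorˡ (<⇒# xy<0))) (0≤∧#⇒0< 0≤y (#0-factorʳ (<⇒# xy<0))))

  #0⇒0<² : ∀ {x} → x # 0# → 0# < x * x
  #0⇒0<² {x} x#0 with #⇒<⊎> x#0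
  ... | inj₂ 0<x = *-positive 0<x 0<x
  ... | inj₁ x<0 = <-respʳ-≈ (solve 1 (λ x → :- x :* :- x := x :* x) x)
                     (*-positive (<0⇒0<- x<0) (<0⇒0<- x<0))

  0≤x*x : ∀ x → 0# ≤ x * x
  0≤x*x x xx<0 = <-asym xx<0 (#0⇒0<² (#0-factorˡ (<⇒# xx<0)))

  0≤x² : ∀ x → 0# ≤ x ^ 2
  0≤x² x = ≤-cong refl (solve 1 (λ x → x :* x := x :^ 2) x) (0≤x*x x)

  *-monoˡ-≤ : ∀ {z} → 0# ≤ z → ∀ {x y} → x ≤ y → z * x ≤ z * y
  *-monoˡ-≤ {z} 0≤z {x} {y} x≤y = ≤-fromDifference (z * (y - x)) (0≤-* 0≤z (x≤y⇒0≤y-x x≤y))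
    (solve 3 (λ x y z → z :* x :+ z :* (y :- x) := z :* y) x y z)

  *-monoʳ-≤ : ∀ {z} → 0# ≤ z → ∀ {x y} → x ≤ y → x * z ≤ y * z
  *-monoʳ-≤ 0≤z x≤y = ≤-cong (*-comm _ _) (*-comm _ _) (*-monoˡ-≤ 0≤z x≤y)

  *-mono-≤ : ∀ {w x y z} → 0# ≤ w → 0# ≤ y → w ≤ x → y ≤ z → w * y ≤ x * z
  *-mono-≤ 0≤w 0≤y w≤x y≤z = ≤-trans (*-monoʳ-≤ 0≤y w≤x) (*-monoˡ-≤ (≤-trans 0≤w w≤x) y≤z)

  ^-mono-≤ : ∀ k {x y} → 0# ≤ x → x ≤ y → x ^ k ≤ y ^ k
  0≤-^ : ∀ k {x} → 0# ≤ x → 0# ≤ x ^ k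

  0≤-^ zero 0≤x = <⇒≤ 0<1
  0≤-^ (suc k) 0≤x = 0≤-* 0≤x (0≤-^ k 0≤x)

  ^-mono-≤ zero 0≤x x≤y = ≤-refl
  ^-mono-≤ (suc k) 0≤x x≤y = *-mono-≤ 0≤x (0≤-^ k 0≤x) x≤y (^-mono-≤ k 0≤x x≤y)

  0<-^ : ∀ k {x} → 0# < x → 0# < x ^ k
  0<-^ zero 0<x = 0<1
  0<-^ (suc k) 0<x = *-positive 0<x (0<-^ k 0<x)

  *-cancelˡ-≤ : ∀ {z} → 0# < z → ∀ {x y} → z * x ≤ z * y → x ≤ y
  *-cancelˡ-≤ {z} 0<z {x} {y} le lt = le (<-fromDifference (z * (x - y))
    (*-positive 0<z (x<y⇒0<y-x lt)) (solve 3 (λ x y z → z :* y :+ z :* (x :- y) := z :* x) x y z))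

  *-cancelˡ-< : ∀ {z} → 0# ≤ z → ∀ {x y} → z * x < z * y → x < y
  *-cancelˡ-< {z} 0≤z {x} {y} lt = [ contra , positive ]′ (#⇒<⊎> y-x#0)
    where
    y-x#0 : y - x # 0#
    y-x#0 = #0-factorʳ {z} (#-respˡ-≈
      (solve 3 (λ x y z → z :* y :- z :* x := z :* (y :- x)) x y z) (#-sym (<⇒# (x<y⇒0<y-x lt))))
    positive : 0# < y - x → x < y
    positive 0<y-x = <-fromDifference (y - x) 0<y-x (solve 2 (λ x y → x :+ (y :- x) := y) x y)
    contra : y - x < 0# → x < y
    contra y-x<0 = ⊥-elim (*-monoˡ-≤ 0≤z (<⇒≤ y<x) lt)
      where
      y<x : y < x
      y<x = <-fromDifference (- (y - x)) (<0⇒0<- y-x<0) (solve 2 (λ x y → y :+ :- (y :- x) := x) x y)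

  *≈0∧#0⇒≈0 : ∀ {x y} → x * y ≈ 0# → x # 0# → y ≈ 0#
  *≈0∧#0⇒≈0 {x} {y} xy≈0 x#0 with #⇒invertible x#0
  ... | z , zx≈1 , _ = begin
    y                    ≈⟨ *-identityˡ y ⟨
    1# * y               ≈⟨ *-congʳ zx≈1 ⟨
    z * (x - 0#) * y     ≈⟨ solve 3 (λ x y z → z :* (x :- :0) :* y := z :* (x :* y)) x y z ⟩
    z * (x * y)          ≈⟨ *-congˡ xy≈0 ⟩
    z * 0#               ≈⟨ zeroʳ z ⟩
    0#                   ∎
    where open ≈-Reasoning

  0<fromℕ : ∀ n → 0# < fromℕ (suc n)
  0≤fromℕ : ∀ n → 0# ≤ fromℕ n

  0≤fromℕ zero    = ≤-refl
  0≤fromℕ (suc n) = <⇒≤ (0<fromℕ n)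

  0<fromℕ n = 0<-+ 0<1 (0≤fromℕ n)

  fromℕ-mono-≤ : ∀ {m n} → m ℕ.≤ n → fromℕ m ≤ fromℕ n
  fromℕ-mono-≤ {n = n} ℕ.z≤n = 0≤fromℕ n
  fromℕ-mono-≤ (ℕ.s≤s m≤n) = +-mono-≤ ≤-refl (fromℕ-mono-≤ m≤n)

  0≤1 : 0# ≤ 1#
  0≤1 = <⇒≤ 0<1

  1≤fromℕ : ∀ n → 1# ≤ fromℕ (suc n)
  1≤fromℕ n = ≤-fromDifference (fromℕ n) (0≤fromℕ n) refl

  0<inverse : ∀ {x} (x#0 : x # 0#) → 0# < x → 0# < inverse x#0
  0<inverse {x} x#0 0<x with #⇒invertible x#0
  ... | y , yx≈1 , _ = *-cancelˡ-< (<⇒≤ 0<x) (<-respˡ-≈ (sym (zeroʳ x))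
    (<-respʳ-≈ (trans (sym yx≈1) (solve 2 (λ x y → y :* (x :- :0) := x :* y) x y)) 0<1))

  inverseʳ : ∀ {x} (x#0 : x # 0#) → x * inverse x#0 ≈ 1#
  inverseʳ {x} x#0 with #⇒invertible x#0
  ... | y , yx≈1 , _ = trans (solve 2 (λ x y → x :* y := y :* (x :- :0)) x y) yx≈1

  -- 2 a b ≤ a² + b²
  sq-+-≤ : ∀ x y → (x + y) ^ 2 ≤ fromℕ 2 * (x ^ 2 + y ^ 2)
  sq-+-≤ x y = ≤-fromDifference ((x - y) ^ 2) (0≤x² (x - y))
    (solve 2 (λ x y → (x :+ y) :^ 2 :+ (x :- y) :^ 2 := :2 :* (x :^ 2 :+ y :^ 2)) x y)

  private
    module S = SemiringSum semiring

  -- Opaque, so that unification does not see through it.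
  opaque
    ∑ : ∀ {n} → (Fin n → ℝ) → ℝ
    ∑ = sum

    sum≈∑ : ∀ {n} (f : Fin n → ℝ) → sum f ≈ ∑ f
    sum≈∑ f = refl

    ∑-empty : (f : Fin 0 → ℝ) → ∑ f ≈ 0#
    ∑-empty f = refl

    ∑-suc : ∀ {n} (f : Fin (suc n) → ℝ) → ∑ f ≈ f zero + ∑ (f ∘ suc)
    ∑-suc f = refl

    ∑-cong : ∀ {n} {f g : Fin n → ℝ} → (∀ i → f i ≈ g i) → ∑ f ≈ ∑ g
    ∑-cong = S.sum-cong-≋

    ∑-+ : ∀ {n} (f g : Fin n → ℝ) → ∑ (λ i → f i + g i) ≈ ∑ f + ∑ g
    ∑-+ = S.∑-distrib-+

    ∑-*ˡ : ∀ {n} c (f : Fin n → ℝ) → ∑ (λ i → c * f i) ≈ c * ∑ f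
    ∑-*ˡ c f = sym (S.*-distribˡ-sum c f)

    ∑-*ʳ : ∀ {n} (f : Fin n → ℝ) c → ∑ (λ i → f i * c) ≈ ∑ f * c
    ∑-*ʳ f c = sym (S.*-distribʳ-sum c f)

    ∑-swap : ∀ {m n} (f : Fin m → Fin n → ℝ) →
      ∑ (λ i → ∑ (λ j → f i j)) ≈ ∑ (λ j → ∑ (λ i → f i j))
    ∑-swap = S.∑-comm

    ∑-zero : ∀ {n} {f : Fin n → ℝ} → (∀ i → f i ≈ 0#) → ∑ f ≈ 0#
    ∑-zero {n} h = trans (∑-cong h) (S.sum-replicate-zero n)

    ∑-const : ∀ n c → ∑ {n} (λ _ → c) ≈ fromℕ n * c
    ∑-const zero c = sym (zeroˡ c)
    ∑-const (suc n) c = trans (+-congˡ (∑-const n c))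
      (solve 2 (λ c k → c :+ k :* c := (:1 :+ k) :* c) c (fromℕ n))

    ∑-neg : ∀ {n} (f : Fin n → ℝ) → ∑ (λ i → - f i) ≈ - ∑ f
    ∑-neg f = trans (∑-cong (λ i → solve 1 (λ x → :- x := (:0 :- :1) :* x) (f i)))
      (trans (∑-*ˡ (0# - 1#) f) (solve 1 (λ x → (:0 :- :1) :* x := :- x) (∑ f)))

    ∑-sub : ∀ {n} (f g : Fin n → ℝ) → ∑ (λ i → f i - g i) ≈ ∑ f - ∑ g
    ∑-sub f g = trans (∑-+ f (λ i → - g i)) (+-congˡ (∑-neg g))

    ∑-mono : ∀ {n} {f g : Fin n → ℝ} → (∀ i → f i ≤ g i) → ∑ f ≤ ∑ g
    ∑-mono {zero} h = ≤-refl
    ∑-mono {suc n} h = +-mono-≤ (h zero) (∑-mono (h ∘ suc))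

    0≤∑ : ∀ {n} {f : Fin n → ℝ} → (∀ i → 0# ≤ f i) → 0# ≤ ∑ f
    0≤∑ {zero} h = ≤-refl
    0≤∑ {suc n} h = 0≤-+ (h zero) (0≤∑ (h ∘ suc))

    ∑-term : ∀ {n} {f : Fin n → ℝ} → (∀ i → 0# ≤ f i) → ∀ i → f i ≤ ∑ f
    ∑-term {suc n} {f} h zero = ≤-fromDifference _ (0≤∑ (h ∘ suc)) refl
    ∑-term {suc n} {f} h (suc i) = ≤-trans (∑-term (h ∘ suc) i)
      (≤-fromDifference (f zero) (h zero) (+-comm _ _))

    ∑-≤const : ∀ {n} {f : Fin n → ℝ} c → (∀ i → f i ≤ c) → ∑ f ≤ fromℕ n * c
    ∑-≤const {n} c h = ≤-trans (∑-mono h) (≤-reflexive (∑-const n c))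

  𝐞-≡ : ∀ {n} (i : Fin n) → 𝐞 i i ≡ 1#
  𝐞-≡ i = ≡.cong (if_then 1# else 0#) (dec-true (i ≟ i) ≡.refl)

  𝐞-≢ : ∀ {n} {i k : Fin n} → i ≢ k → 𝐞 i k ≡ 0#
  𝐞-≢ {i = i} {k} i≢k = ≡.cong (if_then 1# else 0#) (dec-false (i ≟ k) i≢k)

  𝐞-suc : ∀ {n} (i k : Fin n) → 𝐞 (suc i) (suc k) ≡ 𝐞 i k
  𝐞-suc i k with i ≟ k
  ... | yes _ = ≡.refl
  ... | no _  = ≡.refl

  𝐞-sym : ∀ {n} (i k : Fin n) → 𝐞 i k ≡ 𝐞 k i
  𝐞-sym i k with i ≟ k
  ... | yes ≡.refl = ≡.sym (𝐞-≡ i)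
  ... | no i≢k    = ≡.sym (𝐞-≢ (i≢k ∘ ≡.sym))

  opaque
    unfolding ∑

    ∑-𝐞ˡ : ∀ {n} (i : Fin n) (f : Fin n → ℝ) → ∑ (λ k → 𝐞 i k * f k) ≈ f i
    ∑-𝐞ˡ {suc n} zero f = trans (+-cong (*-identityˡ _) (∑-zero (λ k → zeroˡ (f (suc k))))) (+-identityʳ _)
    ∑-𝐞ˡ {suc n} (suc i) f = trans (+-cong (zeroˡ _)
      (trans (∑-cong (λ k → *-congʳ (reflexive (𝐞-suc i k)))) (∑-𝐞ˡ i (f ∘ suc)))) (+-identityˡ _)

  ∑-𝐞ʳ : ∀ {n} (i : Fin n) (f : Fin n → ℝ) → ∑ (λ k → 𝐞 k i * f k) ≈ f i
  ∑-𝐞ʳ i f = trans (∑-cong (λ k → *-congʳ (reflexive (𝐞-sym k i)))) (∑-𝐞ˡ i f)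

  ∑-𝐞 : ∀ {n} (i : Fin n) → ∑ (𝐞 i) ≈ 1#
  ∑-𝐞 i = trans (∑-cong (λ k → sym (*-identityʳ (𝐞 i k)))) (∑-𝐞ˡ i (λ _ → 1#))

  0≤indicator : ∀ b → 0# ≤ (if b then 1# else 0#)
  0≤indicator true  = 0≤1
  0≤indicator false = ≤-refl

  indicator≤1 : ∀ b → (if b then 1# else 0#) ≤ 1#
  indicator≤1 true  = ≤-refl
  indicator≤1 false = 0≤1

  0≤𝐞 : ∀ {n} (i k : Fin n) → 0# ≤ 𝐞 i k
  0≤𝐞 i k = 0≤indicator (does (i ≟ k))

  D : ∀ {n} → Fin n → Fin n → (Graph n → ℝ) → Graph n → ℝ
  D i j f G = f (setEdge i j true G) - f (setEdge i j false G)

  Matrix : ℕ → Set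
  Matrix n = Fin n → Fin n → ℝ

  ∑∑ : ∀ {n} → Matrix n → ℝ
  ∑∑ f = ∑ (λ a → ∑ (λ b → f a b))

  ∑∑-cong : ∀ {n} {f g : Matrix n} → (∀ a b → f a b ≈ g a b) → ∑∑ f ≈ ∑∑ g
  ∑∑-cong e = ∑-cong (λ a → ∑-cong (e a))

  ∑∑-+ : ∀ {n} (f g : Matrix n) → ∑∑ (λ a b → f a b + g a b) ≈ ∑∑ f + ∑∑ g
  ∑∑-+ f g = trans (∑-cong (λ a → ∑-+ (f a) (g a))) (∑-+ (λ a → ∑ (f a)) (λ a → ∑ (g a)))

  ∑∑-*ˡ : ∀ {n} c (f : Matrix n) → ∑∑ (λ a b → c * f a b) ≈ c * ∑∑ f
  ∑∑-*ˡ c f = trans (∑-cong (λ a → ∑-*ˡ c (f a))) (∑-*ˡ c (λ a → ∑ (f a)))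

  ∑∑-mono : ∀ {n} {f g : Matrix n} → (∀ a b → f a b ≤ g a b) → ∑∑ f ≤ ∑∑ g
  ∑∑-mono h = ∑-mono (λ a → ∑-mono (h a))

  0≤∑∑ : ∀ {n} {f : Matrix n} → (∀ a b → 0# ≤ f a b) → 0# ≤ ∑∑ f
  0≤∑∑ h = 0≤∑ (λ a → 0≤∑ (h a))

  ∑-product : ∀ {n} (f g : Fin n → ℝ) → ∑ f * ∑ g ≈ ∑∑ (λ a b → f a * g b)
  ∑-product f g = trans (sym (∑-*ʳ f (∑ g))) (∑-cong (λ a → sym (∑-*ˡ (f a) g)))

  δ : ∀ {n} → Fin n → Fin n → Matrix n
  δ i j a b = 𝐞 i a * 𝐞 j b + 𝐞 j a * 𝐞 i b

  ∑∑-δ : ∀ {n} (i j : Fin n) (f : Matrix n) → ∑∑ (λ a b → δ i j a b * f a b) ≈ f i j + f j i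
  ∑∑-δ {n} i j f = begin
    ∑∑ (λ a b → δ i j a b * f a b)
      ≈⟨ ∑∑-cong (λ a b → solve 5 (λ x y z w f → (x :* y :+ z :* w) :* f := x :* (y :* f) :+ z :* (w :* f)) (𝐞 i a) (𝐞 j b) (𝐞 j a) (𝐞 i b) (f a b)) ⟩
    ∑∑ (λ a b → 𝐞 i a * (𝐞 j b * f a b) + 𝐞 j a * (𝐞 i b * f a b))
      ≈⟨ ∑∑-+ {n} _ _ ⟩
    ∑∑ (λ a b → 𝐞 i a * (𝐞 j b * f a b)) + ∑∑ (λ a b → 𝐞 j a * (𝐞 i b * f a b))
      ≈⟨ +-cong (single i j) (single j i) ⟩
    f i j + f j i ∎
    where
    open ≈-Reasoning
    single : ∀ i j → ∑∑ (λ a b → 𝐞 i a * (𝐞 j b * f a b)) ≈ f i j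
    single i j = trans (∑-cong (λ a → trans (∑-*ˡ {n} (𝐞 i a) _) (*-congˡ (∑-𝐞ˡ j (f a))))) (∑-𝐞ˡ i (λ a → f a j))

  size : ∀ {n} → Matrix n → ℝ
  size A = ∑∑ A

  degree : ∀ {n} → Matrix n → Fin n → ℝ
  degree A a = ∑ (A a)

  walks₃ : ∀ {n} → Matrix n → Matrix n → Matrix n → Matrix n
  walks₃ A B C a b = ∑∑ (λ k l → A a k * (B k l * C l b))

  trace₄ : ∀ {n} → Matrix n → Matrix n → Matrix n → Matrix n → ℝ
  trace₄ A B C E = ∑∑ (λ a b → A a b * walks₃ B C E b a)

  closedWalks₄ : ∀ {n} → Matrix n → ℝ
  closedWalks₄ A = trace₄ A A A A

  trace₄-cyclic : ∀ {n} (A B C E : Matrix n) → trace₄ A B C E ≈ trace₄ B C E A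
  trace₄-cyclic {n} A B C E = begin
    ∑ (λ a → ∑ (λ b → A a b * walks₃ B C E b a))
      ≈⟨ ∑-swap {n} {n} _ ⟩
    ∑ (λ b → ∑ (λ a → A a b * walks₃ B C E b a))
      ≈⟨ ∑-cong (λ b → ∑-cong (λ a → sym (∑∑-*ˡ {n} (A a b) _))) ⟩
    ∑ (λ b → ∑ (λ a → ∑ (λ c → ∑ (λ d → A a b * (B b c * (C c d * E d a))))))
      ≈⟨ ∑-cong (λ b → ∑-swap {n} {n} _) ⟩
    ∑ (λ b → ∑ (λ c → ∑ (λ a → ∑ (λ d → A a b * (B b c * (C c d * E d a))))))
      ≈⟨ ∑-cong (λ b → ∑-cong (λ c → ∑-swap {n} {n} _)) ⟩
    ∑ (λ b → ∑ (λ c → ∑∑ (λ d a → A a b * (B b c * (C c d * E d a)))))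
      ≈⟨ ∑-cong (λ b → ∑-cong (λ c → ∑∑-cong (λ d a → rotate (A a b) (B b c) (C c d) (E d a)))) ⟩
    ∑ (λ b → ∑ (λ c → ∑∑ (λ d a → B b c * (C c d * (E d a * A a b)))))
      ≈⟨ ∑-cong (λ b → ∑-cong (λ c → ∑∑-*ˡ {n} (B b c) _)) ⟩
    ∑ (λ b → ∑ (λ c → B b c * walks₃ C E A c b)) ∎
    where
    open ≈-Reasoning
    rotate : ∀ x y z w → x * (y * (z * w)) ≈ y * (z * (w * x))
    rotate = solve 4 (λ x y z w → x :* (y :* (z :* w)) := y :* (z :* (w :* x)))

  module AddEdge {n} (s t : Matrix n) (i j : Fin n)
    (s-sym : ∀ a b → s a b ≈ s b a) (s-diag : ∀ a → s a a ≈ 0#) (s-idem : ∀ a b → s a b * s a b ≈ s a b)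
    (s-ij : s i j ≈ 0#) (t≈ : ∀ a b → t a b ≈ s a b + δ i j a b) (i≢j : i ≢ j) where

    W : Matrix n
    W = walks₃ s s s

    row-i : ∀ k → t i k ≈ s i k + 𝐞 j k
    row-i k = trans (t≈ i k) (+-congˡ (trans (+-cong (*-congʳ (reflexive (𝐞-≡ i))) (*-congʳ (reflexive (𝐞-≢ (i≢j ∘ ≡.sym)))))
      (solve 2 (λ x y → :1 :* x :+ :0 :* y := x) (𝐞 j k) (𝐞 i k))))

    row-j : ∀ k → t j k ≈ s j k + 𝐞 i k
    row-j k = trans (t≈ j k) (+-congˡ (trans (+-cong (*-congʳ (reflexive (𝐞-≢ i≢j))) (*-congʳ (reflexive (𝐞-≡ j))))
      (solve 2 (λ x y → :0 :* x :+ :1 :* y := y) (𝐞 j k) (𝐞 i k))))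

    t-sym : ∀ a b → t a b ≈ t b a
    t-sym a b = trans (t≈ a b) (trans (+-cong (s-sym a b)
      (solve 4 (λ x y z w → x :* y :+ z :* w := w :* z :+ y :* x) (𝐞 i a) (𝐞 j b) (𝐞 j a) (𝐞 i b)))
      (sym (t≈ b a)))

    first-slot : ∀ B C E → trace₄ t B C E ≈ trace₄ s B C E + (walks₃ B C E j i + walks₃ B C E i j)
    first-slot B C E = trans
      (∑∑-cong (λ a b → trans (*-congʳ (t≈ a b)) (distribʳ (walks₃ B C E b a) (s a b) (δ i j a b))))
      (trans (∑∑-+ {n} _ _) (+-congˡ (∑∑-δ i j (λ a b → walks₃ B C E b a))))

    walks₃-sym : ∀ a b → W a b ≈ W b a
    walks₃-sym a b = trans (∑-swap {n} {n} _) (∑∑-cong (λ l k →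
      trans (solve 3 (λ x y z → x :* (y :* z) := z :* (y :* x)) (s a k) (s k l) (s l b))
        (*-cong (s-sym l b) (*-cong (s-sym k l) (s-sym a k)))))

    s·s : ∀ a → ∑ (λ l → s a l * s l a) ≈ degree s a
    s·s a = ∑-cong (λ l → trans (*-congˡ (s-sym l a)) (s-idem a l))

    -- W with a middle factor t equals W, since s i j, s i i and s j j vanish.
    middle : walks₃ s t s i j ≈ W i j
    middle = begin
      ∑∑ (λ k l → s i k * (t k l * s l j))
        ≈⟨ ∑∑-cong (λ k l → trans (*-congˡ (*-congʳ (t≈ k l)))
             (solve 4 (λ x y z w → x :* ((y :+ w) :* z) := x :* (y :* z) :+ w :* (x :* z)) (s i k) (s k l) (s l j) (δ i j k l))) ⟩
      ∑∑ (λ k l → s i k * (s k l * s l j) + δ i j k l * (s i k * s l j))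
        ≈⟨ trans (∑∑-+ {n} _ _) (+-congˡ (∑∑-δ i j (λ k l → s i k * s l j))) ⟩
      W i j + (s i i * s j j + s i j * s i j)
        ≈⟨ +-congˡ (+-cong (*-cong (s-diag i) (s-diag j)) (*-cong s-ij s-ij)) ⟩
      W i j + (0# * 0# + 0# * 0#)
        ≈⟨ solve 1 (λ w → w :+ (:0 :* :0 :+ :0 :* :0) := w) (W i j) ⟩
      W i j ∎
      where open ≈-Reasoning

    -- Splitting off the edge {i , j} as the first step.
    first-step : ∀ B C → walks₃ t B C i j ≈ walks₃ s B C i j + ∑ (λ l → B j l * C l j)
    first-step B C = begin
      ∑∑ (λ k l → t i k * (B k l * C l j))
        ≈⟨ ∑∑-cong (λ k l → trans (*-congʳ (row-i k)) (distribʳ _ (s i k) (𝐞 j k))) ⟩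
      ∑∑ (λ k l → s i k * (B k l * C l j) + 𝐞 j k * (B k l * C l j))
        ≈⟨ trans (∑∑-+ {n} _ _) (+-congˡ (trans (∑-cong (λ k → ∑-*ˡ {n} (𝐞 j k) _)) (∑-𝐞ˡ j (λ k → ∑ (λ l → B k l * C l j))))) ⟩
      walks₃ s B C i j + ∑ (λ l → B j l * C l j) ∎
      where open ≈-Reasoning

    walks-tss : walks₃ t s s i j ≈ W i j + degree s j
    walks-tss = trans (first-step s s) (+-congˡ (s·s j))

    walks-tts : walks₃ t t s i j ≈ W i j + degree s j
    walks-tts = trans (first-step t s) (+-cong middle (begin
      ∑ (λ l → t j l * s l j)
        ≈⟨ ∑-cong (λ l → trans (*-congʳ (row-j l)) (distribʳ (s l j) (s j l) (𝐞 i l))) ⟩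
      ∑ (λ l → s j l * s l j + 𝐞 i l * s l j)
        ≈⟨ trans (∑-+ {n} _ _) (+-cong (s·s j) (trans (∑-𝐞ˡ i (λ l → s l j)) s-ij)) ⟩
      degree s j + 0#
        ≈⟨ +-identityʳ _ ⟩
      degree s j ∎))
      where open ≈-Reasoning

    walks-ttt : walks₃ t t t i j ≈ W i j + degree s j + (degree s i + 1#)
    walks-ttt = begin
      ∑∑ (λ k l → t i k * (t k l * t l j))
        ≈⟨ ∑∑-cong (λ k l → trans (*-congˡ (*-congˡ (trans (t-sym l j) (trans (row-j l) (+-congʳ (s-sym j l))))))
             (solve 4 (λ x y z w → x :* (y :* (z :+ w)) := x :* (y :* z) :+ w :* (x :* y)) (t i k) (t k l) (s l j) (𝐞 i l))) ⟩
      ∑∑ (λ k l → t i k * (t k l * s l j) + 𝐞 i l * (t i k * t k l))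
        ≈⟨ ∑∑-+ {n} _ _ ⟩
      walks₃ t t s i j + ∑∑ (λ k l → 𝐞 i l * (t i k * t k l))
        ≈⟨ +-cong walks-tts (∑-cong (λ k → ∑-𝐞ˡ i (λ l → t i k * t k l))) ⟩
      W i j + degree s j + ∑ (λ k → t i k * t k i)
        ≈⟨ +-congˡ (∑-cong (λ k → trans (*-cong (row-i k) (trans (t-sym k i) (row-i k))) (expand k))) ⟩
      W i j + degree s j + ∑ (λ k → s i k + (𝐞 j k * (fromℕ 2 * s i k) + 𝐞 j k * 𝐞 j k))
        ≈⟨ +-congˡ (trans (∑-+ {n} _ _) (+-congˡ (trans (∑-+ {n} _ _)
             (+-cong (trans (∑-𝐞ˡ j (λ k → fromℕ 2 * s i k)) (*-congˡ s-ij)) (trans (∑-𝐞ˡ j (𝐞 j)) (reflexive (𝐞-≡ j))))))) ⟩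
      W i j + degree s j + (degree s i + (fromℕ 2 * 0# + 1#))
        ≈⟨ +-congˡ (+-congˡ (solve 0 (:2 :* :0 :+ :1 := :1))) ⟩
      W i j + degree s j + (degree s i + 1#) ∎
      where
      open ≈-Reasoning
      expand : ∀ k → (s i k + 𝐞 j k) * (s i k + 𝐞 j k) ≈ s i k + (𝐞 j k * (fromℕ 2 * s i k) + 𝐞 j k * 𝐞 j k)
      expand k = trans (solve 2 (λ x e → (x :+ e) :* (x :+ e) := x :* x :+ (e :* (:2 :* x) :+ e :* e)) (s i k) (𝐞 j k))
        (+-congʳ (s-idem i k))

    size-add : size t ≈ size s + fromℕ 2
    size-add = trans (∑∑-cong t≈) (trans (∑∑-+ s (δ i j)) (+-congˡ (trans
      (∑∑-cong (λ a b → sym (*-identityʳ (δ i j a b)))) (trans (∑∑-δ i j (λ _ _ → 1#)) (+-congˡ (sym (+-identityʳ 1#)))))))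


  closedWalks₄-add : ∀ {n} (s t : Matrix n) (i j : Fin n) →
    (∀ a b → s a b ≈ s b a) → (∀ a → s a a ≈ 0#) → (∀ a b → s a b * s a b ≈ s a b) →
    s i j ≈ 0# → (∀ a b → t a b ≈ s a b + δ i j a b) → i ≢ j →
    closedWalks₄ t ≈ closedWalks₄ s + (fromℕ 8 * walks₃ s s s i j + fromℕ 4 * (degree s i + degree s j) + fromℕ 2)
  closedWalks₄-add s t i j s-sym s-diag s-idem s-ij t≈ i≢j = begin
    trace₄ t t t t
      ≈⟨ ij.first-slot t t t ⟩
    trace₄ s t t t + (walks₃ t t t j i + walks₃ t t t i j)
      ≈⟨ +-congʳ (trans (trace₄-cyclic s t t t) (ij.first-slot t t s)) ⟩
    trace₄ s t t s + (walks₃ t t s j i + walks₃ t t s i j) + (walks₃ t t t j i + walks₃ t t t i j)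
      ≈⟨ +-congʳ (+-congʳ (trans (trace₄-cyclic s t t s) (ij.first-slot t s s))) ⟩
    trace₄ s t s s + (walks₃ t s s j i + walks₃ t s s i j) + (walks₃ t t s j i + walks₃ t t s i j)
      + (walks₃ t t t j i + walks₃ t t t i j)
      ≈⟨ +-congʳ (+-congʳ (+-congʳ (trans (trace₄-cyclic s t s s) (ij.first-slot s s s)))) ⟩
    trace₄ s s s s + (walks₃ s s s j i + W) + (walks₃ t s s j i + walks₃ t s s i j)
      + (walks₃ t t s j i + walks₃ t t s i j) + (walks₃ t t t j i + walks₃ t t t i j)
      ≈⟨ +-cong (+-cong (+-cong (+-congˡ (+-congʳ W-sym))
           (+-cong (trans ji.walks-tss (+-congʳ W-sym)) ij.walks-tss))
           (+-cong (trans ji.walks-tts (+-congʳ W-sym)) ij.walks-tts))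
           (+-cong (trans ji.walks-ttt (+-congʳ (+-congʳ W-sym))) ij.walks-ttt) ⟩
    closedWalks₄ s + (W + W) + (W + dᵢ + (W + dⱼ)) + (W + dᵢ + (W + dⱼ))
      + (W + dᵢ + (dⱼ + 1#) + (W + dⱼ + (dᵢ + 1#)))
      ≈⟨ solve 4 (λ c w x y → c :+ (w :+ w) :+ (w :+ x :+ (w :+ y)) :+ (w :+ x :+ (w :+ y))
           :+ (w :+ x :+ (y :+ :1) :+ (w :+ y :+ (x :+ :1))) := c :+ (:8 :* w :+ :4 :* (x :+ y) :+ :2)) (closedWalks₄ s) W dᵢ dⱼ ⟩
    closedWalks₄ s + (fromℕ 8 * W + fromℕ 4 * (dᵢ + dⱼ) + fromℕ 2) ∎
    where
    open ≈-Reasoning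
    module ij = AddEdge s t i j s-sym s-diag s-idem s-ij t≈ i≢j
    module ji = AddEdge s t j i s-sym s-diag s-idem (trans (s-sym j i) s-ij)
      (λ a b → trans (t≈ a b) (+-congˡ (+-comm _ _))) (i≢j ∘ ≡.sym)
    W dᵢ dⱼ : ℝ
    W  = walks₃ s s s i j
    dᵢ = degree s i
    dⱼ = degree s j
    W-sym : walks₃ s s s j i ≈ W
    W-sym = ij.walks₃-sym j i

  C₁ : ℝ
  C₁ = fromℕ 4 * (fromℕ 16 * fromℕ 4 + fromℕ 16 + fromℕ 16 + fromℕ 64 * fromℕ 133)

  0≤C₁ : 0# ≤ C₁
  0≤C₁ = 0≤-* (0≤fromℕ 4) (0≤-+ (0≤-+ (0≤-+ (0≤-* (0≤fromℕ 16) (0≤fromℕ 4)) (0≤fromℕ 16)) (0≤fromℕ 16)) (0≤-* (0≤fromℕ 64) (0≤fromℕ 133)))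

  upperConstant : ℝ
  upperConstant = fromℕ 576 + fromℕ 4 * C₁

  threshold : ℝ
  threshold = fromℕ 2 * (fromℕ 4352 * fromℕ 75) + fromℕ 2 * fromℕ 6144 + fromℕ 26

  lowerConstant : ℝ
  lowerConstant = fromℕ 76 * fromℕ 128 + fromℕ 16704 + fromℕ 24

  indicator : Bool → ℝ
  indicator b = if b then 1# else 0#

  x : ∀ {n} → Graph n → Matrix n
  x G a b = indicator (adjacent G a b)

  x-sym : ∀ {n} (G : Graph n) a b → x G a b ≈ x G b a
  x-sym G a b = reflexive (≡.cong indicator (adjacent-sym G a b))

  x-diag : ∀ {n} (G : Graph n) a → x G a a ≈ 0#
  x-diag G a = reflexive (≡.cong indicator (adjacent-irrefl G a))

  indicator-idem : ∀ b → indicator b * indicator b ≈ indicator b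
  indicator-idem true  = *-identityˡ 1#
  indicator-idem false = zeroˡ 0#

  x-idem : ∀ {n} (G : Graph n) a b → x G a b * x G a b ≈ x G a b
  x-idem G a b = indicator-idem (adjacent G a b)

  0≤x : ∀ {n} (G : Graph n) a b → 0# ≤ x G a b
  0≤x G a b = 0≤indicator (adjacent G a b)

  x≤1 : ∀ {n} (G : Graph n) a b → x G a b ≤ 1#
  x≤1 G a b = indicator≤1 (adjacent G a b)

  m : ∀ {n} → Graph n → ℝ
  m G = size (x G)

  d : ∀ {n} → Graph n → Fin n → ℝ
  d G = degree (x G)

  0≤d : ∀ {n} (G : Graph n) a → 0# ≤ d G a
  0≤d G a = 0≤∑ (0≤x G a)

  Y : ∀ {n} → Graph n → ℝ
  Y G = m G ^ 2 - m G - closedWalks₄ (x G)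

  U : ∀ {n} → Graph n → ℝ
  U G = ∑∑ (λ a c → indicator (hasUniquePath G a c))

  away : ∀ {n} → Fin n → Fin n → Fin n → ℝ
  away i j k = (1# - 𝐞 i k) * (1# - 𝐞 j k)

  w : ∀ {n} → Graph n → Fin n → Fin n → ℝ
  w G i j = ∑∑ (λ k l → away i j k * away i j l * (x G i k * (x G k l * x G l j)))

  indicator-count : ∀ {n} (f : Fin n → Bool) → fromℕ (count f) ≈ ∑ (indicator ∘ f)
  indicator-count {zero} f = sym (∑-empty _)
  indicator-count {suc n} f with f zero | ∑-suc (indicator ∘ f)
  ... | true  | e = trans (+-congˡ (indicator-count (f ∘ suc))) (sym e)
  ... | false | e = trans (indicator-count (f ∘ suc)) (trans (sym (+-identityˡ _)) (sym e))

  δ-same : ∀ {n} {i j a b : Fin n} → i ≢ j → SameEdge i j a b → δ i j a b ≈ 1#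
  δ-same {i = i} {j} i≢j (inj₁ (≡.refl , ≡.refl)) =
    trans (+-cong (*-cong (reflexive (𝐞-≡ i)) (reflexive (𝐞-≡ j))) (*-congˡ (reflexive (𝐞-≢ i≢j))))
      (solve 1 (λ y → :1 :* :1 :+ y :* :0 := :1) (𝐞 j i))
  δ-same {i = i} {j} i≢j (inj₂ (≡.refl , ≡.refl)) =
    trans (+-cong (*-congˡ (reflexive (𝐞-≢ (i≢j ∘ ≡.sym)))) (*-cong (reflexive (𝐞-≡ j)) (reflexive (𝐞-≡ i))))
      (solve 1 (λ y → y :* :0 :+ :1 :* :1 := :1) (𝐞 i j))

  𝐞𝐞≈0 : ∀ {n} {i j a b : Fin n} → ¬ (a ≡ i × b ≡ j) → 𝐞 i a * 𝐞 j b ≈ 0#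
  𝐞𝐞≈0 {i = i} {j} {a} {b} h with i ≟ a | j ≟ b
  ... | yes p | yes q = ⊥-elim (h (≡.sym p , ≡.sym q))
  ... | yes _ | no _  = zeroʳ 1#
  ... | no _  | _     = zeroˡ _

  δ-different : ∀ {n} {i j a b : Fin n} → ¬ SameEdge i j a b → δ i j a b ≈ 0#
  δ-different h = trans (+-cong (𝐞𝐞≈0 (h ∘ inj₁)) (𝐞𝐞≈0 (h ∘ inj₂))) (+-identityʳ 0#)

  0≤δ : ∀ {n} (i j a b : Fin n) → 0# ≤ δ i j a b
  0≤δ i j a b = 0≤-+ (0≤-* (0≤𝐞 i a) (0≤𝐞 j b)) (0≤-* (0≤𝐞 j a) (0≤𝐞 i b))

  module Perturb {n} (G : Graph n) {i j : Fin n} (i≢j : i ≢ j) where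

    G⁺ G⁻ : Graph n
    G⁺ = setEdge i j true G
    G⁻ = setEdge i j false G

    x-different : ∀ b {k l} → ¬ SameEdge i j k l → x (setEdge i j b G) k l ≈ x G k l
    x-different b h = reflexive (≡.cong indicator (adjacent-setEdge-different G b h))

    x-same : ∀ b {k l} → SameEdge i j k l → x (setEdge i j b G) k l ≈ indicator b
    x-same b h = reflexive (≡.cong indicator (adjacent-setEdge-same G b i≢j h))

    x⁺≈ : ∀ a b → x G⁺ a b ≈ x G⁻ a b + δ i j a b
    x⁺≈ a b with sameEdge? i j a b
    ... | yes s = trans (x-same true s) (sym (trans (+-cong (x-same false s) (δ-same i≢j s)) (+-identityˡ 1#)))
    ... | no s = trans (x-different true s) (sym (trans (+-cong (x-different false s) (δ-different s)) (+-identityʳ _)))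

    x≈ : ∀ a b → x G a b ≈ x G⁻ a b + δ i j a b * x G i j
    x≈ a b with sameEdge? i j a b
    ... | yes s = sym (trans (+-cong (x-same false s) (*-congʳ (δ-same i≢j s)))
                    (trans (+-identityˡ _) (trans (*-identityˡ _) (edge s))))
      where
      edge : SameEdge i j a b → x G i j ≈ x G a b
      edge (inj₁ (≡.refl , ≡.refl)) = refl
      edge (inj₂ (≡.refl , ≡.refl)) = x-sym G _ _
    ... | no s = sym (trans (+-cong (x-different false s) (*-congʳ (δ-different s))) (trans (+-congˡ (zeroˡ _)) (+-identityʳ _)))

    x⁻ij : x G⁻ i j ≈ 0#
    x⁻ij = x-same false (inj₁ (≡.refl , ≡.refl))

    x⁻≤x : ∀ a b → x G⁻ a b ≤ x G a b
    x⁻≤x a b = ≤-fromDifference _ (0≤-* (0≤δ i j a b) (0≤x G i j)) (sym (x≈ a b))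

    m⁻ : m G ≈ m G⁻ + fromℕ 2 * x G i j
    m⁻ = trans (∑∑-cong x≈) (trans (∑∑-+ _ _) (+-congˡ (trans (∑∑-δ i j (λ _ _ → x G i j))
      (solve 1 (λ y → y :+ y := :2 :* y) (x G i j)))))

    private
      δ-row : ∀ a y → ∑ (λ b → δ i j a b * y) ≈ (𝐞 i a + 𝐞 j a) * y
      δ-row a y = trans (∑-*ʳ (δ i j a) y) (*-congʳ (trans (∑-+ _ _)
        (+-cong (trans (∑-*ˡ (𝐞 i a) (𝐞 j)) (trans (*-congˡ (∑-𝐞 j)) (*-identityʳ _)))
                (trans (∑-*ˡ (𝐞 j a) (𝐞 i)) (trans (*-congˡ (∑-𝐞 i)) (*-identityʳ _))))))

      d⁻ : ∀ a → d G a ≈ d G⁻ a + (𝐞 i a + 𝐞 j a) * x G i j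
      d⁻ a = trans (∑-cong (x≈ a)) (trans (∑-+ _ _) (+-congˡ (δ-row a (x G i j))))

    dᵢ⁻ : d G i ≈ d G⁻ i + x G i j
    dᵢ⁻ = trans (d⁻ i) (+-congˡ (trans (*-congʳ (+-cong (reflexive (𝐞-≡ i)) (reflexive (𝐞-≢ (i≢j ∘ ≡.sym)))))
      (solve 1 (λ y → (:1 :+ :0) :* y := y) (x G i j))))

    dⱼ⁻ : d G j ≈ d G⁻ j + x G i j
    dⱼ⁻ = trans (d⁻ j) (+-congˡ (trans (*-congʳ (+-cong (reflexive (𝐞-≢ i≢j)) (reflexive (𝐞-≡ j))))
      (solve 1 (λ y → (:0 :+ :1) :* y := y) (x G i j))))

    d⁻≤d : ∀ a → d G⁻ a ≤ d G a
    d⁻≤d a = ∑-mono (x⁻≤x a)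

    away-i : away i j i ≈ 0#
    away-i = trans (*-congʳ (trans (+-congˡ (-‿cong (reflexive (𝐞-≡ i)))) (-‿inverseʳ 1#))) (zeroˡ _)

    away-j : away i j j ≈ 0#
    away-j = trans (*-congˡ (trans (+-congˡ (-‿cong (reflexive (𝐞-≡ j)))) (-‿inverseʳ 1#))) (zeroʳ _)

    away-other : ∀ {k} → k ≢ i → k ≢ j → away i j k ≈ 1#
    away-other k≢i k≢j = trans (*-cong (+-congˡ (-‿cong (reflexive (𝐞-≢ (k≢i ∘ ≡.sym)))))
      (+-congˡ (-‿cong (reflexive (𝐞-≢ (k≢j ∘ ≡.sym)))))) (solve 0 ((:1 :- :0) :* (:1 :- :0) := :1))

    w≈walks₃ : w G i j ≈ walks₃ (x G⁻) (x G⁻) (x G⁻) i j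
    w≈walks₃ = ∑∑-cong term
      where
      zeroᵏ : ∀ {k l} → away i j k ≈ 0# → x G⁻ i k ≈ 0# →
        away i j k * away i j l * (x G i k * (x G k l * x G l j)) ≈ x G⁻ i k * (x G⁻ k l * x G⁻ l j)
      zeroᵏ e f = trans (*-congʳ (*-congʳ e)) (trans (solve 2 (λ a b → :0 :* a :* b := :0) _ _)
        (sym (trans (*-congʳ f) (zeroˡ _))))
      zeroˡ′ : ∀ {k l} → away i j l ≈ 0# → x G⁻ l j ≈ 0# →
        away i j k * away i j l * (x G i k * (x G k l * x G l j)) ≈ x G⁻ i k * (x G⁻ k l * x G⁻ l j)
      zeroˡ′ e f = trans (*-congʳ (*-congˡ e)) (trans (solve 2 (λ a b → a :* :0 :* b := :0) _ _)
        (sym (trans (*-congˡ (*-congˡ f)) (solve 2 (λ a b → a :* (b :* :0) := :0) _ _))))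
      term : ∀ k l → away i j k * away i j l * (x G i k * (x G k l * x G l j)) ≈ x G⁻ i k * (x G⁻ k l * x G⁻ l j)
      term k l with k ≟ i | k ≟ j | l ≟ i | l ≟ j
      ... | yes ≡.refl | _ | _ | _ = zeroᵏ away-i (x-diag G⁻ i)
      ... | no _ | yes ≡.refl | _ | _ = zeroᵏ away-j x⁻ij
      ... | no _ | no _ | yes ≡.refl | _ = zeroˡ′ {k} away-i x⁻ij
      ... | no _ | no _ | no _ | yes ≡.refl = zeroˡ′ {k} away-j (x-diag G⁻ j)
      ... | no k≢i | no k≢j | no l≢i | no l≢j =
        trans (*-congʳ (trans (*-cong (away-other k≢i k≢j) (away-other l≢i l≢j)) (*-identityˡ 1#)))
          (trans (*-identityˡ _) (sym (*-cong
            (x-different false λ { (inj₁ (_ , e)) → k≢j e ; (inj₂ (_ , e)) → k≢i e })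
            (*-cong (x-different false λ { (inj₁ (e , _)) → k≢i e ; (inj₂ (e , _)) → k≢j e })
                    (x-different false λ { (inj₁ (e , _)) → l≢i e ; (inj₂ (e , _)) → l≢j e })))))

    D-Y : D i j Y G ≈ fromℕ 4 * (m G - d G i - d G j) - fromℕ 8 * w G i j
    D-Y = begin
      m G⁺ ^ 2 - m G⁺ - closedWalks₄ (x G⁺) - (m G⁻ ^ 2 - m G⁻ - closedWalks₄ (x G⁻))
        ≈⟨ +-congʳ (+-cong (+-cong (*-cong m⁺ (*-congʳ m⁺)) (-‿cong m⁺)) (-‿cong
             (closedWalks₄-add (x G⁻) (x G⁺) i j (x-sym G⁻) (x-diag G⁻) (x-idem G⁻) x⁻ij x⁺≈ i≢j))) ⟩
      (m G⁻ + fromℕ 2) ^ 2 - (m G⁻ + fromℕ 2) - (closedWalks₄ (x G⁻) + (fromℕ 8 * W + fromℕ 4 * (d G⁻ i + d G⁻ j) + fromℕ 2))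
        - (m G⁻ ^ 2 - m G⁻ - closedWalks₄ (x G⁻))
        ≈⟨ solve 6 (λ s c v y z e → (s :+ :2) :^ 2 :- (s :+ :2) :- (c :+ (:8 :* v :+ :4 :* (y :+ z) :+ :2))
             :- (s :^ 2 :- s :- c) := :4 :* (s :+ :2 :* e :- (y :+ e) :- (z :+ e)) :- :8 :* v) (m G⁻) (closedWalks₄ (x G⁻)) W (d G⁻ i) (d G⁻ j) (x G i j) ⟩
      fromℕ 4 * (m G⁻ + fromℕ 2 * x G i j - (d G⁻ i + x G i j) - (d G⁻ j + x G i j)) - fromℕ 8 * W
        ≈⟨ +-cong (*-congˡ (+-cong (+-cong m⁻ (-‿cong dᵢ⁻)) (-‿cong dⱼ⁻))) (-‿cong (*-congˡ w≈walks₃)) ⟨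
      fromℕ 4 * (m G - d G i - d G j) - fromℕ 8 * w G i j ∎
      where
      open ≈-Reasoning
      W : ℝ
      W = walks₃ (x G⁻) (x G⁻) (x G⁻) i j
      m⁺ : m G⁺ ≈ m G⁻ + fromℕ 2
      m⁺ = AddEdge.size-add (x G⁻) (x G⁺) i j (x-sym G⁻) (x-diag G⁻) (x-idem G⁻) x⁻ij x⁺≈ i≢j

    private
      adj-different : ∀ {k l} → ¬ SameEdge i j k l → adjacent G⁺ k l ≡ adjacent G⁻ k l
      adj-different h = ≡.trans (adjacent-setEdge-different G true h) (≡.sym (adjacent-setEdge-different G false h))

      -- The edge {i , j} lies on a path a - b - c.
      Touches : Fin n → Fin n → Set
      Touches a c = (a ≡ i × adjacent G⁻ j c ≡ true) ⊎ (a ≡ j × adjacent G⁻ i c ≡ true) ⊎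
                    (c ≡ i × adjacent G⁻ a j ≡ true) ⊎ (c ≡ j × adjacent G⁻ a i ≡ true)

      touches? : ∀ a c → Dec (Touches a c)
      touches? a c = (a ≟ i ×-dec adjacent G⁻ j c Bool.≟ true) ⊎-dec (a ≟ j ×-dec adjacent G⁻ i c Bool.≟ true) ⊎-dec
                     (c ≟ i ×-dec adjacent G⁻ a j Bool.≟ true) ⊎-dec (c ≟ j ×-dec adjacent G⁻ a i Bool.≟ true)

      false-both : ∀ {k l} → ¬ SameEdge i j k l → ¬ (adjacent G⁻ k l ≡ true) →
        adjacent G⁺ k l ≡ false × adjacent G⁻ k l ≡ false
      false-both h f = ≡.trans (adj-different h) (Bool.¬-not f) , Bool.¬-not f

      ∧-falseʳ : ∀ {b c} → c ≡ false → b ∧ c ≡ false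
      ∧-falseʳ {b} ≡.refl = Bool.∧-zeroʳ b

      ∧-falseˡ : ∀ {b c} → b ≡ false → b ∧ c ≡ false
      ∧-falseˡ ≡.refl = ≡.refl

      unaffected : ∀ {a c} → ¬ SameEdge i j a c → ¬ Touches a c → hasUniquePath G⁺ a c ≡ hasUniquePath G⁻ a c
      unaffected {a} {c} h t with a ≟ c
      ... | yes _ = ≡.refl
      ... | no a≢c = ≡.cong₂ (λ b k → not b ∧ does (k ℕ.≟ 1)) (adj-different h) (count-cong common)
        where
        common : ∀ b → commonNeighbour G⁺ a c b ≡ commonNeighbour G⁻ a c b
        common b with sameEdge? i j a b | sameEdge? i j b c
        common b | yes (inj₁ (≡.refl , ≡.refl)) | _
          with e , f ← false-both {j} {c} (λ { (inj₁ (p , _)) → i≢j (≡.sym p) ; (inj₂ (_ , p)) → a≢c (≡.sym p) })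
                 (λ r → t (inj₁ (≡.refl , r))) = ≡.trans (∧-falseʳ e) (≡.sym (∧-falseʳ f))
        common b | yes (inj₂ (≡.refl , ≡.refl)) | _
          with e , f ← false-both {i} {c} (λ { (inj₂ (p , _)) → i≢j p ; (inj₁ (_ , p)) → a≢c (≡.sym p) })
                 (λ r → t (inj₂ (inj₁ (≡.refl , r)))) = ≡.trans (∧-falseʳ e) (≡.sym (∧-falseʳ f))
        common b | no n₁ | yes (inj₁ (≡.refl , ≡.refl))
          with e , f ← false-both {a} {i} n₁ (λ r → t (inj₂ (inj₂ (inj₂ (≡.refl , r)))))
          = ≡.trans (∧-falseˡ e) (≡.sym (∧-falseˡ f))
        common b | no n₁ | yes (inj₂ (≡.refl , ≡.refl))
          with e , f ← false-both {a} {j} n₁ (λ r → t (inj₂ (inj₂ (inj₁ (≡.refl , r)))))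
          = ≡.trans (∧-falseˡ e) (≡.sym (∧-falseˡ f))
        common b | no n₁ | no n₂ = ≡.cong₂ _∧_ (adj-different n₁) (adj-different n₂)

      s : Matrix n
      s = x G⁻

      bound : Matrix n
      bound a c = 𝐞 i a * s j c + (𝐞 j a * s i c + (𝐞 i c * s a j + (𝐞 j c * s a i + δ i j a c * d G⁻ i)))

      0≤s : ∀ a b → 0# ≤ s a b
      0≤s = 0≤x G⁻

      true⇒x≈1 : ∀ {a b} → adjacent G⁻ a b ≡ true → s a b ≈ 1#
      true⇒x≈1 e = reflexive (≡.cong indicator e)

      0≤t₁ : ∀ (i j c a : Fin n) → 0# ≤ 𝐞 i a * s j c
      0≤t₁ i j c a = 0≤-* (0≤𝐞 i a) (0≤s j c)
      0≤t₅ : ∀ a c → 0# ≤ δ i j a c * d G⁻ i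
      0≤t₅ a c = 0≤-* (0≤δ i j a c) (0≤d G⁻ i)

      1≤𝐞s : ∀ (i : Fin n) {b c} → adjacent G⁻ b c ≡ true → 1# ≤ 𝐞 i i * s b c
      1≤𝐞s i {b} {c} r = ≤-reflexive (sym (trans (*-cong (reflexive (𝐞-≡ i)) (true⇒x≈1 {b} {c} r)) (*-identityˡ 1#)))

      ≤+ : ∀ {a b c} → 0# ≤ b → c ≤ a → c ≤ a + b
      ≤+ {a} {b} h l = ≤-trans l (≤-fromDifference b h refl)
      ≤+′ : ∀ {a b c} → 0# ≤ a → c ≤ b → c ≤ a + b
      ≤+′ {a} {b} h l = ≤-trans l (≤-fromDifference a h (+-comm b a))

      0≤bound : ∀ a c → 0# ≤ bound a c
      0≤bound a c = 0≤-+ (0≤t₁ i j c a) (0≤-+ (0≤t₁ j i c a) (0≤-+ (0≤-* (0≤𝐞 i c) (0≤s a j))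
        (0≤-+ (0≤-* (0≤𝐞 j c) (0≤s a i)) (0≤t₅ a c))))

      1≤bound-touches : ∀ {a c} → Touches a c → 1# ≤ bound a c
      1≤bound-touches {a} {c} (inj₁ (≡.refl , r)) = ≤+ (0≤-+ (0≤t₁ j i c a) (0≤-+ (0≤-* (0≤𝐞 i c) (0≤s a j))
        (0≤-+ (0≤-* (0≤𝐞 j c) (0≤s a i)) (0≤t₅ a c)))) (1≤𝐞s i {j} {c} r)
      1≤bound-touches {a} {c} (inj₂ (inj₁ (≡.refl , r))) = ≤+′ (0≤t₁ i j c a) (≤+ (0≤-+ (0≤-* (0≤𝐞 i c) (0≤s a j))
        (0≤-+ (0≤-* (0≤𝐞 j c) (0≤s a i)) (0≤t₅ a c))) (1≤𝐞s j {i} {c} r))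
      1≤bound-touches {a} {c} (inj₂ (inj₂ (inj₁ (≡.refl , r)))) = ≤+′ (0≤t₁ i j c a) (≤+′ (0≤t₁ j i c a)
        (≤+ (0≤-+ (0≤-* (0≤𝐞 j c) (0≤s a i)) (0≤t₅ a c)) (1≤𝐞s i {a} {j} r)))
      1≤bound-touches {a} {c} (inj₂ (inj₂ (inj₂ (≡.refl , r)))) = ≤+′ (0≤t₁ i j c a) (≤+′ (0≤t₁ j i c a)
        (≤+′ (0≤-* (0≤𝐞 i c) (0≤s a j)) (≤+ (0≤t₅ a c) (1≤𝐞s j {a} {i} r))))

      1≤d⁻ : ∀ {b} → adjacent G⁻ i b ≡ true → 1# ≤ d G⁻ i
      1≤d⁻ {b} r = ≤-trans (≤-reflexive (sym (true⇒x≈1 {i} {b} r))) (∑-term (0≤s i) b)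

      1≤bound-same : ∀ {a c} → SameEdge i j a c → hasUniquePath G⁻ a c ≡ true → 1# ≤ bound a c
      1≤bound-same {a} {c} same h = ≤+′ (0≤t₁ i j c a) (≤+′ (0≤t₁ j i c a) (≤+′ (0≤-* (0≤𝐞 i c) (0≤s a j))
        (≤+′ (0≤-* (0≤𝐞 j c) (0≤s a i)) (≤-trans (degree≥1 same) (≤-reflexive
          (sym (trans (*-congʳ (δ-same i≢j same)) (*-identityˡ _))))))))
        where
        degree≥1 : SameEdge i j a c → 1# ≤ d G⁻ i
        degree≥1 (inj₁ (≡.refl , ≡.refl)) with b , r , _ ← hasUniquePath-middle G⁻ {a} {c} h = 1≤d⁻ {b} r
        degree≥1 (inj₂ (≡.refl , ≡.refl)) with b , _ , r ← hasUniquePath-middle G⁻ {a} {c} h =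
          1≤d⁻ {b} (≡.trans (adjacent-sym G⁻ i b) r)

      u⁺ u⁻ : Matrix n
      u⁺ a c = indicator (hasUniquePath G⁺ a c)
      u⁻ a c = indicator (hasUniquePath G⁻ a c)

      indicator-difference : ∀ b b′ {β} → 1# ≤ β → indicator b - indicator b′ ≤ β × - β ≤ indicator b - indicator b′
      indicator-difference b b′ 1≤β =
        ≤-trans (≤-trans (+-mono-≤ (indicator≤1 b) (neg-mono-≤ (0≤indicator b′))) (≤-reflexive (trans (+-congˡ -0#≈0#) (+-identityʳ 1#)))) 1≤β ,
        ≤-trans (neg-mono-≤ 1≤β) (≤-trans (≤-reflexive (sym (+-identityˡ _))) (+-mono-≤ (0≤indicator b) (neg-mono-≤ (indicator≤1 b′))))

      difference≈0 : ∀ {y z β} → y ≈ z → 0# ≤ β → y - z ≤ β × - β ≤ y - z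
      difference≈0 {y} {z} e 0≤β = ≤-trans (≤-reflexive y-z≈0) 0≤β ,
        ≤-trans (neg-mono-≤ 0≤β) (≤-reflexive (trans -0#≈0# (sym y-z≈0)))
        where
        y-z≈0 : y - z ≈ 0#
        y-z≈0 = trans (+-congʳ e) (-‿inverseʳ z)

      term : ∀ a c → u⁺ a c - u⁻ a c ≤ bound a c × - bound a c ≤ u⁺ a c - u⁻ a c
      term a c with sameEdge? i j a c | touches? a c
      ... | no _ | yes t = indicator-difference (hasUniquePath G⁺ a c) (hasUniquePath G⁻ a c) (1≤bound-touches t)
      ... | no h | no t = difference≈0 (reflexive (≡.cong indicator (unaffected h t))) (0≤bound a c)
      ... | yes h | _ with hasUniquePath G⁻ a c in e
      ...   | true = indicator-difference (hasUniquePath G⁺ a c) true (1≤bound-same h e)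
      ...   | false = difference≈0 (reflexive (≡.cong indicator (absent h))) (0≤bound a c)
        where
        absent : SameEdge i j a c → hasUniquePath G⁺ a c ≡ false
        absent h = ∧-falseʳ {not (does (a ≟ c))} (∧-falseˡ (≡.cong not (adjacent-setEdge-same G true i≢j h)))

      bound-sum : ∑∑ bound ≈ fromℕ 4 * d G⁻ i + fromℕ 2 * d G⁻ j
      bound-sum = begin
        ∑∑ bound
          ≈⟨ trans (∑∑-+ _ _) (+-congˡ (trans (∑∑-+ _ _) (+-congˡ (trans (∑∑-+ _ _) (+-congˡ (∑∑-+ _ _)))))) ⟩
        ∑∑ (λ a c → 𝐞 i a * s j c) + (∑∑ (λ a c → 𝐞 j a * s i c) + (∑∑ (λ a c → 𝐞 i c * s a j)
          + (∑∑ (λ a c → 𝐞 j c * s a i) + ∑∑ (λ a c → δ i j a c * d G⁻ i))))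
          ≈⟨ +-cong (starts i j) (+-cong (starts j i) (+-cong (ends i j) (+-cong (ends j i) (∑∑-δ i j (λ _ _ → d G⁻ i))))) ⟩
        d G⁻ j + (d G⁻ i + (d G⁻ j + (d G⁻ i + (d G⁻ i + d G⁻ i))))
          ≈⟨ solve 2 (λ y z → z :+ (y :+ (z :+ (y :+ (y :+ y)))) := :4 :* y :+ :2 :* z) (d G⁻ i) (d G⁻ j) ⟩
        fromℕ 4 * d G⁻ i + fromℕ 2 * d G⁻ j ∎
        where
        open ≈-Reasoning
        starts : ∀ i j → ∑∑ (λ a c → 𝐞 i a * s j c) ≈ d G⁻ j
        starts i j = trans (∑-cong (λ a → ∑-*ˡ (𝐞 i a) (s j))) (∑-𝐞ˡ i (λ _ → d G⁻ j))
        ends : ∀ i j → ∑∑ (λ a c → 𝐞 i c * s a j) ≈ d G⁻ j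
        ends i j = ∑-cong (λ a → trans (∑-𝐞ˡ i (λ _ → s a j)) (x-sym G⁻ a j))

      D-U≈ : D i j U G ≈ ∑∑ (λ a c → u⁺ a c - u⁻ a c)
      D-U≈ = sym (trans (∑-cong (λ a → ∑-sub (u⁺ a) (u⁻ a))) (∑-sub (λ a → ∑ (u⁺ a)) (λ a → ∑ (u⁻ a))))

      bound-sum≤ : ∑∑ bound ≤ fromℕ 4 * (d G i + d G j)
      bound-sum≤ = ≤-trans (≤-reflexive bound-sum) (≤-fromDifference
        (fromℕ 4 * (d G i - d G⁻ i) + fromℕ 4 * (d G j - d G⁻ j) + fromℕ 2 * d G⁻ j)
        (0≤-+ (0≤-+ (0≤-* (0≤fromℕ 4) (x≤y⇒0≤y-x (d⁻≤d i))) (0≤-* (0≤fromℕ 4) (x≤y⇒0≤y-x (d⁻≤d j)))) (0≤-* (0≤fromℕ 2) (0≤d G⁻ j)))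
        (solve 4 (λ a b c e → :4 :* a :+ :2 :* b :+ (:4 :* (c :- a) :+ :4 :* (e :- b) :+ :2 :* b) := :4 :* (c :+ e)) (d G⁻ i) (d G⁻ j) (d G i) (d G j)))

    D-U-upper : D i j U G ≤ fromℕ 4 * (d G i + d G j)
    D-U-upper = ≤-trans (≤-reflexive D-U≈) (≤-trans (∑∑-mono (λ a c → proj₁ (term a c))) bound-sum≤)

    D-U-lower : - (fromℕ 4 * (d G i + d G j)) ≤ D i j U G
    D-U-lower = ≤-trans (neg-mono-≤ bound-sum≤) (≤-trans
      (≤-trans (≤-reflexive (sym (trans (∑-cong (λ a → ∑-neg (bound a))) (∑-neg (λ a → ∑ (bound a))))))
        (∑∑-mono (λ a c → proj₂ (term a c)))) (≤-reflexive (sym D-U≈)))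

    private
      t : Matrix n
      t = x G⁺

      incidence : Fin n → ℝ
      incidence a = 𝐞 i a + 𝐞 j a

      s≤t : ∀ a b → s a b ≤ t a b
      s≤t a b = ≤-fromDifference (δ i j a b) (0≤δ i j a b) (sym (x⁺≈ a b))

      0≤t : ∀ a b → 0# ≤ t a b
      0≤t = 0≤x G⁺

      ∑-δ-row : ∀ a → ∑ (δ i j a) ≈ incidence a
      ∑-δ-row a = trans (∑-cong (λ b → sym (*-identityʳ (δ i j a b)))) (trans (δ-row a 1#) (*-identityʳ _))

      ∑-δ-column : ∀ b → ∑ (λ a → δ i j a b) ≈ incidence b
      ∑-δ-column b = trans (∑-cong (λ a → solve 4 (λ x y z w → x :* y :+ z :* w := w :* z :+ y :* x) (𝐞 i a) (𝐞 j b) (𝐞 j a) (𝐞 i b))) (∑-δ-row b)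

      t-degree : ∀ a → degree t a ≤ d G a + fromℕ 2
      t-degree a = begin
        degree t a             ≈⟨ ∑-cong (x⁺≈ a) ⟩
        ∑ (λ b → s a b + δ i j a b) ≈⟨ trans (∑-+ _ _) (+-congˡ (∑-δ-row a)) ⟩
        d G⁻ a + incidence a   ≤⟨ +-mono-≤ (d⁻≤d a) (+-mono-≤ (indicator≤1 (does (i ≟ a))) (indicator≤1 (does (j ≟ a)))) ⟩
        d G a + (1# + 1#)      ≈⟨ +-congˡ (+-congˡ (sym (+-identityʳ 1#))) ⟩
        d G a + fromℕ 2 ∎
        where open ≤-Reasoning

      away01 : ∀ (a b k : Fin n) → 0# ≤ away a b k × away a b k ≤ 1#
      away01 a b k with does (a ≟ k) | does (b ≟ k)
      ... | true  | _     = ≤-reflexive (sym (trans (*-congʳ (-‿inverseʳ 1#)) (zeroˡ _))) , ≤-trans (≤-reflexive (trans (*-congʳ (-‿inverseʳ 1#)) (zeroˡ _))) 0≤1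
      ... | false | true  = ≤-reflexive (sym (trans (*-congˡ (-‿inverseʳ 1#)) (zeroʳ _))) , ≤-trans (≤-reflexive (trans (*-congˡ (-‿inverseʳ 1#)) (zeroʳ _))) 0≤1
      ... | false | false = ≤-trans 0≤1 (≤-reflexive (sym one)) , ≤-reflexive one
        where
        one : (1# - 0#) * (1# - 0#) ≈ 1#
        one = solve 0 ((:1 :- :0) :* (:1 :- :0) := :1)

      gain : Fin n → Fin n → Fin n → Fin n → ℝ
      gain a b k l = t a k * (t k l * t l b) - s a k * (s k l * s l b)

      0≤gain : ∀ a b k l → 0# ≤ gain a b k l
      0≤gain a b k l = x≤y⇒0≤y-x (*-mono-≤ (0≤s a k) (0≤-* (0≤s k l) (0≤s l b)) (s≤t a k)
        (*-mono-≤ (0≤s k l) (0≤s l b) (s≤t k l) (s≤t l b)))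

      gain≤ : ∀ a b k l → gain a b k l ≤ δ i j a k * t l b + δ i j k l + s a k * δ i j l b
      gain≤ a b k l = begin
        gain a b k l
          ≈⟨ +-congʳ (*-cong (x⁺≈ a k) (*-congʳ (x⁺≈ k l))) ⟩
        (s a k + δ i j a k) * ((s k l + δ i j k l) * t l b) - s a k * (s k l * s l b)
          ≈⟨ trans (solve 6 (λ x e y f z w → (x :+ e) :* ((y :+ f) :* z) :- x :* (y :* w)
               := e :* ((y :+ f) :* z) :+ x :* (f :* z) :+ x :* (y :* (z :- w))) _ _ _ _ _ _)
               (+-cong (+-congʳ (*-congˡ (*-congʳ (sym (x⁺≈ k l)))))
                 (*-congˡ (*-congˡ (trans (+-congʳ (x⁺≈ l b)) (solve 2 (λ x e → x :+ e :- x := e) (s l b) (δ i j l b)))))) ⟩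
        δ i j a k * (t k l * t l b) + s a k * (δ i j k l * t l b) + s a k * (s k l * δ i j l b)
          ≤⟨ +-mono-≤ (+-mono-≤ (*-monoˡ-≤ (0≤δ i j a k) (below1 (x≤1 G⁺ k l) (0≤t l b)))
               (≤-trans (below1 (x≤1 G⁻ a k) (0≤-* (0≤δ i j k l) (0≤t l b)))
                 (≤-trans (*-monoˡ-≤ (0≤δ i j k l) (x≤1 G⁺ l b)) (≤-reflexive (*-identityʳ _)))))
               (*-monoˡ-≤ (0≤s a k) (below1 (x≤1 G⁻ k l) (0≤δ i j l b))) ⟩
        δ i j a k * t l b + δ i j k l + s a k * δ i j l b ∎
        where
        open ≤-Reasoning
        below1 : ∀ {y z} → y ≤ 1# → 0# ≤ z → y * z ≤ z
        below1 h 0≤z = ≤-trans (*-monoʳ-≤ 0≤z h) (≤-reflexive (*-identityˡ _))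

      D-w≈ : ∀ a b → D i j (λ G → w G a b) G ≈ ∑∑ (λ k l → away a b k * away a b l * gain a b k l)
      D-w≈ a b = sym (trans (∑-cong (λ k → trans (∑-cong (λ l →
          solve 3 (λ c y z → c :* (y :- z) := c :* y :- c :* z) (away a b k * away a b l) _ _)) (∑-sub _ _)))
        (∑-sub _ _))

      0≤away² : ∀ (a b k l : Fin n) → 0# ≤ away a b k * away a b l
      0≤away² a b k l = 0≤-* (proj₁ (away01 a b k)) (proj₁ (away01 a b l))

    0≤D-w : ∀ a b → 0# ≤ D i j (λ G → w G a b) G
    0≤D-w a b = ≤-trans (0≤∑∑ (λ k l → 0≤-* (0≤away² a b k l) (0≤gain a b k l))) (≤-reflexive (sym (D-w≈ a b)))

    D-w≤ : ∀ a b → D i j (λ G → w G a b) G ≤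
      (𝐞 i a + 𝐞 j a) * (d G b + fromℕ 2) + fromℕ 2 + d G a * (𝐞 i b + 𝐞 j b)
    D-w≤ a b = begin
      D i j (λ G → w G a b) G
        ≈⟨ D-w≈ a b ⟩
      ∑∑ (λ k l → away a b k * away a b l * gain a b k l)
        ≤⟨ ∑∑-mono (λ k l → ≤-trans (≤-trans (*-monoʳ-≤ (0≤gain a b k l)
             (≤-trans (*-mono-≤ (proj₁ (away01 a b k)) (proj₁ (away01 a b l)) (proj₂ (away01 a b k)) (proj₂ (away01 a b l))) (≤-reflexive (*-identityˡ 1#))))
             (≤-reflexive (*-identityˡ _))) (gain≤ a b k l)) ⟩
      ∑∑ (λ k l → δ i j a k * t l b + δ i j k l + s a k * δ i j l b)
        ≈⟨ trans (∑∑-+ _ _) (+-cong (trans (∑∑-+ _ _) (+-cong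
             (trans (sym (∑-product (δ i j a) (λ l → t l b))) (*-cong (∑-δ-row a) (∑-cong (λ l → x-sym G⁺ l b))))
             (trans (∑∑-cong (λ a b → sym (*-identityʳ (δ i j a b)))) (trans (∑∑-δ i j (λ _ _ → 1#)) (+-congˡ (sym (+-identityʳ 1#)))))))
             (trans (sym (∑-product (s a) (λ l → δ i j l b))) (*-congˡ (∑-δ-column b)))) ⟩
      incidence a * degree t b + fromℕ 2 + d G⁻ a * incidence b
        ≤⟨ +-mono-≤ (+-mono-≤ (*-monoˡ-≤ (0≤incidence a) (t-degree b)) ≤-refl) (*-monoʳ-≤ (0≤incidence b) (d⁻≤d a)) ⟩
      incidence a * (d G b + fromℕ 2) + fromℕ 2 + d G a * incidence b ∎
      where
      open ≤-Reasoning
      0≤incidence : ∀ a → 0# ≤ incidence a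
      0≤incidence a = 0≤-+ (0≤𝐞 i a) (0≤𝐞 j a)

    -- The walks from i to b whose first step is the edge {i , j}.
    D-w≥ : ∀ {b} → b ≢ i → b ≢ j → ∑ (λ l → away i b l * (x G j l * x G l b)) ≤ D i j (λ G → w G i b) G
    D-w≥ {b} b≢i b≢j = begin
      ∑ (λ l → away i b l * (x G j l * x G l b))
        ≈⟨ ∑-cong term′ ⟩
      ∑ (λ l → away i b j * away i b l * gain i b j l)
        ≤⟨ ∑-term (λ k → 0≤∑ (λ l → 0≤-* (0≤away² i b k l) (0≤gain i b k l))) j ⟩
      ∑∑ (λ k l → away i b k * away i b l * gain i b k l)
        ≈⟨ D-w≈ i b ⟨
      D i j (λ G → w G i b) G ∎
      where
      open ≤-Reasoning
      away-ib-j : away i b j ≈ 1#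
      away-ib-j = trans (*-cong (+-congˡ (-‿cong (reflexive (𝐞-≢ i≢j)))) (+-congˡ (-‿cong (reflexive (𝐞-≢ b≢j)))))
        (solve 0 ((:1 :- :0) :* (:1 :- :0) := :1))
      gain≈ : ∀ l → gain i b j l ≈ t j l * t l b
      gain≈ l = trans (+-cong (*-congʳ (x-same true (inj₁ (≡.refl , ≡.refl)))) (-‿cong (*-congʳ x⁻ij)))
        (solve 2 (λ y z → :1 :* y :- :0 :* z := y) _ _)
      0away : ∀ {l y z} → away i b l ≈ 0# → away i b l * y ≈ away i b j * away i b l * z
      0away e = trans (*-congʳ e) (trans (solve 3 (λ a y z → :0 :* y := a :* :0 :* z) (away i b j) _ _) (*-congʳ (*-congˡ (sym e))))
      term′ : ∀ l → away i b l * (x G j l * x G l b) ≈ away i b j * away i b l * gain i b j l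
      term′ l with l ≟ i | l ≟ b
      ... | yes ≡.refl | _ = 0away {l} (trans (*-congʳ (trans (+-congˡ (-‿cong (reflexive (𝐞-≡ i)))) (-‿inverseʳ 1#))) (zeroˡ _))
      ... | no _ | yes ≡.refl = 0away {l} (trans (*-congˡ (trans (+-congˡ (-‿cong (reflexive (𝐞-≡ b)))) (-‿inverseʳ 1#))) (zeroʳ _))
      ... | no l≢i | no l≢b = trans (*-congˡ (sym (*-cong
          (x-different true λ { (inj₁ (e , _)) → i≢j (≡.sym e) ; (inj₂ (_ , e)) → l≢i e })
          (x-different true λ { (inj₁ (_ , e)) → b≢j e ; (inj₂ (_ , e)) → b≢i e }))))
        (trans (solve 2 (λ c y → c :* y := :1 :* c :* y) (away i b l) _)
          (*-cong (*-congʳ (sym away-ib-j)) (sym (gain≈ l))))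

    D-x : ∀ a b → D i j (λ G → x G a b) G ≈ δ i j a b
    D-x a b = trans (+-congʳ (x⁺≈ a b)) (solve 2 (λ y e → y :+ e :- y := e) (s a b) (δ i j a b))

    D-d : ∀ a → D i j (λ G → d G a) G ≈ 𝐞 i a + 𝐞 j a
    D-d a = trans (sym (∑-sub (t a) (s a))) (trans (∑-cong (D-x a)) (∑-δ-row a))

    D-m : D i j m G ≈ fromℕ 2
    D-m = trans (+-congʳ (AddEdge.size-add s t i j (x-sym G⁻) (x-diag G⁻) (x-idem G⁻) x⁻ij x⁺≈ i≢j))
      (solve 1 (λ y → y :+ :2 :- y := :2) (m G⁻))

  module Probability (p : ℝ) (0≤p : 0# ≤ p) (p≤1 : p ≤ 1#) where

    q : ℝ
    q = 1# - p

    0≤q : 0# ≤ q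
    0≤q = x≤y⇒0≤y-x p≤1

    0≤pq : 0# ≤ p * q
    0≤pq = 0≤-* 0≤p 0≤q

    opaque
      𝐒 : ∀ {n} → (Subset n → ℝ) → ℝ
      𝐒 {zero}  f = f []
      𝐒 {suc n} f = p * 𝐒 (f ∘ (true ∷_)) + q * 𝐒 (f ∘ (false ∷_))

    opaque
      𝐄 : ∀ {n} → (Graph n → ℝ) → ℝ
      𝐄 {zero}  f = f []
      𝐄 {suc n} f = 𝐒 (λ S → 𝐄 (λ G → f (S ∷ G)))

    opaque
      unfolding 𝐒 𝐄

      private
        weightedSum : ∀ {A : Set} → (A → ℝ) → (A → ℝ) → List A → ℝ
        weightedSum w f = List.foldr (λ a s → w a * f a + s) 0#

        weightedSum-++ : ∀ {A : Set} (w f : A → ℝ) xs ys →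
          weightedSum w f (xs List.++ ys) ≈ weightedSum w f xs + weightedSum w f ys
        weightedSum-++ w f [] ys = sym (+-identityˡ _)
        weightedSum-++ w f (x ∷ xs) ys = trans (+-congˡ (weightedSum-++ w f xs ys)) (sym (+-assoc _ _ _))

        weightedSum-map : ∀ {A B : Set} (w f : B → ℝ) (u : A → ℝ) c (h : A → B) →
          (∀ a → w (h a) ≈ c * u a) → ∀ xs →
          weightedSum w f (List.map h xs) ≈ c * weightedSum u (f ∘ h) xs
        weightedSum-map w f u c h e [] = sym (zeroʳ c)
        weightedSum-map w f u c h e (x ∷ xs) =
          trans (+-cong (*-congʳ (e x)) (weightedSum-map w f u c h e xs))
            (solve 4 (λ c u f s → c :* u :* f :+ c :* s := c :* (u :* f :+ s)) c (u x) (f (h x)) _)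

        weightedSum-product : ∀ {A B C : Set} (w f : C → ℝ) (u : A → ℝ) (v : B → ℝ) (h : A → B → C) →
          (∀ a b → w (h a b) ≈ u a * v b) → ∀ xs ys →
          weightedSum w f (cartesianProductWith h xs ys) ≈
          weightedSum u (λ a → weightedSum v (λ b → f (h a b)) ys) xs
        weightedSum-product w f u v h e [] ys = refl
        weightedSum-product w f u v h e (x ∷ xs) ys =
          trans (weightedSum-++ w f (List.map (h x) ys) _)
            (+-cong (weightedSum-map w f v (u x) (h x) (e x) ys) (weightedSum-product w f u v h e xs ys))

        weightedSum-cong : ∀ {A : Set} (w : A → ℝ) {f g : A → ℝ} → (∀ a → f a ≈ g a) → ∀ xs →
          weightedSum w f xs ≈ weightedSum w g xs
        weightedSum-cong w e [] = refl
        weightedSum-cong w e (x ∷ xs) = +-cong (*-congˡ (e x)) (weightedSum-cong w e xs)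

        weight : ∀ {n} → Subset n → ℝ
        weight = Vec.foldr _ (λ s r → bernoulli p s * r) 1#

        𝐒-weightedSum : ∀ n (f : Subset n → ℝ) → weightedSum weight f (allSubsets n) ≈ 𝐒 f
        𝐒-weightedSum zero f = solve 1 (λ x → :1 :* x :+ :0 := x) (f [])
        𝐒-weightedSum (suc n) f =
          trans (weightedSum-product weight f (bernoulli p) weight _∷_ (λ _ _ → refl) (true ∷ false ∷ []) (allSubsets n))
            (+-cong (*-congˡ (𝐒-weightedSum n (f ∘ (true ∷_))))
              (trans (+-identityʳ _) (*-congˡ (𝐒-weightedSum n (f ∘ (false ∷_))))))

      𝔼≈𝐄 : ∀ {n} (f : Graph n → ℝ) → 𝔼 p f ≈ 𝐄 f
      𝔼≈𝐄 {zero} f = solve 1 (λ x → :1 :* x :+ :0 := x) (f [])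
      𝔼≈𝐄 {suc n} f =
        trans (weightedSum-product (probability p) f weight (probability p) _∷_ (λ _ _ → refl) (allSubsets n) (allGraphs n))
          (trans (weightedSum-cong weight (λ S → 𝔼≈𝐄 (λ G → f (S ∷ G))) (allSubsets n))
            (𝐒-weightedSum n _))

      𝐒-mono : ∀ {n} {f g : Subset n → ℝ} → (∀ S → f S ≤ g S) → 𝐒 f ≤ 𝐒 g
      𝐒-mono {zero} h = h []
      𝐒-mono {suc n} h =
        +-mono-≤ (*-monoˡ-≤ 0≤p (𝐒-mono (h ∘ (true ∷_)))) (*-monoˡ-≤ 0≤q (𝐒-mono (h ∘ (false ∷_))))

      𝐄-mono : ∀ {n} {f g : Graph n → ℝ} → (∀ G → f G ≤ g G) → 𝐄 f ≤ 𝐄 g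
      𝐄-mono {zero} h = h []
      𝐄-mono {suc n} h = 𝐒-mono (λ S → 𝐄-mono (λ G → h (S ∷ G)))

    𝐒-cong : ∀ {n} {f g : Subset n → ℝ} → (∀ S → f S ≈ g S) → 𝐒 f ≈ 𝐒 g
    𝐒-cong h = ≤-antisym (𝐒-mono (λ S → ≤-reflexive (h S))) (𝐒-mono (λ S → ≤-reflexive (sym (h S))))

    𝐄-cong : ∀ {n} {f g : Graph n → ℝ} → (∀ G → f G ≈ g G) → 𝐄 f ≈ 𝐄 g
    𝐄-cong h = ≤-antisym (𝐄-mono (λ G → ≤-reflexive (h G))) (𝐄-mono (λ G → ≤-reflexive (sym (h G))))

    opaque
      unfolding 𝐒 𝐄

      𝐒-+ : ∀ {n} (f g : Subset n → ℝ) → 𝐒 (λ S → f S + g S) ≈ 𝐒 f + 𝐒 g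
      𝐒-+ {zero} f g = refl
      𝐒-+ {suc n} f g =
        trans (+-cong (*-congˡ (𝐒-+ (f ∘ (true ∷_)) (g ∘ (true ∷_)))) (*-congˡ (𝐒-+ (f ∘ (false ∷_)) (g ∘ (false ∷_)))))
          (solve 6 (λ p q a b c d → p :* (a :+ b) :+ q :* (c :+ d) := p :* a :+ q :* c :+ (p :* b :+ q :* d)) p q (𝐒 (f ∘ (true ∷_))) (𝐒 (g ∘ (true ∷_))) (𝐒 (f ∘ (false ∷_))) (𝐒 (g ∘ (false ∷_))))

      𝐄-+ : ∀ {n} (f g : Graph n → ℝ) → 𝐄 (λ G → f G + g G) ≈ 𝐄 f + 𝐄 g
      𝐄-+ {zero} f g = refl
      𝐄-+ {suc n} f g = trans (𝐒-cong (λ S → 𝐄-+ (λ G → f (S ∷ G)) (λ G → g (S ∷ G)))) (𝐒-+ {n} _ _)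

      𝐒-* : ∀ {n} c (f : Subset n → ℝ) → 𝐒 (λ S → c * f S) ≈ c * 𝐒 f
      𝐒-* {zero} c f = refl
      𝐒-* {suc n} c f =
        trans (+-cong (*-congˡ (𝐒-* c (f ∘ (true ∷_)))) (*-congˡ (𝐒-* c (f ∘ (false ∷_)))))
          (solve 5 (λ p q c a b → p :* (c :* a) :+ q :* (c :* b) := c :* (p :* a :+ q :* b)) p q c (𝐒 (f ∘ (true ∷_))) (𝐒 (f ∘ (false ∷_))))

      𝐄-* : ∀ {n} c (f : Graph n → ℝ) → 𝐄 (λ G → c * f G) ≈ c * 𝐄 f
      𝐄-* {zero} c f = refl
      𝐄-* {suc n} c f = trans (𝐒-cong (λ S → 𝐄-* c (λ G → f (S ∷ G)))) (𝐒-* {n} c _)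

      𝐒-const : ∀ {n} c → 𝐒 {n} (λ _ → c) ≈ c
      𝐒-const {zero} c = refl
      𝐒-const {suc n} c = trans (+-cong (*-congˡ (𝐒-const {n} c)) (*-congˡ (𝐒-const {n} c)))
        (solve 2 (λ p c → p :* c :+ (:1 :- p) :* c := c) p c)

      𝐄-const : ∀ {n} c → 𝐄 {n} (λ _ → c) ≈ c
      𝐄-const {zero} c = refl
      𝐄-const {suc n} c = trans (𝐒-cong {n} (λ S → 𝐄-const {n} c)) (𝐒-const {n} c)

    𝐒-sub : ∀ {n} (f g : Subset n → ℝ) → 𝐒 (λ S → f S - g S) ≈ 𝐒 f - 𝐒 g
    𝐒-sub {n} f g = trans (𝐒-cong (λ S → neg (f S) (g S))) (trans (𝐒-+ f (λ S → (0# - 1#) * g S))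
      (trans (+-congˡ (𝐒-* (0# - 1#) g)) (sym (neg _ _))))
      where
      neg : ∀ x y → x - y ≈ x + (0# - 1#) * y
      neg = solve 2 (λ x y → x :- y := x :+ (:0 :- :1) :* y)

    𝐄-sub : ∀ {n} (f g : Graph n → ℝ) → 𝐄 (λ G → f G - g G) ≈ 𝐄 f - 𝐄 g
    𝐄-sub {n} f g = trans (𝐄-cong (λ G → neg (f G) (g G))) (trans (𝐄-+ f (λ G → (0# - 1#) * g G))
      (trans (+-congˡ (𝐄-* (0# - 1#) g)) (sym (neg _ _))))
      where
      neg : ∀ x y → x - y ≈ x + (0# - 1#) * y
      neg = solve 2 (λ x y → x :- y := x :+ (:0 :- :1) :* y)

    𝐄-∑ : ∀ {n m} (f : Fin m → Graph n → ℝ) → 𝐄 (λ G → ∑ (λ i → f i G)) ≈ ∑ (λ i → 𝐄 (f i))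
    𝐄-∑ {n} {zero} f = trans (𝐄-cong {n} (λ G → ∑-empty _)) (trans (𝐄-const {n} 0#) (sym (∑-empty _)))
    𝐄-∑ {n} {suc m} f = trans (𝐄-cong (λ G → ∑-suc (λ i → f i G)))
      (trans (𝐄-+ (f zero) _) (trans (+-congˡ (𝐄-∑ (f ∘ suc))) (sym (∑-suc (λ i → 𝐄 (f i))))))

    𝐒-∑ : ∀ {n m} (f : Fin m → Subset n → ℝ) → 𝐒 (λ S → ∑ (λ i → f i S)) ≈ ∑ (λ i → 𝐒 (f i))
    𝐒-∑ {n} {zero} f = trans (𝐒-cong {n} (λ S → ∑-empty _)) (trans (𝐒-const {n} 0#) (sym (∑-empty _)))
    𝐒-∑ {n} {suc m} f = trans (𝐒-cong (λ S → ∑-suc (λ i → f i S)))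
      (trans (𝐒-+ (f zero) _) (trans (+-congˡ (𝐒-∑ (f ∘ suc))) (sym (∑-suc (λ i → 𝐒 (f i))))))

    0≤𝐄 : ∀ {n} {f : Graph n → ℝ} → (∀ G → 0# ≤ f G) → 0# ≤ 𝐄 f
    0≤𝐄 {n} h = ≤-cong (𝐄-const {n} 0#) refl (𝐄-mono h)

    0≤𝐒 : ∀ {n} {f : Subset n → ℝ} → (∀ S → 0# ≤ f S) → 0# ≤ 𝐒 f
    0≤𝐒 {n} h = ≤-cong (𝐒-const {n} 0#) refl (𝐒-mono h)

    opaque
      unfolding 𝐒 𝐄

      𝐒-resample : ∀ {n} (j : Fin n) (f : Subset n → ℝ) →
        𝐒 f ≈ p * 𝐒 (λ S → f (S [ j ]≔ true)) + q * 𝐒 (λ S → f (S [ j ]≔ false))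
      𝐒-resample {suc n} zero f = sym (+-cong (*-congˡ (collapse _)) (*-congˡ (collapse _)))
        where
        collapse : ∀ c → p * c + q * c ≈ c
        collapse = solve 2 (λ p c → p :* c :+ (:1 :- p) :* c := c) p
      𝐒-resample {suc n} (suc j) f =
        trans (+-cong (*-congˡ (𝐒-resample j (f ∘ (true ∷_)))) (*-congˡ (𝐒-resample j (f ∘ (false ∷_)))))
          (solve 6 (λ p q a b c d → p :* (p :* a :+ q :* b) :+ q :* (p :* c :+ q :* d)
              := p :* (p :* a :+ q :* c) :+ q :* (p :* b :+ q :* d)) p q _ _ _ _)

      𝐄-resample : ∀ {n} {i j : Fin n} → i ≢ j → (f : Graph n → ℝ) →
        𝐄 f ≈ p * 𝐄 (f ∘ setEdge i j true) + q * 𝐄 (f ∘ setEdge i j false)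
      𝐄-resample {suc n} {zero}  {zero}  i≢j f = ⊥-elim (i≢j ≡.refl)
      𝐄-resample {suc n} {zero}  {suc j} i≢j f = 𝐒-resample j (λ S → 𝐄 (λ G → f (S ∷ G)))
      𝐄-resample {suc n} {suc i} {zero}  i≢j f = 𝐒-resample i (λ S → 𝐄 (λ G → f (S ∷ G)))
      𝐄-resample {suc n} {suc i} {suc j} i≢j f =
        trans (𝐒-cong (λ S → 𝐄-resample {i = i} {j} (i≢j ∘ ≡.cong suc) (λ G → f (S ∷ G))))
          (trans (𝐒-+ {n} _ _) (+-cong (𝐒-* {n} p _) (𝐒-* {n} q _)))

    Var : ∀ {n} → (Graph n → ℝ) → ℝ
    Var f = 𝐄 (λ G → f G ^ 2) - 𝐄 f ^ 2

    private
      VarS : ∀ {n} → (Subset n → ℝ) → ℝ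
      VarS f = 𝐒 (λ S → f S ^ 2) - 𝐒 f ^ 2

    -- (f - c)² = (f² + c²) - 2cf
    𝐄-square : ∀ {n} (f : Graph n → ℝ) c → 𝐄 (λ G → (f G - c) ^ 2) ≈ Var f + (𝐄 f - c) ^ 2
    𝐄-square {n} f c = begin
      𝐄 (λ G → (f G - c) ^ 2)
        ≈⟨ 𝐄-cong (λ G → solve 2 (λ x c → (x :- c) :^ 2 := x :^ 2 :+ c :^ 2 :- :2 :* c :* x) (f G) c) ⟩
      𝐄 (λ G → f G ^ 2 + c ^ 2 - fromℕ 2 * c * f G)
        ≈⟨ 𝐄-sub {n} _ _ ⟩
      𝐄 (λ G → f G ^ 2 + c ^ 2) - 𝐄 (λ G → fromℕ 2 * c * f G)
        ≈⟨ +-cong (trans (𝐄-+ {n} _ _) (+-congˡ (𝐄-const {n} _))) (-‿cong (𝐄-* (fromℕ 2 * c) f)) ⟩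
      𝐄 (λ G → f G ^ 2) + c ^ 2 - fromℕ 2 * c * 𝐄 f
        ≈⟨ solve 3 (λ a e c → a :+ c :^ 2 :- :2 :* c :* e := a :- e :^ 2 :+ (e :- c) :^ 2) _ (𝐄 f) c ⟩
      Var f + (𝐄 f - c) ^ 2 ∎
      where open ≈-Reasoning

    𝐒-square : ∀ {n} (f : Subset n → ℝ) c → 𝐒 (λ S → (f S - c) ^ 2) ≈ VarS f + (𝐒 f - c) ^ 2
    𝐒-square {n} f c = begin
      𝐒 (λ S → (f S - c) ^ 2)
        ≈⟨ 𝐒-cong (λ S → solve 2 (λ x c → (x :- c) :^ 2 := x :^ 2 :+ c :^ 2 :- :2 :* c :* x) (f S) c) ⟩
      𝐒 (λ S → f S ^ 2 + c ^ 2 - fromℕ 2 * c * f S)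
        ≈⟨ 𝐒-sub {n} _ _ ⟩
      𝐒 (λ S → f S ^ 2 + c ^ 2) - 𝐒 (λ S → fromℕ 2 * c * f S)
        ≈⟨ +-cong (trans (𝐒-+ {n} _ _) (+-congˡ (𝐒-const {n} _))) (-‿cong (𝐒-* (fromℕ 2 * c) f)) ⟩
      𝐒 (λ S → f S ^ 2) + c ^ 2 - fromℕ 2 * c * 𝐒 f
        ≈⟨ solve 3 (λ a e c → a :+ c :^ 2 :- :2 :* c :* e := a :- e :^ 2 :+ (e :- c) :^ 2) _ (𝐒 f) c ⟩
      VarS f + (𝐒 f - c) ^ 2 ∎
      where open ≈-Reasoning

    private
      x-x : ∀ x y → x + (y - y) ^ 2 ≈ x
      x-x = solve 2 (λ x y → x :+ (y :- y) :^ 2 := x)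

    𝕍≈Var : ∀ {n} (f : Graph n → ℝ) → 𝕍 p f ≈ Var f
    𝕍≈Var {n} f = trans (𝔼≈𝐄 {n} _) (trans (𝐄-square f (𝔼 p f))
      (trans (+-congˡ (*-cong centre (*-congʳ centre))) (x-x (Var f) (𝐄 f))))
      where
      centre : 𝐄 f - 𝔼 p f ≈ 𝐄 f - 𝐄 f
      centre = +-congˡ (-‿cong (𝔼≈𝐄 f))

    0≤Var : ∀ {n} (f : Graph n → ℝ) → 0# ≤ Var f
    0≤Var f = ≤-cong refl (trans (𝐄-square f (𝐄 f)) (x-x (Var f) (𝐄 f))) (0≤𝐄 (λ G → 0≤x² (f G - 𝐄 f)))

    jensen : ∀ {n} (f : Graph n → ℝ) → 𝐄 f ^ 2 ≤ 𝐄 (λ G → f G ^ 2)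
    jensen f = 0≤y-x⇒x≤y (0≤Var f)

    private
      jensenS : ∀ {n} (f : Subset n → ℝ) → 𝐒 f ^ 2 ≤ 𝐒 (λ S → f S ^ 2)
      jensenS f = 0≤y-x⇒x≤y (≤-cong refl (trans (𝐒-square f (𝐒 f)) (x-x (VarS f) (𝐒 f)))
        (0≤𝐒 (λ S → 0≤x² (f S - 𝐒 f))))

    private
      DS : ∀ {n} → Fin n → (Subset n → ℝ) → Subset n → ℝ
      DS j f S = f (S [ j ]≔ true) - f (S [ j ]≔ false)

      opaque
        unfolding ∑ 𝐒

        efronSteinS : ∀ {n} (f : Subset n → ℝ) → VarS f ≤ p * q * ∑ (λ j → 𝐒 (λ S → DS j f S ^ 2))
        efronSteinS {zero} f = ≤-reflexive (solve 2 (λ x c → x :^ 2 :- x :^ 2 := c :* :0) (f []) (p * q))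
        efronSteinS {suc n} f = begin
          VarS f
            ≈⟨ solve 5 (λ p a b c d →
                 p :* a :+ (:1 :- p) :* b :- (p :* c :+ (:1 :- p) :* d) :^ 2
                   := p :* (:1 :- p) :* (c :- d) :^ 2 :+ (p :* (a :- c :^ 2) :+ (:1 :- p) :* (b :- d :^ 2))) p (𝐒 (λ S → f₁ S ^ 2)) (𝐒 (λ S → f₀ S ^ 2)) (𝐒 f₁) (𝐒 f₀) ⟩
          p * q * (𝐒 f₁ - 𝐒 f₀) ^ 2 + (p * VarS f₁ + q * VarS f₀)
            ≤⟨ +-mono-≤ (*-monoˡ-≤ 0≤pq first)
                 (+-mono-≤ (*-monoˡ-≤ 0≤p (efronSteinS f₁)) (*-monoˡ-≤ 0≤q (efronSteinS f₀))) ⟩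
          p * q * 𝐒 (λ S → DS zero f S ^ 2) + (p * (p * q * s₁) + q * (p * q * s₀))
            ≈⟨ solve 5 (λ p q a b c → p :* q :* a :+ (p :* (p :* q :* b) :+ q :* (p :* q :* c))
                 := p :* q :* (a :+ (p :* b :+ q :* c))) p q _ s₁ s₀ ⟩
          p * q * (𝐒 (λ S → DS zero f S ^ 2) + (p * s₁ + q * s₀))
            ≈⟨ *-congˡ (+-congˡ (trans (∑-+ {n} _ _) (+-cong (∑-*ˡ {n} p _) (∑-*ˡ {n} q _)))) ⟨
          p * q * ∑ (λ j → 𝐒 (λ S → DS j f S ^ 2)) ∎
          where
          open ≤-Reasoning
          f₁ f₀ : Subset n → ℝ
          f₁ = f ∘ (true ∷_)
          f₀ = f ∘ (false ∷_)
          s₁ s₀ : ℝ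
          s₁ = ∑ (λ j → 𝐒 (λ S → DS j f₁ S ^ 2))
          s₀ = ∑ (λ j → 𝐒 (λ S → DS j f₀ S ^ 2))
          first : (𝐒 f₁ - 𝐒 f₀) ^ 2 ≤ 𝐒 (λ S → DS zero f S ^ 2)
          first = begin
            (𝐒 f₁ - 𝐒 f₀) ^ 2               ≈⟨ *-cong (𝐒-sub f₁ f₀) (*-congʳ (𝐒-sub f₁ f₀)) ⟨
            𝐒 (λ S → f₁ S - f₀ S) ^ 2       ≤⟨ jensenS (λ S → f₁ S - f₀ S) ⟩
            𝐒 (λ S → (f₁ S - f₀ S) ^ 2)     ≈⟨ solve 2 (λ p a → a := p :* a :+ (:1 :- p) :* a) p _ ⟩
            𝐒 (λ S → DS zero f S ^ 2)       ∎

    opaque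
      unfolding ∑ 𝐒 𝐄

      efronStein : ∀ {n} (f : Graph n → ℝ) →
        Var f ≤ p * q * ∑ (λ i → ∑ (λ j → 𝐄 (λ G → D i j f G ^ 2)))
      efronStein {zero} f = ≤-reflexive (solve 2 (λ x c → x :^ 2 :- x :^ 2 := c :* :0) (f []) (p * q))
      efronStein {suc n} f = begin
        Var f
          ≈⟨ solve 3 (λ a b c → a :- c := (a :- b) :+ (b :- c)) _ (𝐒 (λ S → h S ^ 2)) _ ⟩
        (𝐒 (λ S → 𝐄 (λ G → f (S ∷ G) ^ 2)) - 𝐒 (λ S → h S ^ 2)) + VarS h
          ≈⟨ +-congʳ (𝐒-sub {n} _ _) ⟨
        𝐒 (λ S → Var (λ G → f (S ∷ G))) + VarS h
          ≤⟨ +-mono-≤ (𝐒-mono (λ S → efronStein (λ G → f (S ∷ G)))) (efronSteinS h) ⟩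
        𝐒 (λ S → p * q * ∑ (λ i → ∑ (λ j → 𝐄 (λ G → D i j (λ G → f (S ∷ G)) G ^ 2))))
          + p * q * ∑ (λ j → 𝐒 (λ S → DS j h S ^ 2))
          ≈⟨ +-congʳ (trans (𝐒-* {n} (p * q) _) (*-congˡ (trans (𝐒-∑ {n} {n} _) (∑-cong {n} (λ i → 𝐒-∑ {n} {n} _))))) ⟩
        p * q * ∑ (λ i → ∑ (λ j → energy (suc i) (suc j)))
          + p * q * ∑ (λ j → 𝐒 (λ S → DS j h S ^ 2))
          ≤⟨ +-mono-≤ (*-monoˡ-≤ 0≤pq (∑-mono {n} (λ i → ≤-fromDifference (energy (suc i) zero) (0≤energy (suc i) zero) (+-comm _ _))))
               (*-monoˡ-≤ 0≤pq (≤-trans (∑-mono {n} cross) (≤-fromDifference (energy zero zero) (0≤energy zero zero) (+-comm _ _)))) ⟩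
        p * q * ∑ (λ i → ∑ (λ j → energy (suc i) j)) + p * q * ∑ (λ j → energy zero j)
          ≈⟨ solve 3 (λ c a b → c :* a :+ c :* b := c :* (b :+ a)) (p * q) _ _ ⟩
        p * q * ∑ (λ i → ∑ (λ j → energy i j)) ∎
        where
        open ≤-Reasoning
        h : Subset n → ℝ
        h S = 𝐄 (λ G → f (S ∷ G))
        energy : Fin (suc n) → Fin (suc n) → ℝ
        energy i j = 𝐄 (λ G → D i j f G ^ 2)
        0≤energy : ∀ i j → 0# ≤ energy i j
        0≤energy i j = 0≤𝐄 (λ G → 0≤x² (D i j f G))
        cross : ∀ j → 𝐒 (λ S → DS j h S ^ 2) ≤ energy zero (suc j)
        cross j = 𝐒-mono (λ S → begin
          DS j h S ^ 2
            ≈⟨ *-cong (𝐄-sub {n} _ _) (*-congʳ (𝐄-sub {n} _ _)) ⟨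
          𝐄 (λ G → D zero (suc j) f (S ∷ G)) ^ 2
            ≤⟨ jensen {n} _ ⟩
          𝐄 (λ G → D zero (suc j) f (S ∷ G) ^ 2) ∎)

    x-set-different : ∀ {n} (G : Graph n) {i j} b {k l} → ¬ SameEdge i j k l → x (setEdge i j b G) k l ≈ x G k l
    x-set-different G b h = reflexive (≡.cong indicator (adjacent-setEdge-different G b h))

    x-set-same : ∀ {n} (G : Graph n) {i j} b {k l} → i ≢ j → SameEdge i j k l → x (setEdge i j b G) k l ≈ indicator b
    x-set-same G b i≢j h = reflexive (≡.cong indicator (adjacent-setEdge-same G b i≢j h))

    𝐄-x* : ∀ {n} {i j : Fin n} → i ≢ j → (f : Graph n → ℝ) →
      𝐄 (λ G → x G i j * f G) ≈ p * 𝐄 (f ∘ setEdge i j true)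
    𝐄-x* {n} {i} {j} i≢j f = begin
      𝐄 (λ G → x G i j * f G)
        ≈⟨ 𝐄-resample i≢j _ ⟩
      p * 𝐄 (λ G → x (setEdge i j true G) i j * f (setEdge i j true G))
        + q * 𝐄 (λ G → x (setEdge i j false G) i j * f (setEdge i j false G))
        ≈⟨ +-cong (*-congˡ (𝐄-cong (λ G → trans (*-congʳ (x-set-same G true i≢j (inj₁ (≡.refl , ≡.refl)))) (*-identityˡ _))))
             (*-congˡ (trans (𝐄-cong (λ G → trans (*-congʳ (x-set-same G false i≢j (inj₁ (≡.refl , ≡.refl)))) (zeroˡ _))) (𝐄-const {n} 0#))) ⟩
      p * 𝐄 (f ∘ setEdge i j true) + q * 0#
        ≈⟨ solve 2 (λ a b → a :+ b :* :0 := a) _ q ⟩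
      p * 𝐄 (f ∘ setEdge i j true) ∎
      where open ≈-Reasoning

    𝐄-x*-independent : ∀ {n} {i j : Fin n} → i ≢ j → (f : Graph n → ℝ) → (∀ G → f (setEdge i j true G) ≈ f G) →
      𝐄 (λ G → x G i j * f G) ≈ p * 𝐄 f
    𝐄-x*-independent i≢j f h = trans (𝐄-x* i≢j f) (*-congˡ (𝐄-cong h))

    𝐄-x : ∀ {n} {i j : Fin n} → i ≢ j → 𝐄 (λ G → x G i j) ≈ p
    𝐄-x {n} {i} {j} i≢j = trans (𝐄-cong (λ G → sym (*-identityʳ (x G i j))))
      (trans (𝐄-x* i≢j (λ _ → 1#)) (trans (*-congˡ (𝐄-const {n} 1#)) (*-identityʳ p)))

    𝐄-x-loop : ∀ {n} (i : Fin n) → 𝐄 (λ G → x G i i) ≈ 0#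
    𝐄-x-loop {n} i = trans (𝐄-cong (λ G → x-diag G i)) (𝐄-const {n} 0#)

    𝐄-x≈ : ∀ {n} (i j : Fin n) → 𝐄 (λ G → x G i j) ≈ p * (1# - 𝐞 i j)
    𝐄-x≈ i j with i ≟ j
    ... | yes ≡.refl = trans (𝐄-x-loop i) (solve 1 (λ p → :0 := p :* (:1 :- :1)) p)
    ... | no i≢j = trans (𝐄-x i≢j) (solve 1 (λ p → p := p :* (:1 :- :0)) p)

    𝐄-xx : ∀ {n} {i j k l : Fin n} → i ≢ j → k ≢ l → ¬ SameEdge i j k l → 𝐄 (λ G → x G i j * x G k l) ≈ p * p
    𝐄-xx {i = i} {j} {k} {l} i≢j k≢l h = trans (𝐄-x*-independent i≢j (λ G → x G k l) (λ G → x-set-different G true h))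
      (*-congˡ (𝐄-x k≢l))

    𝐄-xxx : ∀ {n} {i j k l a b : Fin n} → i ≢ j → k ≢ l → a ≢ b →
      ¬ SameEdge i j k l → ¬ SameEdge i j a b → ¬ SameEdge k l a b →
      𝐄 (λ G → x G i j * (x G k l * x G a b)) ≈ p * (p * p)
    𝐄-xxx {i = i} {j} {k} {l} {a} {b} i≢j k≢l a≢b h₁ h₂ h₃ =
      trans (𝐄-x*-independent i≢j (λ G → x G k l * x G a b) (λ G → *-cong (x-set-different G true h₁) (x-set-different G true h₂)))
        (*-congˡ (𝐄-xx k≢l a≢b h₃))

    integrationByParts : ∀ {n} (i j : Fin n) (f : Graph n → ℝ) → i ≢ j →
      𝐄 (λ G → (x G i j - p) * f G) ≈ p * q * 𝐄 (D i j f)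
    integrationByParts i j f i≢j = begin
      𝐄 (λ G → (x G i j - p) * f G)
        ≈⟨ trans (𝐄-cong (λ G → solve 3 (λ x p f → (x :- p) :* f := x :* f :- p :* f) (x G i j) p (f G)))
             (trans (𝐄-sub _ _) (+-cong (𝐄-x* i≢j f) (-‿cong (trans (𝐄-* p f) (*-congˡ (𝐄-resample i≢j f)))))) ⟩
      p * f⁺ - p * (p * f⁺ + q * f⁻)
        ≈⟨ solve 3 (λ p a b → p :* a :- p :* (p :* a :+ (:1 :- p) :* b) := p :* (:1 :- p) :* (a :- b)) p f⁺ f⁻ ⟩
      p * q * (f⁺ - f⁻)
        ≈⟨ *-congˡ (𝐄-sub _ _) ⟨
      p * q * 𝐄 (D i j f) ∎
      where
      open ≈-Reasoning
      f⁺ f⁻ : ℝ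
      f⁺ = 𝐄 (f ∘ setEdge i j true)
      f⁻ = 𝐄 (f ∘ setEdge i j false)

    Cov : ∀ {n} → (Graph n → ℝ) → (Graph n → ℝ) → ℝ
    Cov f g = 𝐄 (λ G → f G * g G) - 𝐄 f * 𝐄 g

    -- Var (f - λ g) ≥ 0
    Var-≥-Cov : ∀ {n} (f g : Graph n → ℝ) c → fromℕ 2 * c * Cov f g - c ^ 2 * Var g ≤ Var f
    Var-≥-Cov f g c = ≤-fromDifference (Var (λ G → f G - c * g G)) (0≤Var _)
      (trans (+-congˡ expand) (solve 3 (λ a b c → a :- b :+ (c :- a :+ b) := c) _ _ _))
      where
      open ≈-Reasoning
      expand : Var (λ G → f G - c * g G) ≈ Var f - fromℕ 2 * c * Cov f g + c ^ 2 * Var g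
      expand = begin
        Var (λ G → f G - c * g G)
          ≈⟨ +-cong (trans (𝐄-cong (λ G → solve 3 (λ f g c → (f :- c :* g) :^ 2 := f :^ 2 :- :2 :* c :* (f :* g) :+ c :^ 2 :* g :^ 2) (f G) (g G) c))
               (trans (𝐄-+ _ _) (+-cong (trans (𝐄-sub _ _) (+-congˡ (-‿cong (𝐄-* (fromℕ 2 * c) _)))) (𝐄-* (c ^ 2) _))))
               (-‿cong (trans (*-congˡ (*-congʳ e)) (*-congʳ e))) ⟩
        𝐄 (λ G → f G ^ 2) - fromℕ 2 * c * 𝐄 (λ G → f G * g G) + c ^ 2 * 𝐄 (λ G → g G ^ 2) - (𝐄 f - c * 𝐄 g) ^ 2
          ≈⟨ solve 6 (λ f g a b h c → a :- :2 :* c :* h :+ c :^ 2 :* b :- (f :- c :* g) :^ 2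
               := a :- f :^ 2 :- :2 :* c :* (h :- f :* g) :+ c :^ 2 :* (b :- g :^ 2)) (𝐄 f) (𝐄 g) _ _ _ c ⟩
        Var f - fromℕ 2 * c * Cov f g + c ^ 2 * Var g ∎
        where
        e : 𝐄 (λ G → f G - c * g G) ≈ 𝐄 f - c * 𝐄 g
        e = trans (𝐄-sub _ _) (+-congˡ (-‿cong (𝐄-* c g)))

    Var-+-≤ : ∀ {n} (f g : Graph n → ℝ) → Var (λ G → f G + g G) ≤ fromℕ 2 * Var f + fromℕ 2 * Var g
    Var-+-≤ {n} f g = begin
      Var (λ G → f G + g G)
        ≤⟨ ≤-fromDifference _ (0≤x² _) (sym (𝐄-square (λ G → f G + g G) (𝐄 f + 𝐄 g))) ⟩
      𝐄 (λ G → (f G + g G - (𝐄 f + 𝐄 g)) ^ 2)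
        ≤⟨ 𝐄-mono (λ G → ≤-trans (≤-reflexive (solve 4 (λ a b c d → (a :+ b :- (c :+ d)) :^ 2 := ((a :- c) :+ (b :- d)) :^ 2) (f G) (g G) (𝐄 f) (𝐄 g)))
             (sq-+-≤ (f G - 𝐄 f) (g G - 𝐄 g))) ⟩
      𝐄 (λ G → fromℕ 2 * ((f G - 𝐄 f) ^ 2 + (g G - 𝐄 g) ^ 2))
        ≈⟨ trans (𝐄-* (fromℕ 2) _) (*-congˡ (trans (𝐄-+ _ _) (+-cong (𝐄-square f (𝐄 f)) (𝐄-square g (𝐄 g))))) ⟩
      fromℕ 2 * (Var f + (𝐄 f - 𝐄 f) ^ 2 + (Var g + (𝐄 g - 𝐄 g) ^ 2))
        ≈⟨ solve 4 (λ a b c d → :2 :* (a :+ (c :- c) :^ 2 :+ (b :+ (d :- d) :^ 2)) := :2 :* a :+ :2 :* b) (Var f) (Var g) (𝐄 f) (𝐄 g) ⟩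
      fromℕ 2 * Var f + fromℕ 2 * Var g ∎
      where open ≤-Reasoning

    Var-cong : ∀ {n} {f g : Graph n → ℝ} → (∀ G → f G ≈ g G) → Var f ≈ Var g
    Var-cong h = +-cong (𝐄-cong (λ G → *-cong (h G) (*-congʳ (h G)))) (-‿cong (*-cong (𝐄-cong h) (*-congʳ (𝐄-cong h))))

    Var-* : ∀ {n} c (f : Graph n → ℝ) → Var (λ G → c * f G) ≈ c ^ 2 * Var f
    Var-* c f = trans (+-cong (trans (𝐄-cong (λ G → solve 2 (λ c f → (c :* f) :^ 2 := c :^ 2 :* f :^ 2) c (f G))) (𝐄-* (c ^ 2) _))
        (-‿cong (*-cong (𝐄-* c f) (*-congʳ (𝐄-* c f)))))
      (solve 3 (λ c a b → c :^ 2 :* a :- (c :* b) :^ 2 := c :^ 2 :* (a :- b :^ 2)) c _ (𝐄 f))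

    ν : ℕ → ℝ
    ν = fromℕ

    𝐄-d : ∀ {n} (i : Fin n) → 𝐄 (λ G → d G i) ≈ p * (ν n - 1#)
    𝐄-d {n} i = trans (𝐄-∑ _) (trans (∑-cong (𝐄-x≈ i)) (trans (∑-*ˡ p _)
      (*-congˡ (trans (∑-sub (λ _ → 1#) (𝐞 i)) (+-cong (trans (∑-const n 1#) (*-identityʳ _)) (-‿cong (∑-𝐞 i)))))))

    𝐄-m : ∀ {n} → 𝐄 (m {n}) ≈ ν n * (p * (ν n - 1#))
    𝐄-m {n} = trans (𝐄-∑ _) (trans (∑-cong (𝐄-d {n})) (∑-const n _))

    𝐄-x≤ : ∀ {n} (i j : Fin n) → 𝐄 (λ G → x G i j) ≤ p
    𝐄-x≤ i j = ≤-trans (≤-reflexive (𝐄-x≈ i j)) (≤-fromDifference (p * 𝐞 i j) (0≤-* 0≤p (0≤𝐞 i j))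
      (solve 2 (λ p e → p :* (:1 :- e) :+ p :* e := p) p (𝐞 i j)))

    SameEdge-star : ∀ {n} {i b c : Fin n} → b ≢ c → ¬ SameEdge i b i c
    SameEdge-star b≢c (inj₁ (_ , c≡b)) = b≢c (≡.sym c≡b)
    SameEdge-star b≢c (inj₂ (i≡b , c≡i)) = b≢c (≡.trans (≡.sym i≡b) (≡.sym c≡i))

    𝐄-xx-star≤ : ∀ {n} (i b c : Fin n) → 𝐄 (λ G → x G i b * x G i c) ≤ p * p + 𝐞 b c * p
    𝐄-xx-star≤ {n} i b c with b ≟ c
    ... | yes ≡.refl = ≤-trans (≤-reflexive (𝐄-cong (λ G → x-idem G i b))) (≤-trans (𝐄-x≤ i b)
      (≤-fromDifference (p * p) (0≤-* 0≤p 0≤p) (solve 1 (λ p → p :+ p :* p := p :* p :+ :1 :* p) p)))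
    ... | no b≢c with i ≟ b | i ≟ c
    ...   | yes ≡.refl | _ = ≤-trans (≤-reflexive (trans (𝐄-cong (λ G → trans (*-congʳ (x-diag G i)) (zeroˡ _))) (𝐄-const {n} 0#)))
              (≤-trans (0≤-* 0≤p 0≤p) (≤-reflexive (solve 1 (λ p → p :* p := p :* p :+ :0 :* p) p)))
    ...   | no _ | yes ≡.refl = ≤-trans (≤-reflexive (trans (𝐄-cong (λ G → trans (*-congˡ (x-diag G i)) (zeroʳ _))) (𝐄-const {n} 0#)))
              (≤-trans (0≤-* 0≤p 0≤p) (≤-reflexive (solve 1 (λ p → p :* p := p :* p :+ :0 :* p) p)))
    ...   | no i≢b | no i≢c = ≤-reflexive (trans (𝐄-xx i≢b i≢c (SameEdge-star b≢c)) (solve 1 (λ p → p :* p := p :* p :+ :0 :* p) p))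

    sq≈* : ∀ y → y ^ 2 ≈ y * y
    sq≈* = solve 1 (λ y → y :^ 2 := y :* y)

    𝐄-d²≤ : ∀ {n} (i : Fin n) → 𝐄 (λ G → d G i ^ 2) ≤ ν n ^ 2 * p ^ 2 + ν n * p
    𝐄-d²≤ {n} i = begin
      𝐄 (λ G → d G i ^ 2)
        ≈⟨ 𝐄-cong (λ G → trans (sq≈* (d G i)) (∑-product (x G i) (x G i))) ⟩
      𝐄 (λ G → ∑∑ (λ b c → x G i b * x G i c))
        ≈⟨ trans (𝐄-∑ _) (∑-cong (λ b → 𝐄-∑ _)) ⟩
      ∑∑ (λ b c → 𝐄 (λ G → x G i b * x G i c))
        ≤⟨ ∑∑-mono (𝐄-xx-star≤ i) ⟩
      ∑∑ (λ b c → p * p + 𝐞 b c * p)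
        ≈⟨ ∑-cong (λ b → trans (∑-+ _ _) (+-cong (∑-const n (p * p)) (∑-𝐞ˡ b (λ _ → p)))) ⟩
      ∑ (λ b → ν n * (p * p) + p)
        ≈⟨ ∑-const n _ ⟩
      ν n * (ν n * (p * p) + p)
        ≈⟨ solve 2 (λ v p → v :* (v :* (p :* p) :+ p) := v :^ 2 :* p :^ 2 :+ v :* p) (ν n) p ⟩
      ν n ^ 2 * p ^ 2 + ν n * p ∎
      where open ≤-Reasoning

    D-loop : ∀ {n} (i : Fin n) (f : Graph n → ℝ) G → D i i f G ≈ 0#
    D-loop i f G = trans (+-cong (reflexive (≡.cong f (setEdge-loop G i true))) (-‿cong (reflexive (≡.cong f (setEdge-loop G i false)))))
      (-‿inverseʳ (f G))

    ^-cong : ∀ k {y z} → y ≈ z → y ^ k ≈ z ^ k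
    ^-cong zero e = refl
    ^-cong (suc k) e = *-cong e (^-cong k e)

    |y|≤⇒y²≤ : ∀ {y b} → y ≤ b → - b ≤ y → y ^ 2 ≤ b ^ 2
    |y|≤⇒y²≤ {y} {b} h l = ≤-fromDifference ((b - y) * (y - - b)) (0≤-* (x≤y⇒0≤y-x h) (x≤y⇒0≤y-x l))
      (solve 2 (λ y b → y :^ 2 :+ (b :- y) :* (y :- :- b) := b :^ 2) y b)

    efronStein-≤ : ∀ {n} (f : Graph n → ℝ) c → (∀ i j → i ≢ j → 𝐄 (λ G → D i j f G ^ 2) ≤ c) → 0# ≤ c →
      Var f ≤ p * q * (ν n ^ 2 * c)
    efronStein-≤ {n} f c h 0≤c = ≤-trans (efronStein f) (*-monoˡ-≤ 0≤pq (≤-trans (∑∑-mono term)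
      (≤-reflexive (trans (∑-cong {n} (λ _ → ∑-const n c)) (trans (∑-const n _) (solve 2 (λ v c → v :* (v :* c) := v :^ 2 :* c) (ν n) c))))))
      where
      term : ∀ i j → 𝐄 (λ G → D i j f G ^ 2) ≤ c
      term i j with i ≟ j
      ... | yes ≡.refl = ≤-trans (≤-reflexive (trans (𝐄-cong (λ G → trans (^-cong 2 (D-loop i f G)) (solve 0 (:0 :^ 2 := :0)))) (𝐄-const {n} 0#))) 0≤c
      ... | no i≢j = h i j i≢j

    Var-U≤ : ∀ {n} → Var (U {n}) ≤ p * q * (ν n ^ 2 * (fromℕ 64 * (ν n ^ 2 * p ^ 2 + ν n * p)))
    Var-U≤ {n} = efronStein-≤ U _ bound (0≤-* (0≤fromℕ 64) (0≤-+ (0≤-* (0≤x² (ν n)) (0≤x² p)) (0≤-* (0≤fromℕ n) 0≤p)))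
      where
      open ≤-Reasoning
      bound : ∀ i j → i ≢ j → 𝐄 (λ G → D i j U G ^ 2) ≤ fromℕ 64 * (ν n ^ 2 * p ^ 2 + ν n * p)
      bound i j i≢j = begin
        𝐄 (λ G → D i j U G ^ 2)
          ≤⟨ 𝐄-mono (λ G → ≤-trans (|y|≤⇒y²≤ (Perturb.D-U-upper G i≢j) (Perturb.D-U-lower G i≢j))
               (≤-fromDifference (fromℕ 16 * (d G i - d G j) ^ 2) (0≤-* (0≤fromℕ 16) (0≤x² _))
                 (solve 2 (λ a b → (:4 :* (a :+ b)) :^ 2 :+ con (ℤ.+ 16) :* (a :- b) :^ 2 := con (ℤ.+ 32) :* (a :^ 2 :+ b :^ 2)) (d G i) (d G j)))) ⟩
        𝐄 (λ G → fromℕ 32 * (d G i ^ 2 + d G j ^ 2))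
          ≈⟨ trans (𝐄-* _ _) (*-congˡ (𝐄-+ _ _)) ⟩
        fromℕ 32 * (𝐄 (λ G → d G i ^ 2) + 𝐄 (λ G → d G j ^ 2))
          ≤⟨ *-monoˡ-≤ (0≤fromℕ 32) (+-mono-≤ (𝐄-d²≤ i) (𝐄-d²≤ j)) ⟩
        fromℕ 32 * (ν n ^ 2 * p ^ 2 + ν n * p + (ν n ^ 2 * p ^ 2 + ν n * p))
          ≈⟨ solve 1 (λ a → con (ℤ.+ 32) :* (a :+ a) := con (ℤ.+ 64) :* a) (ν n ^ 2 * p ^ 2 + ν n * p) ⟩
        fromℕ 64 * (ν n ^ 2 * p ^ 2 + ν n * p) ∎

    1≤ν : ∀ {n} → Fin n → 1# ≤ ν n
    1≤ν {suc n} _ = 1≤fromℕ n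

    d≤ν : ∀ {n} (G : Graph n) i → d G i ≤ ν n
    d≤ν {n} G i = ≤-trans (∑-≤const 1# (x≤1 G i)) (≤-reflexive (*-identityʳ _))

    𝐄-d²≤ν²p : ∀ {n} (i : Fin n) → 𝐄 (λ G → d G i ^ 2) ≤ ν n ^ 2 * p
    𝐄-d²≤ν²p {n} i = begin
      𝐄 (λ G → d G i ^ 2)
        ≤⟨ 𝐄-mono (λ G → ≤-trans (≤-reflexive (sq≈* (d G i))) (*-monoʳ-≤ (0≤d G i) (d≤ν G i))) ⟩
      𝐄 (λ G → ν n * d G i)
        ≈⟨ trans (𝐄-* (ν n) _) (*-congˡ (𝐄-d i)) ⟩
      ν n * (p * (ν n - 1#))
        ≤⟨ ≤-fromDifference (ν n * p) (0≤-* (0≤fromℕ n) 0≤p) (solve 2 (λ v p → v :* (p :* (v :- :1)) :+ v :* p := v :^ 2 :* p) (ν n) p) ⟩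
      ν n ^ 2 * p ∎
      where open ≤-Reasoning

    Γ : ℕ → ℝ
    Γ n = ν n ^ 3 * p ^ 2 + ν n ^ 2 * p

    0≤ν^p : ∀ {n} k l → 0# ≤ ν n ^ k * p ^ l
    0≤ν^p {n} k l = 0≤-* (0≤-^ k (0≤fromℕ n)) (0≤-^ l 0≤p)

    0≤Γ : ∀ {n} → 0# ≤ Γ n
    0≤Γ {n} = 0≤-+ (0≤ν^p {n} 3 2) (0≤-* (0≤x² (ν n)) 0≤p)

    ν²p≤Γ : ∀ {n} → ν n ^ 2 * p ≤ Γ n
    ν²p≤Γ {n} = ≤-fromDifference _ (0≤ν^p {n} 3 2) (+-comm _ _)

    p^≤p : ∀ k → p ^ suc k ≤ p
    p^≤p zero = ≤-reflexive (*-identityʳ p)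
    p^≤p (suc k) = ≤-trans (*-monoˡ-≤ 0≤p (p^≤p k)) (≤-trans (*-monoʳ-≤ 0≤p p≤1) (≤-reflexive (*-identityˡ p)))

    Var-m≤ : ∀ {n} → Var (m {n}) ≤ p * q * (ν n ^ 2 * fromℕ 4)
    Var-m≤ {n} = efronStein-≤ m _ (λ i j i≢j → ≤-reflexive (trans (𝐄-cong (λ G → trans (^-cong 2 (Perturb.D-m G i≢j))
      (solve 0 (:2 :^ 2 := :4)))) (𝐄-const {n} _))) (0≤fromℕ 4)

    𝐄-m-deviation : ∀ {n} → 𝐄 (λ G → (m {n} G - ν n ^ 2 * p) ^ 2) ≤ fromℕ 4 * Γ n
    𝐄-m-deviation {n} = begin
      𝐄 (λ G → (m G - ν n ^ 2 * p) ^ 2)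
        ≈⟨ trans (𝐄-square m _) (+-congˡ (^-cong 2 (+-congʳ 𝐄-m))) ⟩
      Var m + (ν n * (p * (ν n - 1#)) - ν n ^ 2 * p) ^ 2
        ≤⟨ +-mono-≤ Var-m≤ ≤-refl ⟩
      p * q * (ν n ^ 2 * fromℕ 4) + (ν n * (p * (ν n - 1#)) - ν n ^ 2 * p) ^ 2
        ≤⟨ ≤-fromDifference (fromℕ 4 * (ν n ^ 3 * p ^ 2) + fromℕ 3 * (ν n ^ 2 * p ^ 2))
             (0≤-+ (0≤-* (0≤fromℕ 4) (0≤ν^p {n} 3 2)) (0≤-* (0≤fromℕ 3) (0≤ν^p {n} 2 2)))
             (solve 2 (λ v p → p :* (:1 :- p) :* (v :^ 2 :* :4) :+ (v :* (p :* (v :- :1)) :- v :^ 2 :* p) :^ 2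
               :+ (:4 :* (v :^ 3 :* p :^ 2) :+ con (ℤ.+ 3) :* (v :^ 2 :* p :^ 2)) := :4 :* (v :^ 3 :* p :^ 2 :+ v :^ 2 :* p)) (ν n) p) ⟩
      fromℕ 4 * Γ n ∎
      where open ≤-Reasoning

    sq-+-+-≤ : ∀ x y z → (x + y + z) ^ 2 ≤ fromℕ 3 * (x ^ 2 + y ^ 2 + z ^ 2)
    sq-+-+-≤ x y z = ≤-fromDifference ((x - y) ^ 2 + (y - z) ^ 2 + (x - z) ^ 2)
      (0≤-+ (0≤-+ (0≤x² _) (0≤x² _)) (0≤x² _))
      (solve 3 (λ x y z → (x :+ y :+ z) :^ 2 :+ ((x :- y) :^ 2 :+ (y :- z) :^ 2 :+ (x :- z) :^ 2)
        := con (ℤ.+ 3) :* (x :^ 2 :+ y :^ 2 :+ z :^ 2)) x y z)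

    incidence²≤ : ∀ {n} (i j a : Fin n) → (𝐞 i a + 𝐞 j a) ^ 2 ≤ fromℕ 2 * (𝐞 i a + 𝐞 j a)
    incidence²≤ i j a = ≤-fromDifference ((𝐞 i a - 𝐞 j a) ^ 2) (0≤x² _)
      (trans (solve 2 (λ e f → (e :+ f) :^ 2 :+ (e :- f) :^ 2 := :2 :* (e :* e :+ f :* f)) (𝐞 i a) (𝐞 j a))
        (*-congˡ (+-cong (indicator-idem (does (i ≟ a))) (indicator-idem (does (j ≟ a))))))

    𝐄-D-w²≤ : ∀ {n} (a b i j : Fin n) → 𝐄 (λ G → D i j (λ G → w G a b) G ^ 2) ≤
      (𝐞 i a + 𝐞 j a) * (fromℕ 12 * (ν n ^ 2 * p) + fromℕ 48) + fromℕ 12 + (𝐞 i b + 𝐞 j b) * (fromℕ 6 * (ν n ^ 2 * p))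
    𝐄-D-w²≤ {n} a b i j with i ≟ j
    ... | yes ≡.refl = ≤-trans (≤-reflexive (trans (𝐄-cong (λ G → trans (^-cong 2 (D-loop i (λ G → w G a b) G)) (solve 0 (:0 :^ 2 := :0)))) (𝐄-const {n} 0#)))
            (0≤-+ (0≤-+ (0≤-* (0≤-+ (0≤𝐞 i a) (0≤𝐞 i a)) (0≤-+ (0≤-* (0≤fromℕ 12) 0≤ν²p) (0≤fromℕ 48))) (0≤fromℕ 12))
              (0≤-* (0≤-+ (0≤𝐞 i b) (0≤𝐞 i b)) (0≤-* (0≤fromℕ 6) 0≤ν²p)))
      where
      0≤ν²p : 0# ≤ ν n ^ 2 * p
      0≤ν²p = 0≤-* (0≤x² (ν n)) 0≤p
    ... | no i≢j = begin
      𝐄 (λ G → D i j (λ G → w G a b) G ^ 2)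
        ≤⟨ 𝐄-mono pointwise ⟩
      𝐄 (λ G → α * (fromℕ 12 * d G b ^ 2 + fromℕ 48) + fromℕ 12 + β * (fromℕ 6 * d G a ^ 2))
        ≈⟨ trans (𝐄-+ _ _) (+-cong (trans (𝐄-+ _ _) (+-cong (trans (𝐄-* α _) (*-congˡ (trans (𝐄-+ _ _) (+-cong (𝐄-* _ _) (𝐄-const {n} _))))) (𝐄-const {n} _)))
             (trans (𝐄-* β _) (*-congˡ (𝐄-* _ _)))) ⟩
      α * (fromℕ 12 * 𝐄 (λ G → d G b ^ 2) + fromℕ 48) + fromℕ 12 + β * (fromℕ 6 * 𝐄 (λ G → d G a ^ 2))
        ≤⟨ +-mono-≤ (+-mono-≤ (*-monoˡ-≤ 0≤α (+-mono-≤ (*-monoˡ-≤ (0≤fromℕ 12) (𝐄-d²≤ν²p b)) ≤-refl)) ≤-refl)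
             (*-monoˡ-≤ 0≤β (*-monoˡ-≤ (0≤fromℕ 6) (𝐄-d²≤ν²p a))) ⟩
      α * (fromℕ 12 * (ν n ^ 2 * p) + fromℕ 48) + fromℕ 12 + β * (fromℕ 6 * (ν n ^ 2 * p)) ∎
      where
      open ≤-Reasoning
      α β : ℝ
      α = 𝐞 i a + 𝐞 j a
      β = 𝐞 i b + 𝐞 j b
      0≤α : 0# ≤ α
      0≤α = 0≤-+ (0≤𝐞 i a) (0≤𝐞 j a)
      0≤β : 0# ≤ β
      0≤β = 0≤-+ (0≤𝐞 i b) (0≤𝐞 j b)
      pointwise : ∀ G → D i j (λ G → w G a b) G ^ 2 ≤ α * (fromℕ 12 * d G b ^ 2 + fromℕ 48) + fromℕ 12 + β * (fromℕ 6 * d G a ^ 2)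
      pointwise G = begin
        D i j (λ G → w G a b) G ^ 2
          ≤⟨ ^-mono-≤ 2 (Perturb.0≤D-w G i≢j a b) (Perturb.D-w≤ G i≢j a b) ⟩
        (α * (d G b + fromℕ 2) + fromℕ 2 + d G a * β) ^ 2
          ≤⟨ sq-+-+-≤ _ _ _ ⟩
        fromℕ 3 * ((α * (d G b + fromℕ 2)) ^ 2 + fromℕ 2 ^ 2 + (d G a * β) ^ 2)
          ≈⟨ solve 4 (λ a b u v → con (ℤ.+ 3) :* ((a :* (u :+ :2)) :^ 2 :+ :2 :^ 2 :+ (v :* b) :^ 2)
               := con (ℤ.+ 3) :* (a :^ 2 :* (u :+ :2) :^ 2 :+ :4 :+ b :^ 2 :* v :^ 2)) α β (d G b) (d G a) ⟩
        fromℕ 3 * (α ^ 2 * (d G b + fromℕ 2) ^ 2 + fromℕ 4 + β ^ 2 * d G a ^ 2)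
          ≤⟨ *-monoˡ-≤ (0≤fromℕ 3) (+-mono-≤ (+-mono-≤ (*-mono-≤ (0≤x² α) (0≤x² _) (incidence²≤ i j a) (sq-+-≤ _ _)) ≤-refl)
               (*-monoʳ-≤ (0≤x² _) (incidence²≤ i j b))) ⟩
        fromℕ 3 * (fromℕ 2 * α * (fromℕ 2 * (d G b ^ 2 + fromℕ 2 ^ 2)) + fromℕ 4 + fromℕ 2 * β * d G a ^ 2)
          ≈⟨ solve 4 (λ a b u v → con (ℤ.+ 3) :* (:2 :* a :* (:2 :* (u :^ 2 :+ :2 :^ 2)) :+ :4 :+ :2 :* b :* v :^ 2)
               := a :* (con (ℤ.+ 12) :* u :^ 2 :+ con (ℤ.+ 48)) :+ con (ℤ.+ 12) :+ b :* (con (ℤ.+ 6) :* v :^ 2)) α β (d G b) (d G a) ⟩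
        α * (fromℕ 12 * d G b ^ 2 + fromℕ 48) + fromℕ 12 + β * (fromℕ 6 * d G a ^ 2) ∎

    ∑∑-incidence : ∀ {n} (a : Fin n) c → ∑∑ (λ i j → (𝐞 i a + 𝐞 j a) * c) ≈ fromℕ 2 * ν n * c
    ∑∑-incidence {n} a c = begin
      ∑∑ (λ i j → (𝐞 i a + 𝐞 j a) * c)
        ≈⟨ ∑-cong (λ i → trans (∑-cong (λ j → distribʳ c (𝐞 i a) (𝐞 j a))) (trans (∑-+ _ _) (+-cong (∑-const n _) (∑-𝐞ʳ a (λ _ → c))))) ⟩
      ∑ (λ i → ν n * (𝐞 i a * c) + c)
        ≈⟨ trans (∑-+ _ _) (+-cong (trans (∑-*ˡ (ν n) _) (*-congˡ (∑-𝐞ʳ a (λ _ → c)))) (∑-const n c)) ⟩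
      ν n * c + ν n * c
        ≈⟨ solve 2 (λ v c → v :* c :+ v :* c := :2 :* v :* c) (ν n) c ⟩
      fromℕ 2 * ν n * c ∎
      where open ≈-Reasoning

    ∑∑-const : ∀ n c → ∑∑ {n} (λ _ _ → c) ≈ ν n ^ 2 * c
    ∑∑-const n c = trans (∑-cong {n} (λ _ → ∑-const n c)) (trans (∑-const n _) (solve 2 (λ v c → v :* (v :* c) := v :^ 2 :* c) (ν n) c))

    Var-w≤ : ∀ {n} (a b : Fin n) → Var (λ G → w G a b) ≤ fromℕ 108 * Γ n
    Var-w≤ {n} a b = begin
      Var (λ G → w G a b)
        ≤⟨ efronStein _ ⟩
      p * q * ∑∑ (λ i j → 𝐄 (λ G → D i j (λ G → w G a b) G ^ 2))
        ≤⟨ *-monoˡ-≤ 0≤pq (∑∑-mono (𝐄-D-w²≤ a b)) ⟩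
      p * q * ∑∑ (λ i j → (𝐞 i a + 𝐞 j a) * c + fromℕ 12 + (𝐞 i b + 𝐞 j b) * (fromℕ 6 * (v ^ 2 * p)))
        ≈⟨ *-congˡ (trans (∑∑-+ _ _) (+-cong (trans (∑∑-+ _ _) (+-cong (∑∑-incidence a c) (∑∑-const n _))) (∑∑-incidence b _))) ⟩
      p * q * (fromℕ 2 * v * c + v ^ 2 * fromℕ 12 + fromℕ 2 * v * (fromℕ 6 * (v ^ 2 * p)))
        ≤⟨ ≤-fromDifference
             (p * p * (fromℕ 36 * (v ^ 3 * p) + fromℕ 96 * v + fromℕ 12 * v ^ 2) + fromℕ 72 * (v ^ 3 * p ^ 2) + fromℕ 96 * (v * p * (v - 1#)))
             (0≤-+ (0≤-+ (0≤-* (0≤-* 0≤p 0≤p) (0≤-+ (0≤-+ (0≤-* (0≤fromℕ 36) (0≤-* (0≤-^ 3 (0≤fromℕ n)) 0≤p)) (0≤-* (0≤fromℕ 96) (0≤fromℕ n))) (0≤-* (0≤fromℕ 12) (0≤x² v))))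
               (0≤-* (0≤fromℕ 72) (0≤ν^p {n} 3 2))) (0≤-* (0≤fromℕ 96) (0≤-* (0≤-* (0≤fromℕ n) 0≤p) (x≤y⇒0≤y-x (1≤ν a)))))
             (solve 2 (λ v p → p :* (:1 :- p) :* (:2 :* v :* (con (ℤ.+ 12) :* (v :^ 2 :* p) :+ con (ℤ.+ 48)) :+ v :^ 2 :* con (ℤ.+ 12) :+ :2 :* v :* (con (ℤ.+ 6) :* (v :^ 2 :* p)))
               :+ (p :* p :* (con (ℤ.+ 36) :* (v :^ 3 :* p) :+ con (ℤ.+ 96) :* v :+ con (ℤ.+ 12) :* v :^ 2) :+ con (ℤ.+ 72) :* (v :^ 3 :* p :^ 2) :+ con (ℤ.+ 96) :* (v :* p :* (v :- :1)))
               := con (ℤ.+ 108) :* (v :^ 3 :* p :^ 2 :+ v :^ 2 :* p)) v p) ⟩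
      fromℕ 108 * Γ n ∎
      where
      open ≤-Reasoning
      v c : ℝ
      v = ν n
      c = fromℕ 12 * (v ^ 2 * p) + fromℕ 48

    -- There are n - 2 nodes away from i and j; the formula fails for i ≡ j.
    away-linear : ∀ {n} {i j : Fin n} → i ≢ j → ∀ k → away i j k ≈ 1# - 𝐞 i k - 𝐞 j k
    away-linear {i = i} {j} i≢j k with i ≟ k | j ≟ k
    ... | yes ≡.refl | yes ≡.refl = ⊥-elim (i≢j ≡.refl)
    ... | yes _ | no _ = solve 0 ((:1 :- :1) :* (:1 :- :0) := :1 :- :1 :- :0)
    ... | no _ | yes _ = solve 0 ((:1 :- :0) :* (:1 :- :1) := :1 :- :0 :- :1)
    ... | no _ | no _ = solve 0 ((:1 :- :0) :* (:1 :- :0) := :1 :- :0 :- :0)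

    away-idem : ∀ {n} (i j k : Fin n) → away i j k * away i j k ≈ away i j k
    away-idem i j k with does (i ≟ k) | does (j ≟ k)
    ... | true  | true  = solve 0 ((:1 :- :1) :* (:1 :- :1) :* ((:1 :- :1) :* (:1 :- :1)) := (:1 :- :1) :* (:1 :- :1))
    ... | true  | false = solve 0 ((:1 :- :1) :* (:1 :- :0) :* ((:1 :- :1) :* (:1 :- :0)) := (:1 :- :1) :* (:1 :- :0))
    ... | false | true  = solve 0 ((:1 :- :0) :* (:1 :- :1) :* ((:1 :- :0) :* (:1 :- :1)) := (:1 :- :0) :* (:1 :- :1))
    ... | false | false = solve 0 ((:1 :- :0) :* (:1 :- :0) :* ((:1 :- :0) :* (:1 :- :0)) := (:1 :- :0) :* (:1 :- :0))

    ∑-away : ∀ {n} {i j : Fin n} → i ≢ j → ∑ (away i j) ≈ ν n - fromℕ 2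
    ∑-away {n} {i} {j} i≢j = begin
      ∑ (away i j)                          ≈⟨ ∑-cong (away-linear i≢j) ⟩
      ∑ (λ k → 1# - 𝐞 i k - 𝐞 j k)          ≈⟨ trans (∑-sub _ _) (+-cong (trans (∑-sub _ _) (+-cong (∑-const n 1#) (-‿cong (∑-𝐞 i)))) (-‿cong (∑-𝐞 j))) ⟩
      ν n * 1# - 1# - 1#                    ≈⟨ solve 1 (λ v → v :* :1 :- :1 :- :1 := v :- :2) (ν n) ⟩
      ν n - fromℕ 2 ∎
      where open ≈-Reasoning

    ∑-away-except : ∀ {n} {i j : Fin n} → i ≢ j → ∀ k → ∑ (λ l → away i j l * (1# - 𝐞 k l)) ≈ ν n - fromℕ 2 - away i j k
    ∑-away-except {n} {i} {j} i≢j k = trans (∑-cong (λ l → solve 2 (λ a e → a :* (:1 :- e) := a :- e :* a) (away i j l) (𝐞 k l)))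
      (trans (∑-sub _ _) (+-cong (∑-away i≢j) (-‿cong (∑-𝐞ˡ k (away i j)))))

    𝐄-w-term : ∀ {n} {i j : Fin n} → i ≢ j → ∀ k l →
      𝐄 (λ G → away i j k * away i j l * (x G i k * (x G k l * x G l j))) ≈ p ^ 3 * (away i j k * (away i j l * (1# - 𝐞 k l)))
    𝐄-w-term {n} {i} {j} i≢j k l = trans (𝐄-* _ _) (by-cases (i ≟ k) (j ≟ k) (i ≟ l) (j ≟ l) (k ≟ l))
      where
      E : ℝ
      E = 𝐄 (λ G → x G i k * (x G k l * x G l j))
      away-i : ∀ {k} → i ≡ k → away i j k ≈ 0#
      away-i {k} ≡.refl = trans (*-congʳ (trans (+-congˡ (-‿cong (reflexive (𝐞-≡ i)))) (-‿inverseʳ 1#))) (zeroˡ _)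
      away-j : ∀ {k} → j ≡ k → away i j k ≈ 0#
      away-j {k} ≡.refl = trans (*-congˡ (trans (+-congˡ (-‿cong (reflexive (𝐞-≡ j)))) (-‿inverseʳ 1#))) (zeroʳ _)
      zero-k : away i j k ≈ 0# → away i j k * away i j l * E ≈ p ^ 3 * (away i j k * (away i j l * (1# - 𝐞 k l)))
      zero-k e = trans (*-congʳ (*-congʳ e)) (trans (solve 4 (λ a b c d → :0 :* a :* b := c :^ 3 :* (:0 :* d)) _ _ p _) (*-congˡ (*-congʳ (sym e))))
      zero-l : away i j l ≈ 0# → away i j k * away i j l * E ≈ p ^ 3 * (away i j k * (away i j l * (1# - 𝐞 k l)))
      zero-l e = trans (*-congʳ (*-congˡ e)) (trans (solve 4 (λ a b c d → a :* :0 :* b := c :^ 3 :* (a :* (:0 :* d))) (away i j k) _ p _) (*-congˡ (*-congˡ (*-congʳ (sym e)))))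
      by-cases : Dec (i ≡ k) → Dec (j ≡ k) → Dec (i ≡ l) → Dec (j ≡ l) → Dec (k ≡ l) →
        away i j k * away i j l * E ≈ p ^ 3 * (away i j k * (away i j l * (1# - 𝐞 k l)))
      by-cases (yes e) _ _ _ _ = zero-k (away-i e)
      by-cases (no _) (yes e) _ _ _ = zero-k (away-j e)
      by-cases (no _) (no _) (yes e) _ _ = zero-l (away-i e)
      by-cases (no _) (no _) (no _) (yes e) _ = zero-l (away-j e)
      by-cases (no _) (no _) (no _) (no _) (yes ≡.refl) =
        trans (*-congˡ (trans (𝐄-cong (λ G → trans (*-congˡ (trans (*-congʳ (x-diag G k)) (zeroˡ _))) (zeroʳ _))) (𝐄-const {n} 0#)))
          (trans (solve 3 (λ a b c → a :* b :* :0 := c :^ 3 :* (a :* (b :* (:1 :- :1)))) (away i j k) (away i j k) p)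
            (*-congˡ (*-congˡ (*-congˡ (+-congˡ (-‿cong (sym (reflexive (𝐞-≡ k)))))))))
      by-cases (no i≢k) (no j≢k) (no i≢l) (no j≢l) (no k≢l) =
        trans (*-congˡ (𝐄-xxx i≢k k≢l (j≢l ∘ ≡.sym)
          (λ { (inj₁ (k≡i , _)) → i≢k (≡.sym k≡i) ; (inj₂ (_ , l≡i)) → i≢l (≡.sym l≡i) })
          (λ { (inj₁ (l≡i , _)) → i≢l (≡.sym l≡i) ; (inj₂ (l≡k , _)) → k≢l (≡.sym l≡k) })
          (λ { (inj₁ (l≡k , _)) → k≢l (≡.sym l≡k) ; (inj₂ (_ , j≡k)) → j≢k j≡k })))
        (trans (solve 3 (λ a b p → a :* b :* (p :* (p :* p)) := p :^ 3 :* (a :* (b :* (:1 :- :0)))) _ _ p)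
          (*-congˡ (*-congˡ (*-congˡ (+-congˡ (-‿cong (sym (reflexive (𝐞-≢ k≢l)))))))))

    𝐄-w : ∀ {n} {i j : Fin n} → i ≢ j → 𝐄 (λ G → w G i j) ≈ p ^ 3 * ((ν n - fromℕ 2) * (ν n - fromℕ 3))
    𝐄-w {n} {i} {j} i≢j = begin
      𝐄 (λ G → w G i j)
        ≈⟨ trans (𝐄-∑ _) (∑-cong (λ k → 𝐄-∑ _)) ⟩
      ∑∑ (λ k l → 𝐄 (λ G → away i j k * away i j l * (x G i k * (x G k l * x G l j))))
        ≈⟨ trans (∑∑-cong (𝐄-w-term i≢j)) (∑∑-*ˡ (p ^ 3) _) ⟩
      p ^ 3 * ∑∑ (λ k l → away i j k * (away i j l * (1# - 𝐞 k l)))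
        ≈⟨ *-congˡ (∑-cong (λ k → trans (∑-*ˡ (away i j k) _) (trans (*-congˡ (∑-away-except i≢j k))
             (trans (solve 2 (λ a v → a :* (v :- :2 :- a) := a :* (v :- :2) :- a :* a) (away i j k) (ν n)) (+-congˡ (-‿cong (away-idem i j k))))))) ⟩
      p ^ 3 * ∑ (λ k → away i j k * (ν n - fromℕ 2) - away i j k)
        ≈⟨ *-congˡ (trans (∑-sub _ _) (+-cong (trans (∑-*ʳ _ _) (*-congʳ (∑-away i≢j))) (-‿cong (∑-away i≢j)))) ⟩
      p ^ 3 * ((ν n - fromℕ 2) * (ν n - fromℕ 2) - (ν n - fromℕ 2))
        ≈⟨ solve 2 (λ p v → p :^ 3 :* ((v :- :2) :* (v :- :2) :- (v :- :2)) := p :^ 3 :* ((v :- :2) :* (v :- con (ℤ.+ 3)))) p (ν n) ⟩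
      p ^ 3 * ((ν n - fromℕ 2) * (ν n - fromℕ 3)) ∎
      where open ≈-Reasoning

    𝐄-w-deviation : ∀ {n} {i j : Fin n} → i ≢ j → 𝐄 (λ G → (w G i j - ν n ^ 2 * p ^ 3) ^ 2) ≤ fromℕ 133 * Γ n
    𝐄-w-deviation {n} {i} {j} i≢j = begin
      𝐄 (λ G → (w G i j - v ^ 2 * p ^ 3) ^ 2)
        ≈⟨ trans (𝐄-square _ _) (+-congˡ (^-cong 2 (+-congʳ (𝐄-w i≢j)))) ⟩
      Var (λ G → w G i j) + (p ^ 3 * ((v - fromℕ 2) * (v - fromℕ 3)) - v ^ 2 * p ^ 3) ^ 2
        ≤⟨ +-mono-≤ (Var-w≤ i j) (≤-trans
             (≤-fromDifference (p ^ 6 * (fromℕ 60 * (v - 1#) + fromℕ 24))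
               (0≤-* (0≤-^ 6 0≤p) (0≤-+ (0≤-* (0≤fromℕ 60) (x≤y⇒0≤y-x (1≤ν i))) (0≤fromℕ 24)))
               (solve 2 (λ v p → (p :^ 3 :* ((v :- :2) :* (v :- con (ℤ.+ 3))) :- v :^ 2 :* p :^ 3) :^ 2 :+ p :^ 6 :* (con (ℤ.+ 60) :* (v :- :1) :+ con (ℤ.+ 24))
                 := con (ℤ.+ 25) :* (v :^ 2 :* p :^ 6)) v p))
             (*-monoˡ-≤ (0≤fromℕ 25) (*-monoˡ-≤ (0≤x² v) (p^≤p 5)))) ⟩
      fromℕ 108 * Γ n + fromℕ 25 * (v ^ 2 * p)
        ≤⟨ +-mono-≤ ≤-refl (*-monoˡ-≤ (0≤fromℕ 25) (ν²p≤Γ {n})) ⟩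
      fromℕ 108 * Γ n + fromℕ 25 * Γ n
        ≈⟨ solve 1 (λ g → con (ℤ.+ 108) :* g :+ con (ℤ.+ 25) :* g := con (ℤ.+ 133) :* g) (Γ n) ⟩
      fromℕ 133 * Γ n ∎
      where
      open ≤-Reasoning
      v : ℝ
      v = ν n

    sq-sum₄-≤ : ∀ x y z w → (x + y + z + w) ^ 2 ≤ fromℕ 4 * (x ^ 2 + y ^ 2 + z ^ 2 + w ^ 2)
    sq-sum₄-≤ x y z w = ≤-fromDifference
      ((x - y) ^ 2 + (x - z) ^ 2 + (x - w) ^ 2 + (y - z) ^ 2 + (y - w) ^ 2 + (z - w) ^ 2)
      (0≤-+ (0≤-+ (0≤-+ (0≤-+ (0≤-+ (0≤x² _) (0≤x² _)) (0≤x² _)) (0≤x² _)) (0≤x² _)) (0≤x² _))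
      (solve 4 (λ x y z w → (x :+ y :+ z :+ w) :^ 2
        :+ ((x :- y) :^ 2 :+ (x :- z) :^ 2 :+ (x :- w) :^ 2 :+ (y :- z) :^ 2 :+ (y :- w) :^ 2 :+ (z :- w) :^ 2)
        := :4 :* (x :^ 2 :+ y :^ 2 :+ z :^ 2 :+ w :^ 2)) x y z w)

    𝐄-D-Y²≤ : ∀ {n} {i j : Fin n} → i ≢ j → 𝐄 (λ G → D i j Y G ^ 2) ≤
      fromℕ 2 * (fromℕ 4 * (ν n ^ 2 * p) - fromℕ 8 * (ν n ^ 2 * p ^ 3)) ^ 2 + fromℕ 2 * (C₁ * Γ n)
    𝐄-D-Y²≤ {n} {i} {j} i≢j = begin
      𝐄 (λ G → D i j Y G ^ 2)
        ≤⟨ 𝐄-mono pointwise ⟩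
      𝐄 (λ G → fromℕ 2 * α ^ 2 + fromℕ 2 * (fromℕ 4 * (fromℕ 16 * M G + fromℕ 16 * d G i ^ 2 + fromℕ 16 * d G j ^ 2 + fromℕ 64 * W G)))
        ≈⟨ trans (𝐄-+ _ _) (+-cong (𝐄-const {n} _) (trans (𝐄-* _ _) (*-congˡ (trans (𝐄-* _ _) (*-congˡ
             (trans (𝐄-+ _ _) (+-cong (trans (𝐄-+ _ _) (+-cong (trans (𝐄-+ _ _) (+-cong (𝐄-* _ _) (𝐄-* _ _))) (𝐄-* _ _))) (𝐄-* _ _)))))))) ⟩
      fromℕ 2 * α ^ 2 + fromℕ 2 * (fromℕ 4 * (fromℕ 16 * 𝐄 M + fromℕ 16 * 𝐄 (λ G → d G i ^ 2) + fromℕ 16 * 𝐄 (λ G → d G j ^ 2) + fromℕ 64 * 𝐄 W))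
        ≤⟨ +-mono-≤ ≤-refl (*-monoˡ-≤ (0≤fromℕ 2) (*-monoˡ-≤ (0≤fromℕ 4)
             (+-mono-≤ (+-mono-≤ (+-mono-≤ (*-monoˡ-≤ (0≤fromℕ 16) 𝐄-m-deviation) (*-monoˡ-≤ (0≤fromℕ 16) (≤-trans (𝐄-d²≤ν²p i) (ν²p≤Γ {n}))))
               (*-monoˡ-≤ (0≤fromℕ 16) (≤-trans (𝐄-d²≤ν²p j) (ν²p≤Γ {n})))) (*-monoˡ-≤ (0≤fromℕ 64) (𝐄-w-deviation i≢j))))) ⟩
      fromℕ 2 * α ^ 2 + fromℕ 2 * (fromℕ 4 * (fromℕ 16 * (fromℕ 4 * Γ n) + fromℕ 16 * Γ n + fromℕ 16 * Γ n + fromℕ 64 * (fromℕ 133 * Γ n)))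
        ≈⟨ +-congˡ (*-congˡ (solve 5 (λ a b c e g → a :* (b :* (a :* g) :+ b :* g :+ b :* g :+ c :* (e :* g)) := a :* (b :* a :+ b :+ b :+ c :* e) :* g) (fromℕ 4) (fromℕ 16) (fromℕ 64) (fromℕ 133) (Γ n))) ⟩
      fromℕ 2 * α ^ 2 + fromℕ 2 * (C₁ * Γ n) ∎
      where
      open ≤-Reasoning
      v α : ℝ
      v = ν n
      α = fromℕ 4 * (v ^ 2 * p) - fromℕ 8 * (v ^ 2 * p ^ 3)
      M W : Graph n → ℝ
      M G = (m G - v ^ 2 * p) ^ 2
      W G = (w G i j - v ^ 2 * p ^ 3) ^ 2
      pointwise : ∀ G → D i j Y G ^ 2 ≤ fromℕ 2 * α ^ 2 +
        fromℕ 2 * (fromℕ 4 * (fromℕ 16 * M G + fromℕ 16 * d G i ^ 2 + fromℕ 16 * d G j ^ 2 + fromℕ 64 * W G))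
      pointwise G = begin
        D i j Y G ^ 2
          ≈⟨ ^-cong 2 (trans (Perturb.D-Y G i≢j) (solve 6 (λ m a b w v p → :4 :* (m :- a :- b) :- :8 :* w :=
               (:4 :* (v :* p) :- :8 :* (v :* p :^ 3)) :+ (:4 :* (m :- v :* p) :+ :- (:4 :* a) :+ :- (:4 :* b) :+ :- (:8 :* (w :- v :* p :^ 3)))) (m G) (d G i) (d G j) (w G i j) (v ^ 2) p)) ⟩
        (α + (fromℕ 4 * (m G - v ^ 2 * p) + - (fromℕ 4 * d G i) + - (fromℕ 4 * d G j) + - (fromℕ 8 * (w G i j - v ^ 2 * p ^ 3)))) ^ 2
          ≤⟨ sq-+-≤ _ _ ⟩
        fromℕ 2 * (α ^ 2 + (fromℕ 4 * (m G - v ^ 2 * p) + - (fromℕ 4 * d G i) + - (fromℕ 4 * d G j) + - (fromℕ 8 * (w G i j - v ^ 2 * p ^ 3))) ^ 2)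
          ≤⟨ *-monoˡ-≤ (0≤fromℕ 2) (+-mono-≤ ≤-refl (sq-sum₄-≤ _ _ _ _)) ⟩
        fromℕ 2 * (α ^ 2 + fromℕ 4 * ((fromℕ 4 * (m G - v ^ 2 * p)) ^ 2 + (- (fromℕ 4 * d G i)) ^ 2 + (- (fromℕ 4 * d G j)) ^ 2 + (- (fromℕ 8 * (w G i j - v ^ 2 * p ^ 3))) ^ 2))
          ≈⟨ solve 5 (λ al x y z u → :2 :* (al :^ 2 :+ :4 :* ((:4 :* x) :^ 2 :+ (:- (:4 :* y)) :^ 2 :+ (:- (:4 :* z)) :^ 2 :+ (:- (:8 :* u)) :^ 2))
               := :2 :* al :^ 2 :+ :2 :* (:4 :* (con (ℤ.+ 16) :* x :^ 2 :+ con (ℤ.+ 16) :* y :^ 2 :+ con (ℤ.+ 16) :* z :^ 2 :+ con (ℤ.+ 64) :* u :^ 2))) α _ _ _ _ ⟩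
        fromℕ 2 * α ^ 2 + fromℕ 2 * (fromℕ 4 * (fromℕ 16 * M G + fromℕ 16 * d G i ^ 2 + fromℕ 16 * d G j ^ 2 + fromℕ 64 * W G)) ∎

    Var-Y≤ : ∀ {n} → Var (Y {n}) ≤ p * q * (ν n ^ 2 *
      (fromℕ 2 * (fromℕ 4 * (ν n ^ 2 * p) - fromℕ 8 * (ν n ^ 2 * p ^ 3)) ^ 2 + fromℕ 2 * (C₁ * Γ n)))
    Var-Y≤ {n} = efronStein-≤ Y _ (λ i j i≢j → 𝐄-D-Y²≤ i≢j)
      (0≤-+ (0≤-* (0≤fromℕ 2) (0≤x² _)) (0≤-* (0≤fromℕ 2) (0≤-* 0≤C₁ (0≤Γ {n}))))

    Cov-m : ∀ {n} (f : Graph n → ℝ) → Cov f m ≈ p * q * ∑∑ (λ i j → 𝐄 (D i j f))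
    Cov-m {n} f = begin
      𝐄 (λ G → f G * m G) - 𝐄 f * 𝐄 m
        ≈⟨ +-cong (trans (𝐄-cong (λ G → sym (trans (∑-cong (λ i → ∑-*ˡ (f G) _)) (∑-*ˡ (f G) _)))) (trans (𝐄-∑ _) (∑-cong (λ i → 𝐄-∑ _))))
             (-‿cong (trans (*-congˡ (trans (𝐄-∑ _) (∑-cong (λ i → 𝐄-∑ _)))) (sym (trans (∑-cong (λ i → ∑-*ˡ (𝐄 f) _)) (∑-*ˡ (𝐄 f) _))))) ⟩
      ∑∑ (λ i j → 𝐄 (λ G → f G * x G i j)) - ∑∑ (λ i j → 𝐄 f * 𝐄 (λ G → x G i j))
        ≈⟨ sym (trans (∑-cong (λ i → ∑-sub _ _)) (∑-sub _ _)) ⟩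
      ∑∑ (λ i j → 𝐄 (λ G → f G * x G i j) - 𝐄 f * 𝐄 (λ G → x G i j))
        ≈⟨ trans (∑∑-cong term) (∑∑-*ˡ (p * q) _) ⟩
      p * q * ∑∑ (λ i j → 𝐄 (D i j f)) ∎
      where
      open ≈-Reasoning
      term : ∀ i j → 𝐄 (λ G → f G * x G i j) - 𝐄 f * 𝐄 (λ G → x G i j) ≈ p * q * 𝐄 (D i j f)
      term i j with i ≟ j
      ... | yes ≡.refl = trans (+-cong (trans (𝐄-cong (λ G → trans (*-congˡ (x-diag G i)) (zeroʳ _))) (𝐄-const {n} 0#)) (-‿cong (*-congˡ (𝐄-x-loop i))))
          (trans (solve 2 (λ e c → :0 :- e :* :0 := c :* :0) (𝐄 f) (p * q))
            (*-congˡ (sym (trans (𝐄-cong (D-loop i f)) (𝐄-const {n} 0#)))))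
      ... | no i≢j = trans (+-congˡ (-‿cong (trans (*-congˡ (𝐄-x i≢j)) (trans (*-comm _ _) (sym (𝐄-* p f))))))
          (trans (sym (𝐄-sub _ _)) (trans (𝐄-cong (λ G → solve 3 (λ f x p → f :* x :- p :* f := (x :- p) :* f) (f G) (x G i j) p))
            (integrationByParts i j f i≢j)))

    ∑∑-offDiagonal : ∀ {n} (f : Matrix n) c → (∀ i → f i i ≈ 0#) → (∀ i j → i ≢ j → f i j ≈ c) →
      ∑∑ f ≈ (ν n ^ 2 - ν n) * c
    ∑∑-offDiagonal {n} f c diagonal other = begin
      ∑∑ f                                 ≈⟨ ∑∑-cong term ⟩
      ∑∑ (λ i j → c - 𝐞 i j * c)           ≈⟨ ∑-cong (λ i → trans (∑-sub _ _) (+-cong (∑-const n c) (-‿cong (∑-𝐞ˡ i (λ _ → c))))) ⟩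
      ∑ {n} (λ i → ν n * c - c)                ≈⟨ ∑-const n _ ⟩
      ν n * (ν n * c - c)                  ≈⟨ solve 2 (λ v c → v :* (v :* c :- c) := (v :^ 2 :- v) :* c) (ν n) c ⟩
      (ν n ^ 2 - ν n) * c                  ∎
      where
      open ≈-Reasoning
      term : ∀ i j → f i j ≈ c - 𝐞 i j * c
      term i j with i ≟ j
      ... | yes ≡.refl = trans (diagonal i) (solve 1 (λ c → :0 := c :- :1 :* c) c)
      ... | no i≢j = trans (other i j i≢j) (solve 1 (λ c → c := c :- :0 :* c) c)

    𝐄-D-loop : ∀ {n} (i : Fin n) f → 𝐄 (D i i f) ≈ 0#
    𝐄-D-loop {n} i f = trans (𝐄-cong (D-loop i f)) (𝐄-const {n} 0#)

    Var≈Cov : ∀ {n} (f : Graph n → ℝ) → Var f ≈ Cov f f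
    Var≈Cov f = +-cong (𝐄-cong (λ G → sq≈* (f G))) (-‿cong (sq≈* (𝐄 f)))

    Var-m : ∀ {n} → Var (m {n}) ≈ p * q * ((ν n ^ 2 - ν n) * fromℕ 2)
    Var-m {n} = trans (Var≈Cov m) (trans (Cov-m m) (*-congˡ (∑∑-offDiagonal _ (fromℕ 2) (λ i → 𝐄-D-loop i m)
      (λ i j i≢j → trans (𝐄-cong (λ G → Perturb.D-m G i≢j)) (𝐄-const {n} _)))))

    meanSlope : ℕ → ℝ
    meanSlope n = fromℕ 4 * p * ((ν n - fromℕ 2) * (ν n - 1# - fromℕ 2 * ((ν n - fromℕ 3) * p ^ 2)))

    𝐄-D-Y : ∀ {n} {i j : Fin n} → i ≢ j → 𝐄 (D i j Y) ≈ meanSlope n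
    𝐄-D-Y {n} {i} {j} i≢j = begin
      𝐄 (D i j Y)
        ≈⟨ 𝐄-cong (λ G → Perturb.D-Y G i≢j) ⟩
      𝐄 (λ G → fromℕ 4 * (m G - d G i - d G j) - fromℕ 8 * w G i j)
        ≈⟨ trans (𝐄-sub _ _) (+-cong (trans (𝐄-* _ _) (*-congˡ (trans (𝐄-sub _ _) (+-cong (trans (𝐄-sub _ _) (+-cong 𝐄-m (-‿cong (𝐄-d i)))) (-‿cong (𝐄-d j))))))
             (-‿cong (trans (𝐄-* _ _) (*-congˡ (𝐄-w i≢j))))) ⟩
      fromℕ 4 * (v * (p * (v - 1#)) - p * (v - 1#) - p * (v - 1#)) - fromℕ 8 * (p ^ 3 * ((v - fromℕ 2) * (v - fromℕ 3)))
        ≈⟨ solve 2 (λ v p → :4 :* (v :* (p :* (v :- :1)) :- p :* (v :- :1) :- p :* (v :- :1)) :- :8 :* (p :^ 3 :* ((v :- :2) :* (v :- con (ℤ.+ 3))))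
             := :4 :* p :* ((v :- :2) :* (v :- :1 :- :2 :* ((v :- con (ℤ.+ 3)) :* p :^ 2)))) v p ⟩
      meanSlope n ∎
      where
      open ≈-Reasoning
      v : ℝ
      v = ν n

    Cov-Y-m : ∀ {n} → Cov (Y {n}) m ≈ p * q * ((ν n ^ 2 - ν n) * meanSlope n)
    Cov-Y-m {n} = trans (Cov-m Y) (*-congˡ (∑∑-offDiagonal _ _ (λ i → 𝐄-D-loop i Y) (λ i j → 𝐄-D-Y)))

    Cov-*ˡ : ∀ {n} c (f g : Graph n → ℝ) → Cov (λ G → c * f G) g ≈ c * Cov f g
    Cov-*ˡ c f g = trans (+-cong (trans (𝐄-cong (λ G → *-assoc c (f G) (g G))) (𝐄-* c _)) (-‿cong (*-congʳ (𝐄-* c f))))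
      (solve 4 (λ c a b e → c :* a :- c :* b :* e := c :* (a :- b :* e)) c _ (𝐄 f) (𝐄 g))

    Var-Y≥-linear : ∀ {n} → p * q * ((ν n ^ 2 - ν n) * meanSlope n ^ 2) ≤ fromℕ 2 * Var (Y {n})
    Var-Y≥-linear {n} = *-cancelˡ-≤ (0<fromℕ 1) (≤-trans (≤-reflexive (begin
      fromℕ 2 * (p * q * (N * A ^ 2))
        ≈⟨ solve 3 (λ c N A → :2 :* (c :* (N :* A :^ 2)) := :2 :* A :* (:2 :* (c :* (N :* A))) :- A :^ 2 :* (c :* (N :* :2))) (p * q) N A ⟩
      fromℕ 2 * A * (fromℕ 2 * (p * q * (N * A))) - A ^ 2 * (p * q * (N * fromℕ 2))
        ≈⟨ +-cong (*-congˡ (trans (Cov-*ˡ (fromℕ 2) Y m) (*-congˡ Cov-Y-m))) (-‿cong (*-congˡ Var-m)) ⟨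
      fromℕ 2 * A * Cov (λ G → fromℕ 2 * Y G) m - A ^ 2 * Var m ∎))
      (≤-trans (Var-≥-Cov (λ G → fromℕ 2 * Y G) m A)
        (≤-reflexive (trans (Var-* (fromℕ 2) Y) (solve 1 (λ y → :2 :^ 2 :* y := :2 :* (:2 :* y)) (Var Y))))))
      where
      open ≈-Reasoning
      N A : ℝ
      N = ν n ^ 2 - ν n
      A = meanSlope n

    y : ∀ {n} → Graph n → Matrix n
    y G i j = x G i j - p

    y-set-different : ∀ {n} (G : Graph n) {i j} b {k l} → ¬ SameEdge i j k l → y (setEdge i j b G) k l ≈ y G k l
    y-set-different G b h = +-congʳ (x-set-different G b h)

    D-y* : ∀ {n} {i j k l : Fin n} → ¬ SameEdge i j k l → (f : Graph n → ℝ) → ∀ G →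
      D i j (λ G → y G k l * f G) G ≈ y G k l * D i j f G
    D-y* h f G = trans (+-cong (*-congʳ (y-set-different G true h)) (-‿cong (*-congʳ (y-set-different G false h))))
      (solve 3 (λ y a b → y :* a :- y :* b := y :* (a :- b)) _ _ _)

    𝐄-y*-independent : ∀ {n} {i j : Fin n} → i ≢ j → (f : Graph n → ℝ) → (∀ b G → f (setEdge i j b G) ≈ f G) →
      𝐄 (λ G → y G i j * f G) ≈ 0#
    𝐄-y*-independent {n} {i} {j} i≢j f h = trans (integrationByParts i j f i≢j) (trans (*-congˡ (trans
      (𝐄-cong (λ G → trans (+-cong (h true G) (-‿cong (h false G))) (-‿inverseʳ (f G)))) (𝐄-const {n} 0#))) (zeroʳ _))

    -- x² = x turns y² into (1 - 2p) y + p q.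
    𝐄-y²* : ∀ {n} {i j : Fin n} → i ≢ j → (f : Graph n → ℝ) → (∀ b G → f (setEdge i j b G) ≈ f G) →
      𝐄 (λ G → y G i j * (y G i j * f G)) ≈ p * q * 𝐄 f
    𝐄-y²* {n} {i} {j} i≢j f h = begin
      𝐄 (λ G → y G i j * (y G i j * f G))
        ≈⟨ 𝐄-cong (λ G → trans (solve 3 (λ x p f → (x :- p) :* ((x :- p) :* f) := (x :* x :- :2 :* p :* x :+ p :* p) :* f) (x G i j) p (f G))
             (trans (*-congʳ (+-congʳ (+-congʳ (x-idem G i j))))
               (solve 3 (λ x p f → (x :- :2 :* p :* x :+ p :* p) :* f := (:1 :- :2 :* p) :* ((x :- p) :* f) :+ p :* (:1 :- p) :* f) (x G i j) p (f G)))) ⟩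
      𝐄 (λ G → (1# - fromℕ 2 * p) * (y G i j * f G) + p * q * f G)
        ≈⟨ trans (𝐄-+ _ _) (+-cong (trans (𝐄-* _ _) (*-congˡ (𝐄-y*-independent i≢j f h))) (𝐄-* _ _)) ⟩
      (1# - fromℕ 2 * p) * 0# + p * q * 𝐄 f
        ≈⟨ solve 2 (λ a b → a :* :0 :+ b := b) _ _ ⟩
      p * q * 𝐄 f ∎
      where open ≈-Reasoning

    𝐄-y² : ∀ {n} {i j : Fin n} → i ≢ j → 𝐄 (λ G → y G i j * y G i j) ≈ p * q
    𝐄-y² {n} {i} {j} i≢j = trans (𝐄-cong (λ G → *-congˡ (sym (*-identityʳ (y G i j)))))
      (trans (𝐄-y²* i≢j (λ _ → 1#) (λ _ _ → refl)) (trans (*-congˡ (𝐄-const {n} 1#)) (*-identityʳ _)))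

    κ : ∀ {n} → Fin n → Fin n → Fin n → ℝ
    κ i j k = (1# - 𝐞 i j) * away i j k

    Distinct : ∀ {n} → Fin n → Fin n → Fin n → Set
    Distinct i j k = i ≢ j × i ≢ k × j ≢ k

    κ-cases : ∀ {n} (i j k : Fin n) → (κ i j k ≈ 0#) ⊎ (Distinct i j k × κ i j k ≈ 1#)
    κ-cases i j k with i ≟ j | i ≟ k | j ≟ k
    ... | yes _ | _ | _ = inj₁ (trans (*-congʳ (-‿inverseʳ 1#)) (zeroˡ _))
    ... | no _ | yes _ | _ = inj₁ (trans (*-congˡ (trans (*-congʳ (-‿inverseʳ 1#)) (zeroˡ _))) (zeroʳ _))
    ... | no _ | no _ | yes _ = inj₁ (trans (*-congˡ (trans (*-congˡ (-‿inverseʳ 1#)) (zeroʳ _))) (zeroʳ _))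
    ... | no i≢j | no i≢k | no j≢k = inj₂ ((i≢j , i≢k , j≢k) ,
      solve 0 ((:1 :- :0) :* ((:1 :- :0) :* (:1 :- :0)) := :1))

    0≤κ : ∀ {n} (i j k : Fin n) → 0# ≤ κ i j k
    0≤κ i j k with κ-cases i j k
    ... | inj₁ e = ≤-reflexive (sym e)
    ... | inj₂ (_ , e) = ≤-trans 0≤1 (≤-reflexive (sym e))

    κ≤1 : ∀ {n} (i j k : Fin n) → κ i j k ≤ 1#
    κ≤1 i j k with κ-cases i j k
    ... | inj₁ e = ≤-trans (≤-reflexive e) 0≤1
    ... | inj₂ (_ , e) = ≤-reflexive e

    κ*≤ : ∀ {n} (i j k : Fin n) {a b} → (Distinct i j k → a ≤ b) → κ i j k * a ≤ κ i j k * b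
    κ*≤ i j k {a} {b} h with κ-cases i j k
    ... | inj₁ e = ≤-reflexive (trans (*-congʳ e) (trans (zeroˡ a) (sym (trans (*-congʳ e) (zeroˡ b)))))
    ... | inj₂ (distinct , _) = *-monoˡ-≤ (0≤κ i j k) (h distinct)

    ∑∑∑ : ∀ {n} → (Fin n → Fin n → Fin n → ℝ) → ℝ
    ∑∑∑ f = ∑ (λ i → ∑ (λ j → ∑ (λ k → f i j k)))

    ∑∑∑-mono : ∀ {n} {f g : Fin n → Fin n → Fin n → ℝ} → (∀ i j k → f i j k ≤ g i j k) → ∑∑∑ f ≤ ∑∑∑ g
    ∑∑∑-mono h = ∑-mono (λ i → ∑∑-mono (h i))

    𝐄-∑∑∑ : ∀ {n k} (f : Fin k → Fin k → Fin k → Graph n → ℝ) →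
      𝐄 (λ G → ∑∑∑ (λ a b c → f a b c G)) ≈ ∑∑∑ (λ a b c → 𝐄 (f a b c))
    𝐄-∑∑∑ f = trans (𝐄-∑ _) (∑-cong (λ a → trans (𝐄-∑ _) (∑-cong (λ b → 𝐄-∑ _))))

    ∑∑∑-cong : ∀ {n} {f g : Fin n → Fin n → Fin n → ℝ} → (∀ i j k → f i j k ≈ g i j k) → ∑∑∑ f ≈ ∑∑∑ g
    ∑∑∑-cong h = ∑-cong (λ i → ∑∑-cong (h i))

    ∑∑∑-*ʳ : ∀ {n} (f : Fin n → Fin n → Fin n → ℝ) c → ∑∑∑ (λ a b k → f a b k * c) ≈ ∑∑∑ f * c
    ∑∑∑-*ʳ f c = trans (∑-cong (λ a → trans (∑-cong (λ b → ∑-*ʳ _ c)) (∑-*ʳ _ c))) (∑-*ʳ _ c)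

    Z : ∀ {n} → Graph n → ℝ
    Z G = ∑∑∑ (λ i j k → κ i j k * (y G i j * y G i k))

    ∑∑∑-κ : ∀ {n} → ∑∑∑ (κ {n}) ≈ (ν n ^ 2 - ν n) * (ν n - fromℕ 2)
    ∑∑∑-κ {n} = trans (∑∑-cong (λ i j → ∑-*ˡ (1# - 𝐞 i j) (away i j)))
      (∑∑-offDiagonal _ _ (λ i → trans (*-congʳ (trans (+-congˡ (-‿cong (reflexive (𝐞-≡ i)))) (-‿inverseʳ 1#))) (zeroˡ _))
        (λ i j i≢j → trans (*-cong (trans (+-congˡ (-‿cong (reflexive (𝐞-≢ i≢j)))) (solve 0 (:1 :- :0 := :1))) (∑-away i≢j)) (*-identityˡ _)))

    𝐄-f*Z : ∀ {n} (f : Graph n → ℝ) → 𝐄 (λ G → f G * Z G) ≈ ∑∑∑ (λ i j k → κ i j k * 𝐄 (λ G → y G i j * (y G i k * f G)))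
    𝐄-f*Z f = trans (𝐄-cong (λ G → trans (*-comm (f G) (Z G)) (sym (∑∑∑-*ʳ _ (f G))))) (trans (𝐄-∑∑∑ _) (∑∑∑-cong (λ i j k →
      trans (𝐄-cong (λ G → solve 4 (λ a b c f → a :* (b :* c) :* f := a :* (b :* (c :* f))) (κ i j k) (y G i j) (y G i k) (f G))) (𝐄-* _ _))))

    𝐄-yyf : ∀ {n} {i j k : Fin n} → Distinct i j k → (f : Graph n → ℝ) →
      𝐄 (λ G → y G i j * (y G i k * f G)) ≈ (p * q) * (p * q) * 𝐄 (D i k (D i j f))
    𝐄-yyf {i = i} {j} {k} (i≢j , i≢k , j≢k) f = trans (integrationByParts i j _ i≢j) (trans (*-congˡ
      (trans (𝐄-cong (D-y* (SameEdge-star j≢k) f)) (integrationByParts i k (D i j f) i≢k))) (sym (*-assoc (p * q) (p * q) _)))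

    𝐄-Z : ∀ {n} → 𝐄 (Z {n}) ≈ 0#
    𝐄-Z {n} = trans (𝐄-∑∑∑ _) (∑-zero (λ i → ∑-zero (λ j → ∑-zero (λ k → trans (𝐄-* _ _) (term i j k)))))
      where
      term : ∀ i j k → κ i j k * 𝐄 (λ G → y G i j * y G i k) ≈ 0#
      term i j k with κ-cases i j k
      ... | inj₁ e = trans (*-congʳ e) (zeroˡ _)
      ... | inj₂ ((i≢j , i≢k , j≢k) , _) = trans (*-congˡ (𝐄-y*-independent i≢j _ (λ b G → y-set-different G b (SameEdge-star j≢k)))) (zeroʳ _)

    𝐄-D-D-Y≤ : ∀ {n} {i j k : Fin n} → Distinct i j k →
      𝐄 (D i k (D i j Y)) ≤ fromℕ 4 - fromℕ 8 * (p ^ 2 * (ν n - fromℕ 3))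
    𝐄-D-D-Y≤ {n} {i} {j} {k} (i≢j , i≢k , j≢k) = begin
      𝐄 (D i k (D i j Y))
        ≤⟨ 𝐄-mono pointwise ⟩
      𝐄 (λ G → fromℕ 4 - fromℕ 8 * ∑ (λ l → away i j l * (x G k l * x G l j)))
        ≈⟨ trans (𝐄-sub _ _) (+-cong (𝐄-const {n} _) (-‿cong (trans (𝐄-* _ _) (*-congˡ (trans (𝐄-∑ _) (∑-cong term)))))) ⟩
      fromℕ 4 - fromℕ 8 * ∑ (λ l → p ^ 2 * (away i j l * (1# - 𝐞 k l)))
        ≈⟨ +-congˡ (-‿cong (*-congˡ (trans (∑-*ˡ _ _) (*-congˡ (trans (∑-away-except i≢j k) (trans (+-congˡ (-‿cong away-k))
             (solve 1 (λ v → v :- :2 :- :1 := v :- con (ℤ.+ 3)) (ν n)))))))) ⟩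
      fromℕ 4 - fromℕ 8 * (p ^ 2 * (ν n - fromℕ 3)) ∎
      where
      open ≤-Reasoning
      away-k : away i j k ≈ 1#
      away-k = trans (*-cong (+-congˡ (-‿cong (reflexive (𝐞-≢ i≢k)))) (+-congˡ (-‿cong (reflexive (𝐞-≢ j≢k)))))
        (solve 0 ((:1 :- :0) :* (:1 :- :0) := :1))
      term : ∀ l → 𝐄 (λ G → away i j l * (x G k l * x G l j)) ≈ p ^ 2 * (away i j l * (1# - 𝐞 k l))
      term l with i ≟ l | j ≟ l | k ≟ l
      ... | yes _ | _ | _ = trans (𝐄-cong (λ G → trans (*-congʳ (trans (*-congʳ (-‿inverseʳ 1#)) (zeroˡ _))) (zeroˡ _)))
          (trans (𝐄-const {n} 0#) (solve 3 (λ p a b → :0 := p :^ 2 :* ((:1 :- :1) :* a :* b)) p _ _))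
      ... | no _ | yes _ | _ = trans (𝐄-cong (λ G → trans (*-congʳ (trans (*-congˡ (-‿inverseʳ 1#)) (zeroʳ _))) (zeroˡ _)))
          (trans (𝐄-const {n} 0#) (solve 3 (λ p a b → :0 := p :^ 2 :* (a :* (:1 :- :1) :* b)) p _ _))
      ... | no _ | no _ | yes ≡.refl = trans (𝐄-cong (λ G → trans (*-congˡ (trans (*-congʳ (x-diag G k)) (zeroˡ _))) (zeroʳ _)))
          (trans (𝐄-const {n} 0#) (solve 2 (λ p a → :0 := p :^ 2 :* (a :* (:1 :- :1))) p _))
      ... | no i≢l | no j≢l | no k≢l = trans (𝐄-* _ _) (trans (*-congˡ (𝐄-xx k≢l (j≢l ∘ ≡.sym)
            (λ { (inj₁ (l≡k , _)) → k≢l (≡.sym l≡k) ; (inj₂ (_ , j≡k)) → j≢k j≡k })))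
          (solve 2 (λ p a → a :* (p :* p) := p :^ 2 :* (a :* (:1 :- :0))) p _))
      pointwise : ∀ G → D i k (D i j Y) G ≤ fromℕ 4 - fromℕ 8 * ∑ (λ l → away i j l * (x G k l * x G l j))
      pointwise G = begin
        D i k (D i j Y) G
          ≈⟨ +-cong (Perturb.D-Y (setEdge i k true G) i≢j) (-‿cong (Perturb.D-Y (setEdge i k false G) i≢j)) ⟩
        fromℕ 4 * (m G⁺ - d G⁺ i - d G⁺ j) - fromℕ 8 * w G⁺ i j - (fromℕ 4 * (m G⁻ - d G⁻ i - d G⁻ j) - fromℕ 8 * w G⁻ i j)
          ≈⟨ solve 8 (λ m a b w m′ a′ b′ w′ → :4 :* (m :- a :- b) :- :8 :* w :- (:4 :* (m′ :- a′ :- b′) :- :8 :* w′)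
               := :4 :* ((m :- m′) :- (a :- a′) :- (b :- b′)) :- :8 :* (w :- w′)) _ _ _ _ _ _ _ _ ⟩
        fromℕ 4 * (D i k m G - D i k (λ G → d G i) G - D i k (λ G → d G j) G) - fromℕ 8 * Dw
          ≈⟨ +-congʳ (*-congˡ (+-cong (+-cong (Perturb.D-m G i≢k) (-‿cong (Perturb.D-d G i≢k i))) (-‿cong (Perturb.D-d G i≢k j)))) ⟩
        fromℕ 4 * (fromℕ 2 - (𝐞 i i + 𝐞 k i) - (𝐞 i j + 𝐞 k j)) - fromℕ 8 * Dw
          ≈⟨ +-congʳ (trans (*-congˡ (+-cong (+-congˡ (-‿cong (+-cong (reflexive (𝐞-≡ i)) (reflexive (𝐞-≢ (i≢k ∘ ≡.sym))))))
               (-‿cong (+-cong (reflexive (𝐞-≢ i≢j)) (reflexive (𝐞-≢ (j≢k ∘ ≡.sym)))))))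
               (solve 0 (:4 :* (:2 :- (:1 :+ :0) :- (:0 :+ :0)) := :4))) ⟩
        fromℕ 4 - fromℕ 8 * Dw
          ≤⟨ +-mono-≤ ≤-refl (neg-mono-≤ (*-monoˡ-≤ (0≤fromℕ 8) (Perturb.D-w≥ G i≢k (i≢j ∘ ≡.sym) j≢k))) ⟩
        fromℕ 4 - fromℕ 8 * ∑ (λ l → away i j l * (x G k l * x G l j)) ∎
        where
        G⁺ G⁻ : Graph n
        G⁺ = setEdge i k true G
        G⁻ = setEdge i k false G
        Dw : ℝ
        Dw = D i k (λ G → w G i j) G

    𝐄-Y*Z≤ : ∀ {n} → 𝐄 (λ G → Y {n} G * Z G) ≤
      (ν n ^ 2 - ν n) * (ν n - fromℕ 2) * ((p * q) * (p * q) * (fromℕ 4 - fromℕ 8 * (p ^ 2 * (ν n - fromℕ 3))))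
    𝐄-Y*Z≤ {n} = ≤-trans (≤-reflexive (𝐄-f*Z Y)) (≤-trans (∑∑∑-mono (λ i j k → κ*≤ i j k (λ distinct →
      ≤-trans (≤-reflexive (𝐄-yyf distinct Y)) (*-monoˡ-≤ (0≤-* 0≤pq 0≤pq) (𝐄-D-D-Y≤ distinct)))))
      (≤-reflexive (trans (∑∑∑-*ʳ (κ {n}) _) (*-congʳ ∑∑∑-κ))))

    matching : ∀ {n} → Fin n → Fin n → Fin n → Fin n → Fin n → Fin n → ℝ
    matching i j k a b c = 𝐞 i a * (𝐞 j b * 𝐞 k c) + 𝐞 i a * (𝐞 k b * 𝐞 j c)

    0≤matching : ∀ {n} (i j k a b c : Fin n) → 0# ≤ matching i j k a b c
    0≤matching i j k a b c = 0≤-+ (0≤-* (0≤𝐞 i a) (0≤-* (0≤𝐞 j b) (0≤𝐞 k c))) (0≤-* (0≤𝐞 i a) (0≤-* (0≤𝐞 k b) (0≤𝐞 j c)))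

    𝐄-yyyy≤ : ∀ {n} {i j k a b c : Fin n} → Distinct i j k → Distinct a b c →
      𝐄 (λ G → y G i j * (y G i k * (y G a b * y G a c))) ≤ (p * q) * (p * q) * matching i j k a b c
    𝐄-yyyy≤ {n} {i} {j} {k} {a} {b} {c} (i≢j , i≢k , j≢k) (a≢b , a≢c , b≢c) =
      by-cases (sameEdge? i j a b) (sameEdge? i j a c) (sameEdge? i k a b) (sameEdge? i k a c)
      where
      vanishing : 𝐄 (λ G → y G i j * (y G i k * (y G a b * y G a c))) ≈ 0# →
        𝐄 (λ G → y G i j * (y G i k * (y G a b * y G a c))) ≤ (p * q) * (p * q) * matching i j k a b c
      vanishing e = ≤-trans (≤-reflexive e) (0≤-* (0≤-* 0≤pq 0≤pq) (0≤matching i j k a b c))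
      value : ∀ {i j k : Fin n} → i ≢ j → i ≢ k → j ≢ k → 𝐄 (λ G → y G i j * (y G i k * (y G i j * y G i k))) ≈ (p * q) * (p * q)
      value {i} {j} {k} i≢j i≢k j≢k = trans (𝐄-cong (λ G → solve 2 (λ u v → u :* (v :* (u :* v)) := u :* (u :* (v :* v))) (y G i j) (y G i k)))
        (trans (𝐄-y²* i≢j (λ G → y G i k * y G i k) (λ b G → *-cong (y-set-different G b (SameEdge-star j≢k)) (y-set-different G b (SameEdge-star j≢k))))
          (*-congˡ (𝐄-y² i≢k)))
      by-cases : Dec (SameEdge i j a b) → Dec (SameEdge i j a c) → Dec (SameEdge i k a b) → Dec (SameEdge i k a c) →
        𝐄 (λ G → y G i j * (y G i k * (y G a b * y G a c))) ≤ (p * q) * (p * q) * matching i j k a b c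
      by-cases (no h₁) (no h₂) _ _ = vanishing (𝐄-y*-independent i≢j _ (λ s G → *-cong (y-set-different G s (SameEdge-star j≢k))
        (*-cong (y-set-different G s h₁) (y-set-different G s h₂))))
      by-cases _ _ (no h₁) (no h₂) = vanishing (trans (𝐄-cong (λ G → solve 3 (λ u v w → u :* (v :* w) := v :* (u :* w)) (y G i j) (y G i k) _))
        (𝐄-y*-independent i≢k _ (λ s G → *-cong (y-set-different G s (SameEdge-star (j≢k ∘ ≡.sym)))
          (*-cong (y-set-different G s h₁) (y-set-different G s h₂)))))
      by-cases (yes (inj₁ (≡.refl , ≡.refl))) _ _ (yes (inj₁ (_ , ≡.refl))) =
        ≤-trans (≤-reflexive (value i≢j i≢k j≢k)) (≤-fromDifference ((p * q) * (p * q) * (𝐞 i i * (𝐞 k j * 𝐞 j k)))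
          (0≤-* (0≤-* 0≤pq 0≤pq) (0≤-* (0≤𝐞 i i) (0≤-* (0≤𝐞 k j) (0≤𝐞 j k))))
          (trans (solve 2 (λ c z → c :+ c :* z := c :* (:1 :* (:1 :* :1) :+ z)) _ _)
            (*-congˡ (+-congʳ (*-cong (reflexive (≡.sym (𝐞-≡ i))) (*-cong (reflexive (≡.sym (𝐞-≡ j))) (reflexive (≡.sym (𝐞-≡ k)))))))))
      by-cases _ (yes (inj₁ (≡.refl , ≡.refl))) (yes (inj₁ (_ , ≡.refl))) _ =
        ≤-trans (≤-reflexive (trans (𝐄-cong (λ G → *-congˡ (*-congˡ (*-comm _ _)))) (value i≢j i≢k j≢k)))
          (≤-fromDifference ((p * q) * (p * q) * (𝐞 i i * (𝐞 j k * 𝐞 k j)))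
          (0≤-* (0≤-* 0≤pq 0≤pq) (0≤-* (0≤𝐞 i i) (0≤-* (0≤𝐞 j k) (0≤𝐞 k j))))
          (trans (solve 2 (λ c z → c :+ c :* z := c :* (z :+ :1 :* (:1 :* :1))) _ _)
            (*-congˡ (+-congˡ (*-cong (reflexive (≡.sym (𝐞-≡ i))) (*-cong (reflexive (≡.sym (𝐞-≡ k))) (reflexive (≡.sym (𝐞-≡ j)))))))))
      by-cases (yes (inj₁ (≡.refl , ≡.refl))) _ (yes (inj₁ (_ , j≡k))) (no _) = ⊥-elim (j≢k j≡k)
      by-cases (yes (inj₁ (≡.refl , ≡.refl))) _ (yes (inj₂ (i≡k , _))) (no _) = ⊥-elim (i≢k i≡k)
      by-cases (yes (inj₁ (≡.refl , ≡.refl))) _ _ (yes (inj₂ (i≡k , _))) = ⊥-elim (i≢k i≡k)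
      by-cases (yes (inj₂ (≡.refl , ≡.refl))) _ _ (yes (inj₁ (j≡i , _))) = ⊥-elim (i≢j (≡.sym j≡i))
      by-cases (yes (inj₂ (≡.refl , ≡.refl))) _ _ (yes (inj₂ (j≡k , _))) = ⊥-elim (j≢k j≡k)
      by-cases (yes (inj₂ (≡.refl , ≡.refl))) _ (yes (inj₁ (j≡i , _))) (no _) = ⊥-elim (i≢j (≡.sym j≡i))
      by-cases (yes (inj₂ (≡.refl , ≡.refl))) _ (yes (inj₂ (j≡k , _))) (no _) = ⊥-elim (j≢k j≡k)
      by-cases (no _) (yes (inj₁ (≡.refl , ≡.refl))) (no _) (yes (inj₁ (_ , j≡k))) = ⊥-elim (j≢k j≡k)
      by-cases (no _) (yes (inj₁ (≡.refl , ≡.refl))) (no _) (yes (inj₂ (i≡k , _))) = ⊥-elim (i≢k i≡k)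
      by-cases (no _) (yes (inj₁ (≡.refl , ≡.refl))) (yes (inj₂ (i≡k , _))) _ = ⊥-elim (i≢k i≡k)
      by-cases (no _) (yes (inj₂ (≡.refl , ≡.refl))) (yes (inj₁ (j≡i , _))) _ = ⊥-elim (i≢j (≡.sym j≡i))
      by-cases (no _) (yes (inj₂ (≡.refl , ≡.refl))) (yes (inj₂ (j≡k , _))) _ = ⊥-elim (j≢k j≡k)
      by-cases (no _) (yes (inj₂ (≡.refl , ≡.refl))) (no _) (yes (inj₁ (j≡i , _))) = ⊥-elim (i≢j (≡.sym j≡i))
      by-cases (no _) (yes (inj₂ (≡.refl , ≡.refl))) (no _) (yes (inj₂ (j≡k , _))) = ⊥-elim (j≢k j≡k)

    ∑∑∑-matching : ∀ {n} (i j k : Fin n) → ∑∑∑ (matching i j k) ≈ fromℕ 2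
    ∑∑∑-matching i j k = trans (∑-cong (λ a → trans (∑-cong (λ b → ∑-+ _ _)) (∑-+ _ _))) (trans (∑-+ _ _)
      (trans (+-cong (single i j k) (single i k j)) (+-congˡ (sym (+-identityʳ 1#)))))
      where
      single : ∀ i j k → ∑∑∑ (λ a b c → 𝐞 i a * (𝐞 j b * 𝐞 k c)) ≈ 1#
      single i j k = trans (∑-cong (λ a → trans (∑-cong (λ b → trans (∑-*ˡ (𝐞 i a) _) (*-congˡ (trans (∑-*ˡ (𝐞 j b) _)
        (trans (*-congˡ (∑-𝐞 k)) (*-identityʳ _)))))) (trans (∑-*ˡ (𝐞 i a) _) (trans (*-congˡ (∑-𝐞 j)) (*-identityʳ _))))) (∑-𝐞 i)

    𝐄-Z²≤ : ∀ {n} → 𝐄 (λ G → Z {n} G * Z G) ≤ ν n ^ 3 * (fromℕ 2 * ((p * q) * (p * q)))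
    𝐄-Z²≤ {n} = begin
      𝐄 (λ G → Z G * Z G)
        ≈⟨ 𝐄-f*Z Z ⟩
      ∑∑∑ (λ i j k → κ i j k * 𝐄 (λ G → y G i j * (y G i k * Z G)))
        ≤⟨ ∑∑∑-mono (λ i j k → ≤-trans (κ*≤ i j k (inner i j k)) (≤-trans (*-monoʳ-≤ 0≤c (κ≤1 i j k)) (≤-reflexive (*-identityˡ _)))) ⟩
      ∑∑∑ (λ (i j k : Fin n) → fromℕ 2 * ((p * q) * (p * q)))
        ≈⟨ trans (∑-cong {n} (λ _ → ∑∑-const n _)) (trans (∑-const n _) (solve 2 (λ v c → v :* (v :^ 2 :* c) := v :^ 3 :* c) (ν n) _)) ⟩
      ν n ^ 3 * (fromℕ 2 * ((p * q) * (p * q))) ∎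
      where
      open ≤-Reasoning
      0≤c : 0# ≤ fromℕ 2 * ((p * q) * (p * q))
      0≤c = 0≤-* (0≤fromℕ 2) (0≤-* 0≤pq 0≤pq)
      inner : ∀ i j k → Distinct i j k → 𝐄 (λ G → y G i j * (y G i k * Z G)) ≤ fromℕ 2 * ((p * q) * (p * q))
      inner i j k distinct = begin
        𝐄 (λ G → y G i j * (y G i k * Z G))
          ≈⟨ trans (𝐄-cong (λ G → sym (*-assoc (y G i j) (y G i k) (Z G)))) (trans (𝐄-f*Z (λ G → y G i j * y G i k))
               (∑∑∑-cong (λ a b c → *-congˡ (𝐄-cong (λ G → solve 4 (λ u v s t → u :* (v :* (s :* t)) := s :* (t :* (u :* v))) (y G a b) (y G a c) (y G i j) (y G i k)))))) ⟩
        ∑∑∑ (λ a b c → κ a b c * 𝐄 (λ G → y G i j * (y G i k * (y G a b * y G a c))))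
          ≤⟨ ∑∑∑-mono (λ a b c → ≤-trans (κ*≤ a b c (𝐄-yyyy≤ distinct))
               (≤-trans (*-monoʳ-≤ (0≤-* (0≤-* 0≤pq 0≤pq) (0≤matching i j k a b c)) (κ≤1 a b c)) (≤-reflexive (trans (*-identityˡ _) (*-comm _ _))))) ⟩
        ∑∑∑ (λ a b c → matching i j k a b c * ((p * q) * (p * q)))
          ≈⟨ trans (∑∑∑-*ʳ (matching i j k) _) (*-congʳ (∑∑∑-matching i j k)) ⟩
        fromℕ 2 * ((p * q) * (p * q)) ∎

    Var-Y≥-quadratic : ∀ {n} → (p * q) ^ 2 *
      (fromℕ 2 * ν n * ((ν n ^ 2 - ν n) * (ν n - fromℕ 2) * (fromℕ 8 * (p ^ 2 * (ν n - fromℕ 3)) - fromℕ 4)) - fromℕ 2 * ν n ^ 5)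
      ≤ Var (Y {n})
    Var-Y≥-quadratic {n} = begin
      (p * q) ^ 2 * (fromℕ 2 * v * (N * B) - fromℕ 2 * v ^ 5)
        ≈⟨ solve 4 (λ c v N B → c :^ 2 :* (:2 :* v :* (N :* B) :- :2 :* v :^ 5)
             := :- (:2 :* v :* (N :* (c :* c :* :- B))) :- v :^ 2 :* (v :^ 3 :* (:2 :* (c :* c)))) (p * q) v N B ⟩
      - (fromℕ 2 * v * (N * ((p * q) * (p * q) * - B))) - v ^ 2 * (v ^ 3 * (fromℕ 2 * ((p * q) * (p * q))))
        ≤⟨ +-mono-≤ (neg-mono-≤ (*-monoˡ-≤ (0≤-* (0≤fromℕ 2) (0≤fromℕ n)) (≤-trans 𝐄-Y*Z≤ (≤-reflexive (*-congˡ (*-congˡ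
             (solve 1 (λ b → :4 :- b := :- (b :- :4)) _)))))))
             (neg-mono-≤ (*-monoˡ-≤ (0≤x² v) 𝐄-Z²≤)) ⟩
      - (fromℕ 2 * v * 𝐄 (λ G → Y G * Z G)) - v ^ 2 * 𝐄 (λ G → Z G * Z G)
        ≈⟨ trans (solve 4 (λ v a b e → :- (:2 :* v :* a) :- v :^ 2 :* b := :2 :* (:- v) :* (a :- e :* :0) :- (:- v) :^ 2 :* (b :- :0 :^ 2)) v _ _ (𝐄 Y))
             (+-cong (*-congˡ (+-congˡ (-‿cong (*-congˡ (sym 𝐄-Z))))) (-‿cong (*-congˡ (+-cong (𝐄-cong (λ G → sym (sq≈* (Z G)))) (-‿cong (^-cong 2 (sym 𝐄-Z))))))) ⟩
      fromℕ 2 * (- v) * Cov Y Z - (- v) ^ 2 * Var Z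
        ≤⟨ Var-≥-Cov Y Z (- v) ⟩
      Var Y ∎
      where
      open ≤-Reasoning
      v N B : ℝ
      v = ν n
      N = (ν n ^ 2 - ν n) * (ν n - fromℕ 2)
      B = fromℕ 8 * (p ^ 2 * (ν n - fromℕ 3)) - fromℕ 4

    𝐄-zero : ∀ {n} {f : Graph n → ℝ} → (∀ G → f G ≈ 0#) → 𝐄 f ≈ 0#
    𝐄-zero {n} h = trans (𝐄-cong h) (𝐄-const {n} 0#)

    hasUniquePath-irrefl : ∀ {n} (G : Graph n) a → hasUniquePath G a a ≡ false
    hasUniquePath-irrefl G a with a ≟ a
    ... | yes _ = ≡.refl
    ... | no a≢a = ⊥-elim (a≢a ≡.refl)

    uniquePath≤paths : ∀ {n} (G : Graph n) a c → indicator (hasUniquePath G a c) ≤ ∑ (λ b → (1# - 𝐞 a c) * (x G a b * x G b c))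
    uniquePath≤paths G a c with hasUniquePath G a c in e
    ... | false = 0≤∑ 0≤term
      where
      0≤term : ∀ b → 0# ≤ (1# - 𝐞 a c) * (x G a b * x G b c)
      0≤term b = 0≤-* (x≤y⇒0≤y-x (indicator≤1 (does (a ≟ c)))) (0≤-* (0≤x G a b) (0≤x G b c))
    ... | true with b , e₁ , e₂ ← hasUniquePath-middle G {a} {c} e = ≤-trans (≤-reflexive (sym (trans (*-cong
        (trans (+-congˡ (-‿cong (reflexive (𝐞-≢ a≢c)))) (solve 0 (:1 :- :0 := :1)))
        (trans (*-cong (reflexive (≡.cong indicator e₁)) (reflexive (≡.cong indicator e₂))) (*-identityˡ 1#))) (*-identityˡ 1#))))
      (∑-term 0≤term b)
      where
      0≤term : ∀ b → 0# ≤ (1# - 𝐞 a c) * (x G a b * x G b c)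
      0≤term b = 0≤-* (x≤y⇒0≤y-x (indicator≤1 (does (a ≟ c)))) (0≤-* (0≤x G a b) (0≤x G b c))
      a≢c : a ≢ c
      a≢c ≡.refl with () ← ≡.trans (≡.sym e) (hasUniquePath-irrefl G a)

    𝐄-path≤ : ∀ {n} (a c b : Fin n) → 𝐄 (λ G → (1# - 𝐞 a c) * (x G a b * x G b c)) ≤ p ^ 2
    𝐄-path≤ a c b with a ≟ c | a ≟ b | b ≟ c
    ... | yes _ | _ | _ = ≤-trans (≤-reflexive (𝐄-zero (λ G → trans (*-congʳ (-‿inverseʳ 1#)) (zeroˡ _)))) (0≤x² p)
    ... | no _ | yes ≡.refl | _ = ≤-trans (≤-reflexive (𝐄-zero (λ G → trans (*-congˡ (trans (*-congʳ (x-diag G a)) (zeroˡ _))) (zeroʳ _)))) (0≤x² p)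
    ... | no _ | no _ | yes ≡.refl = ≤-trans (≤-reflexive (𝐄-zero (λ G → trans (*-congˡ (trans (*-congˡ (x-diag G b)) (zeroʳ _))) (zeroʳ _)))) (0≤x² p)
    ... | no a≢c | no a≢b | no b≢c = ≤-reflexive (trans (𝐄-* _ _) (trans (*-congˡ (𝐄-xx a≢b b≢c
        (λ { (inj₁ (b≡a , _)) → a≢b (≡.sym b≡a) ; (inj₂ (_ , c≡a)) → a≢c (≡.sym c≡a) })))
        (solve 1 (λ p → (:1 :- :0) :* (p :* p) := p :^ 2) p)))

    𝐄-U≤ : ∀ {n} → 𝐄 (U {n}) ≤ ν n ^ 3 * p ^ 2
    𝐄-U≤ {n} = begin
      𝐄 U
        ≤⟨ 𝐄-mono (λ G → ∑∑-mono (uniquePath≤paths G)) ⟩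
      𝐄 (λ G → ∑∑∑ (λ a c b → (1# - 𝐞 a c) * (x G a b * x G b c)))
        ≈⟨ 𝐄-∑∑∑ _ ⟩
      ∑∑∑ (λ a c b → 𝐄 (λ G → (1# - 𝐞 a c) * (x G a b * x G b c)))
        ≤⟨ ∑∑∑-mono 𝐄-path≤ ⟩
      ∑∑∑ {n} (λ _ _ _ → p ^ 2)
        ≈⟨ trans (∑-cong {n} (λ _ → ∑∑-const n _)) (trans (∑-const n _) (solve 2 (λ v c → v :* (v :^ 2 :* c) := v :^ 3 :* c) (ν n) _)) ⟩
      ν n ^ 3 * p ^ 2 ∎
      where open ≤-Reasoning

    0≤U : ∀ {n} (G : Graph n) → 0# ≤ U G
    0≤U G = 0≤∑∑ (λ a c → 0≤indicator (hasUniquePath G a c))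

    x*x≤x : ∀ {n} (G : Graph n) a b {z} → 0# ≤ z → x G a b * z ≤ z
    x*x≤x G a b 0≤z = ≤-trans (*-monoʳ-≤ 0≤z (x≤1 G a b)) (≤-reflexive (*-identityˡ _))

    walkBound : ∀ {n} → Fin n → Fin n → Fin n → Fin n → ℝ
    walkBound a b c e = 𝐞 a c * (𝐞 b e * (p * (1# - 𝐞 a b))) + (𝐞 a c * p ^ 2 + 𝐞 b e * p ^ 2) + p ^ 3

    𝐄-walk≤ : ∀ {n} (a b c e : Fin n) → 𝐄 (λ G → x G a b * (x G b c * (x G c e * x G e a))) ≤ walkBound a b c e
    𝐄-walk≤ {n} a b c e with a ≟ c | b ≟ e
    ... | yes ≡.refl | yes ≡.refl = ≤-trans (𝐄-mono (λ G → ≤-trans (*-monoˡ-≤ (0≤x G a b)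
          (≤-trans (x*x≤x G b a (0≤-* (0≤x G a b) (0≤x G b a))) (≤-trans (x*x≤x G a b (0≤x G b a)) (x≤1 G b a)))) (≤-reflexive (*-identityʳ _))))
        (≤-trans (≤-reflexive (𝐄-x≈ a b)) (≤-fromDifference (p ^ 2 + p ^ 2 + p ^ 3) (0≤-+ (0≤-+ (0≤x² p) (0≤x² p)) (0≤-^ 3 0≤p))
          (solve 2 (λ p e → p :* (:1 :- e) :+ (p :^ 2 :+ p :^ 2 :+ p :^ 3) := :1 :* (:1 :* (p :* (:1 :- e))) :+ (:1 :* p :^ 2 :+ :1 :* p :^ 2) :+ p :^ 3) p (𝐞 a b))))
    ... | yes ≡.refl | no b≢e = ≤-trans (𝐄-mono (λ G → *-monoˡ-≤ (0≤x G a b)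
          (≤-trans (x*x≤x G b a (0≤-* (0≤x G a e) (0≤x G e a))) (≤-trans (*-monoˡ-≤ (0≤x G a e) (x≤1 G e a)) (≤-reflexive (*-identityʳ _))))))
        (≤-trans (𝐄-xx-star≤ a b e) (≤-fromDifference (p ^ 3) (0≤-^ 3 0≤p)
          (trans (+-congʳ (+-congˡ (*-congʳ (reflexive (𝐞-≢ b≢e)))))
            (solve 2 (λ p e → p :* p :+ :0 :* p :+ p :^ 3 := :1 :* (:0 :* (p :* (:1 :- e))) :+ (:1 :* p :^ 2 :+ :0 :* p :^ 2) :+ p :^ 3) p (𝐞 a b)))))
    ... | no a≢c | yes ≡.refl = ≤-trans (𝐄-mono (λ G → ≤-trans (≤-reflexive (*-congʳ (x-sym G a b))) (*-monoˡ-≤ (0≤x G b a)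
          (≤-trans (*-monoˡ-≤ (0≤x G b c) (≤-trans (x*x≤x G c b (0≤x G b a)) (x≤1 G b a))) (≤-reflexive (*-identityʳ _))))))
        (≤-trans (𝐄-xx-star≤ b a c) (≤-fromDifference (p ^ 3) (0≤-^ 3 0≤p)
          (trans (+-congʳ (+-congˡ (*-congʳ (reflexive (𝐞-≢ a≢c)))))
            (solve 2 (λ p e → p :* p :+ :0 :* p :+ p :^ 3 := :0 :* (:1 :* (p :* (:1 :- e))) :+ (:0 :* p :^ 2 :+ :1 :* p :^ 2) :+ p :^ 3) p (𝐞 a b)))))
    ... | no a≢c | no b≢e = ≤-trans (𝐄-mono (λ G → *-monoˡ-≤ (0≤x G a b) (*-monoˡ-≤ (0≤x G b c)
          (≤-trans (*-monoˡ-≤ (0≤x G c e) (x≤1 G e a)) (≤-reflexive (*-identityʳ _))))))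
        (≤-trans (three (a ≟ b) (b ≟ c) (c ≟ e)) (≤-reflexive
          (solve 2 (λ p e → p :^ 3 := :0 :* (:0 :* (p :* (:1 :- e))) :+ (:0 :* p :^ 2 :+ :0 :* p :^ 2) :+ p :^ 3) p (𝐞 a b))))
      where
      three : Dec (a ≡ b) → Dec (b ≡ c) → Dec (c ≡ e) → 𝐄 (λ G → x G a b * (x G b c * x G c e)) ≤ p ^ 3
      three (yes ≡.refl) _ _ = ≤-trans (≤-reflexive (𝐄-zero (λ G → trans (*-congʳ (x-diag G a)) (zeroˡ _)))) (0≤-^ 3 0≤p)
      three (no _) (yes ≡.refl) _ = ≤-trans (≤-reflexive (𝐄-zero (λ G → trans (*-congˡ (trans (*-congʳ (x-diag G b)) (zeroˡ _))) (zeroʳ _)))) (0≤-^ 3 0≤p)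
      three (no _) (no _) (yes ≡.refl) = ≤-trans (≤-reflexive (𝐄-zero (λ G → trans (*-congˡ (trans (*-congˡ (x-diag G c)) (zeroʳ _))) (zeroʳ _)))) (0≤-^ 3 0≤p)
      three (no a≢b) (no b≢c) (no c≢e) = ≤-reflexive (trans (𝐄-xxx a≢b b≢c c≢e
        (λ { (inj₁ (b≡a , _)) → a≢b (≡.sym b≡a) ; (inj₂ (_ , c≡a)) → a≢c (≡.sym c≡a) })
        (λ { (inj₁ (c≡a , _)) → a≢c (≡.sym c≡a) ; (inj₂ (c≡b , _)) → b≢c (≡.sym c≡b) })
        (λ { (inj₁ (c≡b , _)) → b≢c (≡.sym c≡b) ; (inj₂ (_ , e≡b)) → b≢e (≡.sym e≡b) }))
        (solve 1 (λ p → p :* (p :* p) := p :^ 3) p))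

    𝐄-closedWalks₄≤ : ∀ {n} → 𝐄 (λ (G : Graph n) → closedWalks₄ (x G)) ≤
      p * (ν n ^ 2 - ν n) + fromℕ 2 * (ν n ^ 3 * p ^ 2) + ν n ^ 4 * p ^ 3
    𝐄-closedWalks₄≤ {n} = begin
      𝐄 (λ G → closedWalks₄ (x G))
        ≈⟨ 𝐄-cong (λ G → ∑∑-cong (λ a b → sym (∑∑-*ˡ (x G a b) _))) ⟩
      𝐄 (λ G → ∑∑ (λ a b → ∑∑ (λ c e → x G a b * (x G b c * (x G c e * x G e a)))))
        ≈⟨ trans (𝐄-∑ _) (∑-cong (λ a → trans (𝐄-∑ _) (∑-cong (λ b → trans (𝐄-∑ _) (∑-cong (λ c → 𝐄-∑ _)))))) ⟩
      ∑∑ (λ a b → ∑∑ (λ c e → 𝐄 (λ G → x G a b * (x G b c * (x G c e * x G e a)))))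
        ≤⟨ ∑∑-mono (λ a b → ∑∑-mono (λ c e → 𝐄-walk≤ a b c e)) ⟩
      ∑∑ (λ a b → ∑∑ (walkBound {n} a b))
        ≈⟨ ∑∑-cong inner ⟩
      ∑∑ (λ a b → p * (1# - 𝐞 a b) + (fromℕ 2 * (v * p ^ 2) + v ^ 2 * p ^ 3))
        ≈⟨ trans (∑∑-+ _ _) (+-cong (trans (∑∑-*ˡ p _) (*-congˡ offDiagonal)) (∑∑-const n _)) ⟩
      p * (v ^ 2 - v) + v ^ 2 * (fromℕ 2 * (v * p ^ 2) + v ^ 2 * p ^ 3)
        ≈⟨ solve 2 (λ v p → p :* (v :^ 2 :- v) :+ v :^ 2 :* (:2 :* (v :* p :^ 2) :+ v :^ 2 :* p :^ 3)
             := p :* (v :^ 2 :- v) :+ :2 :* (v :^ 3 :* p :^ 2) :+ v :^ 4 :* p :^ 3) v p ⟩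
      p * (v ^ 2 - v) + fromℕ 2 * (v ^ 3 * p ^ 2) + v ^ 4 * p ^ 3 ∎
      where
      open ≤-Reasoning
      v : ℝ
      v = ν n
      offDiagonal : ∑∑ (λ (a b : Fin n) → 1# - 𝐞 a b) ≈ v ^ 2 - v
      offDiagonal = trans (∑∑-offDiagonal _ 1# (λ a → trans (+-congˡ (-‿cong (reflexive (𝐞-≡ a)))) (-‿inverseʳ 1#))
        (λ a b a≢b → trans (+-congˡ (-‿cong (reflexive (𝐞-≢ a≢b)))) (solve 0 (:1 :- :0 := :1)))) (*-identityʳ _)
      inner : ∀ a b → ∑∑ (walkBound a b) ≈ p * (1# - 𝐞 a b) + (fromℕ 2 * (v * p ^ 2) + v ^ 2 * p ^ 3)
      inner a b = trans (∑∑-+ _ _) (trans (+-cong (trans (∑∑-+ _ _) (+-cong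
          (trans (∑-cong (λ c → trans (∑-*ˡ (𝐞 a c) _) (*-congˡ (∑-𝐞ˡ b (λ _ → p * (1# - 𝐞 a b)))))) (∑-𝐞ˡ a (λ _ → p * (1# - 𝐞 a b))))
          (trans (∑∑-+ _ _) (+-cong (trans (∑-cong (λ c → ∑-const n _)) (trans (∑-*ˡ v _) (*-congˡ (∑-𝐞ˡ a (λ _ → p ^ 2)))))
            (trans (∑-cong {n} (λ c → ∑-𝐞ˡ b (λ _ → p ^ 2))) (∑-const n _))))))
          (∑∑-const n _))
        (solve 4 (λ u v s t → u :+ (v :* s :+ v :* s) :+ v :^ 2 :* t := u :+ (:2 :* (v :* s) :+ v :^ 2 :* t)) _ v _ _))

    m≤closedWalks₄ : ∀ {n} (G : Graph n) → m G ≤ closedWalks₄ (x G)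
    m≤closedWalks₄ G = ∑∑-mono (λ a b → begin
      x G a b
        ≈⟨ trans (*-cong (x-idem G a b) (x-idem G a b)) (x-idem G a b) ⟨
      x G a b * x G a b * (x G a b * x G a b)
        ≈⟨ *-cong (*-congˡ (x-sym G a b)) (*-congˡ (x-sym G a b)) ⟩
      x G a b * x G b a * (x G a b * x G b a)
        ≈⟨ *-assoc _ _ _ ⟩
      x G a b * (x G b a * (x G a b * x G b a))
        ≤⟨ *-monoˡ-≤ (0≤x G a b) (≤-trans (∑-term (λ e → 0≤-* (0≤x G b a) (0≤-* (0≤x G a e) (0≤x G e a))) b)
             (∑-term (λ c → 0≤∑ (λ e → 0≤-* (0≤x G b c) (0≤-* (0≤x G c e) (0≤x G e a)))) a)) ⟩
      x G a b * walks₃ (x G) (x G) (x G) b a ∎)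
      where open ≤-Reasoning

    𝐄-m² : ∀ {n} → 𝐄 (λ G → m {n} G ^ 2) ≈ p * q * ((ν n ^ 2 - ν n) * fromℕ 2) + ((ν n ^ 2 - ν n) * p) ^ 2
    𝐄-m² {n} = trans (solve 2 (λ a e → a := a :- e :^ 2 :+ e :^ 2) _ (𝐄 m)) (+-cong Var-m (^-cong 2 (trans 𝐄-m
      (solve 2 (λ v p → v :* (p :* (v :- :1)) := (v :^ 2 :- v) :* p) (ν n) p))))

    𝐄-Y : ∀ {n} → 𝐄 (Y {n}) ≈ p * q * ((ν n ^ 2 - ν n) * fromℕ 2) + ((ν n ^ 2 - ν n) * p) ^ 2 - ν n * (p * (ν n - 1#)) - 𝐄 (λ (G : Graph n) → closedWalks₄ (x G))
    𝐄-Y {n} = trans (𝐄-sub _ _) (+-congʳ (trans (𝐄-sub _ _) (+-cong 𝐄-m² (-‿cong 𝐄-m))))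

    𝐄-Y≥ : ∀ {n} → (ν n ^ 2 - ν n) ^ 2 * p ^ 2 - fromℕ 2 * ((ν n ^ 2 - ν n) * p ^ 2) - fromℕ 2 * (ν n ^ 3 * p ^ 2) - ν n ^ 4 * p ^ 3 ≤ 𝐄 (Y {n})
    𝐄-Y≥ {n} = ≤-trans (≤-reflexive (solve 2 (λ v p →
        (v :^ 2 :- v) :^ 2 :* p :^ 2 :- :2 :* ((v :^ 2 :- v) :* p :^ 2) :- :2 :* (v :^ 3 :* p :^ 2) :- v :^ 4 :* p :^ 3
        := p :* (:1 :- p) :* ((v :^ 2 :- v) :* :2) :+ ((v :^ 2 :- v) :* p) :^ 2 :- v :* (p :* (v :- :1))
           :- (p :* (v :^ 2 :- v) :+ :2 :* (v :^ 3 :* p :^ 2) :+ v :^ 4 :* p :^ 3)) (ν n) p))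
      (≤-trans (+-mono-≤ ≤-refl (neg-mono-≤ 𝐄-closedWalks₄≤)) (≤-reflexive (sym 𝐄-Y)))

    𝐄-Y≤ : ∀ {n} → 1# ≤ ν n → 𝐄 (Y {n}) ≤ ν n ^ 4 * p ^ 2
    𝐄-Y≤ {n} 1≤v = ≤-trans (≤-reflexive 𝐄-Y) (≤-trans (+-mono-≤ ≤-refl (neg-mono-≤ (≤-trans (≤-reflexive (sym 𝐄-m)) (𝐄-mono m≤closedWalks₄))))
      (≤-fromDifference (v ^ 2 * p ^ 2 * (fromℕ 2 * (v - 1#) + 1#) + fromℕ 2 * (v * (v - 1#)) * p ^ 2)
        (0≤-+ (0≤-* (0≤ν^p {n} 2 2) (0≤-+ (0≤-* (0≤fromℕ 2) (x≤y⇒0≤y-x 1≤v)) 0≤1))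
          (0≤-* (0≤-* (0≤fromℕ 2) (0≤-* (0≤fromℕ n) (x≤y⇒0≤y-x 1≤v))) (0≤x² p)))
        (solve 2 (λ v p → p :* (:1 :- p) :* ((v :^ 2 :- v) :* :2) :+ ((v :^ 2 :- v) :* p) :^ 2 :- v :* (p :* (v :- :1)) :- v :* (p :* (v :- :1))
          :+ (v :^ 2 :* p :^ 2 :* (:2 :* (v :- :1) :+ :1) :+ :2 :* (v :* (v :- :1)) :* p :^ 2) := v :^ 4 :* p :^ 2) v p)))
      where
      v : ℝ
      v = ν n

    fromℕ≤fromℕ² : ∀ k → fromℕ k ≤ fromℕ k ^ 2
    fromℕ≤fromℕ² zero = 0≤x² 0#
    fromℕ≤fromℕ² (suc k) = ≤-fromDifference (fromℕ (suc k) * fromℕ k) (0≤-* (0≤fromℕ (suc k)) (0≤fromℕ k))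
      (solve 1 (λ k → (:1 :+ k) :+ (:1 :+ k) :* k := (:1 :+ k) :^ 2) (fromℕ k))

    module _ {n} (K : Graph n → ℕ) (2K≈ : ∀ G → fromℕ 2 * fromℕ (K G) ≈ Y G + fromℕ 2 * U G) where

      private
        v μ : ℝ
        v = ν n
        μ = 𝐄 (λ G → fromℕ (K G))

        2μ≈ : fromℕ 2 * μ ≈ 𝐄 Y + fromℕ 2 * 𝐄 U
        2μ≈ = trans (sym (𝐄-* _ _)) (trans (𝐄-cong 2K≈) (trans (𝐄-+ _ _) (+-congˡ (𝐄-* _ _))))

      -- For a random variable with values in ℕ the variance is at least μ - μ².
      Var-K≥-sparse : fromℕ 10 ≤ v → fromℕ 2 * (v ^ 2 * p) ≤ 1# → v ^ 4 * p ^ 2 ≤ fromℕ 8 * Var (λ G → fromℕ (K G))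
      Var-K≥-sparse 10≤v 2v²p≤1 = begin
        v ^ 4 * p ^ 2
          ≤⟨ μ-lower ⟩
        fromℕ 4 * μ
          ≤⟨ ≤-fromDifference (fromℕ 4 * μ * (1# - fromℕ 2 * μ)) (0≤-* (0≤-* (0≤fromℕ 4) 0≤μ) (x≤y⇒0≤y-x 2μ≤1))
               (solve 1 (λ k → :4 :* k :+ :4 :* k :* (:1 :- :2 :* k) := :8 :* (k :- k :^ 2)) μ) ⟩
        fromℕ 8 * (μ - μ ^ 2)
          ≤⟨ *-monoˡ-≤ (0≤fromℕ 8) (+-mono-≤ (𝐄-mono (λ G → fromℕ≤fromℕ² (K G))) ≤-refl) ⟩
        fromℕ 8 * Var (λ G → fromℕ (K G)) ∎
        where
        open ≤-Reasoning
        0≤μ : 0# ≤ μ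
        0≤μ = 0≤𝐄 (λ G → 0≤fromℕ (K G))
        1≤v : 1# ≤ v
        1≤v = ≤-trans (≤-trans (1≤fromℕ 9) ≤-refl) 10≤v
        0≤v-10 : 0# ≤ v - fromℕ 10
        0≤v-10 = x≤y⇒0≤y-x 10≤v
        μ-lower : v ^ 4 * p ^ 2 ≤ fromℕ 4 * μ
        μ-lower = begin
          v ^ 4 * p ^ 2
            ≤⟨ ≤-fromDifference (v ^ 2 * p ^ 2 * (1# - fromℕ 2 * (v ^ 2 * p))
                 + p ^ 2 * (v ^ 2 * ((v - fromℕ 10) * (v + fromℕ 2) + fromℕ 17) + fromℕ 4 * v))
                 (0≤-+ (0≤-* (0≤ν^p {n} 2 2) (x≤y⇒0≤y-x 2v²p≤1)) (0≤-* (0≤x² p) (0≤-+ (0≤-* (0≤x² v)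
                   (0≤-+ (0≤-* 0≤v-10 (0≤-+ (0≤fromℕ n) (0≤fromℕ 2))) (0≤fromℕ 17))) (0≤-* (0≤fromℕ 4) (0≤fromℕ n)))))
                 (solve 2 (λ v p → v :^ 4 :* p :^ 2 :+ (v :^ 2 :* p :^ 2 :* (:1 :- :2 :* (v :^ 2 :* p))
                     :+ p :^ 2 :* (v :^ 2 :* ((v :- con (ℤ.+ 10)) :* (v :+ :2) :+ con (ℤ.+ 17)) :+ :4 :* v))
                   := :2 :* ((v :^ 2 :- v) :^ 2 :* p :^ 2 :- :2 :* ((v :^ 2 :- v) :* p :^ 2) :- :2 :* (v :^ 3 :* p :^ 2) :- v :^ 4 :* p :^ 3)) v p) ⟩
          fromℕ 2 * ((v ^ 2 - v) ^ 2 * p ^ 2 - fromℕ 2 * ((v ^ 2 - v) * p ^ 2) - fromℕ 2 * (v ^ 3 * p ^ 2) - v ^ 4 * p ^ 3)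
            ≤⟨ *-monoˡ-≤ (0≤fromℕ 2) (≤-trans 𝐄-Y≥ (≤-fromDifference _ (0≤-* (0≤fromℕ 2) (0≤𝐄 0≤U)) refl)) ⟩
          fromℕ 2 * (𝐄 Y + fromℕ 2 * 𝐄 U)
            ≈⟨ trans (*-congˡ (sym 2μ≈)) (solve 1 (λ k → :2 :* (:2 :* k) := :4 :* k) μ) ⟩
          fromℕ 4 * μ ∎
        2μ≤1 : fromℕ 2 * μ ≤ 1#
        2μ≤1 = begin
          fromℕ 2 * μ
            ≈⟨ 2μ≈ ⟩
          𝐄 Y + fromℕ 2 * 𝐄 U
            ≤⟨ +-mono-≤ (𝐄-Y≤ 1≤v) (*-monoˡ-≤ (0≤fromℕ 2) 𝐄-U≤) ⟩
          v ^ 4 * p ^ 2 + fromℕ 2 * (v ^ 3 * p ^ 2)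
            ≤⟨ ≤-fromDifference (v ^ 3 * p ^ 2 * ((v - fromℕ 10) + fromℕ 8) + fromℕ 2 * v ^ 4 * p ^ 2)
                 (0≤-+ (0≤-* (0≤ν^p {n} 3 2) (0≤-+ 0≤v-10 (0≤fromℕ 8))) (0≤-* (0≤-* (0≤fromℕ 2) (0≤-^ 4 (0≤fromℕ n))) (0≤x² p)))
                 (solve 2 (λ v p → v :^ 4 :* p :^ 2 :+ :2 :* (v :^ 3 :* p :^ 2) :+ (v :^ 3 :* p :^ 2 :* ((v :- con (ℤ.+ 10)) :+ :8) :+ :2 :* v :^ 4 :* p :^ 2)
                   := (:2 :* (v :^ 2 :* p)) :^ 2) v p) ⟩
          (fromℕ 2 * (v ^ 2 * p)) ^ 2
            ≤⟨ ^-mono-≤ 2 (0≤-* (0≤fromℕ 2) (0≤-* (0≤x² v) 0≤p)) 2v²p≤1 ⟩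
          1# ^ 2
            ≈⟨ solve 0 (:1 :^ 2 := :1) ⟩
          1# ∎

    η : ℝ
    η = 1# - fromℕ 2 * p ^ 2

    T₁ T₂ T₃ : ℕ → ℝ
    T₁ n = ν n ^ 6 * p ^ 3 * q * η ^ 2
    T₂ n = ν n ^ 5 * p ^ 3 * q
    T₃ n = ν n ^ 4 * p ^ 2 * q

    0≤T₁ : ∀ n → 0# ≤ T₁ n
    0≤T₁ n = 0≤-* (0≤-* (0≤ν^p {n} 6 3) 0≤q) (0≤x² η)
    0≤T₂ : ∀ n → 0# ≤ T₂ n
    0≤T₂ n = 0≤-* (0≤ν^p {n} 5 3) 0≤q
    0≤T₃ : ∀ n → 0# ≤ T₃ n
    0≤T₃ n = 0≤-* (0≤ν^p {n} 4 2) 0≤q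

    Var-Y≤T : ∀ {n} → Var (Y {n}) ≤ fromℕ 32 * T₁ n + fromℕ 2 * C₁ * (T₂ n + T₃ n)
    Var-Y≤T {n} = ≤-trans Var-Y≤ (≤-reflexive (solve 3 (λ v p c →
      p :* (:1 :- p) :* (v :^ 2 :* (:2 :* (:4 :* (v :^ 2 :* p) :- :8 :* (v :^ 2 :* p :^ 3)) :^ 2 :+ :2 :* (c :* (v :^ 3 :* p :^ 2 :+ v :^ 2 :* p))))
      := con (ℤ.+ 32) :* (v :^ 6 :* p :^ 3 :* (:1 :- p) :* (:1 :- :2 :* p :^ 2) :^ 2) :+ :2 :* c :* (v :^ 5 :* p :^ 3 :* (:1 :- p) :+ v :^ 4 :* p :^ 2 :* (:1 :- p))) (ν n) p C₁))

    ν*Var-U≤ : ∀ {n} → ν n * Var (U {n}) ≤ fromℕ 64 * (T₂ n + T₃ n)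
    ν*Var-U≤ {n} = ≤-trans (*-monoˡ-≤ (0≤fromℕ n) Var-U≤) (≤-reflexive (solve 2 (λ v p →
      v :* (p :* (:1 :- p) :* (v :^ 2 :* (con (ℤ.+ 64) :* (v :^ 2 :* p :^ 2 :+ v :* p))))
      := con (ℤ.+ 64) :* (v :^ 5 :* p :^ 3 :* (:1 :- p) :+ v :^ 4 :* p :^ 2 :* (:1 :- p))) (ν n) p))

    grow : ∀ {v t} → 1# ≤ v → 0# ≤ t → t ≤ v * t
    grow 1≤v 0≤t = ≤-trans (≤-reflexive (sym (*-identityˡ _))) (*-monoʳ-≤ 0≤t 1≤v)

    -- 2(z + 2)² ≥ z² - 8, so the main term of the slope survives for large n.
    ν*T₁≤ : ∀ {n} → fromℕ 6 ≤ ν n → ν n * T₁ n ≤ fromℕ 8 * (ν n * Var (Y {n})) + fromℕ 256 * T₂ n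
    ν*T₁≤ {n} 6≤v = *-cancelˡ-≤ (0<fromℕ 1) (begin
      fromℕ 2 * (v * T₁ n)
        ≤⟨ ≤-fromDifference (v * (fromℕ 2 * p ^ 3 * q * (rest * η ^ 2)))
             (0≤-* (0≤fromℕ n) (0≤-* (0≤-* (0≤-* (0≤fromℕ 2) (0≤-^ 3 0≤p)) 0≤q) (0≤-* 0≤rest (0≤x² η))))
             (solve 4 (λ v p q h → :2 :* (v :* (v :^ 6 :* p :^ 3 :* q :* h :^ 2)) :+ v :* (:2 :* p :^ 3 :* q :*
                 ((con (ℤ.+ 32) :* (v :* (v :- :1)) :* (v :- :2) :^ 2 :* (v :- con (ℤ.+ 3)) :^ 2 :- v :^ 6) :* h :^ 2))
               := v :* (con (ℤ.+ 64) :* p :^ 3 :* q :* ((v :^ 2 :- v) :* (v :- :2) :^ 2 :* ((v :- con (ℤ.+ 3)) :* h) :^ 2))) v p q η) ⟩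
      v * (fromℕ 64 * p ^ 3 * q * ((v ^ 2 - v) * (v - fromℕ 2) ^ 2 * z ^ 2))
        ≤⟨ ≤-fromDifference (v * (fromℕ 64 * p ^ 3 * q * (v * (v - 1#) * (v - fromℕ 2) ^ 2 * (z + fromℕ 4) ^ 2)))
             (0≤-* (0≤fromℕ n) (0≤-* (0≤-* (0≤-* (0≤fromℕ 64) (0≤-^ 3 0≤p)) 0≤q) (0≤-* (0≤-* (0≤-* (0≤fromℕ n) 0≤v-1) (0≤x² _)) (0≤x² _))))
             (solve 4 (λ v p q h → v :* (con (ℤ.+ 64) :* p :^ 3 :* q :* ((v :^ 2 :- v) :* (v :- :2) :^ 2 :* ((v :- con (ℤ.+ 3)) :* h) :^ 2))
                 :+ v :* (con (ℤ.+ 64) :* p :^ 3 :* q :* (v :* (v :- :1) :* (v :- :2) :^ 2 :* ((v :- con (ℤ.+ 3)) :* h :+ :4) :^ 2))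
               := v :* (con (ℤ.+ 8) :* (p :* q :* ((v :^ 2 :- v) :* (:4 :* p :* ((v :- :2) :* ((v :- con (ℤ.+ 3)) :* h :+ :2))) :^ 2)))
                 :+ con (ℤ.+ 512) :* (v :* (p :^ 3 :* q :* ((v :^ 2 :- v) :* (v :- :2) :^ 2)))) v p q η) ⟩
      v * (fromℕ 8 * (p * q * ((v ^ 2 - v) * (fromℕ 4 * p * ((v - fromℕ 2) * (z + fromℕ 2))) ^ 2)))
        + fromℕ 512 * (v * (p ^ 3 * q * ((v ^ 2 - v) * (v - fromℕ 2) ^ 2)))
        ≤⟨ +-mono-≤ (≤-reflexive (*-congˡ (*-congˡ (*-congˡ (*-congˡ (^-cong 2 (solve 2 (λ v p → :4 :* p :* ((v :- :2) :* ((v :- con (ℤ.+ 3)) :* (:1 :- :2 :* p :^ 2) :+ :2))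
               := :4 :* p :* ((v :- :2) :* (v :- :1 :- :2 :* ((v :- con (ℤ.+ 3)) :* p :^ 2)))) v p)))))))
             (*-monoˡ-≤ (0≤fromℕ 512) (≤-fromDifference (v ^ 2 * p ^ 3 * q * (fromℕ 5 * v * (v - fromℕ 6) + fromℕ 22 * v + fromℕ 4))
               (0≤-* (0≤-* (0≤ν^p {n} 2 3) 0≤q) (0≤-+ (0≤-+ (0≤-* (0≤-* (0≤fromℕ 5) (0≤fromℕ n)) 0≤v-6) (0≤-* (0≤fromℕ 22) (0≤fromℕ n))) (0≤fromℕ 4)))
               (solve 3 (λ v p q → v :* (p :^ 3 :* q :* ((v :^ 2 :- v) :* (v :- :2) :^ 2)) :+ v :^ 2 :* p :^ 3 :* q :* (con (ℤ.+ 5) :* v :* (v :- con (ℤ.+ 6)) :+ con (ℤ.+ 22) :* v :+ :4)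
                 := v :^ 5 :* p :^ 3 :* q) v p q))) ⟩
      v * (fromℕ 8 * (p * q * ((v ^ 2 - v) * meanSlope n ^ 2))) + fromℕ 512 * T₂ n
        ≤⟨ +-mono-≤ (*-monoˡ-≤ (0≤fromℕ n) (*-monoˡ-≤ (0≤fromℕ 8) Var-Y≥-linear)) ≤-refl ⟩
      v * (fromℕ 8 * (fromℕ 2 * Var (Y {n}))) + fromℕ 512 * T₂ n
        ≈⟨ solve 3 (λ v y t → v :* (:8 :* (:2 :* y)) :+ con (ℤ.+ 512) :* t := :2 :* (:8 :* (v :* y) :+ con (ℤ.+ 256) :* t)) v _ (T₂ n) ⟩
      fromℕ 2 * (fromℕ 8 * (v * Var (Y {n})) + fromℕ 256 * T₂ n) ∎)
      where
      open ≤-Reasoning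
      v z rest : ℝ
      v = ν n
      z = (v - fromℕ 3) * η
      rest = fromℕ 32 * (v * (v - 1#)) * (v - fromℕ 2) ^ 2 * (v - fromℕ 3) ^ 2 - v ^ 6
      0≤v-6 : 0# ≤ v - fromℕ 6
      0≤v-6 = x≤y⇒0≤y-x 6≤v
      0≤v-1 : 0# ≤ v - 1#
      0≤v-1 = ≤-trans (0≤-+ 0≤v-6 (0≤fromℕ 5)) (≤-reflexive (solve 1 (λ v → v :- con (ℤ.+ 6) :+ con (ℤ.+ 5) := v :- :1) v))
      half : ∀ {a} → v ≤ fromℕ 2 * a → 0# ≤ a → v ^ 2 ≤ fromℕ 4 * a ^ 2
      half h 0≤a = ≤-trans (^-mono-≤ 2 (0≤fromℕ n) h) (≤-reflexive (solve 1 (λ a → (:2 :* a) :^ 2 := :4 :* a :^ 2) _))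
      -- v - 1, v - 2 and v - 3 are at least v / 2.
      0≤rest : 0# ≤ rest
      0≤rest = x≤y⇒0≤y-x (begin
        v ^ 6
          ≈⟨ solve 1 (λ v → v :^ 6 := v :* v :* (v :^ 2 :* v :^ 2)) v ⟩
        v * v * (v ^ 2 * v ^ 2)
          ≤⟨ *-mono-≤ (0≤-* (0≤fromℕ n) (0≤fromℕ n)) (0≤-* (0≤x² v) (0≤x² v))
               (*-monoˡ-≤ (0≤fromℕ n) (≤-fromDifference ((v - fromℕ 6) + fromℕ 4) (0≤-+ 0≤v-6 (0≤fromℕ 4))
                 (solve 1 (λ v → v :+ ((v :- con (ℤ.+ 6)) :+ :4) := :2 :* (v :- :1)) v)))
               (*-mono-≤ (0≤x² v) (0≤x² v)
                 (half (≤-fromDifference ((v - fromℕ 6) + fromℕ 2) (0≤-+ 0≤v-6 (0≤fromℕ 2)) (solve 1 (λ v → v :+ ((v :- con (ℤ.+ 6)) :+ :2) := :2 :* (v :- :2)) v))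
                   (≤-trans (0≤-+ 0≤v-6 (0≤fromℕ 4)) (≤-reflexive (solve 1 (λ v → v :- con (ℤ.+ 6) :+ :4 := v :- :2) v))))
                 (half (≤-fromDifference (v - fromℕ 6) 0≤v-6 (solve 1 (λ v → v :+ (v :- con (ℤ.+ 6)) := :2 :* (v :- con (ℤ.+ 3))) v))
                   (≤-trans (0≤-+ 0≤v-6 (0≤fromℕ 3)) (≤-reflexive (solve 1 (λ v → v :- con (ℤ.+ 6) :+ con (ℤ.+ 3) := v :- con (ℤ.+ 3)) v))))) ⟩
        v * (fromℕ 2 * (v - 1#)) * (fromℕ 4 * (v - fromℕ 2) ^ 2 * (fromℕ 4 * (v - fromℕ 3) ^ 2))
          ≈⟨ solve 1 (λ v → v :* (:2 :* (v :- :1)) :* (:4 :* (v :- :2) :^ 2 :* (:4 :* (v :- con (ℤ.+ 3)) :^ 2))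
               := con (ℤ.+ 32) :* (v :* (v :- :1)) :* (v :- :2) :^ 2 :* (v :- con (ℤ.+ 3)) :^ 2) v ⟩
        fromℕ 32 * (v * (v - 1#)) * (v - fromℕ 2) ^ 2 * (v - fromℕ 3) ^ 2 ∎)

    T₂≤-middle : ∀ {n} → fromℕ 26 ≤ ν n → fromℕ 5 ≤ fromℕ 8 * p → fromℕ 5 * p ≤ fromℕ 4 → T₂ n ≤ fromℕ 4 * Var (Y {n})
    T₂≤-middle {n} 26≤v 5≤8p 5p≤4 = begin
      T₂ n
        ≤⟨ ≤-fromDifference (v ^ 5 * p ^ 2 * q * (fromℕ 4 - fromℕ 5 * p)) (0≤-* (0≤-* (0≤ν^p {n} 5 2) 0≤q) (x≤y⇒0≤y-x 5p≤4))
             (solve 2 (λ v p → v :^ 5 :* p :^ 3 :* (:1 :- p) :+ v :^ 5 :* p :^ 2 :* (:1 :- p) :* (:4 :- con (ℤ.+ 5) :* p)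
               := :4 :* ((p :* (:1 :- p)) :^ 2 :* v :^ 5)) v p) ⟩
      fromℕ 4 * ((p * q) ^ 2 * v ^ 5)
        ≤⟨ *-monoˡ-≤ (0≤fromℕ 4) (*-monoˡ-≤ (0≤x² _) (≤-fromDifference
             (v ^ 2 * (v ^ 2 * (fromℕ 3 * u + fromℕ 34) + fromℕ 90 * u + fromℕ 2288))
             (0≤-* (0≤x² v) (0≤-+ (0≤-+ (0≤-* (0≤x² v) (0≤-+ (0≤-* (0≤fromℕ 3) 0≤u) (0≤fromℕ 34))) (0≤-* (0≤fromℕ 90) 0≤u)) (0≤fromℕ 2288)))
             (solve 1 (λ v → v :^ 5 :+ v :^ 2 :* (v :^ 2 :* (con (ℤ.+ 3) :* (v :- con (ℤ.+ 26)) :+ con (ℤ.+ 34)) :+ con (ℤ.+ 90) :* (v :- con (ℤ.+ 26)) :+ con (ℤ.+ 2288))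
               := :2 :* v :* ((v :^ 2 :- v) :* (v :- :2) :* (con (ℤ.+ 3) :* (v :- con (ℤ.+ 3)) :- :4)) :- :2 :* v :^ 5) v))) ⟩
      fromℕ 4 * ((p * q) ^ 2 * (fromℕ 2 * v * ((v ^ 2 - v) * (v - fromℕ 2) * (fromℕ 3 * (v - fromℕ 3) - fromℕ 4)) - fromℕ 2 * v ^ 5))
        ≤⟨ *-monoˡ-≤ (0≤fromℕ 4) (*-monoˡ-≤ (0≤x² _) (+-mono-≤ (*-monoˡ-≤ (0≤-* (0≤fromℕ 2) (0≤fromℕ n)) (*-monoˡ-≤ 0≤N
             (+-mono-≤ (≤-trans (*-monoʳ-≤ 0≤v-3 3≤8p²) (≤-reflexive (*-assoc _ _ _))) ≤-refl))) ≤-refl)) ⟩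
      fromℕ 4 * ((p * q) ^ 2 * (fromℕ 2 * v * ((v ^ 2 - v) * (v - fromℕ 2) * (fromℕ 8 * (p ^ 2 * (v - fromℕ 3)) - fromℕ 4)) - fromℕ 2 * v ^ 5))
        ≤⟨ *-monoˡ-≤ (0≤fromℕ 4) Var-Y≥-quadratic ⟩
      fromℕ 4 * Var (Y {n}) ∎
      where
      open ≤-Reasoning
      v u : ℝ
      v = ν n
      u = v - fromℕ 26
      0≤u : 0# ≤ u
      0≤u = x≤y⇒0≤y-x 26≤v
      0≤v-3 : 0# ≤ v - fromℕ 3
      0≤v-3 = ≤-trans (0≤-+ 0≤u (0≤fromℕ 23)) (≤-reflexive (solve 1 (λ v → v :- con (ℤ.+ 26) :+ con (ℤ.+ 23) := v :- con (ℤ.+ 3)) v))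
      0≤N : 0# ≤ (v ^ 2 - v) * (v - fromℕ 2)
      0≤N = ≤-trans (0≤-* (0≤-* (0≤fromℕ n) (0≤-+ 0≤u (0≤fromℕ 25))) (0≤-+ 0≤u (0≤fromℕ 24)))
        (≤-reflexive (solve 1 (λ v → v :* (v :- con (ℤ.+ 26) :+ con (ℤ.+ 25)) :* (v :- con (ℤ.+ 26) :+ con (ℤ.+ 24)) := (v :^ 2 :- v) :* (v :- :2)) v))
      3≤8p² : fromℕ 3 ≤ fromℕ 8 * p ^ 2
      3≤8p² = *-cancelˡ-≤ (0<fromℕ 7) (≤-trans (≤-fromDifference 1# 0≤1 (solve 0 (:8 :* con (ℤ.+ 3) :+ :1 := con (ℤ.+ 5) :^ 2)))
        (≤-trans (^-mono-≤ 2 (0≤fromℕ 5) 5≤8p) (≤-reflexive (solve 1 (λ p → (:8 :* p) :^ 2 := :8 :* (:8 :* p :^ 2)) p))))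

    η²≥-low : fromℕ 8 * p ≤ fromℕ 5 → 1# ≤ fromℕ 25 * η ^ 2
    η²≥-low h = ≤-trans (≤-reflexive (solve 0 (:1 := :1 :^ 2))) (≤-trans (^-mono-≤ 2 0≤1 1≤5η)
      (≤-reflexive (solve 1 (λ h → (con (ℤ.+ 5) :* h) :^ 2 := con (ℤ.+ 25) :* h :^ 2) η)))
      where
      1≤5η : 1# ≤ fromℕ 5 * η
      1≤5η = *-cancelˡ-≤ (0<fromℕ 63) (≤-fromDifference (fromℕ 10 * (fromℕ 5 ^ 2 - (fromℕ 8 * p) ^ 2) + fromℕ 6)
        (0≤-+ (0≤-* (0≤fromℕ 10) (x≤y⇒0≤y-x (^-mono-≤ 2 (0≤-* (0≤fromℕ 8) 0≤p) h))) (0≤fromℕ 6))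
        (solve 1 (λ p → con (ℤ.+ 64) :* :1 :+ (con (ℤ.+ 10) :* (con (ℤ.+ 5) :^ 2 :- (:8 :* p) :^ 2) :+ con (ℤ.+ 6))
          := con (ℤ.+ 64) :* (con (ℤ.+ 5) :* (:1 :- :2 :* p :^ 2))) p))

    η²≥-high : fromℕ 4 ≤ fromℕ 5 * p → 1# ≤ fromℕ 25 * η ^ 2
    η²≥-high h = ≤-trans (≤-reflexive (solve 0 (:1 := :1 :^ 2))) (≤-trans (^-mono-≤ 2 0≤1 1≤-5η)
      (≤-reflexive (solve 1 (λ h → (con (ℤ.+ 5) :* (:- h)) :^ 2 := con (ℤ.+ 25) :* h :^ 2) η)))
      where
      1≤-5η : 1# ≤ fromℕ 5 * (- η)
      1≤-5η = *-cancelˡ-≤ (0<fromℕ 24) (≤-fromDifference (fromℕ 10 * ((fromℕ 5 * p) ^ 2 - fromℕ 4 ^ 2) + fromℕ 10)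
        (0≤-+ (0≤-* (0≤fromℕ 10) (x≤y⇒0≤y-x (^-mono-≤ 2 (0≤fromℕ 4) h))) (0≤fromℕ 10))
        (solve 1 (λ p → con (ℤ.+ 25) :* :1 :+ (con (ℤ.+ 10) :* ((con (ℤ.+ 5) :* p) :^ 2 :- :4 :^ 2) :+ con (ℤ.+ 10))
          := con (ℤ.+ 25) :* (con (ℤ.+ 5) :* (:- (:1 :- :2 :* p :^ 2)))) p))

    η²≤1 : η ^ 2 ≤ 1#
    η²≤1 = ≤-fromDifference (fromℕ 4 * p ^ 2 * (q * (1# + p)))
      (0≤-* (0≤-* (0≤fromℕ 4) (0≤x² p)) (0≤-* 0≤q (0≤-+ 0≤1 0≤p)))
      (solve 1 (λ p → (:1 :- :2 :* p :^ 2) :^ 2 :+ :4 :* p :^ 2 :* ((:1 :- p) :* (:1 :+ p)) := :1) p)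

    module _ {n} (K : Graph n → ℕ) (2K≈ : ∀ G → fromℕ 2 * fromℕ (K G) ≈ Y G + fromℕ 2 * U G) where

      private
        v X VY VU : ℝ
        v = ν n
        X  = Var (λ G → fromℕ (K G))
        VY = Var (Y {n})
        VU = Var (U {n})

        0≤X : 0# ≤ X
        0≤X = 0≤Var _

        4X≤ : fromℕ 4 * X ≤ fromℕ 2 * VY + fromℕ 8 * VU
        4X≤ = begin
          fromℕ 4 * X
            ≈⟨ trans (*-congʳ (solve 0 (:4 := :2 :^ 2))) (sym (Var-* (fromℕ 2) _)) ⟩
          Var (λ G → fromℕ 2 * fromℕ (K G))
            ≈⟨ Var-cong 2K≈ ⟩
          Var (λ G → Y G + fromℕ 2 * U G)
            ≤⟨ Var-+-≤ Y (λ G → fromℕ 2 * U G) ⟩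
          fromℕ 2 * VY + fromℕ 2 * Var (λ G → fromℕ 2 * U G)
            ≈⟨ +-congˡ (trans (*-congˡ (Var-* (fromℕ 2) U)) (solve 1 (λ u → :2 :* (:2 :^ 2 :* u) := :8 :* u) VU)) ⟩
          fromℕ 2 * VY + fromℕ 8 * VU ∎
          where open ≤-Reasoning

        VY≤ : VY ≤ fromℕ 8 * X + fromℕ 8 * VU
        VY≤ = begin
          VY
            ≈⟨ Var-cong (λ G → trans (solve 2 (λ y u → y := (y :+ :2 :* u) :+ (:- :2) :* u) (Y G) (U G)) (+-congʳ (sym (2K≈ G)))) ⟩
          Var (λ G → fromℕ 2 * fromℕ (K G) + (- fromℕ 2) * U G)
            ≤⟨ Var-+-≤ (λ G → fromℕ 2 * fromℕ (K G)) (λ G → (- fromℕ 2) * U G) ⟩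
          fromℕ 2 * Var (λ G → fromℕ 2 * fromℕ (K G)) + fromℕ 2 * Var (λ G → (- fromℕ 2) * U G)
            ≈⟨ +-cong (*-congˡ (Var-* (fromℕ 2) _)) (*-congˡ (Var-* (- fromℕ 2) U)) ⟩
          fromℕ 2 * (fromℕ 2 ^ 2 * X) + fromℕ 2 * ((- fromℕ 2) ^ 2 * VU)
            ≈⟨ solve 2 (λ x u → :2 :* (:2 :^ 2 :* x) :+ :2 :* ((:- :2) :^ 2 :* u) := :8 :* x :+ :8 :* u) X VU ⟩
          fromℕ 8 * X + fromℕ 8 * VU ∎
          where open ≤-Reasoning

      Var-K≤ : 1# ≤ v → X ≤ upperConstant * (T₁ n + T₂ n + T₃ n)
      Var-K≤ 1≤v = begin
        X
          ≤⟨ ≤-fromDifference (fromℕ 3 * X) (0≤-* (0≤fromℕ 3) 0≤X) (solve 1 (λ x → x :+ con (ℤ.+ 3) :* x := :4 :* x) X) ⟩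
        fromℕ 4 * X
          ≤⟨ 4X≤ ⟩
        fromℕ 2 * VY + fromℕ 8 * VU
          ≤⟨ +-mono-≤ (*-monoˡ-≤ (0≤fromℕ 2) Var-Y≤T) (*-monoˡ-≤ (0≤fromℕ 8) (≤-trans (grow 1≤v (0≤Var U)) ν*Var-U≤)) ⟩
        fromℕ 2 * (fromℕ 32 * T₁ n + fromℕ 2 * C₁ * (T₂ n + T₃ n)) + fromℕ 8 * (fromℕ 64 * (T₂ n + T₃ n))
          ≤⟨ ≤-fromDifference (fromℕ 512 * T₁ n + fromℕ 4 * C₁ * T₁ n + fromℕ 64 * (T₂ n + T₃ n))
               (0≤-+ (0≤-+ (0≤-* (0≤fromℕ 512) (0≤T₁ n)) (0≤-* (0≤-* (0≤fromℕ 4) 0≤C₁) (0≤T₁ n))) (0≤-* (0≤fromℕ 64) (0≤-+ (0≤T₂ n) (0≤T₃ n))))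
               (solve 4 (λ a b c k → :2 :* (con (ℤ.+ 32) :* a :+ :2 :* k :* (b :+ c)) :+ :8 :* (con (ℤ.+ 64) :* (b :+ c))
                  :+ (con (ℤ.+ 512) :* a :+ :4 :* k :* a :+ con (ℤ.+ 64) :* (b :+ c)) := (con (ℤ.+ 576) :+ :4 :* k) :* (a :+ b :+ c)) (T₁ n) (T₂ n) (T₃ n) C₁) ⟩
        upperConstant * (T₁ n + T₂ n + T₃ n) ∎
        where open ≤-Reasoning

      -- v a ≤ v b + c a with v ≥ 2c gives a ≤ 2b.
      absorb : ∀ {a b c} → 0# < v → 0# ≤ a → fromℕ 2 * c ≤ v → v * a ≤ v * b + c * a → a ≤ fromℕ 2 * b
      absorb {a} {b} {c} 0<v 0≤a h l = *-cancelˡ-≤ 0<v (≤-fromDifference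
        (fromℕ 2 * (v * b + c * a - v * a) + (v - fromℕ 2 * c) * a)
        (0≤-+ (0≤-* (0≤fromℕ 2) (x≤y⇒0≤y-x l)) (0≤-* (x≤y⇒0≤y-x h) 0≤a))
        (solve 4 (λ v a b c → v :* a :+ (:2 :* (v :* b :+ c :* a :- v :* a) :+ (v :- :2 :* c) :* a) := v :* (:2 :* b)) v a b c))

      private
        v*VY≤ : v * VY ≤ fromℕ 8 * (v * X) + fromℕ 512 * (T₂ n + T₃ n)
        v*VY≤ = begin
          v * VY
            ≤⟨ *-monoˡ-≤ (0≤fromℕ n) VY≤ ⟩
          v * (fromℕ 8 * X + fromℕ 8 * VU)
            ≈⟨ solve 3 (λ v x u → v :* (:8 :* x :+ :8 :* u) := :8 :* (v :* x) :+ :8 :* (v :* u)) v X VU ⟩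
          fromℕ 8 * (v * X) + fromℕ 8 * (v * VU)
            ≤⟨ +-mono-≤ ≤-refl (*-monoˡ-≤ (0≤fromℕ 8) ν*Var-U≤) ⟩
          fromℕ 8 * (v * X) + fromℕ 8 * (fromℕ 64 * (T₂ n + T₃ n))
            ≈⟨ +-congˡ (solve 1 (λ t → :8 :* (con (ℤ.+ 64) :* t) := con (ℤ.+ 512) :* t) _) ⟩
          fromℕ 8 * (v * X) + fromℕ 512 * (T₂ n + T₃ n) ∎
          where open ≤-Reasoning

      module Large (large : threshold ≤ v) where

        private
          split : fromℕ 2 * (fromℕ 4352 * fromℕ 75) ≤ v × fromℕ 2 * fromℕ 6144 ≤ v × fromℕ 26 ≤ v
          split = ≤-trans (≤-fromDifference _ (0≤-+ 0≤b 0≤c) (sym (+-assoc a b c))) large ,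
                  ≤-trans (≤-fromDifference (a + c) (0≤-+ 0≤a 0≤c) (solve 3 (λ a b c → b :+ (a :+ c) := a :+ b :+ c) a b c)) large ,
                  ≤-trans (≤-fromDifference (a + b) (0≤-+ 0≤a 0≤b) (+-comm _ _)) large
            where
            a b c : ℝ
            a = fromℕ 2 * (fromℕ 4352 * fromℕ 75)
            b = fromℕ 2 * fromℕ 6144
            c = fromℕ 26
            0≤a : 0# ≤ a
            0≤a = 0≤-* (0≤fromℕ 2) (0≤-* (0≤fromℕ 4352) (0≤fromℕ 75))
            0≤b : 0# ≤ b
            0≤b = 0≤-* (0≤fromℕ 2) (0≤fromℕ 6144)
            0≤c : 0# ≤ c
            0≤c = 0≤fromℕ 26

          26≤v : fromℕ 26 ≤ v
          26≤v = proj₂ (proj₂ split)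

          below26 : ∀ k l → k ℕ.+ l ≡ 26 → fromℕ k ≤ v
          below26 k l e = ≤-trans (fromℕ-mono-≤ (ℕ.≤-trans (ℕ.m≤m+n k l) (ℕ.≤-reflexive e))) 26≤v
            where import Data.Nat.Properties as ℕ

          1≤v : 1# ≤ v
          1≤v = ≤-trans (1≤fromℕ 25) 26≤v

          0<v : 0# < v
          0<v = <-≤-trans 0<1 1≤v

        -- η is bounded away from 0 and n²p away from 0.
        linearRegime : 1# ≤ fromℕ 25 * η ^ 2 → 1# ≤ fromℕ 2 * (v ^ 2 * p) → T₁ n + T₂ n + T₃ n ≤ fromℕ 76 * fromℕ 128 * X
        linearRegime hη hp = begin
          T₁ n + T₂ n + T₃ n
            ≤⟨ +-mono-≤ (+-mono-≤ ≤-refl T₂≤) T₃≤ ⟩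
          T₁ n + fromℕ 25 * T₁ n + fromℕ 50 * T₁ n
            ≈⟨ solve 1 (λ t → t :+ con (ℤ.+ 25) :* t :+ con (ℤ.+ 50) :* t := con (ℤ.+ 76) :* t) (T₁ n) ⟩
          fromℕ 76 * T₁ n
            ≤⟨ *-monoˡ-≤ (0≤fromℕ 76) (≤-trans (absorb 0<v (0≤T₁ n) (proj₁ split) main)
                 (≤-reflexive (solve 1 (λ x → :2 :* (con (ℤ.+ 64) :* x) := con (ℤ.+ 128) :* x) X))) ⟩
          fromℕ 76 * (fromℕ 128 * X)
            ≈⟨ *-assoc _ _ _ ⟨
          fromℕ 76 * fromℕ 128 * X ∎
          where
          open ≤-Reasoning
          v⁶ : ℝ
          v⁶ = v ^ 6 * p ^ 3 * q
          v⁶≤ : v⁶ ≤ fromℕ 25 * T₁ n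
          v⁶≤ = ≤-trans (≤-reflexive (sym (*-identityʳ v⁶))) (≤-trans (*-monoˡ-≤ (0≤-* (0≤ν^p {n} 6 3) 0≤q) hη)
            (≤-reflexive (solve 2 (λ a h → a :* (con (ℤ.+ 25) :* h) := con (ℤ.+ 25) :* (a :* h)) v⁶ (η ^ 2))))
          T₂≤ : T₂ n ≤ fromℕ 25 * T₁ n
          T₂≤ = ≤-trans (grow 1≤v (0≤T₂ n)) (≤-trans (≤-reflexive (solve 3 (λ v p q → v :* (v :^ 5 :* p :^ 3 :* q) := v :^ 6 :* p :^ 3 :* q) v p q)) v⁶≤)
          T₃≤ : T₃ n ≤ fromℕ 50 * T₁ n
          T₃≤ = ≤-trans (grow hp (0≤T₃ n)) (≤-trans (≤-reflexive (solve 3 (λ v p q → :2 :* (v :^ 2 :* p) :* (v :^ 4 :* p :^ 2 :* q) := :2 :* (v :^ 6 :* p :^ 3 :* q)) v p q))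
            (≤-trans (*-monoˡ-≤ (0≤fromℕ 2) v⁶≤) (≤-reflexive (solve 1 (λ t → :2 :* (con (ℤ.+ 25) :* t) := con (ℤ.+ 50) :* t) (T₁ n)))))
          main : v * T₁ n ≤ v * (fromℕ 64 * X) + fromℕ 4352 * fromℕ 75 * T₁ n
          main = begin
            v * T₁ n
              ≤⟨ ν*T₁≤ (below26 6 20 ≡.refl) ⟩
            fromℕ 8 * (v * VY) + fromℕ 256 * T₂ n
              ≤⟨ +-mono-≤ (*-monoˡ-≤ (0≤fromℕ 8) v*VY≤) ≤-refl ⟩
            fromℕ 8 * (fromℕ 8 * (v * X) + fromℕ 512 * (T₂ n + T₃ n)) + fromℕ 256 * T₂ n
              ≤⟨ ≤-fromDifference (fromℕ 256 * T₃ n) (0≤-* (0≤fromℕ 256) (0≤T₃ n))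
                   (solve 4 (λ v x b c → :8 :* (:8 :* (v :* x) :+ con (ℤ.+ 512) :* (b :+ c)) :+ con (ℤ.+ 256) :* b :+ con (ℤ.+ 256) :* c
                     := v :* (con (ℤ.+ 64) :* x) :+ con (ℤ.+ 4352) :* (b :+ c)) v X (T₂ n) (T₃ n)) ⟩
            v * (fromℕ 64 * X) + fromℕ 4352 * (T₂ n + T₃ n)
              ≤⟨ +-mono-≤ ≤-refl (*-monoˡ-≤ (0≤fromℕ 4352) (+-mono-≤ T₂≤ T₃≤)) ⟩
            v * (fromℕ 64 * X) + fromℕ 4352 * (fromℕ 25 * T₁ n + fromℕ 50 * T₁ n)
              ≈⟨ +-congˡ (trans (*-congˡ (solve 1 (λ t → con (ℤ.+ 25) :* t :+ con (ℤ.+ 50) :* t := con (ℤ.+ 75) :* t) (T₁ n))) (sym (*-assoc _ _ _))) ⟩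
            v * (fromℕ 64 * X) + fromℕ 4352 * fromℕ 75 * T₁ n ∎

        -- η may vanish here; the adjacent pairs of arcs give the variance.
        quadraticRegime : fromℕ 5 ≤ fromℕ 8 * p → fromℕ 5 * p ≤ fromℕ 4 → T₁ n + T₂ n + T₃ n ≤ fromℕ 16704 * X
        quadraticRegime 5≤8p 5p≤4 = begin
          T₁ n + T₂ n + T₃ n
            ≤⟨ +-mono-≤ (+-mono-≤ T₁≤ ≤-refl) T₃≤ ⟩
          fromℕ 8 * VY + fromℕ 256 * T₂ n + T₂ n + fromℕ 2 * T₂ n
            ≈⟨ solve 2 (λ y t → :8 :* y :+ con (ℤ.+ 256) :* t :+ t :+ :2 :* t := :8 :* y :+ con (ℤ.+ 259) :* t) VY (T₂ n) ⟩
          fromℕ 8 * VY + fromℕ 259 * T₂ n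
            ≤⟨ +-mono-≤ ≤-refl (*-monoˡ-≤ (0≤fromℕ 259) T₂≤) ⟩
          fromℕ 8 * VY + fromℕ 259 * (fromℕ 4 * VY)
            ≈⟨ solve 1 (λ y → :8 :* y :+ con (ℤ.+ 259) :* (:4 :* y) := con (ℤ.+ 1044) :* y) VY ⟩
          fromℕ 1044 * VY
            ≤⟨ *-monoˡ-≤ (0≤fromℕ 1044) (absorb 0<v (0≤Var Y) (proj₁ (proj₂ split)) main) ⟩
          fromℕ 1044 * (fromℕ 2 * (fromℕ 8 * X))
            ≈⟨ solve 1 (λ x → con (ℤ.+ 1044) :* (:2 :* (:8 :* x)) := con (ℤ.+ 16704) :* x) X ⟩
          fromℕ 16704 * X ∎
          where
          open ≤-Reasoning
          T₂≤ : T₂ n ≤ fromℕ 4 * VY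
          T₂≤ = T₂≤-middle 26≤v 5≤8p 5p≤4
          1≤2p : 1# ≤ fromℕ 2 * p
          1≤2p = *-cancelˡ-≤ (0<fromℕ 3) (≤-trans (≤-fromDifference 1# 0≤1 (solve 0 (:4 :* :1 :+ :1 := con (ℤ.+ 5))))
            (≤-trans 5≤8p (≤-reflexive (solve 1 (λ p → :8 :* p := :4 :* (:2 :* p)) p))))
          T₃≤ : T₃ n ≤ fromℕ 2 * T₂ n
          T₃≤ = ≤-trans (grow 1≤v (0≤T₃ n)) (≤-trans (grow 1≤2p (0≤-* (0≤fromℕ n) (0≤T₃ n)))
            (≤-reflexive (solve 3 (λ v p q → :2 :* p :* (v :* (v :^ 4 :* p :^ 2 :* q)) := :2 :* (v :^ 5 :* p :^ 3 :* q)) v p q)))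
          T₁≤ : T₁ n ≤ fromℕ 8 * VY + fromℕ 256 * T₂ n
          T₁≤ = *-cancelˡ-≤ 0<v (≤-trans (ν*T₁≤ (below26 6 20 ≡.refl)) (≤-trans (+-mono-≤ ≤-refl (grow 1≤v (0≤-* (0≤fromℕ 256) (0≤T₂ n))))
            (≤-reflexive (solve 3 (λ v y t → :8 :* (v :* y) :+ v :* t := v :* (:8 :* y :+ t)) v VY _))))
          main : v * VY ≤ v * (fromℕ 8 * X) + fromℕ 6144 * VY
          main = begin
            v * VY
              ≤⟨ v*VY≤ ⟩
            fromℕ 8 * (v * X) + fromℕ 512 * (T₂ n + T₃ n)
              ≤⟨ +-mono-≤ ≤-refl (*-monoˡ-≤ (0≤fromℕ 512) (+-mono-≤ T₂≤ (≤-trans T₃≤ (*-monoˡ-≤ (0≤fromℕ 2) T₂≤)))) ⟩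
            fromℕ 8 * (v * X) + fromℕ 512 * (fromℕ 4 * VY + fromℕ 2 * (fromℕ 4 * VY))
              ≈⟨ solve 3 (λ v x y → :8 :* (v :* x) :+ con (ℤ.+ 512) :* (:4 :* y :+ :2 :* (:4 :* y)) := v :* (:8 :* x) :+ con (ℤ.+ 6144) :* y) v X VY ⟩
            v * (fromℕ 8 * X) + fromℕ 6144 * VY ∎

        sparseRegime : fromℕ 2 * (v ^ 2 * p) ≤ 1# → T₁ n + T₂ n + T₃ n ≤ fromℕ 24 * X
        sparseRegime h = begin
          T₁ n + T₂ n + T₃ n
            ≤⟨ +-mono-≤ (+-mono-≤ T₁≤ T₂≤) T₃≤ ⟩
          v ^ 4 * p ^ 2 + v ^ 4 * p ^ 2 + v ^ 4 * p ^ 2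
            ≈⟨ solve 1 (λ t → t :+ t :+ t := con (ℤ.+ 3) :* t) _ ⟩
          fromℕ 3 * (v ^ 4 * p ^ 2)
            ≤⟨ *-monoˡ-≤ (0≤fromℕ 3) (Var-K≥-sparse K 2K≈ (below26 10 16 ≡.refl) h) ⟩
          fromℕ 3 * (fromℕ 8 * X)
            ≈⟨ solve 1 (λ x → con (ℤ.+ 3) :* (:8 :* x) := con (ℤ.+ 24) :* x) X ⟩
          fromℕ 24 * X ∎
          where
          open ≤-Reasoning
          t : ℝ
          t = v ^ 4 * p ^ 2
          0≤t : 0# ≤ t
          0≤t = 0≤ν^p {n} 4 2
          v²p≤1 : v ^ 2 * p ≤ 1#
          v²p≤1 = ≤-trans (≤-fromDifference _ (0≤-* (0≤x² v) 0≤p) (solve 1 (λ t → t :+ t := :2 :* t) (v ^ 2 * p))) h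
          shrink : ∀ {a b} → 0# ≤ b → a ≤ 1# → a * b ≤ b
          shrink 0≤b l = ≤-trans (*-monoʳ-≤ 0≤b l) (≤-reflexive (*-identityˡ _))
          q≤1 : q ≤ 1#
          q≤1 = ≤-fromDifference p 0≤p (solve 1 (λ p → :1 :- p :+ p := :1) p)
          T₃≤ : T₃ n ≤ t
          T₃≤ = ≤-trans (≤-reflexive (*-comm _ _)) (shrink 0≤t q≤1)
          T₁≤ : T₁ n ≤ t
          T₁≤ = ≤-trans (≤-reflexive (solve 4 (λ v p q h → v :^ 6 :* p :^ 3 :* q :* h := h :* (q :* (v :^ 2 :* p :* (v :^ 4 :* p :^ 2)))) v p q (η ^ 2)))
            (≤-trans (shrink (0≤-* 0≤q (0≤-* (0≤-* (0≤x² v) 0≤p) 0≤t)) η²≤1) (≤-trans (shrink (0≤-* (0≤-* (0≤x² v) 0≤p) 0≤t) q≤1) (shrink 0≤t v²p≤1)))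
          T₂≤ : T₂ n ≤ t
          T₂≤ = ≤-trans (grow 1≤v (0≤T₂ n)) (≤-trans (≤-reflexive (solve 3 (λ v p q → v :* (v :^ 5 :* p :^ 3 :* q) := q :* (v :^ 2 :* p :* (v :^ 4 :* p :^ 2))) v p q))
            (≤-trans (shrink (0≤-* (0≤-* (0≤x² v) 0≤p) 0≤t) q≤1) (shrink 0≤t v²p≤1)))

        Var-K≥ : T₁ n + T₂ n + T₃ n ≤ lowerConstant * X
        Var-K≥ = ≤-byCases (fromℕ 2 * (v ^ 2 * p)) 1#
          (λ h → ≤-trans (sparseRegime (<⇒≤ h)) (weaken₃))
          (λ h → ≤-byCases (fromℕ 8 * p) (fromℕ 5)
            (λ l → ≤-trans (linearRegime (η²≥-low (<⇒≤ l)) h) weaken₁)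
            (λ 5≤8p → ≤-byCases (fromℕ 4) (fromℕ 5 * p)
              (λ l → ≤-trans (linearRegime (η²≥-high (<⇒≤ l)) h) weaken₁)
              (λ 5p≤4 → ≤-trans (quadraticRegime 5≤8p 5p≤4) weaken₂)))
          where
          a b c : ℝ
          a = fromℕ 76 * fromℕ 128
          b = fromℕ 16704
          c = fromℕ 24
          0≤a : 0# ≤ a
          0≤a = 0≤-* (0≤fromℕ 76) (0≤fromℕ 128)
          weaken₁ : a * X ≤ (a + b + c) * X
          weaken₁ = *-monoʳ-≤ 0≤X (≤-fromDifference _ (0≤-+ (0≤fromℕ 16704) (0≤fromℕ 24)) (sym (+-assoc a b c)))
          weaken₂ : b * X ≤ (a + b + c) * X
          weaken₂ = *-monoʳ-≤ 0≤X (≤-fromDifference (a + c) (0≤-+ 0≤a (0≤fromℕ 24)) (solve 3 (λ a b c → b :+ (a :+ c) := a :+ b :+ c) a b c))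
          weaken₃ : c * X ≤ (a + b + c) * X
          weaken₃ = *-monoʳ-≤ 0≤X (≤-fromDifference (a + b) (0≤-+ 0≤a (0≤fromℕ 16704)) (+-comm _ _))

  ∣x∣≈x : ∀ {x} → 0# ≤ x → ∣ x ∣ ≈ x
  ∣x∣≈x {x} 0≤x = ≤-antisym
    (proj₂ (proj₂ (⊔-supremum x (- x))) x ≤-refl (≤-trans (neg-mono-≤ 0≤x) (≤-trans (≤-reflexive -0#≈0#) 0≤x)))
    (proj₁ (⊔-supremum x (- x)))

  positive⇒# : ∀ {x} → 0# < x → x # 0#
  positive⇒# 0<x = #-sym (<⇒# 0<x)

  ≃-fromBounds : ∀ {a b : Sequence} c C N → 0# < c →
    (∀ n → N ℕ.≤ n → 0# < b n × 0# ≤ a n × b n ≤ c * a n × a n ≤ C * b n) → a ≃ b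
  ≃-fromBounds {a} {b} c C N 0<c h = inverse c#0 , C , 0<inverse c#0 0<c , N , λ n N≤n → bounds n (h n N≤n)
    where
    c#0 : c # 0#
    c#0 = positive⇒# 0<c
    bounds : ∀ n → 0# < b n × 0# ≤ a n × b n ≤ c * a n × a n ≤ C * b n →
      Σ (b n # 0#) λ b#0 → inverse c#0 ≤ ∣ a n * inverse b#0 ∣ × ∣ a n * inverse b#0 ∣ ≤ C
    bounds n (0<b , 0≤a , b≤ca , a≤Cb) = b#0 ,
      *-cancelˡ-≤ 0<c (begin
        c * inverse c#0          ≈⟨ trans (inverseʳ c#0) (sym (inverseʳ b#0)) ⟩
        b n * b⁻¹                ≤⟨ *-monoʳ-≤ 0≤b⁻¹ b≤ca ⟩
        c * a n * b⁻¹            ≈⟨ trans (*-assoc c (a n) b⁻¹) (*-congˡ (sym (∣x∣≈x 0≤r))) ⟩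
        c * ∣ a n * b⁻¹ ∣        ∎) ,
      (begin
        ∣ a n * b⁻¹ ∣            ≈⟨ ∣x∣≈x 0≤r ⟩
        a n * b⁻¹                ≤⟨ *-monoʳ-≤ 0≤b⁻¹ a≤Cb ⟩
        C * b n * b⁻¹            ≈⟨ trans (*-assoc C (b n) b⁻¹) (trans (*-congˡ (inverseʳ b#0)) (*-identityʳ C)) ⟩
        C                        ∎)
      where
      open ≤-Reasoning
      b#0 : b n # 0#
      b#0 = positive⇒# 0<b
      b⁻¹ : ℝ
      b⁻¹ = inverse b#0
      0≤b⁻¹ : 0# ≤ b⁻¹
      0≤b⁻¹ = <⇒≤ (0<inverse b#0 0<b)
      0≤r : 0# ≤ a n * b⁻¹
      0≤r = 0≤-* 0≤a 0≤b⁻¹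

  n^k*n^-k≈1 : ∀ k n → fromℕ (suc n) ^ k * (n^- k) (suc n) ≈ 1#
  n^k*n^-k≈1 k n = inverseʳ _

  0<n^-k : ∀ k n → 0# < (n^- k) (suc n)
  0<n^-k k n = 0<inverse _ (0<-^ k (0<fromℕ n))

  ratio≈ : ∀ k n {x} → 0# ≤ x → (b#0 : (n^- k) (suc n) # 0#) → ∣ x * inverse b#0 ∣ ≈ fromℕ (suc n) ^ k * x
  ratio≈ k n {x} 0≤x b#0 = trans (∣x∣≈x (0≤-* 0≤x (<⇒≤ (0<inverse b#0 (0<n^-k k n))))) (begin
    x * b⁻¹                  ≈⟨ *-identityˡ _ ⟨
    1# * (x * b⁻¹)           ≈⟨ *-congʳ (n^k*n^-k≈1 k n) ⟨
    v * b * (x * b⁻¹)        ≈⟨ solve 4 (λ v b x i → v :* b :* (x :* i) := v :* x :* (b :* i)) v b x b⁻¹ ⟩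
    v * x * (b * b⁻¹)        ≈⟨ trans (*-congˡ (inverseʳ b#0)) (*-identityʳ _) ⟩
    v * x                    ∎)
    where
    open ≈-Reasoning
    b b⁻¹ v : ℝ
    b = (n^- k) (suc n)
    b⁻¹ = inverse b#0
    v = fromℕ (suc n) ^ k

  ≫⇒ : ∀ {a : Sequence} k → (∀ n → 0# ≤ a n) → a ≫ (n^- k) →
    ∀ M → ∃[ N ] (∀ n → N ℕ.≤ n → M ≤ fromℕ n ^ k * a n)
  ≫⇒ {a} k 0≤a h M with h M
  ... | N , f = suc N , λ { (suc n) (ℕ.s≤s N≤n) → ≤-trans (proj₂ (f (suc n) (ℕ.m≤n⇒m≤1+n N≤n)))
          (≤-reflexive (ratio≈ k n (0≤a (suc n)) _)) }

  ⇒≫ : ∀ {a : Sequence} k → (∀ n → 0# ≤ a n) →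
    (∀ M → ∃[ N ] (∀ n → N ℕ.≤ n → M ≤ fromℕ n ^ k * a n)) → a ≫ (n^- k)
  ⇒≫ {a} k 0≤a h M with h M
  ... | N , f = suc N , λ { (suc n) (ℕ.s≤s N≤n) → positive⇒# (0<n^-k k n) ,
          ≤-trans (f (suc n) (ℕ.m≤n⇒m≤1+n N≤n)) (≤-reflexive (sym (ratio≈ k n (0≤a (suc n)) _))) }

  ≲⇒ : ∀ {a : Sequence} k → (∀ n → 0# ≤ a n) → a ≲ (n^- k) →
    ∃[ C ] ∃[ N ] (∀ n → N ℕ.≤ n → fromℕ n ^ k * a n ≤ C)
  ≲⇒ {a} k 0≤a (C , N , f) = C , suc N , λ { (suc n) (ℕ.s≤s N≤n) →
    ≤-trans (≤-reflexive (sym (ratio≈ k n (0≤a (suc n)) _))) (proj₂ (f (suc n) (ℕ.m≤n⇒m≤1+n N≤n))) }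

  eventually≥ : ∀ x → ∃[ N ] (∀ n → N ℕ.≤ n → x ≤ fromℕ n)
  eventually≥ x with archimedean x
  ... | N , x<N = N , λ n N≤n → ≤-trans (<⇒≤ x<N) (fromℕ-mono-≤ N≤n)

  infixr 5 _and_
  _and_ : ∀ {P Q : ℕ → Set} → ∃[ N ] (∀ n → N ℕ.≤ n → P n) → ∃[ N ] (∀ n → N ℕ.≤ n → Q n) →
    ∃[ N ] (∀ n → N ℕ.≤ n → P n × Q n)
  (N₁ , f) and (N₂ , g) = N₁ ℕ.⊔ N₂ , λ n h → f n (ℕ.m⊔n≤o⇒m≤o N₁ N₂ h) , g n (ℕ.m⊔n≤o⇒n≤o N₁ N₂ h)

  infixr 4 _eventually⇒_
  _eventually⇒_ : ∀ {P Q : ℕ → Set} → ∃[ N ] (∀ n → N ℕ.≤ n → P n) → (∀ n → P n → Q n) → ∃[ N ] (∀ n → N ℕ.≤ n → Q n)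
  (N , f) eventually⇒ g = N , λ n h → g n (f n h)

  x≤x²+1 : ∀ x → x ≤ x ^ 2 + 1#
  x≤x²+1 x = *-cancelˡ-≤ (0<fromℕ 1) (≤-fromDifference (x ^ 2 + (x - 1#) ^ 2 + 1#) (0≤-+ (0≤-+ (0≤x² x) (0≤x² _)) 0≤1)
    (solve 1 (λ x → :2 :* x :+ (x :^ 2 :+ (x :- :1) :^ 2 :+ :1) := :2 :* (x :^ 2 :+ :1)) x))

  module _ (√2 : ℝ) (0<√2 : 0# < √2) (√2² : √2 ^ 2 ≈ fromℕ 2)
    (K : ∀ n → Graph n → ℕ) (2K≈ : ∀ {n} (G : Graph n) → fromℕ 2 * fromℕ (K n G) ≈ Y G + fromℕ 2 * U G)
    (p : Sequence) (0<p<1 : ∀ n → 0# < p n × p n < 1#) where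

    private
      module B n = Probability (p n) (<⇒≤ (proj₁ (0<p<1 n))) (<⇒≤ (proj₂ (0<p<1 n)))

      𝕍K : Sequence
      𝕍K n = 𝕍 (p n) (λ (G : Graph n) → fromℕ (K n G))

      v q θ η τ₁ τ₂ τ₃ t₁ : Sequence
      v n = fromℕ n
      q n = 1# - p n
      θ n = 1# - √2 * p n
      η n = 1# - fromℕ 2 * p n ^ 2
      τ₁ n = v n ^ 6 * p n ^ 3 * q n * θ n ^ 2
      τ₂ n = v n ^ 5 * p n ^ 3 * q n
      τ₃ n = v n ^ 4 * p n ^ 2 * q n
      t₁ n = v n ^ 6 * p n ^ 3 * q n * η n ^ 2

      0<p : ∀ n → 0# < p n
      0<p n = proj₁ (0<p<1 n)
      0≤p : ∀ n → 0# ≤ p n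
      0≤p n = <⇒≤ (0<p n)
      p≤1 : ∀ n → p n ≤ 1#
      p≤1 n = <⇒≤ (proj₂ (0<p<1 n))
      0<q : ∀ n → 0# < q n
      0<q n = x<y⇒0<y-x (proj₂ (0<p<1 n))
      0≤q : ∀ n → 0# ≤ q n
      0≤q n = <⇒≤ (0<q n)
      0≤v : ∀ n → 0# ≤ v n
      0≤v = 0≤fromℕ

      √2≤2 : √2 ≤ fromℕ 2
      √2≤2 2<√2 = ≤-trans (^-mono-≤ 2 (0≤fromℕ 2) (<⇒≤ 2<√2)) (≤-reflexive √2²)
        (<-fromDifference (fromℕ 2) (0<fromℕ 1) (solve 0 (:2 :+ :2 := :2 :^ 2)))

      η≈θ* : ∀ n → η n ≈ θ n * (1# + √2 * p n)
      η≈θ* n = trans (+-congˡ (-‿cong (*-congʳ (sym √2²)))) (solve 2 (λ r p → :1 :- r :^ 2 :* p :^ 2 := (:1 :- r :* p) :* (:1 :+ r :* p)) √2 (p n))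

      0≤√2p : ∀ n → 0# ≤ √2 * p n
      0≤√2p n = 0≤-* (<⇒≤ 0<√2) (0≤p n)

      θ²≤η² : ∀ n → θ n ^ 2 ≤ η n ^ 2
      θ²≤η² n = ≤-trans (≤-fromDifference (θ n ^ 2 * (s * (s + fromℕ 2))) (0≤-* (0≤x² _) (0≤-* (0≤√2p n) (0≤-+ (0≤√2p n) (0≤fromℕ 2))))
        (solve 2 (λ t s → t :^ 2 :+ t :^ 2 :* (s :* (s :+ :2)) := (t :* (:1 :+ s)) :^ 2) (θ n) s))
        (≤-reflexive (B.^-cong n 2 (sym (η≈θ* n))))
        where
        s : ℝ
        s = √2 * p n

      η²≤9θ² : ∀ n → η n ^ 2 ≤ fromℕ 9 * θ n ^ 2
      η²≤9θ² n = ≤-trans (≤-reflexive (B.^-cong n 2 (η≈θ* n))) (≤-fromDifference (θ n ^ 2 * ((fromℕ 2 - s) * (s + fromℕ 4)))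
        (0≤-* (0≤x² _) (0≤-* (x≤y⇒0≤y-x (≤-trans (*-mono-≤ (<⇒≤ 0<√2) (0≤p n) √2≤2 (p≤1 n)) (≤-reflexive (*-identityʳ _)))) (0≤-+ (0≤√2p n) (0≤fromℕ 4))))
        (solve 2 (λ t s → (t :* (:1 :+ s)) :^ 2 :+ t :^ 2 :* ((:2 :- s) :* (s :+ :4)) := con (ℤ.+ 9) :* t :^ 2) (θ n) s))
        where
        s : ℝ
        s = √2 * p n

      θ²≤1 : ∀ n → θ n ^ 2 ≤ 1#
      θ²≤1 n = ≤-trans (θ²≤η² n) (B.η²≤1 n)

      0≤c₁ : ∀ n k l → 0# ≤ v n ^ k * p n ^ l * q n
      0≤c₁ n k l = 0≤-* (0≤-* (0≤-^ k (0≤v n)) (0≤-^ l (0≤p n))) (0≤q n)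
      0≤τ₁ : ∀ n → 0# ≤ τ₁ n
      0≤τ₁ n = 0≤-* (0≤c₁ n 6 3) (0≤x² _)
      0≤τ₂ : ∀ n → 0# ≤ τ₂ n
      0≤τ₂ n = 0≤c₁ n 5 3
      0≤τ₃ : ∀ n → 0# ≤ τ₃ n
      0≤τ₃ n = 0≤c₁ n 4 2

      τ₁≤t₁ : ∀ n → τ₁ n ≤ t₁ n
      τ₁≤t₁ n = *-monoˡ-≤ (0≤c₁ n 6 3) (θ²≤η² n)

      t₁≤9τ₁ : ∀ n → t₁ n ≤ fromℕ 9 * τ₁ n
      t₁≤9τ₁ n = ≤-trans (*-monoˡ-≤ (0≤c₁ n 6 3) (η²≤9θ² n))
        (solve-eq _ _)
        where
        solve-eq : ∀ a b → a * (fromℕ 9 * b) ≤ fromℕ 9 * (a * b)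
        solve-eq a b = ≤-reflexive (solve 2 (λ a b → a :* (con (ℤ.+ 9) :* b) := con (ℤ.+ 9) :* (a :* b)) a b)

      0<v : ∀ {n} → 1# ≤ v n → 0# < v n
      0<v = <-≤-trans 0<1

      0<τ₂ : ∀ {n} → 1# ≤ v n → 0# < τ₂ n
      0<τ₂ {n} h = *-positive (*-positive (0<-^ 5 (0<v {n} h)) (0<-^ 3 (0<p n))) (0<q n)

      0≤𝕍K : ∀ n → 0# ≤ 𝕍K n
      0≤𝕍K n = ≤-trans (B.0≤Var n (fromℕ ∘ K n)) (≤-reflexive (sym (B.𝕍≈Var n (fromℕ ∘ K n))))

      0≤upper : 0# ≤ upperConstant
      0≤upper = 0≤-+ (0≤fromℕ 576) (0≤-* (0≤fromℕ 4) 0≤C₁)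

      0<lower : 0# < lowerConstant
      0<lower = 0<-+ (0<-+ (*-positive (0<fromℕ 75) (0<fromℕ 127)) (0≤fromℕ 16704)) (0≤fromℕ 24)

      𝕍K≤ : ∀ n → 1# ≤ v n → 𝕍K n ≤ upperConstant * (t₁ n + τ₂ n + τ₃ n)
      𝕍K≤ n 1≤v = ≤-trans (≤-reflexive (B.𝕍≈Var n (fromℕ ∘ K n))) (B.Var-K≤ n (K n) 2K≈ 1≤v)

      𝕍K≥ : ∀ n → threshold ≤ v n → t₁ n + τ₂ n + τ₃ n ≤ lowerConstant * 𝕍K n
      𝕍K≥ n large = ≤-trans (B.Large.Var-K≥ n (K n) 2K≈ large) (*-monoˡ-≤ (<⇒≤ 0<lower) (≤-reflexive (sym (B.𝕍≈Var n (fromℕ ∘ K n)))))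

      grow : ∀ {a t} → 1# ≤ a → 0# ≤ t → t ≤ a * t
      grow 1≤a 0≤t = ≤-trans (≤-reflexive (sym (*-identityˡ _))) (*-monoʳ-≤ 0≤t 1≤a)

      shrink : ∀ {a t} → a ≤ 1# → 0# ≤ t → a * t ≤ t
      shrink a≤1 0≤t = ≤-trans (*-monoʳ-≤ 0≤t a≤1) (≤-reflexive (*-identityˡ _))

    variance-order : 𝕍K ≃ (λ n → τ₁ n + τ₂ n + τ₃ n)
    variance-order with eventually≥ 1# and eventually≥ threshold
    ... | N , h = ≃-fromBounds lowerConstant (upperConstant * fromℕ 9) N 0<lower λ n N≤n → let 1≤v , large = h n N≤n in
      <-≤-trans (0<τ₂ {n} 1≤v) (≤-fromDifference (τ₁ n + τ₃ n) (0≤-+ (0≤τ₁ n) (0≤τ₃ n)) (solve 3 (λ a b c → b :+ (a :+ c) := a :+ b :+ c) (τ₁ n) (τ₂ n) (τ₃ n))) ,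
      0≤𝕍K n ,
      ≤-trans (+-mono-≤ (+-mono-≤ (τ₁≤t₁ n) ≤-refl) ≤-refl) (𝕍K≥ n large) ,
      ≤-trans (𝕍K≤ n 1≤v) (≤-trans (*-monoˡ-≤ 0≤upper (≤-trans (+-mono-≤ (+-mono-≤ (t₁≤9τ₁ n) ≤-refl) ≤-refl)
        (≤-fromDifference (fromℕ 8 * (τ₂ n + τ₃ n)) (0≤-* (0≤fromℕ 8) (0≤-+ (0≤τ₂ n) (0≤τ₃ n)))
          (solve 3 (λ a b c → con (ℤ.+ 9) :* a :+ b :+ c :+ :8 :* (b :+ c) := con (ℤ.+ 9) :* (a :+ b :+ c)) (τ₁ n) (τ₂ n) (τ₃ n)))))
        (≤-reflexive (sym (*-assoc _ _ _))))

    denseOrder : p ≫ (n^- 2) → (λ n → τ₁ n + τ₂ n + τ₃ n) ≃ (λ n → τ₁ n + τ₂ n)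
    denseOrder p≫ with eventually≥ 1# and ≫⇒ 2 0≤p p≫ 1#
    ... | N , h = ≃-fromBounds 1# (fromℕ 226) N 0<1 λ n N≤n → let 1≤v , 1≤v²p = h n N≤n in
      <-≤-trans (0<τ₂ {n} 1≤v) (≤-fromDifference (τ₁ n) (0≤τ₁ n) (+-comm _ _)) ,
      0≤-+ (0≤-+ (0≤τ₁ n) (0≤τ₂ n)) (0≤τ₃ n) ,
      ≤-fromDifference (τ₃ n) (0≤τ₃ n) (solve 3 (λ a b c → a :+ b :+ c := :1 :* (a :+ b :+ c)) (τ₁ n) (τ₂ n) (τ₃ n)) ,
      ≤-trans (+-mono-≤ ≤-refl (third n 1≤v 1≤v²p)) (≤-reflexive (solve 1 (λ a → a :+ con (ℤ.+ 225) :* a := con (ℤ.+ 226) :* a) (τ₁ n + τ₂ n)))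
      where
      third : ∀ n → 1# ≤ v n → 1# ≤ v n ^ 2 * p n → τ₃ n ≤ fromℕ 225 * (τ₁ n + τ₂ n)
      third n 1≤v 1≤v²p = ≤-byCases (fromℕ 8 * p n) (fromℕ 5)
        (λ l → begin
          τ₃ n
            ≤⟨ grow 1≤v²p (0≤τ₃ n) ⟩
          v n ^ 2 * p n * τ₃ n
            ≈⟨ solve 3 (λ v p q → v :^ 2 :* p :* (v :^ 4 :* p :^ 2 :* q) := :1 :* (v :^ 6 :* p :^ 3 :* q)) (v n) (p n) (q n) ⟩
          1# * (v n ^ 6 * p n ^ 3 * q n)
            ≤⟨ *-monoʳ-≤ (0≤c₁ n 6 3) (≤-trans (B.η²≥-low n (<⇒≤ l)) (*-monoˡ-≤ (0≤fromℕ 25) (η²≤9θ² n))) ⟩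
          fromℕ 25 * (fromℕ 9 * θ n ^ 2) * (v n ^ 6 * p n ^ 3 * q n)
            ≤⟨ ≤-fromDifference (fromℕ 225 * τ₂ n) (0≤-* (0≤fromℕ 225) (0≤τ₂ n))
                 (solve 3 (λ t a b → con (ℤ.+ 25) :* (con (ℤ.+ 9) :* t) :* a :+ con (ℤ.+ 225) :* b := con (ℤ.+ 225) :* (a :* t :+ b)) (θ n ^ 2) _ (τ₂ n)) ⟩
          fromℕ 225 * (τ₁ n + τ₂ n) ∎)
        (λ 5≤8p → begin
          τ₃ n
            ≤⟨ grow 1≤v (0≤τ₃ n) ⟩
          v n * τ₃ n
            ≤⟨ *-cancelˡ-≤ (0<fromℕ 4) (≤-trans (*-monoʳ-≤ (0≤-* (0≤v n) (0≤τ₃ n)) 5≤8p) (≤-fromDifference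
                 (fromℕ 1117 * τ₂ n + fromℕ 1125 * τ₁ n) (0≤-+ (0≤-* (0≤fromℕ 1117) (0≤τ₂ n)) (0≤-* (0≤fromℕ 1125) (0≤τ₁ n)))
                 (solve 4 (λ v p q a → :8 :* p :* (v :* (v :^ 4 :* p :^ 2 :* q)) :+ (con (ℤ.+ 1117) :* (v :^ 5 :* p :^ 3 :* q) :+ con (ℤ.+ 1125) :* a)
                   := con (ℤ.+ 5) :* (con (ℤ.+ 225) :* (a :+ v :^ 5 :* p :^ 3 :* q))) (v n) (p n) (q n) (τ₁ n)))) ⟩
          fromℕ 225 * (τ₁ n + τ₂ n) ∎)
        where open ≤-Reasoning

    sparseOrder : p ≲ (n^- 2) → (λ n → τ₁ n + τ₂ n + τ₃ n) ≃ (λ n → v n ^ 4 * p n ^ 2)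
    sparseOrder p≲ with ≲⇒ 2 0≤p p≲
    ... | C , bound with bound and eventually≥ 1# and eventually≥ (fromℕ 2 * C)
    ... | N , h = ≃-fromBounds (fromℕ 2) (fromℕ 2 * C + 1#) N (0<fromℕ 1) λ n N≤n → let v²p≤C , 1≤v , 2C≤v = h n N≤n in
      *-positive (0<-^ 4 (0<v {n} 1≤v)) (0<-^ 2 (0<p n)) ,
      0≤-+ (0≤-+ (0≤τ₁ n) (0≤τ₂ n)) (0≤τ₃ n) ,
      lower n v²p≤C 1≤v 2C≤v ,
      upper n v²p≤C 1≤v
      where
      open ≤-Reasoning
      lower : ∀ n → v n ^ 2 * p n ≤ C → 1# ≤ v n → fromℕ 2 * C ≤ v n → v n ^ 4 * p n ^ 2 ≤ fromℕ 2 * (τ₁ n + τ₂ n + τ₃ n)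
      lower n v²p≤C 1≤v 2C≤v = begin
        v n ^ 4 * p n ^ 2
          ≤⟨ ≤-fromDifference (v n ^ 4 * p n ^ 2 * (1# - fromℕ 2 * p n) + fromℕ 2 * (τ₁ n + τ₂ n))
               (0≤-+ (0≤-* (0≤-* (0≤-^ 4 (0≤v n)) (0≤x² _)) (x≤y⇒0≤y-x 2p≤1)) (0≤-* (0≤fromℕ 2) (0≤-+ (0≤τ₁ n) (0≤τ₂ n))))
               (solve 4 (λ a p x y → a :* p :^ 2 :+ (a :* p :^ 2 :* (:1 :- :2 :* p) :+ :2 :* (x :+ y)) := :2 :* (x :+ y :+ a :* p :^ 2 :* (:1 :- p))) (v n ^ 4) (p n) (τ₁ n) (τ₂ n)) ⟩
        fromℕ 2 * (τ₁ n + τ₂ n + τ₃ n) ∎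
        where
        0<C : 0# < C
        0<C = <-≤-trans (*-positive (0<-^ 2 (0<v {n} 1≤v)) (0<p n)) v²p≤C
        2p≤1 : fromℕ 2 * p n ≤ 1#
        2p≤1 = *-cancelˡ-≤ 0<C (begin
          C * (fromℕ 2 * p n)   ≈⟨ solve 2 (λ c p → c :* (:2 :* p) := :2 :* c :* p) C (p n) ⟩
          fromℕ 2 * C * p n     ≤⟨ *-monoʳ-≤ (0≤p n) (≤-trans 2C≤v (≤-trans (grow 1≤v (0≤v n)) (≤-reflexive (sym (B.sq≈* n (v n)))))) ⟩
          v n ^ 2 * p n         ≤⟨ v²p≤C ⟩
          C                     ≈⟨ *-identityʳ C ⟨
          C * 1#                ∎)
      upper : ∀ n → v n ^ 2 * p n ≤ C → 1# ≤ v n → τ₁ n + τ₂ n + τ₃ n ≤ (fromℕ 2 * C + 1#) * (v n ^ 4 * p n ^ 2)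
      upper n v²p≤C 1≤v = begin
        τ₁ n + τ₂ n + τ₃ n
          ≤⟨ +-mono-≤ (+-mono-≤ τ₁≤ τ₂≤) τ₃≤ ⟩
        C * t + C * t + t
          ≈⟨ solve 2 (λ c t → c :* t :+ c :* t :+ t := (:2 :* c :+ :1) :* t) C t ⟩
        (fromℕ 2 * C + 1#) * t ∎
        where
        t s : ℝ
        t = v n ^ 4 * p n ^ 2
        s = v n ^ 2 * p n
        0≤t : 0# ≤ t
        0≤t = 0≤-* (0≤-^ 4 (0≤v n)) (0≤x² _)
        0≤st : 0# ≤ s * t
        0≤st = 0≤-* (0≤-* (0≤x² _) (0≤p n)) 0≤t
        q≤1 : q n ≤ 1#
        q≤1 = ≤-fromDifference (p n) (0≤p n) (solve 1 (λ p → :1 :- p :+ p := :1) (p n))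
        τ₁≤ : τ₁ n ≤ C * t
        τ₁≤ = ≤-trans (≤-reflexive (solve 4 (λ v p q h → v :^ 6 :* p :^ 3 :* q :* h := h :* (q :* (v :^ 2 :* p :* (v :^ 4 :* p :^ 2)))) (v n) (p n) (q n) (θ n ^ 2)))
          (≤-trans (shrink (θ²≤1 n) (0≤-* (0≤q n) 0≤st)) (≤-trans (shrink q≤1 0≤st) (*-monoʳ-≤ 0≤t v²p≤C)))
        τ₂≤ : τ₂ n ≤ C * t
        τ₂≤ = ≤-trans (grow 1≤v (0≤τ₂ n)) (≤-trans (≤-reflexive (solve 3 (λ v p q → v :* (v :^ 5 :* p :^ 3 :* q) := q :* (v :^ 2 :* p :* (v :^ 4 :* p :^ 2))) (v n) (p n) (q n)))
          (≤-trans (shrink q≤1 0≤st) (*-monoʳ-≤ 0≤t v²p≤C)))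
        τ₃≤ : τ₃ n ≤ t
        τ₃≤ = ≤-trans (≤-reflexive (*-comm _ _)) (shrink q≤1 0≤t)

    private
      0<upper : 0# < upperConstant
      0<upper = 0<-+ (0<fromℕ 575) (0≤-* (0≤fromℕ 4) 0≤C₁)

      q≤1 : ∀ n → q n ≤ 1#
      q≤1 n = ≤-fromDifference (p n) (0≤p n) (solve 1 (λ p → :1 :- p :+ p := :1) (p n))

      p³≤1 : ∀ n → p n ^ 3 ≤ 1#
      p³≤1 n = ≤-trans (B.p^≤p n 2) (p≤1 n)

      necessary-p : 𝕍K →∞ → ∀ M → ∃[ N ] (∀ n → N ℕ.≤ n → M ≤ v n ^ 2 * p n)
      necessary-p unbounded M = unbounded (upperConstant * (fromℕ 2 * S ^ 3 + S ^ 2) + 1#) and eventually≥ 1# eventually⇒ λ n (large , 1≤v) →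
        ≤-trans (x≤x²+1 M) (λ s<S → contradiction n 1≤v (<⇒≤ s<S) large)
        where
        S : ℝ
        S = M ^ 2 + 1#
        contradiction : ∀ n → 1# ≤ v n → v n ^ 2 * p n ≤ S → upperConstant * (fromℕ 2 * S ^ 3 + S ^ 2) + 1# ≤ 𝕍K n → _
        contradiction n 1≤v s≤S large = ≤-trans large (≤-trans (𝕍K≤ n 1≤v) (*-monoˡ-≤ 0≤upper (begin
            t₁ n + τ₂ n + τ₃ n
              ≤⟨ +-mono-≤ (+-mono-≤ t₁≤ τ₂≤) τ₃≤ ⟩
            s ^ 3 + s ^ 3 + s ^ 2
              ≤⟨ +-mono-≤ (+-mono-≤ (^-mono-≤ 3 0≤s s≤S) (^-mono-≤ 3 0≤s s≤S)) (^-mono-≤ 2 0≤s s≤S) ⟩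
            S ^ 3 + S ^ 3 + S ^ 2
              ≈⟨ solve 1 (λ s → s :^ 3 :+ s :^ 3 :+ s :^ 2 := :2 :* s :^ 3 :+ s :^ 2) S ⟩
            fromℕ 2 * S ^ 3 + S ^ 2 ∎)))
          (<-fromDifference 1# 0<1 refl)
          where
          open ≤-Reasoning
          s : ℝ
          s = v n ^ 2 * p n
          0≤s : 0# ≤ s
          0≤s = 0≤-* (0≤x² _) (0≤p n)
          t₁≤ : t₁ n ≤ s ^ 3
          t₁≤ = ≤-trans (≤-reflexive (solve 4 (λ v p q h → v :^ 6 :* p :^ 3 :* q :* h := h :* (q :* (v :^ 2 :* p) :^ 3)) (v n) (p n) (q n) (η n ^ 2)))
            (≤-trans (shrink (B.η²≤1 n) (0≤-* (0≤q n) (0≤-^ 3 0≤s))) (shrink (q≤1 n) (0≤-^ 3 0≤s)))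
          τ₂≤ : τ₂ n ≤ s ^ 3
          τ₂≤ = ≤-trans (grow 1≤v (0≤τ₂ n)) (≤-trans (≤-reflexive (solve 3 (λ v p q → v :* (v :^ 5 :* p :^ 3 :* q) := q :* (v :^ 2 :* p) :^ 3) (v n) (p n) (q n)))
            (shrink (q≤1 n) (0≤-^ 3 0≤s)))
          τ₃≤ : τ₃ n ≤ s ^ 2
          τ₃≤ = ≤-trans (≤-reflexive (solve 3 (λ v p q → v :^ 4 :* p :^ 2 :* q := q :* (v :^ 2 :* p) :^ 2) (v n) (p n) (q n))) (shrink (q≤1 n) (0≤x² s))

      necessary-q : 𝕍K →∞ → ∀ M → ∃[ N ] (∀ n → N ℕ.≤ n → M ≤ v n ^ 6 * q n)
      necessary-q unbounded M = unbounded (upperConstant * (fromℕ 3 * M)) and eventually≥ 1# eventually⇒ λ n (large , 1≤v) →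
        *-cancelˡ-≤ (0<fromℕ 2) (*-cancelˡ-≤ 0<upper (≤-trans large (≤-trans (𝕍K≤ n 1≤v) (*-monoˡ-≤ 0≤upper (bound n 1≤v)))))
        where
        open ≤-Reasoning
        bound : ∀ n → 1# ≤ v n → t₁ n + τ₂ n + τ₃ n ≤ fromℕ 3 * (v n ^ 6 * q n)
        bound n 1≤v = begin
          t₁ n + τ₂ n + τ₃ n
            ≤⟨ +-mono-≤ (+-mono-≤ t₁≤ τ₂≤) τ₃≤ ⟩
          b + b + b
            ≈⟨ solve 1 (λ b → b :+ b :+ b := con (ℤ.+ 3) :* b) b ⟩
          fromℕ 3 * b ∎
          where
          b : ℝ
          b = v n ^ 6 * q n
          0≤b : 0# ≤ b
          0≤b = 0≤-* (0≤-^ 6 (0≤v n)) (0≤q n)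
          t₁≤ : t₁ n ≤ b
          t₁≤ = ≤-trans (≤-reflexive (solve 4 (λ v p q h → v :* p :* q :* h := h :* (p :* (v :* q))) (v n ^ 6) (p n ^ 3) (q n) (η n ^ 2)))
            (≤-trans (shrink (B.η²≤1 n) (0≤-* (0≤-^ 3 (0≤p n)) 0≤b)) (shrink (p³≤1 n) 0≤b))
          τ₂≤ : τ₂ n ≤ b
          τ₂≤ = ≤-trans (grow 1≤v (0≤τ₂ n)) (≤-trans (≤-reflexive (solve 3 (λ v p q → v :* (v :^ 5 :* p :* q) := p :* (v :^ 6 :* q)) (v n) (p n ^ 3) (q n))) (shrink (p³≤1 n) 0≤b))
          τ₃≤ : τ₃ n ≤ b
          τ₃≤ = ≤-trans (grow 1≤v (0≤τ₃ n)) (≤-trans (grow 1≤v (0≤-* (0≤v n) (0≤τ₃ n)))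
            (≤-trans (≤-reflexive (solve 3 (λ v p q → v :* (v :* (v :^ 4 :* p :* q)) := p :* (v :^ 6 :* q)) (v n) (p n ^ 2) (q n)))
              (shrink (≤-trans (B.p^≤p n 1) (p≤1 n)) 0≤b)))

      sufficient : (∀ M → ∃[ N ] (∀ n → N ℕ.≤ n → M ≤ v n ^ 2 * p n)) →
        (∀ M → ∃[ N ] (∀ n → N ℕ.≤ n → M ≤ v n ^ 6 * q n)) → 𝕍K →∞
      sufficient large-p large-q M =
        large-p (fromℕ 200 * L) and large-p 1# and large-q (fromℕ 200 * L) and eventually≥ (fromℕ 200 * L) and eventually≥ 1# and eventually≥ threshold
        eventually⇒ λ n (hp , 1≤s , hq , hv , 1≤v , large) →
          ≤-trans (x≤x²+1 M) (*-cancelˡ-≤ 0<lower (≤-trans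
            (*-cancelˡ-≤ (0<fromℕ 199) (≤-byCases (fromℕ 8 * p n) (fromℕ 5)
              (λ l → ≤-trans hp (≤-trans (byThird n 1≤s (<⇒≤ l)) (weaken n 3)))
              (λ 5≤8p → ≤-byCases (fromℕ 4) (fromℕ 5 * p n)
                (λ l → ≤-trans hq (≤-trans (byFirst n 5≤8p (<⇒≤ l)) (weaken n 1)))
                (λ 5p≤4 → ≤-trans hv (≤-trans (bySecond n 1≤v 5≤8p 5p≤4) (weaken n 2))))))
            (𝕍K≥ n large)))
        where
        open ≤-Reasoning
        L : ℝ
        L = lowerConstant * (M ^ 2 + 1#)
        pick : ℕ → ℕ → ℝ
        pick n 1 = t₁ n
        pick n 2 = τ₂ n
        pick n _ = τ₃ n
        0≤t₁ : ∀ n → 0# ≤ t₁ n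
        0≤t₁ n = 0≤-* (0≤c₁ n 6 3) (0≤x² _)
        weaken : ∀ n i → fromℕ 200 * pick n i ≤ fromℕ 200 * (t₁ n + τ₂ n + τ₃ n)
        weaken n i = *-monoˡ-≤ (0≤fromℕ 200) (part i)
          where
          third : τ₃ n ≤ t₁ n + τ₂ n + τ₃ n
          third = ≤-fromDifference (t₁ n + τ₂ n) (0≤-+ (0≤t₁ n) (0≤τ₂ n)) (+-comm _ _)
          part : ∀ i → pick n i ≤ t₁ n + τ₂ n + τ₃ n
          part 0 = third
          part 1 = ≤-fromDifference (τ₂ n + τ₃ n) (0≤-+ (0≤τ₂ n) (0≤τ₃ n)) (sym (+-assoc _ _ _))
          part 2 = ≤-fromDifference (t₁ n + τ₃ n) (0≤-+ (0≤t₁ n) (0≤τ₃ n)) (solve 3 (λ a b c → b :+ (a :+ c) := a :+ b :+ c) (t₁ n) (τ₂ n) (τ₃ n))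
          part (suc (suc (suc _))) = third
        p³≥ : ∀ n → fromℕ 5 ≤ fromℕ 8 * p n → 1# ≤ fromℕ 8 * p n ^ 3
        p³≥ n h = ≤-trans (≤-reflexive (solve 0 (:1 := :1 :^ 3))) (≤-trans (^-mono-≤ 3 0≤1 1≤2p) (≤-reflexive (solve 1 (λ p → (:2 :* p) :^ 3 := :8 :* p :^ 3) (p n))))
          where
          1≤2p : 1# ≤ fromℕ 2 * p n
          1≤2p = *-cancelˡ-≤ (0<fromℕ 3) (≤-trans (≤-fromDifference 1# 0≤1 (solve 0 (:4 :* :1 :+ :1 := con (ℤ.+ 5))))
            (≤-trans h (≤-reflexive (solve 1 (λ p → :8 :* p := :4 :* (:2 :* p)) (p n)))))
        byFirst : ∀ n → fromℕ 5 ≤ fromℕ 8 * p n → fromℕ 4 ≤ fromℕ 5 * p n → v n ^ 6 * q n ≤ fromℕ 200 * t₁ n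
        byFirst n 5≤8p 4≤5p = begin
          v n ^ 6 * q n
            ≤⟨ grow (p³≥ n 5≤8p) 0≤b ⟩
          fromℕ 8 * p n ^ 3 * b
            ≤⟨ grow (B.η²≥-high n 4≤5p) (0≤-* (0≤-* (0≤fromℕ 8) (0≤-^ 3 (0≤p n))) 0≤b) ⟩
          fromℕ 25 * η n ^ 2 * (fromℕ 8 * p n ^ 3 * b)
            ≈⟨ solve 4 (λ h p v q → con (ℤ.+ 25) :* h :* (:8 :* p :* (v :* q)) := con (ℤ.+ 200) :* (v :* p :* q :* h)) (η n ^ 2) (p n ^ 3) (v n ^ 6) (q n) ⟩
          fromℕ 200 * t₁ n ∎
          where
          b : ℝ
          b = v n ^ 6 * q n
          0≤b : 0# ≤ b
          0≤b = 0≤-* (0≤-^ 6 (0≤v n)) (0≤q n)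
        bySecond : ∀ n → 1# ≤ v n → fromℕ 5 ≤ fromℕ 8 * p n → fromℕ 5 * p n ≤ fromℕ 4 → v n ≤ fromℕ 200 * τ₂ n
        bySecond n 1≤v 5≤8p 5p≤4 = begin
          v n
            ≤⟨ grow (≤-trans (≤-reflexive (solve 0 (:1 := :1 :^ 4))) (^-mono-≤ 4 0≤1 1≤v)) (0≤v n) ⟩
          v n ^ 4 * v n
            ≤⟨ grow (p³≥ n 5≤8p) (0≤-* (0≤-^ 4 (0≤v n)) (0≤v n)) ⟩
          fromℕ 8 * p n ^ 3 * (v n ^ 4 * v n)
            ≤⟨ grow 1≤5q (0≤-* (0≤-* (0≤fromℕ 8) (0≤-^ 3 (0≤p n))) (0≤-* (0≤-^ 4 (0≤v n)) (0≤v n))) ⟩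
          fromℕ 5 * q n * (fromℕ 8 * p n ^ 3 * (v n ^ 4 * v n))
            ≤⟨ ≤-fromDifference (fromℕ 160 * τ₂ n) (0≤-* (0≤fromℕ 160) (0≤τ₂ n))
                 (solve 3 (λ v p q → con (ℤ.+ 5) :* q :* (:8 :* p :* (v :^ 4 :* v)) :+ con (ℤ.+ 160) :* (v :^ 5 :* p :* q) := con (ℤ.+ 200) :* (v :^ 5 :* p :* q)) (v n) (p n ^ 3) (q n)) ⟩
          fromℕ 200 * τ₂ n ∎
          where
          1≤5q : 1# ≤ fromℕ 5 * q n
          1≤5q = ≤-fromDifference (fromℕ 4 - fromℕ 5 * p n) (x≤y⇒0≤y-x 5p≤4) (solve 1 (λ p → :1 :+ (:4 :- con (ℤ.+ 5) :* p) := con (ℤ.+ 5) :* (:1 :- p)) (p n))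
        byThird : ∀ n → 1# ≤ v n ^ 2 * p n → fromℕ 8 * p n ≤ fromℕ 5 → v n ^ 2 * p n ≤ fromℕ 200 * τ₃ n
        byThird n 1≤s 8p≤5 = begin
          s
            ≤⟨ grow 1≤s 0≤s ⟩
          s * s
            ≤⟨ grow 1≤3q (0≤-* 0≤s 0≤s) ⟩
          fromℕ 3 * q n * (s * s)
            ≤⟨ ≤-fromDifference (fromℕ 197 * τ₃ n) (0≤-* (0≤fromℕ 197) (0≤τ₃ n))
                 (solve 3 (λ v p q → con (ℤ.+ 3) :* q :* (v :^ 2 :* p :* (v :^ 2 :* p)) :+ con (ℤ.+ 197) :* (v :^ 4 :* p :^ 2 :* q) := con (ℤ.+ 200) :* (v :^ 4 :* p :^ 2 :* q)) (v n) (p n) (q n)) ⟩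
          fromℕ 200 * τ₃ n ∎
          where
          s : ℝ
          s = v n ^ 2 * p n
          0≤s : 0# ≤ s
          0≤s = 0≤-* (0≤x² _) (0≤p n)
          1≤3q : 1# ≤ fromℕ 3 * q n
          1≤3q = *-cancelˡ-≤ (0<fromℕ 7) (≤-fromDifference (fromℕ 3 * (fromℕ 5 - fromℕ 8 * p n) + 1#) (0≤-+ (0≤-* (0≤fromℕ 3) (x≤y⇒0≤y-x 8p≤5)) 0≤1)
            (solve 1 (λ p → :8 :* :1 :+ (con (ℤ.+ 3) :* (con (ℤ.+ 5) :- :8 :* p) :+ :1) := :8 :* (con (ℤ.+ 3) :* (:1 :- p))) (p n)))

    unboundedVariance : (𝕍K →∞) ⇔ ((p ≫ (n^- 2)) × ((λ n → 1# - p n) ≫ (n^- 6)))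
    unboundedVariance = mk⇔
      (λ h → ⇒≫ 2 0≤p (necessary-p h) , ⇒≫ 6 0≤q (necessary-q h))
      (λ (hp , hq) → sufficient (≫⇒ 2 0≤p hp) (≫⇒ 6 0≤q hq))

  ∑-↑ : ∀ m k (f : Fin (m ℕ.+ k) → ℝ) → ∑ f ≈ ∑ (λ i → f (i ↑ˡ k)) + ∑ (λ j → f (m ↑ʳ j))
  ∑-↑ zero k f = sym (trans (+-congʳ (∑-empty _)) (+-identityˡ _))
  ∑-↑ (suc m) k f = trans (∑-suc f) (trans (+-congˡ (∑-↑ m k (f ∘ suc)))
    (trans (sym (+-assoc _ _ _)) (+-congʳ (sym (∑-suc (λ i → f (i ↑ˡ k)))))))

  ∑-combine : ∀ m k (f : Fin (m ℕ.* k) → ℝ) → ∑ f ≈ ∑ (λ i → ∑ (λ j → f (combine {m} i j)))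
  ∑-combine zero k f = trans (∑-empty f) (sym (∑-empty _))
  ∑-combine (suc m) k f = trans (∑-↑ k (m ℕ.* k) f) (trans (+-congˡ (∑-combine m k (λ j → f (k ↑ʳ j))))
    (sym (∑-suc (λ i → ∑ (λ j → f (combine {suc m} i j))))))

  indicator-∧ : ∀ b c → indicator (b ∧ c) ≈ indicator b * indicator c
  indicator-∧ true c = sym (*-identityˡ _)
  indicator-∧ false c = sym (zeroˡ _)

  indicator-not : ∀ b → indicator (not b) ≈ 1# - indicator b
  indicator-not true = sym (-‿inverseʳ 1#)
  indicator-not false = sym (trans (+-congˡ -0#≈0#) (+-identityʳ 1#))

  module _ {n} (G : Graph n) where

    private
      X : Matrix n
      X = x G

      u : Matrix n
      u a c = indicator (hasUniquePath G a c)

      ∑⁴ : (Fin n → Fin n → Fin n → Fin n → ℝ) → ℝ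
      ∑⁴ f = ∑∑ (λ a b → ∑∑ (f a b))

      ∑⁴-cong : ∀ {f g} → (∀ a b c e → f a b c e ≈ g a b c e) → ∑⁴ f ≈ ∑⁴ g
      ∑⁴-cong h = ∑∑-cong (λ a b → ∑∑-cong (h a b))

      ∑⁴-+ : ∀ f g → ∑⁴ (λ a b c e → f a b c e + g a b c e) ≈ ∑⁴ f + ∑⁴ g
      ∑⁴-+ f g = trans (∑∑-cong (λ a b → ∑∑-+ (f a b) (g a b))) (∑∑-+ _ _)

      ∑⁴-neg : ∀ f → ∑⁴ (λ a b c e → - f a b c e) ≈ - ∑⁴ f
      ∑⁴-neg f = trans (∑∑-cong (λ a b → trans (∑-cong (λ c → ∑-neg _)) (∑-neg _))) (trans (∑-cong (λ a → ∑-neg _)) (∑-neg _))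

      cherries : ℝ
      cherries = ∑ (λ a → d G a * d G a)

      s₁ s₂ s₃ s₄ s₅ s₆ : Fin n → Fin n → Fin n → Fin n → ℝ
      s₁ a b c e = 𝐞 a c * (X a b * X a e)
      s₂ a b c e = 𝐞 b e * (X a b * X c b)
      s₃ a b c e = 𝐞 a c * (𝐞 b e * X a b)
      s₄ a b c e = 𝐞 b c * (𝐞 a e * X a b)
      s₅ a b c e = 𝐞 b c * (X a b * X b e * (1# - u a e))
      s₆ a b c e = 𝐞 a e * (X c a * X a b * (1# - u c b))

      column : ∀ b → ∑ (λ a → X a b) ≈ d G b
      column b = ∑-cong (λ a → x-sym G a b)

      ∑⁴-s₁ : ∑⁴ s₁ ≈ cherries
      ∑⁴-s₁ = trans (∑∑-cong (λ a b → trans (∑-cong (λ c → ∑-*ˡ (𝐞 a c) _)) (trans (∑-𝐞ˡ a (λ _ → ∑ (λ e → X a b * X a e))) (∑-*ˡ _ _))))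
        (∑-cong (λ a → ∑-*ʳ (X a) (d G a)))

      ∑⁴-s₂ : ∑⁴ s₂ ≈ cherries
      ∑⁴-s₂ = trans (∑∑-cong (λ a b → trans (∑-cong (λ c → ∑-𝐞ˡ b (λ _ → X a b * X c b))) (trans (∑-*ˡ (X a b) _) (*-congˡ (column b)))))
        (trans (∑-swap _) (∑-cong (λ b → trans (∑-*ʳ _ (d G b)) (*-congʳ (column b)))))

      ∑⁴-s₃ : ∑⁴ s₃ ≈ m G
      ∑⁴-s₃ = ∑∑-cong (λ a b → trans (∑-cong (λ c → trans (∑-*ˡ (𝐞 a c) _) (*-congˡ (∑-𝐞ˡ b (λ _ → X a b))))) (∑-𝐞ˡ a (λ _ → X a b)))

      ∑⁴-s₄ : ∑⁴ s₄ ≈ m G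
      ∑⁴-s₄ = ∑∑-cong (λ a b → trans (∑-cong (λ c → trans (∑-*ˡ (𝐞 b c) _) (*-congˡ (∑-𝐞ˡ a (λ _ → X a b))))) (∑-𝐞ˡ b (λ _ → X a b)))

      u*paths : ∀ a e → ∑ (λ b → X a b * X b e) * u a e ≈ u a e
      u*paths a e with hasUniquePath G a e in eq
      ... | false = zeroʳ _
      ... | true = trans (*-identityʳ _) (trans (∑-cong (λ b → sym (indicator-∧ (adjacent G a b) (adjacent G b e))))
          (trans (sym (indicator-count (commonNeighbour G a e))) (trans (reflexive (≡.cong fromℕ (single eq))) (+-identityʳ 1#))))
        where
        single : hasUniquePath G a e ≡ true → count (commonNeighbour G a e) ≡ 1
        single h = does-true (count (commonNeighbour G a e) ℕ.≟ 1)
          (proj₂ (∧-true {not (adjacent G a e)} (proj₂ (∧-true {not (does (a ≟ e))} h))))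

      paths : ∑ (λ a → ∑∑ (λ b e → X a b * X b e * (1# - u a e))) ≈ cherries - U G
      paths = begin
        ∑ (λ a → ∑∑ (λ b e → X a b * X b e * (1# - u a e)))
          ≈⟨ ∑-cong (λ a → trans (∑∑-cong (λ b e → solve 2 (λ y z → y :* (:1 :- z) := y :- y :* z) (X a b * X b e) (u a e)))
               (trans (∑-cong (λ b → ∑-sub _ _)) (∑-sub _ _))) ⟩
        ∑ (λ a → ∑∑ (λ b e → X a b * X b e) - ∑∑ (λ b e → X a b * X b e * u a e))
          ≈⟨ ∑-sub _ _ ⟩
        ∑ (λ a → ∑∑ (λ b e → X a b * X b e)) - ∑ (λ a → ∑∑ (λ b e → X a b * X b e * u a e))
          ≈⟨ +-cong (trans (∑∑-cong (λ a b → ∑-*ˡ (X a b) (X b))) (trans (∑-swap _) (∑-cong (λ b → trans (∑-*ʳ _ (d G b)) (*-congʳ (column b))))))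
               (-‿cong (∑-cong (λ a → trans (∑-swap _) (∑-cong (λ e → trans (∑-*ʳ _ (u a e)) (u*paths a e)))))) ⟩
        cherries - U G ∎
        where open ≈-Reasoning

      ∑⁴-s₅ : ∑⁴ s₅ ≈ cherries - U G
      ∑⁴-s₅ = trans (∑∑-cong (λ a b → trans (∑-cong (λ c → ∑-*ˡ (𝐞 b c) _)) (∑-𝐞ˡ b (λ _ → ∑ (λ e → X a b * X b e * (1# - u a e)))))) paths

      ∑⁴-s₆ : ∑⁴ s₆ ≈ cherries - U G
      ∑⁴-s₆ = trans (∑∑-cong (λ a b → ∑-cong (λ c → ∑-𝐞ˡ a (λ _ → X c a * X a b * (1# - u c b)))))
        (trans (∑-cong (λ a → ∑-swap _)) (trans (∑-swap _) paths))

      inclusionExclusion : Fin n → Fin n → Fin n → Fin n → ℝ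
      inclusionExclusion a b c e = X a b * X c e + - (X a b * (X b c * (X c e * X e a)))
        + (s₁ a b c e + s₂ a b c e + - (s₃ a b c e + s₃ a b c e) + s₄ a b c e + - s₅ a b c e + - s₆ a b c e)

      u-loop : ∀ {a b} → a ≡ b → u a b ≈ 0#
      u-loop {a} ≡.refl = reflexive (≡.cong indicator (hasUniquePath-loop G a))

      -- inclusionExclusion for arcs {a , b} and {c , e}, as a function of
      -- 𝐞 a c, 𝐞 b e, 𝐞 b c, 𝐞 a e, u a e, u c b and X b c * X e a.
      reduced : ℝ → ℝ → ℝ → ℝ → ℝ → ℝ → ℝ → ℝ
      reduced α β γ ε y z t = 1# - t + (α + β - (α * β + α * β) + γ * ε - γ * (1# - y) - ε * (1# - z))

      reduced-cong : ∀ {α α′ β β′ γ γ′ ε ε′ y y′ z z′ t t′} → α ≈ α′ → β ≈ β′ → γ ≈ γ′ → ε ≈ ε′ → y ≈ y′ → z ≈ z′ → t ≈ t′ →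
        reduced α β γ ε y z t ≈ reduced α′ β′ γ′ ε′ y′ z′ t′
      reduced-cong e₁ e₂ e₃ e₄ e₅ e₆ e₇ = +-cong (+-congˡ (-‿cong e₇))
        (+-cong (+-cong (+-cong (+-cong (+-cong e₁ e₂) (-‿cong (+-cong (*-cong e₁ e₂) (*-cong e₁ e₂)))) (*-cong e₃ e₄))
          (-‿cong (*-cong e₃ (+-congˡ (-‿cong e₅))))) (-‿cong (*-cong e₄ (+-congˡ (-‿cong e₆)))))

      𝐞-yes : ∀ {a b : Fin n} → a ≡ b → 𝐞 a b ≈ 1#
      𝐞-yes {a} ≡.refl = reflexive (𝐞-≡ a)

      𝐞-no : ∀ {a b : Fin n} → a ≢ b → 𝐞 a b ≈ 0#
      𝐞-no h = reflexive (𝐞-≢ h)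

      reducedAt : Fin n → Fin n → Fin n → Fin n → ℝ
      reducedAt a b c e = reduced (𝐞 a c) (𝐞 b e) (𝐞 b c) (𝐞 a e) (u a e) (u c b) (X b c * X e a)

      compatible≈ : ∀ a b c e → adjacent G a b ≡ true → adjacent G c e ≡ true →
        indicator (compatible G a b c e) ≈ reducedAt a b c e
      compatible≈ a b c e ab ce = by-cases (a ≟ c) (b ≟ e) (b ≟ c) (a ≟ e)
        where
        value : ∀ {t} → compatible G a b c e ≡ t → indicator (compatible G a b c e) ≈ indicator t
        value h = reflexive (≡.cong indicator h)
        X≈1 : ∀ {a b} → adjacent G a b ≡ true → X a b ≈ 1#
        X≈1 h = reflexive (≡.cong indicator h)
        flip : ∀ {a b} → adjacent G a b ≡ true → adjacent G b a ≡ true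
        flip {a} {b} h = ≡.trans (adjacent-sym G b a) h
        loopless : ∀ {a b} → adjacent G a b ≡ true → a ≢ b
        loopless {a} h ≡.refl with () ← ≡.trans (≡.sym h) (adjacent-irrefl G a)
        by-cases : Dec (a ≡ c) → Dec (b ≡ e) → Dec (b ≡ c) → Dec (a ≡ e) → indicator (compatible G a b c e) ≈ reducedAt a b c e
        by-cases (yes ≡.refl) (yes ≡.refl) _ _ = trans (value (compatible-irrefl G a b))
          (sym (trans (reduced-cong (𝐞-yes {a} ≡.refl) (𝐞-yes {b} ≡.refl) (𝐞-no (loopless (flip ab))) (𝐞-no (loopless ab)) refl refl
            (*-cong (X≈1 (flip ab)) (X≈1 (flip ab))))
            (solve 2 (λ y z → :1 :- :1 :* :1 :+ (:1 :+ :1 :- (:1 :* :1 :+ :1 :* :1) :+ :0 :* :0 :- :0 :* (:1 :- y) :- :0 :* (:1 :- z)) := :0) _ _)))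
        by-cases (yes ≡.refl) (no b≢e) _ _ = trans (value (equation b≢e))
          (sym (trans (reduced-cong (𝐞-yes {a} ≡.refl) (𝐞-no b≢e) (𝐞-no (loopless (flip ab))) (𝐞-no (loopless ce)) refl refl
            (*-cong (X≈1 (flip ab)) (X≈1 (flip ce))))
            (solve 2 (λ y z → :1 :- :1 :* :1 :+ (:1 :+ :0 :- (:1 :* :0 :+ :1 :* :0) :+ :0 :* :0 :- :0 :* (:1 :- y) :- :0 :* (:1 :- z)) := :1) _ _)))
          where
          equation : b ≢ e → compatible G a b a e ≡ true
          equation b≢e rewrite dec-true (a ≟ a) ≡.refl | dec-false (b ≟ e) b≢e = ≡.refl
        by-cases (no a≢c) (yes ≡.refl) _ _ = trans (value equation)
          (sym (trans (reduced-cong (𝐞-no a≢c) (𝐞-yes {b} ≡.refl) (𝐞-no (loopless (flip ce))) (𝐞-no (loopless ab)) refl refl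
            (*-cong (X≈1 (flip ce)) (X≈1 (flip ab))))
            (solve 2 (λ y z → :1 :- :1 :* :1 :+ (:0 :+ :1 :- (:0 :* :1 :+ :0 :* :1) :+ :0 :* :0 :- :0 :* (:1 :- y) :- :0 :* (:1 :- z)) := :1) _ _)))
          where
          equation : compatible G a b c b ≡ true
          equation rewrite dec-false (a ≟ c) a≢c | dec-true (b ≟ b) ≡.refl = ≡.refl
        by-cases (no a≢c) (no b≢e) (yes ≡.refl) (yes ≡.refl) = trans (value equation)
          (sym (trans (reduced-cong (𝐞-no a≢c) (𝐞-no b≢e) (𝐞-yes {b} ≡.refl) (𝐞-yes {a} ≡.refl) (u-loop {a} ≡.refl) (u-loop {b} ≡.refl)
            (trans (*-congʳ (x-diag G b)) (zeroˡ _)))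
            (solve 0 (:1 :- :0 :+ (:0 :+ :0 :- (:0 :* :0 :+ :0 :* :0) :+ :1 :* :1 :- :1 :* (:1 :- :0) :- :1 :* (:1 :- :0)) := :0))))
          where
          equation : compatible G a b b a ≡ false
          equation rewrite dec-false (a ≟ b) a≢c | dec-false (b ≟ a) b≢e | dec-true (b ≟ b) ≡.refl = hasUniquePath-loop G a
        by-cases (no a≢c) (no b≢e) (yes ≡.refl) (no a≢e) = trans (value equation)
          (sym (trans (reduced-cong (𝐞-no a≢c) (𝐞-no b≢e) (𝐞-yes {b} ≡.refl) (𝐞-no a≢e) refl refl (trans (*-congʳ (x-diag G b)) (zeroˡ _)))
            (solve 2 (λ y z → :1 :- :0 :+ (:0 :+ :0 :- (:0 :* :0 :+ :0 :* :0) :+ :1 :* :0 :- :1 :* (:1 :- y) :- :0 :* (:1 :- z)) := y) (u a e) _)))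
          where
          equation : compatible G a b b e ≡ hasUniquePath G a e
          equation rewrite dec-false (a ≟ b) a≢c | dec-false (b ≟ e) b≢e | dec-true (b ≟ b) ≡.refl = ≡.refl
        by-cases (no a≢c) (no b≢e) (no b≢c) (yes ≡.refl) = trans (value equation)
          (sym (trans (reduced-cong (𝐞-no a≢c) (𝐞-no b≢e) (𝐞-no b≢c) (𝐞-yes {a} ≡.refl) refl refl (trans (*-congˡ (x-diag G a)) (zeroʳ _)))
            (solve 2 (λ y z → :1 :- :0 :+ (:0 :+ :0 :- (:0 :* :0 :+ :0 :* :0) :+ :0 :* :1 :- :0 :* (:1 :- y) :- :1 :* (:1 :- z)) := z) _ (u c b))))
          where
          equation : compatible G a b c a ≡ hasUniquePath G c b
          equation rewrite dec-false (a ≟ c) a≢c | dec-false (b ≟ a) b≢e | dec-false (b ≟ c) b≢c | dec-true (a ≟ a) ≡.refl = ≡.refl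
        by-cases (no a≢c) (no b≢e) (no b≢c) (no a≢e) = trans (value equation) (trans (trans (indicator-not _)
            (+-congˡ (-‿cong (trans (indicator-∧ (adjacent G a e) (adjacent G c b)) (trans (*-cong (x-sym G a e) (x-sym G c b)) (*-comm _ _))))))
          (sym (trans (reduced-cong (𝐞-no a≢c) (𝐞-no b≢e) (𝐞-no b≢c) (𝐞-no a≢e) refl refl refl)
            (solve 3 (λ y z t → :1 :- t :+ (:0 :+ :0 :- (:0 :* :0 :+ :0 :* :0) :+ :0 :* :0 :- :0 :* (:1 :- y) :- :0 :* (:1 :- z)) := :1 :- t) _ _ _))))
          where
          equation : compatible G a b c e ≡ not (adjacent G a e ∧ adjacent G c b)
          equation rewrite dec-false (a ≟ c) a≢c | dec-false (b ≟ e) b≢e | dec-false (b ≟ c) b≢c | dec-false (a ≟ e) a≢e = ≡.refl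

      transport : ∀ (i j : Fin n) {y z} → (i ≡ j → y ≈ z) → 𝐞 i j * y ≈ 𝐞 i j * z
      transport i j {y} {z} h with i ≟ j
      ... | yes p = *-congˡ (h p)
      ... | no _ = trans (zeroˡ y) (sym (zeroˡ z))

      -- Each degenerate term contains both arcs.
      inclusionExclusion≈ : ∀ a b c e → inclusionExclusion a b c e ≈ X a b * X c e * reducedAt a b c e
      inclusionExclusion≈ a b c e = trans (+-cong refl (+-cong (+-cong (+-cong (+-cong (+-cong
          (transport a c (λ { ≡.refl → refl }))
          (transport b e (λ { ≡.refl → refl })))
          (-‿cong (+-cong t₃ t₃)))
          (transport b c λ { ≡.refl → transport a e λ { ≡.refl → trans (sym (x-idem G a b)) (*-congˡ (x-sym G a b)) } }))
          (-‿cong (transport b c (λ { ≡.refl → refl }))))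
          (-‿cong (transport a e (λ { ≡.refl → *-congʳ (*-comm _ _) })))))
        (solve 10 (λ xab xce xbc xea α β γ ε y z →
            xab :* xce :+ :- (xab :* (xbc :* (xce :* xea))) :+
            (α :* (xab :* xce) :+ β :* (xab :* xce) :+ :- (α :* (β :* (xab :* xce)) :+ α :* (β :* (xab :* xce))) :+ γ :* (ε :* (xab :* xce))
             :+ :- (γ :* (xab :* xce :* (:1 :- y))) :+ :- (ε :* (xab :* xce :* (:1 :- z))))
          := xab :* xce :* (:1 :- xbc :* xea :+ (α :+ β :- (α :* β :+ α :* β) :+ γ :* ε :- γ :* (:1 :- y) :- ε :* (:1 :- z)))) (X a b) (X c e) (X b c) (X e a) (𝐞 a c) (𝐞 b e) (𝐞 b c) (𝐞 a e) (u a e) (u c b))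
        where
        t₃ : s₃ a b c e ≈ 𝐞 a c * (𝐞 b e * (X a b * X c e))
        t₃ = transport a c λ { ≡.refl → transport b e λ { ≡.refl → sym (x-idem G a b) } }

      pointwise : ∀ a b c e → indicator (isPolytopeEdge G a b c e) ≈ inclusionExclusion a b c e
      pointwise a b c e = trans (indicator-∧ _ (compatible G a b c e)) (trans (*-congʳ (indicator-∧ (adjacent G a b) (adjacent G c e)))
        (trans both (sym (inclusionExclusion≈ a b c e))))
        where
        both : X a b * X c e * indicator (compatible G a b c e) ≈ X a b * X c e * reducedAt a b c e
        both = by-cases (adjacent G a b Bool.≟ true) (adjacent G c e Bool.≟ true)
          where
          X≈0 : ∀ {a b} → adjacent G a b ≢ true → X a b ≈ 0#
          X≈0 h = reflexive (≡.cong indicator (Bool.¬-not h))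
          by-cases : Dec (adjacent G a b ≡ true) → Dec (adjacent G c e ≡ true) →
            X a b * X c e * indicator (compatible G a b c e) ≈ X a b * X c e * reducedAt a b c e
          by-cases (yes h) (yes k) = *-congˡ (compatible≈ a b c e h k)
          by-cases (no h) _ = trans (*-congʳ (*-congʳ (X≈0 h))) (trans (solve 3 (λ a b c → :0 :* a :* b := :0 :* a :* c) _ _ _) (*-congʳ (*-congʳ (sym (X≈0 h)))))
          by-cases (yes _) (no k) = trans (*-congʳ (*-congˡ (X≈0 k))) (trans (solve 3 (λ a b c → a :* :0 :* b := a :* :0 :* c) _ _ _) (*-congʳ (*-congˡ (sym (X≈0 k)))))

    ∑-isPolytopeEdge : ∑∑ (λ a b → ∑∑ (λ c e → indicator (isPolytopeEdge G a b c e))) ≈ Y G + fromℕ 2 * U G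
    ∑-isPolytopeEdge = begin
      ∑⁴ (λ a b c e → indicator (isPolytopeEdge G a b c e))
        ≈⟨ ∑⁴-cong pointwise ⟩
      ∑⁴ inclusionExclusion
        ≈⟨ trans (∑⁴-+ _ _) (+-cong (trans (∑⁴-+ _ _) (+-congˡ (∑⁴-neg _)))
             (trans (∑⁴-+ _ _) (+-cong (trans (∑⁴-+ _ _) (+-cong (trans (∑⁴-+ _ _) (+-cong (trans (∑⁴-+ _ _) (+-cong
               (trans (∑⁴-+ _ _) (+-cong ∑⁴-s₁ ∑⁴-s₂)) (trans (∑⁴-neg _) (-‿cong (trans (∑⁴-+ _ _) (+-cong ∑⁴-s₃ ∑⁴-s₃))))))
               ∑⁴-s₄)) (trans (∑⁴-neg _) (-‿cong ∑⁴-s₅)))) (trans (∑⁴-neg _) (-‿cong ∑⁴-s₆))))) ⟩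
      ∑⁴ (λ a b c e → X a b * X c e) + - ∑⁴ (λ a b c e → X a b * (X b c * (X c e * X e a)))
        + (cherries + cherries + - (m G + m G) + m G + - (cherries - U G) + - (cherries - U G))
        ≈⟨ +-congʳ (+-cong (trans (∑∑-cong (λ a b → ∑∑-*ˡ (X a b) X)) (trans (∑-cong (λ a → ∑-*ʳ (X a) (m G))) (∑-*ʳ _ (m G))))
             (-‿cong (∑∑-cong (λ a b → ∑∑-*ˡ (X a b) _)))) ⟩
      m G * m G + - closedWalks₄ X + (cherries + cherries + - (m G + m G) + m G + - (cherries - U G) + - (cherries - U G))
        ≈⟨ solve 4 (λ m w t u → m :* m :+ :- w :+ (t :+ t :+ :- (m :+ m) :+ m :+ :- (t :- u) :+ :- (t :- u)) := m :^ 2 :- m :- w :+ :2 :* u) (m G) (closedWalks₄ X) cherries (U G) ⟩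
      Y G + fromℕ 2 * U G ∎
      where open ≈-Reasoning

    private
      E : Arc n → Arc n → ℝ
      E v w = indicator (joined G v w)

      order : Arc n → Arc n → ℝ
      order v w = indicator (does (v Fin.<? w))

      E-sym : ∀ v w → E v w ≈ E w v
      E-sym v w = reflexive (≡.cong indicator (isPolytopeEdge-sym G (tail v) (head v) (tail w) (head w)))

      E-irrefl : ∀ v → E v v ≈ 0#
      E-irrefl v = reflexive (≡.cong indicator (≡.trans (≡.cong ((adjacent G (tail v) (head v) ∧ adjacent G (tail v) (head v)) ∧_)
        (compatible-irrefl G (tail v) (head v))) (Bool.∧-zeroʳ _)))

      ordered : ∀ v w → order v w * E v w + order w v * E v w ≈ E v w
      ordered v w with Fin.<-cmp v w
      ... | tri< v<w _ w≮v rewrite dec-true (v Fin.<? w) v<w | dec-false (w Fin.<? v) w≮v =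
        solve 1 (λ e → :1 :* e :+ :0 :* e := e) _
      ... | tri> v≮w _ w<v rewrite dec-false (v Fin.<? w) v≮w | dec-true (w Fin.<? v) w<v =
        solve 1 (λ e → :0 :* e :+ :1 :* e := e) _
      ... | tri≈ _ ≡.refl _ = trans (+-cong (*-congˡ (E-irrefl v)) (*-congˡ (E-irrefl v)))
        (trans (solve 1 (λ a → a :* :0 :+ a :* :0 := :0) _) (sym (E-irrefl v)))

      ∑-arcs : (f : Arc n → ℝ) → ∑ f ≈ ∑∑ (λ a b → f (combine {n} a b))
      ∑-arcs = ∑-combine n n

      ∑∑-E : ∑∑ E ≈ Y G + fromℕ 2 * U G
      ∑∑-E = trans (∑-cong (λ v → ∑-arcs (E v))) (trans (∑-arcs _) (trans (∑∑-cong (λ a b → ∑∑-cong (λ c e →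
        reflexive (≡.cong₂ (λ v w → indicator (isPolytopeEdge G (proj₁ v) (proj₂ v) (proj₁ w) (proj₂ w)))
          (Fin.remQuot-combine {n} {n} a b) (Fin.remQuot-combine {n} {n} c e))))) ∑-isPolytopeEdge))

      half : fromℕ (edgeNumber n G) ≈ ∑∑ (λ v w → order v w * E v w)
      half = trans (indicator-count (selected G)) (trans (∑-combine (n ℕ.* n) (n ℕ.* n) _) (∑∑-cong (λ v w →
        trans (reflexive (≡.cong (λ r → indicator (does (proj₁ r Fin.<? proj₂ r) ∧ joined G (proj₁ r) (proj₂ r)))
            (Fin.remQuot-combine {n ℕ.* n} {n ℕ.* n} v w)))
          (indicator-∧ (does (v Fin.<? w)) (joined G v w)))))

    2*edgeNumber : fromℕ 2 * fromℕ (edgeNumber n G) ≈ Y G + fromℕ 2 * U G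
    2*edgeNumber = begin
      fromℕ 2 * fromℕ (edgeNumber n G)
        ≈⟨ *-congˡ half ⟩
      fromℕ 2 * ∑∑ (λ v w → order v w * E v w)
        ≈⟨ solve 1 (λ a → :2 :* a := a :+ a) _ ⟩
      ∑∑ (λ v w → order v w * E v w) + ∑∑ (λ v w → order v w * E v w)
        ≈⟨ +-congˡ (trans (∑-swap _) (∑∑-cong (λ v w → *-congˡ (E-sym w v)))) ⟩
      ∑∑ (λ v w → order v w * E v w) + ∑∑ (λ v w → order w v * E v w)
        ≈⟨ trans (sym (∑∑-+ _ _)) (∑∑-cong ordered) ⟩
      ∑∑ E
        ≈⟨ ∑∑-E ⟩
      Y G + fromℕ 2 * U G ∎
      where open ≈-Reasoning

  open HeytingProperties heytingCommutativeRing using (x#0y#0→xy#0)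

  0<⇒# : ∀ {x} → 0# < x → x # 0#
  0<⇒# 0<x = #-sym (<⇒# 0<x)

  #0-+ : ∀ {x y} → x + y # 0# → x # 0# ⊎ y # 0#
  #0-+ {x} {y} h with #-cotrans h y
  ... | inj₂ y#0 = inj₂ y#0
  ... | inj₁ x+y#y = inj₁ (apart (#⇒<⊎> x+y#y))
    where
    apart : x + y < y ⊎ y < x + y → x # 0#
    apart (inj₁ lt) = <⇒# (+-cancelʳ-< y (<-respʳ-≈ (sym (+-identityˡ y)) lt))
    apart (inj₂ lt) = 0<⇒# (+-cancelʳ-< y (<-respˡ-≈ (sym (+-identityˡ y)) lt))

  #0-∑ : ∀ {n} {f : Fin n → ℝ} → ∑ f # 0# → ∃[ i ] f i # 0#
  #0-∑ {zero} {f} h = ⊥-elim (#-irrefl (∑-empty f) h)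
  #0-∑ {suc n} {f} h with #0-+ (#-respˡ-≈ (∑-suc f) h)
  ... | inj₁ h₀ = zero , h₀
  ... | inj₂ h₁ with #0-∑ h₁
  ...   | i , hᵢ = suc i , hᵢ

  ¬#⇒≈ : ∀ {x y} → ¬ (x # y) → x ≈ y
  ¬#⇒≈ {x} {y} = proj₁ (tight x y)

  root : ∀ {n} → Fin n → Fin n → Point n
  root a b k = 𝐞 a k - 𝐞 b k

  ⟨⟩≈∑ : ∀ {n} (h y : Point n) → ⟨ h , y ⟩ ≈ ∑ (λ k → h k * y k)
  ⟨⟩≈∑ h y = sum≈∑ _

  inner-root : ∀ {n} (h : Point n) a b → ⟨ h , root a b ⟩ ≈ h a - h b
  inner-root h a b = trans (⟨⟩≈∑ h (root a b)) (trans
    (∑-cong (λ k → solve 3 (λ h e f → h :* (e :- f) := e :* h :- f :* h) (h k) (𝐞 a k) (𝐞 b k)))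
    (trans (∑-sub _ _) (+-cong (∑-𝐞ˡ a h) (-‿cong (∑-𝐞ˡ b h)))))

  inner-∑ : ∀ {n k} (h : Point n) (c : Fin k → ℝ) (v : Fin k → Point n) (y : Point n) →
    (∀ l → y l ≈ ∑ (λ i → c i * v i l)) → ⟨ h , y ⟩ ≈ ∑ (λ i → c i * ⟨ h , v i ⟩)
  inner-∑ h c v y e = begin
    ⟨ h , y ⟩
      ≈⟨ trans (⟨⟩≈∑ h y) (∑-cong (λ l → trans (*-congˡ (e l)) (sym (∑-*ˡ (h l) _)))) ⟩
    ∑ (λ l → ∑ (λ i → h l * (c i * v i l)))
      ≈⟨ ∑-swap _ ⟩
    ∑ (λ i → ∑ (λ l → h l * (c i * v i l)))
      ≈⟨ ∑-cong (λ i → trans (∑-cong (λ l → solve 3 (λ h c v → h :* (c :* v) := c :* (h :* v)) (h l) (c i) (v i l)))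
           (trans (∑-*ˡ (c i) _) (*-congˡ (sym (⟨⟩≈∑ h (v i)))))) ⟩
    ∑ (λ i → c i * ⟨ h , v i ⟩) ∎
    where open ≈-Reasoning

  two : ∀ {A : Set} → A → A → Fin 2 → A
  two y z zero = y
  two y z (suc _) = z

  combination₂ : ∀ {n} (c : Fin 2 → ℝ) (v : Fin 2 → Point n) k →
    combination c v k ≈ c zero * v zero k + c (suc zero) * v (suc zero) k
  combination₂ c v k = +-congˡ (+-identityʳ _)

  segment : ∀ {n} → Fin n → Fin n → Fin n → Fin n → Region n
  segment a b c e y = ∃[ s ] ∃[ t ] 0# ≤ s × 0# ≤ t × s + t ≈ 1# × (∀ k → y k ≈ s * root a b k + t * root c e k)

  root-distinct : ∀ {n} {a b c e : Fin n} → a ≢ b → c ≢ e → ¬ (a ≡ c × b ≡ e) → ∃[ k ] root a b k - root c e k # 0#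
  root-distinct {a = a} {b} {c} {e} a≢b c≢e h with a ≟ c
  ... | no a≢c = a , 0<⇒# (<-respʳ-≈ (sym (trans (+-cong (+-cong (reflexive (𝐞-≡ a)) (-‿cong (reflexive (𝐞-≢ (a≢b ∘ ≡.sym)))))
        (-‿cong (+-congʳ (reflexive (𝐞-≢ (a≢c ∘ ≡.sym))))))
        (solve 1 (λ f → :1 :- :0 :- (:0 :- f) := :1 :+ f) (𝐞 e a)))) (0<-+ 0<1 (0≤𝐞 e a)))
  ... | yes ≡.refl = b , #-respˡ-≈ (sym (trans (+-cong (+-congˡ (-‿cong (reflexive (𝐞-≡ b)))) (-‿cong (+-congˡ (-‿cong (reflexive (𝐞-≢ (b≢e ∘ ≡.sym)))))))
        (solve 1 (λ y → y :- :1 :- (y :- :0) := :- :1) (𝐞 a b)))) (<⇒# (<-respʳ-≈ -0#≈0# (neg-mono-< 0<1)))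
    where
    b≢e : b ≢ e
    b≢e p = h (≡.refl , p)

  module _ {n} (G : Graph n) where

    private
      P : Region n
      P = symmetricEdgePolytope G

    record Weights (y : Point n) : Set where
      field
        number  : ℕ
        from to : Fin number → Fin n
        arc     : ∀ i → adjacent G (from i) (to i) ≡ true
        weight  : Fin number → ℝ
        0≤weight : ∀ i → 0# ≤ weight i
        total   : ∑ weight ≈ 1#
        point   : ∀ k → y k ≈ ∑ (λ i → weight i * root (from i) (to i) k)

    weights : ∀ {y} → y ∈ P → Weights y
    weights (k , v , c , v∈ , 0≤c , ∑c , y≋) = record
      { number = k ; from = λ i → proj₁ (v∈ i) ; to = λ i → proj₁ (proj₂ (v∈ i))
      ; arc = λ i → proj₁ (proj₂ (proj₂ (v∈ i))) ; weight = c ; 0≤weight = 0≤c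
      ; total = trans (sym (sum≈∑ c)) ∑c
      ; point = λ l → trans (y≋ l) (trans (sum≈∑ _) (∑-cong (λ i → *-congˡ (proj₂ (proj₂ (proj₂ (v∈ i))) l)))) }

    segment⊆P : ∀ {a b c e} → adjacent G a b ≡ true → adjacent G c e ≡ true → segment a b c e ⊆ P
    segment⊆P {a} {b} {c} {e} ab ce (s , t , 0≤s , 0≤t , s+t≈1 , y≈) =
      2 , two (root a b) (root c e) , two s t ,
      (λ { zero → a , b , ab , λ k → refl ; (suc zero) → c , e , ce , λ k → refl }) ,
      (λ { zero → 0≤s ; (suc zero) → 0≤t }) ,
      trans (+-congˡ (+-identityʳ t)) s+t≈1 ,
      λ k → trans (y≈ k) (sym (combination₂ (two s t) (two (root a b) (root c e)) k))

    segment-first : ∀ (a b c e : Fin n) → root a b ∈ segment a b c e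
    segment-first a b c e = 1# , 0# , 0≤1 , ≤-refl , +-identityʳ 1# ,
      λ k → solve 2 (λ y z → y := :1 :* y :+ :0 :* z) (root a b k) (root c e k)

    segment-second : ∀ (a b c e : Fin n) → root c e ∈ segment a b c e
    segment-second a b c e = 0# , 1# , ≤-refl , 0≤1 , +-identityˡ 1# ,
      λ k → solve 2 (λ y z → z := :0 :* y :+ :1 :* z) (root a b k) (root c e k)

    root∈P : ∀ {a b} → adjacent G a b ≡ true → root a b ∈ P
    root∈P {a} {b} ab = segment⊆P {a} {b} {a} {b} ab ab {root a b} (segment-first a b a b)

    inner-segment : ∀ (h : Point n) {a b c e y β} → y ∈ segment a b c e → h a - h b ≈ β → h c - h e ≈ β → ⟨ h , y ⟩ ≈ β
    inner-segment h {a} {b} {c} {e} {y} {β} (s , t , _ , _ , s+t≈1 , y≈) ab ce = begin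
      ⟨ h , y ⟩
        ≈⟨ inner-∑ h (two s t) (two (root a b) (root c e)) y (λ k → trans (y≈ k) (trans (sym (combination₂ (two s t) (two (root a b) (root c e)) k)) (sum≈∑ _))) ⟩
      ∑ (λ i → two s t i * ⟨ h , two (root a b) (root c e) i ⟩)
        ≈⟨ trans (sym (sum≈∑ _)) (+-congˡ (+-identityʳ _)) ⟩
      s * ⟨ h , root a b ⟩ + t * ⟨ h , root c e ⟩
        ≈⟨ +-cong (*-congˡ (trans (inner-root h a b) ab)) (*-congˡ (trans (inner-root h c e) ce)) ⟩
      s * β + t * β
        ≈⟨ trans (sym (distribʳ β s t)) (trans (*-congʳ s+t≈1) (*-identityˡ β)) ⟩
      β ∎
      where open ≈-Reasoning

    Supports : Point n → ℝ → Set
    Supports h β = ∀ a b → adjacent G a b ≡ true → h a - h b ≤ β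

    inner-weights : ∀ (h : Point n) {y} (W : Weights y) → let open Weights W in
      ⟨ h , y ⟩ ≈ ∑ (λ i → weight i * (h (from i) - h (to i)))
    inner-weights h {y} W = trans (inner-∑ h weight (λ i → root (from i) (to i)) y point) (∑-cong (λ i → *-congˡ (inner-root h (from i) (to i))))
      where open Weights W

    ∑-weight* : ∀ {y} (W : Weights y) β → ∑ (λ i → Weights.weight W i * β) ≈ β
    ∑-weight* W β = trans (∑-*ʳ _ β) (trans (*-congʳ (Weights.total W)) (*-identityˡ β))

    supports⇒≤ : ∀ {h β} → Supports h β → ∀ y → y ∈ P → ⟨ h , y ⟩ ≤ β
    supports⇒≤ {h} {β} sup y y∈P = ≤-trans (≤-reflexive (inner-weights h W))
      (≤-trans (∑-mono (λ i → *-monoˡ-≤ (0≤weight i) (sup (from i) (to i) (arc i)))) (≤-reflexive (∑-weight* W β)))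
      where
      W : Weights y
      W = weights y∈P
      open Weights W

    slack≈0 : ∀ {h β y} → Supports h β → (W : Weights y) → ⟨ h , y ⟩ ≈ β → let open Weights W in
      ∀ i → weight i * (β - (h (from i) - h (to i))) ≈ 0#
    slack≈0 {h} {β} {y} sup W hy i = ≤-antisym (≤-trans (∑-term 0≤slack i) (≤-reflexive vanish)) (0≤slack i)
      where
      open Weights W
      0≤slack : ∀ i → 0# ≤ weight i * (β - (h (from i) - h (to i)))
      0≤slack i = 0≤-* (0≤weight i) (x≤y⇒0≤y-x (sup (from i) (to i) (arc i)))
      vanish : ∑ (λ i → weight i * (β - (h (from i) - h (to i)))) ≈ 0#
      vanish = trans (∑-cong (λ i → solve 3 (λ w b d → w :* (b :- d) := w :* b :- w :* d) (weight i) β _))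
        (trans (∑-sub _ _) (trans (+-cong (∑-weight* W β) (-‿cong (trans (sym (inner-weights h W)) hy))) (-‿inverseʳ β)))

    Tight : Point n → ℝ → Fin n → Fin n → Set
    Tight h β a b = h a - h b ≈ β

    used⇒tight : ∀ {h β y} → Supports h β → (W : Weights y) → ⟨ h , y ⟩ ≈ β → let open Weights W in
      ∀ i → weight i # 0# → Tight h β (from i) (to i)
    used⇒tight {h} {β} sup W hy i w#0 = begin
      z                  ≈⟨ solve 2 (λ b z → z := b :- (b :- z)) β z ⟩
      β - (β - z)        ≈⟨ +-congˡ (-‿cong (*≈0∧#0⇒≈0 (slack≈0 sup W hy i) w#0)) ⟩
      β - 0#             ≈⟨ solve 1 (λ b → b :- :0 := b) β ⟩
      β                  ∎
      where
      open ≈-Reasoning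
      open Weights W
      z : ℝ
      z = h (from i) - h (to i)

    ∈segment : ∀ {h β y a b c e} → Supports h β → y ∈ P → ⟨ h , y ⟩ ≈ β → ¬ (a ≡ c × b ≡ e) →
      (∀ i j → adjacent G i j ≡ true → ¬ (i ≡ a × j ≡ b) → ¬ (i ≡ c × j ≡ e) → ¬ Tight h β i j) →
      y ∈ segment a b c e
    ∈segment {h} {β} {y} {a} {b} {c} {e} sup y∈P hy distinct only =
      ∑ s , ∑ t , 0≤∑ (λ i → 0≤-* (0≤weight i) (0≤indicator _)) , 0≤∑ (λ i → 0≤-* (0≤weight i) (0≤indicator _)) ,
      trans (sym (∑-+ s t)) (trans (∑-cong (λ i → sym (sum-of-parts i (isFirst? i) (isSecond? i)))) total) ,
      λ k → trans (point k) (trans (∑-cong (λ i → part k i (isFirst? i) (isSecond? i)))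
        (trans (∑-+ _ _) (+-cong (∑-*ʳ s _) (∑-*ʳ t _))))
      where
      open Weights (weights y∈P)
      isFirst? : ∀ i → Dec (from i ≡ a × to i ≡ b)
      isFirst? i = from i ≟ a ×-dec to i ≟ b
      isSecond? : ∀ i → Dec (from i ≡ c × to i ≡ e)
      isSecond? i = from i ≟ c ×-dec to i ≟ e
      s t : Fin number → ℝ
      s i = weight i * indicator (does (isFirst? i))
      t i = weight i * indicator (does (isSecond? i))
      unused : ∀ i → ¬ (from i ≡ a × to i ≡ b) → ¬ (from i ≡ c × to i ≡ e) → weight i ≈ 0#
      unused i p q = ¬#⇒≈ (λ w#0 → only (from i) (to i) (arc i) p q (used⇒tight sup (weights y∈P) hy i w#0))
      sum-of-parts : ∀ i → (p : Dec (from i ≡ a × to i ≡ b)) (q : Dec (from i ≡ c × to i ≡ e)) →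
        weight i ≈ weight i * indicator (does p) + weight i * indicator (does q)
      sum-of-parts i (yes (p , q)) (yes (p′ , q′)) = ⊥-elim (distinct (≡.trans (≡.sym p) p′ , ≡.trans (≡.sym q) q′))
      sum-of-parts i (yes _) (no _) = solve 1 (λ w → w := w :* :1 :+ w :* :0) _
      sum-of-parts i (no _) (yes _) = solve 1 (λ w → w := w :* :0 :+ w :* :1) _
      sum-of-parts i (no p) (no q) = trans (unused i p q) (solve 1 (λ w → :0 := w :* :0 :+ w :* :0) (weight i))
      part : ∀ k i → (p : Dec (from i ≡ a × to i ≡ b)) (q : Dec (from i ≡ c × to i ≡ e)) →
        weight i * root (from i) (to i) k ≈ weight i * indicator (does p) * root a b k + weight i * indicator (does q) * root c e k
      part k i (yes (p , q)) (yes (p′ , q′)) = ⊥-elim (distinct (≡.trans (≡.sym p) p′ , ≡.trans (≡.sym q) q′))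
      part k i (yes (p , q)) (no _) = trans (*-congˡ (reflexive (≡.cong₂ (λ a b → root a b k) p q)))
        (solve 3 (λ w y z → w :* y := w :* :1 :* y :+ w :* :0 :* z) (weight i) _ _)
      part k i (no _) (yes (p , q)) = trans (*-congˡ (reflexive (≡.cong₂ (λ a b → root a b k) p q)))
        (solve 3 (λ w y z → w :* z := w :* :0 :* y :+ w :* :1 :* z) (weight i) _ _)
      part k i (no p) (no q) = trans (*-congʳ (unused i p q)) (solve 4 (λ w y z r → :0 :* r := w :* :0 :* y :+ w :* :0 :* z) (weight i) _ _ _)

    segment-dimension : ∀ {a b c e} → a ≢ b → c ≢ e → ¬ (a ≡ c × b ≡ e) → HasDimension 1 (segment a b c e)
    segment-dimension {a} {b} {c} {e} a≢b c≢e distinct = two (root a b) (root c e) ,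
      (λ { zero → segment-first a b c e ; (suc zero) → segment-second a b c e }) ,
      independent ,
      λ { (s , t , _ , _ , s+t≈1 , y≈) → two s t , trans (+-congˡ (+-identityʳ t)) s+t≈1 ,
            λ k → trans (y≈ k) (sym (combination₂ (two s t) (two (root a b) (root c e)) k)) }
      where
      independent : AffinelyIndependent (two (root a b) (root c e))
      independent c′ ∑c≈0 (i , c#0) with root-distinct a≢b c≢e distinct
      ... | k , r#0 = k , #-respˡ-≈ (sym (trans (combination₂ c′ (two (root a b) (root c e)) k)
            (trans (+-congˡ (*-congʳ c₁≈-c₀)) (solve 3 (λ c y z → c :* y :+ :- c :* z := c :* (y :- z)) (c′ zero) _ _))))
            (x#0y#0→xy#0 (c₀#0 i c#0) r#0)
        where
        c₁≈-c₀ : c′ (suc zero) ≈ - c′ zero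
        c₁≈-c₀ = trans (solve 2 (λ y z → z := (y :+ (z :+ :0)) :- y) (c′ zero) (c′ (suc zero)))
          (trans (+-congʳ ∑c≈0) (+-identityˡ _))
        c₀#0 : ∀ i → c′ i # 0# → c′ zero # 0#
        c₀#0 zero h = h
        c₀#0 (suc zero) h = #0-factorʳ {0# - 1#} (#-respˡ-≈ (trans c₁≈-c₀ (solve 1 (λ y → :- y := (:0 :- :1) :* y) _)) h)

    segment-isEdge : ∀ {a b c e} → adjacent G a b ≡ true → adjacent G c e ≡ true → ¬ (a ≡ c × b ≡ e) →
      Potential G a b c e → IsEdge P (segment a b c e)
    segment-isEdge {a} {b} {c} {e} ab ce distinct pot =
      ((h , β , ((a , 0<⇒# 0<ha) , supports⇒≤ sup , root a b , root∈P ab , trans (inner-root h a b) ab-tight) ,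
        ((λ {y} y∈ → segment⊆P ab ce y∈ , inner-segment h y∈ ab-tight ce-tight) ,
         (λ { (y∈P , hy) → ∈segment sup y∈P hy distinct (λ i j ij p q t → <-irrefl t (strict i j ij p q)) }))) ,
       proper) ,
      segment-dimension (adjacent⇒≢ G ab) (adjacent⇒≢ G ce) distinct
      where
      open Potential pot
      h : Point n
      h i = fromℕ (height i)
      β : ℝ
      β = fromℕ (suc drop)
      difference : ∀ {i j} → height i ≡ height j ℕ.+ suc drop → h i - h j ≈ β
      difference {i} {j} eq = trans (+-congʳ (trans (reflexive (≡.cong fromℕ eq)) (fromℕ-+ (height j) (suc drop))))
        (solve 2 (λ y b → y :+ b :- y := b) (h j) β)
      ab-tight : Tight h β a b
      ab-tight = difference drop-ab
      ce-tight : Tight h β c e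
      ce-tight = difference drop-ce
      0<β : 0# < β
      0<β = 0<fromℕ drop
      0<ha : 0# < h a
      0<ha = <-respʳ-≈ (trans (+-comm _ _) (trans (sym (fromℕ-+ (height b) (suc drop))) (reflexive (≡.cong fromℕ (≡.sym drop-ab)))))
        (0<-+ 0<β (0≤fromℕ (height b)))
      strict : ∀ i j → adjacent G i j ≡ true → ¬ (i ≡ a × j ≡ b) → ¬ (i ≡ c × j ≡ e) → h i - h j < β
      strict i j ij p q = +-cancelʳ-< (h j) (<-respˡ-≈ (solve 2 (λ y z → y := y :- z :+ z) (h i) (h j))
        (<-≤-trans (<-respʳ-≈ (+-comm (fromℕ (height i)) 1#) (<-fromDifference 1# 0<1 refl))
          (≤-trans (fromℕ-mono-≤ (others i j ij p q)) (≤-reflexive (trans (fromℕ-+ (height j) (suc drop)) (+-comm _ _))))))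
      sup : Supports h β
      sup i j ij = decide ((i ≟ a) ×-dec (j ≟ b)) ((i ≟ c) ×-dec (j ≟ e))
        where
        decide : Dec (i ≡ a × j ≡ b) → Dec (i ≡ c × j ≡ e) → h i - h j ≤ β
        decide (yes (≡.refl , ≡.refl)) _ = ≤-reflexive ab-tight
        decide (no _) (yes (≡.refl , ≡.refl)) = ≤-reflexive ce-tight
        decide (no p) (no q) = <⇒≤ (strict i j ij p q)
      proper : ¬ (segment a b c e ≐ P)
      proper (_ , P⊆) = <-irrefl (trans (sym (trans (inner-root h b a) (trans (solve 2 (λ y z → z :- y := :- (y :- z)) (h a) (h b)) (-‿cong ab-tight))))
          (inner-segment h (P⊆ {root b a} (root∈P {b} {a} (adjacent-flip G ab))) ab-tight ce-tight))
        (<-trans (<-respʳ-≈ -0#≈0# (neg-mono-< 0<β)) 0<β)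


    -- All roots have the same length, so a line contains at most two of them.
    noThreeCollinear : ∀ {F : Region n} {a b c e i j} → HasDimension 1 F → a ≢ b → c ≢ e → i ≢ j →
      root a b ∈ F → root c e ∈ F → root i j ∈ F →
      ¬ (a ≡ c × b ≡ e) → ¬ (a ≡ i × b ≡ j) → ¬ (c ≡ i × e ≡ j) → ⊥
    noThreeCollinear {F} {a} {b} {c} {e} {i} {j} (v , _ , _ , F⊆) a≢b c≢e i≢j r₁∈ r₂∈ r₃∈ d₁₂ d₁₃ d₂₃ =
      <-irrefl (sym γ≈0) 0<γ
      where
      open ≈-Reasoning
      δ′ : Point n
      δ′ k = v (suc zero) k - v zero k
      α β γ : ℝ
      α = ∑ (λ k → v zero k * v zero k)
      β = ∑ (λ k → v zero k * δ′ k)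
      γ = ∑ (λ k → δ′ k * δ′ k)
      OnLine : Point n → ℝ → Set
      OnLine y t = ∀ k → y k ≈ v zero k + t * δ′ k
      onLine : ∀ y → y ∈ F → ∃[ t ] OnLine y t
      onLine y y∈F = c′ (suc zero) , λ k → trans (proj₂ (proj₂ (F⊆ {y} y∈F)) k) (trans (combination₂ c′ v k) (trans
          (+-congʳ (*-congʳ (trans (first≈ (c′ zero) (c′ (suc zero))) (+-congʳ (proj₁ (proj₂ (F⊆ {y} y∈F)))))))
          (line (c′ (suc zero)) (v zero k) (v (suc zero) k))))
        where
        c′ : Fin 2 → ℝ
        c′ = proj₁ (F⊆ {y} y∈F)
        first≈ : ∀ y z → y ≈ (y + (z + 0#)) - z
        first≈ = solve 2 (λ y z → y := (y :+ (z :+ :0)) :- z)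
        line : ∀ t y z → (1# - t) * y + t * z ≈ y + t * (z - y)
        line = solve 3 (λ t y z → (:1 :- t) :* y :+ t :* z := y :+ t :* (z :- y))
      norm : ∀ {a b} → a ≢ b → ∀ t → OnLine (root a b) t → α + fromℕ 2 * t * β + t * t * γ ≈ fromℕ 2
      norm {a} {b} a≢b t on = begin
        α + fromℕ 2 * t * β + t * t * γ
          ≈⟨ +-cong (+-congˡ (sym (∑-*ˡ _ _))) (sym (∑-*ˡ _ _)) ⟩
        α + ∑ (λ k → fromℕ 2 * t * (v zero k * δ′ k)) + ∑ (λ k → t * t * (δ′ k * δ′ k))
          ≈⟨ trans (+-congʳ (sym (∑-+ _ _))) (sym (∑-+ _ _)) ⟩
        ∑ (λ k → v zero k * v zero k + fromℕ 2 * t * (v zero k * δ′ k) + t * t * (δ′ k * δ′ k))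
          ≈⟨ ∑-cong (λ k → trans (solve 3 (λ y t z → y :* y :+ :2 :* t :* (y :* z) :+ t :* t :* (z :* z) := (y :+ t :* z) :* (y :+ t :* z)) (v zero k) t (δ′ k))
               (*-cong (sym (on k)) (sym (on k)))) ⟩
        ∑ (λ k → root a b k * root a b k)
          ≈⟨ trans (sym (⟨⟩≈∑ (root a b) (root a b))) (inner-root (root a b) a b) ⟩
        root a b a - root a b b
          ≈⟨ +-cong (+-cong (reflexive (𝐞-≡ a)) (-‿cong (reflexive (𝐞-≢ (a≢b ∘ ≡.sym))))) (-‿cong (+-cong (reflexive (𝐞-≢ a≢b)) (-‿cong (reflexive (𝐞-≡ b))))) ⟩
        1# - 0# - (0# - 1#)
          ≈⟨ solve 0 (:1 :- :0 :- (:0 :- :1) := :2) ⟩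
        fromℕ 2 ∎
      apart : ∀ {a b c e} → a ≢ b → c ≢ e → ¬ (a ≡ c × b ≡ e) → ∀ t t′ → OnLine (root a b) t → OnLine (root c e) t′ →
        ∃[ k ] (t - t′) * δ′ k # 0#
      apart {a} {b} {c} {e} a≢b c≢e distinct t t′ on on′ = proj₁ coordinate , #-respˡ-≈ (difference (proj₁ coordinate)) (proj₂ coordinate)
        where
        coordinate : ∃[ k ] root a b k - root c e k # 0#
        coordinate = root-distinct a≢b c≢e distinct
        line : ∀ y t t′ z → y + t * z - (y + t′ * z) ≈ (t - t′) * z
        line = solve 4 (λ y t t′ z → y :+ t :* z :- (y :+ t′ :* z) := (t :- t′) :* z)
        difference : ∀ k → root a b k - root c e k ≈ (t - t′) * δ′ k
        difference k = trans (+-cong (on k) (-‿cong (on′ k))) (line (v zero k) t t′ (δ′ k))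
      t₁ t₂ t₃ : ℝ
      t₁ = proj₁ (onLine (root a b) r₁∈)
      t₂ = proj₁ (onLine (root c e) r₂∈)
      t₃ = proj₁ (onLine (root i j) r₃∈)
      on₁ : OnLine (root a b) t₁
      on₁ = proj₂ (onLine (root a b) r₁∈)
      on₂ : OnLine (root c e) t₂
      on₂ = proj₂ (onLine (root c e) r₂∈)
      on₃ : OnLine (root i j) t₃
      on₃ = proj₂ (onLine (root i j) r₃∈)
      chord : ∀ t t′ → t - t′ # 0# → α + fromℕ 2 * t * β + t * t * γ ≈ fromℕ 2 → α + fromℕ 2 * t′ * β + t′ * t′ * γ ≈ fromℕ 2 →
        fromℕ 2 * β + (t + t′) * γ ≈ 0#
      chord t t′ h e e′ = *≈0∧#0⇒≈0 (trans (solve 5 (λ a b g t s → (t :- s) :* (:2 :* b :+ (t :+ s) :* g)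
          := (a :+ :2 :* t :* b :+ t :* t :* g) :- (a :+ :2 :* s :* b :+ s :* s :* g)) α β γ t t′)
        (trans (+-cong e (-‿cong e′)) (-‿inverseʳ (fromℕ 2)))) h
      γ≈0 : γ ≈ 0#
      γ≈0 = *≈0∧#0⇒≈0 (trans (solve 5 (λ b g t s r → (s :- r) :* g := (:2 :* b :+ (t :+ s) :* g) :- (:2 :* b :+ (t :+ r) :* g)) β γ t₁ t₂ t₃)
        (trans (+-cong (chord t₁ t₂ (#0-factorˡ (proj₂ (apart a≢b c≢e d₁₂ t₁ t₂ on₁ on₂))) (norm a≢b t₁ on₁) (norm c≢e t₂ on₂))
          (-‿cong (chord t₁ t₃ (#0-factorˡ (proj₂ (apart a≢b i≢j d₁₃ t₁ t₃ on₁ on₃))) (norm a≢b t₁ on₁) (norm i≢j t₃ on₃)))) (-‿inverseʳ 0#)))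
        (#0-factorˡ (proj₂ (apart c≢e i≢j d₂₃ t₂ t₃ on₂ on₃)))
      0<γ : 0# < γ
      0<γ = <-≤-trans (#0⇒0<² (#0-factorʳ (proj₂ witness))) (∑-term (λ k → 0≤x*x (δ′ k)) (proj₁ witness))
        where
        witness : ∃[ k ] (t₁ - t₂) * δ′ k # 0#
        witness = apart a≢b c≢e d₁₂ t₁ t₂ on₁ on₂

    module Edge {F : Region n} (edge : IsEdge P F) where

      private
        h : Point n
        h = proj₁ (proj₁ (proj₁ edge))
        β : ℝ
        β = proj₁ (proj₂ (proj₁ (proj₁ edge)))
        supporting : IsSupportingHyperplane P h β
        supporting = proj₁ (proj₂ (proj₂ (proj₁ (proj₁ edge))))
        F≐ : F ≐ (P ∩ hyperplane h β)
        F≐ = proj₂ (proj₂ (proj₂ (proj₁ (proj₁ edge))))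
        F≢P : ¬ (F ≐ P)
        F≢P = proj₂ (proj₁ edge)
        dim : HasDimension 1 F
        dim = proj₂ edge

        sup : Supports h β
        sup a b ab = ≤-trans (≤-reflexive (sym (inner-root h a b))) (proj₁ (proj₂ supporting) (root a b) (root∈P ab))

        ∈F⇒tight : ∀ {a b} → root a b ∈ F → Tight h β a b
        ∈F⇒tight {a} {b} r∈ = trans (sym (inner-root h a b)) (proj₂ (proj₁ F≐ {root a b} r∈))

        tight⇒∈F : ∀ {a b} → adjacent G a b ≡ true → Tight h β a b → root a b ∈ F
        tight⇒∈F {a} {b} ab t = proj₂ F≐ {root a b} (root∈P ab , trans (inner-root h a b) t)

        β≉0 : ¬ (β ≈ 0#)
        β≉0 β≈0 = F≢P ((λ {y} y∈ → proj₁ (proj₁ F≐ y∈)) , λ {y} y∈P → proj₂ F≐ (y∈P , vanish y y∈P))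
          where
          zero-arc : ∀ a b → adjacent G a b ≡ true → h a - h b ≈ 0#
          zero-arc a b ab = ≤-antisym (≤-trans (sup a b ab) (≤-reflexive β≈0))
            (≤-trans (≤-reflexive (sym -0#≈0#)) (≤-trans (neg-mono-≤ (≤-trans (sup b a (adjacent-flip G ab)) (≤-reflexive β≈0)))
              (≤-reflexive (solve 2 (λ y z → :- (z :- y) := y :- z) (h a) (h b)))))
          vanish : ∀ y → y ∈ P → ⟨ h , y ⟩ ≈ β
          vanish y y∈P = trans (inner-weights h W) (trans (∑-zero (λ i → trans (*-congˡ (zero-arc (from i) (to i) (arc i))) (zeroʳ _))) (sym β≈0))
            where
            W : Weights y
            W = weights y∈P
            open Weights W

        noThird : ∀ {a b c e i j} → adjacent G a b ≡ true → adjacent G c e ≡ true → adjacent G i j ≡ true →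
          root a b ∈ F → root c e ∈ F → Tight h β i j → ¬ (a ≡ c × b ≡ e) → ¬ (a ≡ i × b ≡ j) → ¬ (c ≡ i × e ≡ j) → ⊥
        noThird ab ce ij r₁ r₂ t = noThreeCollinear dim (adjacent⇒≢ G ab) (adjacent⇒≢ G ce) (adjacent⇒≢ G ij) r₁ r₂ (tight⇒∈F ij t)

        -- If two arcs are at most β and add up to 2β, both are tight.
        both-tight : ∀ {y z} → y ≤ β → z ≤ β → y + z ≈ β + β → y ≈ β
        both-tight {y} {z} y≤ z≤ e = ≤-antisym y≤ (≤-fromDifference (β - z) (x≤y⇒0≤y-x z≤)
          (trans (solve 2 (λ b z → b :+ (b :- z) := b :+ b :- z) β z) (trans (+-congʳ (sym e)) (solve 2 (λ y z → y :+ z :- z := y) y z))))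

        unobstructed : ∀ {a b c e} → adjacent G a b ≡ true → adjacent G c e ≡ true → ¬ (a ≡ c × b ≡ e) →
          root a b ∈ F → root c e ∈ F → ¬ Obstruction G a b c e
        unobstructed {a} {b} ab ce distinct r₁ r₂ (opposite ≡.refl ≡.refl) = β≉0 (double (begin
            β + β                      ≈⟨ +-cong (∈F⇒tight {a} {b} r₁) (∈F⇒tight {b} {a} r₂) ⟨
            h a - h b + (h b - h a)    ≈⟨ solve 2 (λ y z → y :- z :+ (z :- y) := :0) (h a) (h b) ⟩
            0#                         ∎))
          where
          open ≈-Reasoning
          double : β + β ≈ 0# → β ≈ 0#
          double e = *≈0∧#0⇒≈0 {fromℕ 2} (trans (solve 1 (λ b → :2 :* b := b :+ b) β) e) (0<⇒# (0<fromℕ 1))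
        unobstructed {a} {b} {_} {e} ab be distinct r₁ r₂ (shortcut ≡.refl ae) = β≉0 (≤-antisym β≤0 0≤β)
          where
          open ≤-Reasoning
          sum-tight : β + β ≈ h a - h e
          sum-tight = trans (+-cong (sym (∈F⇒tight {a} {b} r₁)) (sym (∈F⇒tight {b} {e} r₂)))
            (solve 3 (λ a b e → a :- b :+ (b :- e) := a :- e) (h a) (h b) (h e))
          β≤0 : β ≤ 0#
          β≤0 = +-cancelʳ-≤ β (≤-trans (≤-reflexive sum-tight) (≤-trans (sup a e ae) (≤-reflexive (sym (+-identityˡ β)))))
          0≤β : 0# ≤ β
          0≤β = *-cancelˡ-≤ (0<fromℕ 1) (≤-fromDifference (β - (h b - h a)) (x≤y⇒0≤y-x (sup b a (adjacent-flip G ab)))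
            (trans (solve 3 (λ t y z → :2 :* :0 :+ (t :- (z :- y)) := t :+ (y :- z)) β (h a) (h b))
              (trans (+-congˡ (∈F⇒tight {a} {b} r₁)) (solve 1 (λ t → t :+ t := :2 :* t) β))))
        unobstructed {a} {b} {_} {e} ab be distinct r₁ r₂ (detour ≡.refl o o≢b ao oe) =
          noThird ab be ao r₁ r₂ (both-tight (sup a o ao) (sup o e oe) (trans
              (solve 4 (λ a b o e → a :- o :+ (o :- e) := a :- b :+ (b :- e)) (h a) (h b) (h o) (h e))
              (+-cong (∈F⇒tight {a} {b} r₁) (∈F⇒tight {b} {e} r₂))))
            distinct (λ { (_ , b≡o) → o≢b (≡.sym b≡o) }) (λ { (b≡a , _) → adjacent⇒≢ G ab (≡.sym b≡a) })
        unobstructed {a} {b} {c} {e} ab ce distinct r₁ r₂ (square a≢c b≢e ae cb) =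
          noThird ab ce ae r₁ r₂ (both-tight (sup a e ae) (sup c b cb) (trans
              (solve 4 (λ a b c e → a :- e :+ (c :- b) := a :- b :+ (c :- e)) (h a) (h b) (h c) (h e))
              (+-cong (∈F⇒tight {a} {b} r₁) (∈F⇒tight {c} {e} r₂))))
            distinct (λ { (_ , b≡e) → b≢e b≡e }) (λ { (c≡a , _) → a≢c (≡.sym c≡a) })

      compatible-true : ∀ {a b c e} → adjacent G a b ≡ true → adjacent G c e ≡ true → ¬ (a ≡ c × b ≡ e) →
        root a b ∈ F → root c e ∈ F → compatible G a b c e ≡ true
      compatible-true {a} {b} {c} {e} ab ce distinct r₁ r₂ with compatible G a b c e in eq
      ... | true = ≡.refl
      ... | false = ⊥-elim ([ unobstructed ab ce distinct r₁ r₂ ,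
                              unobstructed ce ab (λ { (p , q) → distinct (≡.sym p , ≡.sym q) }) r₂ r₁ ]′
                            (obstruction G ab ce distinct eq))

      ≐segment : ∀ {a b c e} → adjacent G a b ≡ true → adjacent G c e ≡ true → ¬ (a ≡ c × b ≡ e) →
        root a b ∈ F → root c e ∈ F → F ≐ segment a b c e
      ≐segment {a} {b} {c} {e} ab ce distinct r₁ r₂ =
        (λ {y} y∈ → ∈segment sup (proj₁ (proj₁ F≐ y∈)) (proj₂ (proj₁ F≐ y∈)) distinct
          (λ i j ij p q t → noThird ab ce ij r₁ r₂ t distinct (λ { (x , z) → p (≡.sym x , ≡.sym z) }) (λ { (x , z) → q (≡.sym x , ≡.sym z) }))) ,
        (λ {y} y∈ → proj₂ F≐ (segment⊆P ab ce y∈ , inner-segment h y∈ (∈F⇒tight {a} {b} r₁) (∈F⇒tight {c} {e} r₂)))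

      atMostTwo : ∀ {a b c e i j} → adjacent G a b ≡ true → adjacent G c e ≡ true → adjacent G i j ≡ true →
        root a b ∈ F → root c e ∈ F → root i j ∈ F → ¬ (a ≡ c × b ≡ e) → (i ≡ a × j ≡ b) ⊎ (i ≡ c × j ≡ e)
      atMostTwo {a} {b} {c} {e} {i} {j} ab ce ij r₁ r₂ r₃ distinct with i ≟ a ×-dec j ≟ b | i ≟ c ×-dec j ≟ e
      ... | yes p | _ = inj₁ p
      ... | no _ | yes q = inj₂ q
      ... | no p | no q = ⊥-elim (noThird ab ce ij r₁ r₂ (∈F⇒tight {i} {j} r₃) distinct (λ { (x , z) → p (≡.sym x , ≡.sym z) }) (λ { (x , z) → q (≡.sym x , ≡.sym z) }))

      twoVertices : ∃[ a ] ∃[ b ] ∃[ c ] ∃[ e ] adjacent G a b ≡ true × adjacent G c e ≡ true ×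
        ¬ (a ≡ c × b ≡ e) × root a b ∈ F × root c e ∈ F
      twoVertices = from₁ i , to₁ i , from₂ , to₂ , arc₁ i , arc₂ , distinct , first∈F , second∈F
        where
        v : Fin 2 → Point n
        v = proj₁ dim
        v∈F : ∀ l → v l ∈ F
        v∈F = proj₁ (proj₂ dim)
        W : ∀ l → Weights (v l)
        W l = weights (proj₁ (proj₁ F≐ {v l} (v∈F l)))
        hv : ∀ l → ⟨ h , v l ⟩ ≈ β
        hv l = proj₂ (proj₁ F≐ {v l} (v∈F l))
        open Weights (W zero) using (weight) renaming (number to number₁; from to from₁; to to to₁; arc to arc₁; total to total₁)
        used : ∃[ i ] weight i # 0#
        used = #0-∑ (#-respˡ-≈ (sym total₁) (0<⇒# 0<1))
        i : Fin number₁
        i = proj₁ used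
        r : Point n
        r = root (from₁ i) (to₁ i)
        first∈F : r ∈ F
        first∈F = tight⇒∈F (arc₁ i) (used⇒tight sup (W zero) (hv zero) i (proj₂ used))
        separated : ∃[ k ] v zero k - v (suc zero) k # 0#
        separated = proj₁ raw , #-respˡ-≈ (trans (combination₂ (two 1# (- 1#)) v (proj₁ raw)) (minus _ _)) (proj₂ raw)
          where
          raw : ∃[ k ] combination (two 1# (- 1#)) v k # 0#
          raw = proj₁ (proj₂ (proj₂ dim)) (two 1# (- 1#)) (trans (+-congˡ (+-identityʳ _)) (-‿inverseʳ 1#)) (zero , 0<⇒# 0<1)
          minus : ∀ y z → 1# * y + - 1# * z ≈ y - z
          minus = solve 2 (λ y z → :1 :* y :+ :- :1 :* z := y :- z)
        k : Fin n
        k = proj₁ separated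
        away-from-r : ∃[ l ] v l k - r k # 0#
        away-from-r = [ (λ z#0 → zero , z#0) , (λ z#0 → suc zero , #0-factorʳ z#0) ]′
            (#0-+ (#-respˡ-≈ (through (v zero k) (v (suc zero) k) (r k)) (proj₂ separated)))
          where
          through : ∀ y z r → y - z ≈ (y - r) + (0# - 1#) * (z - r)
          through = solve 3 (λ y z r → y :- z := (y :- r) :+ (:0 :- :1) :* (z :- r))
        l : Fin 2
        l = proj₁ away-from-r
        module W₂ = Weights (W l)
        other : ∃[ s ] W₂.weight s * (root (W₂.from s) (W₂.to s) k - r k) # 0#
        other = #0-∑ (#-respˡ-≈ (begin
          v l k - r k
            ≈⟨ +-cong (W₂.point k) (-‿cong (sym (∑-weight* (W l) (r k)))) ⟩
          ∑ (λ s → W₂.weight s * root (W₂.from s) (W₂.to s) k) - ∑ (λ s → W₂.weight s * r k)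
            ≈⟨ ∑-sub _ _ ⟨
          ∑ (λ s → W₂.weight s * root (W₂.from s) (W₂.to s) k - W₂.weight s * r k)
            ≈⟨ ∑-cong (λ s → solve 3 (λ w y z → w :* y :- w :* z := w :* (y :- z)) (W₂.weight s) _ (r k)) ⟩
          ∑ (λ s → W₂.weight s * (root (W₂.from s) (W₂.to s) k - r k)) ∎) (proj₂ away-from-r))
          where open ≈-Reasoning
        s : Fin W₂.number
        s = proj₁ other
        from₂ to₂ : Fin n
        from₂ = W₂.from s
        to₂ = W₂.to s
        arc₂ : adjacent G from₂ to₂ ≡ true
        arc₂ = W₂.arc s
        second∈F : root from₂ to₂ ∈ F
        second∈F = tight⇒∈F arc₂ (used⇒tight sup (W l) (hv l) s (#0-factorˡ (proj₂ other)))
        distinct : ¬ (from₁ i ≡ from₂ × to₁ i ≡ to₂)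
        distinct (p , q) = #-irrefl (trans (+-congˡ (-‿cong (reflexive (≡.cong₂ (λ a b → root a b k) p q)))) (-‿inverseʳ _))
          (#0-factorʳ (proj₂ other))

  module EdgeBijection {n} (G : Graph n) where



    private
      P : Region n
      P = symmetricEdgePolytope G

      arcRoot : Arc n → Point n
      arcRoot v = root (tail v) (head v)

      arcSegment : Arc n → Arc n → Region n
      arcSegment v w = segment (tail v) (head v) (tail w) (head w)

      isEdge : ∀ {v w} → Selected G v w → IsEdge P (arcSegment v w)
      isEdge S = segment-isEdge G first-arc second-arc distinct (potential G first-arc second-arc compatible-arcs)
        where open Selected S

      firstArc secondArc : Fin (edgeNumber n G) → Arc n
      firstArc k = left {n} (nth (selected G) k)
      secondArc k = right {n} (nth (selected G) k)

      selection : ∀ k → Selected G (firstArc k) (secondArc k)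
      selection k = selected⇒ G (nth (selected G) k) (nth-true (selected G) k)

      edge : Fin (edgeNumber n G) → Σ (Region n) (IsEdge P)
      edge k = arcSegment (firstArc k) (secondArc k) , isEdge (selection k)

      vertex : ∀ {v w} → Selected G v w → ∀ {v′} → adjacent G (tail v′) (head v′) ≡ true →
        arcRoot v′ ∈ arcSegment v w → v′ ≡ v ⊎ v′ ≡ w
      vertex {v} {w} S {v′} arc r∈ = [ (λ (p , q) → inj₁ (arc-≡ {n} {v′} {v} p q)) , (λ (p , q) → inj₂ (arc-≡ {n} {v′} {w} p q)) ]′
        (Edge.atMostTwo G {arcSegment v w} (isEdge S) {tail v} {head v} {tail w} {head w} {tail v′} {head v′} first-arc second-arc arc
          (segment-first G (tail v) (head v) (tail w) (head w)) (segment-second G (tail v) (head v) (tail w) (head w)) r∈ distinct)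
        where open Selected S

      same : ∀ {v w v′ w′ : Arc n} → v Fin.< w → v′ Fin.< w′ → v ≡ v′ ⊎ v ≡ w′ → w ≡ v′ ⊎ w ≡ w′ → v ≡ v′ × w ≡ w′
      same lt lt′ (inj₁ p) (inj₂ q) = p , q
      same lt lt′ (inj₁ p) (inj₁ q) = ⊥-elim (Fin.<⇒≢ lt (≡.trans p (≡.sym q)))
      same lt lt′ (inj₂ p) (inj₂ q) = ⊥-elim (Fin.<⇒≢ lt (≡.trans p (≡.sym q)))
      same lt lt′ (inj₂ ≡.refl) (inj₁ ≡.refl) = ⊥-elim (Fin.<-asym lt lt′)

      edge-injective : ∀ {k l} → proj₁ (edge k) ≐ proj₁ (edge l) → k ≡ l
      edge-injective {k} {l} (k⊆l , _) = nth-injective (selected G) k l (pair-≡ {n} (proj₁ equal) (proj₂ equal))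
        where
        open Selected (selection k)
        equal : firstArc k ≡ firstArc l × secondArc k ≡ secondArc l
        equal = same ordered (Selected.ordered (selection l))
          (vertex (selection l) {firstArc k} first-arc (k⊆l {arcRoot (firstArc k)} (segment-first G (tail (firstArc k)) (head (firstArc k)) (tail (secondArc k)) (head (secondArc k)))))
          (vertex (selection l) {secondArc k} second-arc (k⊆l {arcRoot (secondArc k)} (segment-second G (tail (firstArc k)) (head (firstArc k)) (tail (secondArc k)) (head (secondArc k)))))

      edge-surjective : ∀ (F : Σ (Region n) (IsEdge P)) → ∃[ k ] proj₁ (edge k) ≐ proj₁ F
      edge-surjective (F , isE) = orient (Fin.<-cmp v₀ w₀)
        where
        vertices : ∃[ a ] ∃[ b ] ∃[ c ] ∃[ e ] adjacent G a b ≡ true × adjacent G c e ≡ true ×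
          ¬ (a ≡ c × b ≡ e) × root a b ∈ F × root c e ∈ F
        vertices = Edge.twoVertices G isE
        a b c e : Fin n
        a = proj₁ vertices
        b = proj₁ (proj₂ vertices)
        c = proj₁ (proj₂ (proj₂ vertices))
        e = proj₁ (proj₂ (proj₂ (proj₂ vertices)))
        facts : adjacent G a b ≡ true × adjacent G c e ≡ true × ¬ (a ≡ c × b ≡ e) × root a b ∈ F × root c e ∈ F
        facts = proj₂ (proj₂ (proj₂ (proj₂ vertices)))
        atArc : ∀ {a b} (v : Arc n) → remQuot {n} n v ≡ (a , b) → adjacent G a b ≡ true → root a b ∈ F →
          adjacent G (tail v) (head v) ≡ true × arcRoot v ∈ F
        atArc v ≡.refl ab r = ab , r
        v₀ w₀ : Arc n
        v₀ = combine a b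
        w₀ = combine c e
        arcs : remQuot {n} n v₀ ≡ (a , b) × remQuot {n} n w₀ ≡ (c , e)
        arcs = Fin.remQuot-combine {n} {n} a b , Fin.remQuot-combine {n} {n} c e
        v₀∈ : adjacent G (tail v₀) (head v₀) ≡ true × arcRoot v₀ ∈ F
        v₀∈ = atArc v₀ (proj₁ arcs) (proj₁ facts) (proj₁ (proj₂ (proj₂ (proj₂ facts))))
        w₀∈ : adjacent G (tail w₀) (head w₀) ≡ true × arcRoot w₀ ∈ F
        w₀∈ = atArc w₀ (proj₂ arcs) (proj₁ (proj₂ facts)) (proj₂ (proj₂ (proj₂ (proj₂ facts))))
        find : ∀ v w → v Fin.< w → adjacent G (tail v) (head v) ≡ true × arcRoot v ∈ F →
          adjacent G (tail w) (head w) ≡ true × arcRoot w ∈ F → ∃[ k ] proj₁ (edge k) ≐ F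
        find v w v<w (av , rv) (aw , rw) = proj₁ selected-pair , transport (proj₁ (proj₂ selected-pair)) (proj₂ (proj₂ selected-pair))
          where
          apart : ¬ (tail {n} v ≡ tail {n} w × head {n} v ≡ head {n} w)
          apart (p , q) = Fin.<⇒≢ v<w (arc-≡ {n} {v} {w} p q)
          selected-pair : ∃[ k ] firstArc k ≡ v × secondArc k ≡ w
          selected-pair = selected⇐ G v w (record
            { ordered = v<w ; first-arc = av ; second-arc = aw
            ; compatible-arcs = Edge.compatible-true G isE av aw apart rv rw })
          F≐ : F ≐ arcSegment v w
          F≐ = Edge.≐segment G isE av aw apart rv rw
          transport : ∀ {v′ w′} → v′ ≡ v → w′ ≡ w → arcSegment v′ w′ ≐ F
          transport ≡.refl ≡.refl = (λ {y} → proj₂ F≐ {y}) , (λ {y} → proj₁ F≐ {y})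
        orient : _ → ∃[ k ] proj₁ (edge k) ≐ F
        orient (tri< v<w _ _) = find v₀ w₀ v<w v₀∈ w₀∈
        orient (tri> _ _ w<v) = find w₀ v₀ w<v w₀∈ v₀∈
        orient (tri≈ _ v≡w _) = ⊥-elim (proj₁ (proj₂ (proj₂ facts)) (≡.cong proj₁ same-arc , ≡.cong proj₂ same-arc))
          where
          same-arc : (a , b) ≡ (c , e)
          same-arc = ≡.trans (≡.sym (proj₁ arcs)) (≡.trans (≡.cong (remQuot {n} n) v≡w) (proj₂ arcs))

    numberOfEdges : HasNumberOfEdges P (edgeNumber n G)
    numberOfEdges = record
      { to = edge
      ; cong = λ { ≡.refl → (λ y∈ → y∈) , (λ y∈ → y∈) }
      ; bijective = edge-injective , λ F → proj₁ (edge-surjective F) , λ { ≡.refl → proj₂ (edge-surjective F) } }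

theorem3p3 :
  (R : RealField) →
  let open Theory R in
  (√2 : ℝ) → 0# < √2 → √2 ^ 2 ≈ fromℕ 2 →
  Σ (∀ n → Graph n → ℕ) λ K →
  (∀ n (G : Graph n) → HasNumberOfEdges (symmetricEdgePolytope G) (K n G)) ×
  ((p : Sequence) → (∀ n → 0# < p n × p n < 1#) →
   let
     𝕍K : Sequence
     𝕍K = λ n → 𝕍 (p n) (λ (G : Graph n) → fromℕ (K n G))
   in
   (𝕍K ≃ (λ n → fromℕ n ^ 6 * p n ^ 3 * (1# - p n) * (1# - √2 * p n) ^ 2
                + fromℕ n ^ 5 * p n ^ 3 * (1# - p n)
                + fromℕ n ^ 4 * p n ^ 2 * (1# - p n)))
   × (p ≫ (n^- 2) →
      (λ n → fromℕ n ^ 6 * p n ^ 3 * (1# - p n) * (1# - √2 * p n) ^ 2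
             + fromℕ n ^ 5 * p n ^ 3 * (1# - p n)
             + fromℕ n ^ 4 * p n ^ 2 * (1# - p n))
      ≃ (λ n → fromℕ n ^ 6 * p n ^ 3 * (1# - p n) * (1# - √2 * p n) ^ 2
               + fromℕ n ^ 5 * p n ^ 3 * (1# - p n)))
   × (p ≲ (n^- 2) →
      (λ n → fromℕ n ^ 6 * p n ^ 3 * (1# - p n) * (1# - √2 * p n) ^ 2
             + fromℕ n ^ 5 * p n ^ 3 * (1# - p n)
             + fromℕ n ^ 4 * p n ^ 2 * (1# - p n))
      ≃ (λ n → fromℕ n ^ 4 * p n ^ 2))
   × ((𝕍K →∞) ⇔ ((p ≫ (n^- 2)) × ((λ n → 1# - p n) ≫ (n^- 6)))))
theorem3p3 R √2 0<√2 √2² = edgeNumber , (λ n G → numberOfEdges G) , λ p 0<p<1 →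
  variance-order √2 0<√2 √2² edgeNumber 2*edgeNumber p 0<p<1 ,
  denseOrder √2 0<√2 √2² edgeNumber 2*edgeNumber p 0<p<1 ,
  sparseOrder √2 0<√2 √2² edgeNumber 2*edgeNumber p 0<p<1 ,
  unboundedVariance √2 0<√2 √2² edgeNumber 2*edgeNumber p 0<p<1
  where
  open Reals R
  open EdgeBijection using (numberOfEdges)
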